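{- There exists an absolute constant $c>0$ such that the following holds. Let $n \ge 1$ and let $A \subseteq \mathbb{F}_2^n \times \mathbb{F}_2^n$ be such that there are no $x,y,d \in \mathbb{F}_2^n$ with $d \neq 0$ and $(x,y),\ (x+d,y),\ (x,y+d) \in A$. Then, writing $N = 2^n$, \[ |A| \le N^2 \cdot \exp\big(-c(\log N)^{1/178}\big). \] -}

module Defs where

open import Data.Bool using (Bool; true; false; _xor_)
open import Data.Nat using (ℕ; zero; suc; _*_; _^_; _≤_)
open import Data.Vec using (Vec; []; _∷_; zipWith; replicate)
open import Data.List using (List; []; _∷_; _++_; map; concatMap; filter; length)
open import Data.Product using (_×_)
open import Relation.Binary.PropositionalEquality using (_≡_; _≢_)
open import Relation.Nullary using (¬_)
open import Data.Bool.Properties using () renaming (_≟_ to _≟B_)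

𝔽₂^ : ℕ → Set
𝔽₂^ n = Vec Bool n

_⊕_ : ∀ {n} → 𝔽₂^ n → 𝔽₂^ n → 𝔽₂^ n
_⊕_ = zipWith _xor_

𝟘 : ∀ {n} → 𝔽₂^ n
𝟘 {n} = replicate n false

allVecs : (n : ℕ) → List (𝔽₂^ n)
allVecs zero = [] ∷ []
allVecs (suc n) = map (false ∷_) (allVecs n) ++ map (true ∷_) (allVecs n)

SubsetPairs : ℕ → Set
SubsetPairs n = 𝔽₂^ n → 𝔽₂^ n → Bool

card : ∀ {n} → SubsetPairs n → ℕ
card {n} A = length (filter (λ p → A (Data.Product.proj₁ p) (Data.Product.proj₂ p) ≟B true)
                             (concatMap (λ x → map (λ y → (x Data.Product., y)) (allVecs n)) (allVecs n)))

CornerFree : ∀ {n} → SubsetPairs n → Set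
CornerFree {n} A = (x y d : 𝔽₂^ n) → d ≢ 𝟘 →
  ¬ ((A x y ≡ true) × (A (x ⊕ d) y ≡ true) × (A x (y ⊕ d) ≡ true))

-- BoundedBy q n k  expresses the real inequality
--     k ≤ 4ⁿ · 2^(− n^(1/178) / q)
-- without real numbers: it says that for every nonnegative rational r = a/b
-- with r ≤ n^(1/178)/q (i.e. (q·a)^178 ≤ n·b^178) we have k · 2^(a/b) ≤ 4ⁿ,
-- i.e. 2^a · k^b ≤ 4^(n·b).  Since t ↦ 2^t is continuous and increasing,
-- this is equivalent to the real inequality.
BoundedBy : ℕ → ℕ → ℕ → Set
BoundedBy q n k = (a b : ℕ) → (q * a) ^ 178 ≤ n * b ^ 178 →
  2 ^ a * k ^ b ≤ 4 ^ (n * b)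

-- All averages are rational. Let A have density a on X × Y × D = {(x, y) : x ∈ X, y ∈ Y, x + y ∈ D}, where X and Y
-- are spread: no coset of small codimension increases their density noticeably. In the coordinates (x, y), (x, z), (y, z)
-- with z = x + y, corners are triangles, so if A has none, then for (x, y) ∈ A the neighbourhoods of x and y in D
-- have far fewer common elements than expected. Raising this deviation to an even power p and summing along x + y = t
-- gives functions of t with nonnegative Fourier coefficients, and Cauchy–Schwarz on the Fourier side moves the
-- deviation to pairs (x, x'): for many t, the codegrees of x and x + t have a large q-th moment. A spread piece of this
-- set of t behaves like a full coset against rectangles, by almost periodicity of convolutions and sifting, so many
-- pairs in a product of two cosets have codegree 65/64 times the expected one; then A is denser by a constant factor
-- on some rectangle X' × D'. Sets are cut into spread pieces again after each such increment. The density can only grow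
-- O(d) times by a constant factor from 2^-d to 1, and each round costs a codimension polynomial in d.

module Submission where

open import Defs
open import Algebra.Bundles using (CommutativeRing; RawRing)
import Algebra.Solver.Ring
import Algebra.Solver.Ring.AlmostCommutativeRing as ACR
open import Algebra.Structures using (IsCommutativeRing)
open import Data.Bool using (Bool; true; false; _∧_; not; _xor_; if_then_else_)
import Data.Bool.Properties as 𝔹P
open import Data.Empty using (⊥; ⊥-elim)
import Data.Integer as ℤ
open import Data.Maybe using (Maybe; just; nothing)
open import Data.Nat as ℕ using (ℕ; zero; suc)
open import Data.Nat.DivMod using (_/_; m≡m%n+[m/n]*n; m%n<n; m/n*n≤m)
import Data.Nat.Properties as ℕP
import Data.Nat.Solver
open import Data.Product using (Σ; _×_; _,_; proj₁; proj₂)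
open import Data.Rational using (ℚ; 0ℚ; 1ℚ; ½; _≤_; _<_; nonNegative; positive)
import Data.Rational as ℚ
import Data.Rational.Properties as ℚP
open ℚP using (≤-refl; ≤-trans; ≤-reflexive; <⇒≤)
open import Data.Sum using (_⊎_; inj₁; inj₂)
open import Data.Vec using (Vec; []; _∷_; _++_)
open import Relation.Binary.PropositionalEquality using (_≡_; _≢_; refl; sym; trans; cong; cong₂; subst; subst₂)
open import Relation.Nullary using (¬_; yes; no)
open import Relation.Nullary.Decidable using (⌊_⌋; toWitness; True; decidable-stable)

module ℕS = Data.Nat.Solver.+-*-Solver

infixl 6 _+_ _-_
infixl 7 _*_
infix 8 -_
infix 9 _÷_

-- Opaque copies of the field operations: they keep unification from inverting the definitions on ℚ.
opaque
  _+_ : ℚ → ℚ → ℚ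
  _+_ = ℚ._+_

  _*_ : ℚ → ℚ → ℚ
  _*_ = ℚ._*_

  -_ : ℚ → ℚ
  -_ = ℚ.-_

  isRing : IsCommutativeRing _≡_ _+_ _*_ -_ 0ℚ 1ℚ
  isRing = ℚP.+-*-isCommutativeRing

  con-+ : ∀ a b → (a ℚ.+ b) ≡ a + b
  con-+ a b = refl

  con-* : ∀ a b → (a ℚ.* b) ≡ a * b
  con-* a b = refl

  con-neg : ∀ a → (ℚ.- a) ≡ - a
  con-neg a = refl

  +-mono : ∀ {a b c d} → a ≤ b → c ≤ d → a + c ≤ b + d
  +-mono = ℚP.+-mono-≤

  +-mono-<-≤ : ∀ {a b c d} → a < b → c ≤ d → a + c < b + d
  +-mono-<-≤ = ℚP.+-mono-<-≤

  *-monoˡ : ∀ {c a b} → 0ℚ ≤ c → a ≤ b → c * a ≤ c * b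
  *-monoˡ {c} h k = ℚP.*-monoˡ-≤-nonNeg c {{nonNegative h}} k

  *-monoˡ-< : ∀ {c a b} → 0ℚ < c → a < b → c * a < c * b
  *-monoˡ-< {c} h k = ℚP.*-monoʳ-<-pos c {{positive h}} k

  cancelˡ : ∀ {c a b} → 0ℚ < c → c * a ≤ c * b → a ≤ b
  cancelˡ {c} h = ℚP.*-cancelˡ-≤-pos c {{positive h}}

  neg-anti : ∀ {a b} → a ≤ b → - b ≤ - a
  neg-anti = ℚP.neg-antimono-≤

  inv : ∀ {c} → 0ℚ < c → Σ ℚ λ d → c * d ≡ 1ℚ
  inv {c} h = ℚ.1/_ c {{nz}} , ℚP.*-inverseʳ c {{nz}}
    where
    nz : ℚ.NonZero c
    nz = ℚP.pos⇒nonZero c {{positive h}}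

_-_ : ℚ → ℚ → ℚ
a - b = a + (- b)

_÷_ : (m n : ℕ) {{_ : ℕ.NonZero n}} → ℚ
m ÷ n = ℚ._/_ (ℤ.+ m) n

ringℚ : CommutativeRing _ _
ringℚ = record { isCommutativeRing = isRing }

private
  coef : RawRing _ _
  coef = CommutativeRing.rawRing ℚP.+-*-commutativeRing

  hom : coef ACR.-Raw-AlmostCommutative⟶ ACR.fromCommutativeRing ringℚ
  hom = record { ⟦_⟧ = λ x → x ; +-homo = con-+ ; *-homo = con-* ; -‿homo = con-neg ; 0-homo = refl ; 1-homo = refl }

  dec : (x y : ℚ) → Maybe (x ≡ y)
  dec x y with x ℚP.≟ y
  ... | yes p = just p
  ... | no _ = nothing

open Algebra.Solver.Ring coef (ACR.fromCommutativeRing ringℚ) hom dec public using (solve; _:+_; _:*_; _:-_; :-_; _:=_; con)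

open CommutativeRing ringℚ public using (+-identityˡ; +-identityʳ; *-identityˡ; *-identityʳ; *-comm; +-comm; *-assoc; +-assoc)

*-zeroˡ : ∀ a → 0ℚ * a ≡ 0ℚ
*-zeroˡ = solve 1 (λ a → con 0ℚ :* a := con 0ℚ) refl

*-zeroʳ : ∀ a → a * 0ℚ ≡ 0ℚ
*-zeroʳ = solve 1 (λ a → a :* con 0ℚ := con 0ℚ) refl

*≡ˡ : ∀ {c a b} → a ≡ b → c * a ≡ c * b
*≡ˡ refl = refl

*≡ʳ : ∀ {c a b} → a ≡ b → a * c ≡ b * c
*≡ʳ refl = refl

+≡ˡ : ∀ {c a b} → a ≡ b → c + a ≡ c + b
+≡ˡ refl = refl

infixl 6 _⊞_
infixl 7 _⊠_

lit : ∀ {p q} {_ : True (p ℚP.≤? q)} → p ≤ q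
lit {p} {q} {w} = toWitness w

lit< : ∀ {p q} {_ : True (p ℚP.<? q)} → p < q
lit< {p} {q} {w} = toWitness w

dif : ∀ {a b} → a ≤ b → 0ℚ ≤ b - a
dif {a} {b} h = subst (_≤ b - a) (solve 1 (λ a → a :- a := con 0ℚ) refl a) (+-mono h (≤-refl { - a}))

undif : ∀ {a b} → 0ℚ ≤ b - a → a ≤ b
undif {a} {b} h = subst₂ _≤_ (+-identityˡ a) (solve 2 (λ a b → b :- a :+ a := b) refl a b) (+-mono h (≤-refl {a}))

_⊞_ : ∀ {a b} → 0ℚ ≤ a → 0ℚ ≤ b → 0ℚ ≤ a + b
_⊞_ {a} {b} h k = subst (_≤ a + b) (+-identityˡ 0ℚ) (+-mono h k)

*-monoʳ : ∀ {c a b} → 0ℚ ≤ c → a ≤ b → a * c ≤ b * c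
*-monoʳ {c} {a} {b} h k = subst₂ _≤_ (*-comm c a) (*-comm c b) (*-monoˡ h k)

_⊠_ : ∀ {a b} → 0ℚ ≤ a → 0ℚ ≤ b → 0ℚ ≤ a * b
_⊠_ {a} {b} h k = subst (_≤ a * b) (*-zeroʳ a) (*-monoˡ h k)

≤by : ∀ {r a b} → 0ℚ ≤ r → r ≡ b - a → a ≤ b
≤by h e = undif (subst (0ℚ ≤_) e h)

*-mono : ∀ {a b c d} → 0ℚ ≤ a → a ≤ b → 0ℚ ≤ c → c ≤ d → a * c ≤ b * d
*-mono ha h hc k = ≤-trans (*-monoʳ hc h) (*-monoˡ (≤-trans ha h) k)

0≤neg : ∀ {a} → a ≤ 0ℚ → 0ℚ ≤ - a
0≤neg {a} h = subst (_≤ - a) (solve 0 (:- con 0ℚ := con 0ℚ) refl) (neg-anti h)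

sq : ∀ x → 0ℚ ≤ x * x
sq x with ℚP.≤-total 0ℚ x
... | inj₁ h = h ⊠ h
... | inj₂ h = subst (0ℚ ≤_) (solve 1 (λ x → (:- x) :* (:- x) := x :* x) refl x) (0≤neg h ⊠ 0≤neg h)

0≤1 : 0ℚ ≤ 1ℚ
0≤1 = lit

0≤½ : 0ℚ ≤ ½
0≤½ = lit

≰⇒≥ : ∀ {a b} → ¬ a ≤ b → b ≤ a
≰⇒≥ h = <⇒≤ (ℚP.≰⇒> h)

≤-stable : ∀ {a b} → ¬ ¬ a ≤ b → a ≤ b
≤-stable {a} {b} = decidable-stable (a ℚP.≤? b)

by-cases : ∀ {l} (P : Set l) {a b} → (P → a ≤ b) → (¬ P → a ≤ b) → a ≤ b
by-cases P f g = ≤-stable λ n → n (g λ p → n (f p))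

¬¬em : ∀ {l} {P : Set l} → (P → ⊥) → (¬ P → ⊥) → ⊥
¬¬em f g = g f

cancelʳ : ∀ {c a b} → 0ℚ < c → a * c ≤ b * c → a ≤ b
cancelʳ {c} {a} {b} h k = cancelˡ h (subst₂ _≤_ (*-comm a c) (*-comm b c) k)

0<* : ∀ {a b} → 0ℚ < a → 0ℚ < b → 0ℚ < a * b
0<* {a} {b} h k = subst (_< a * b) (*-zeroʳ a) (*-monoˡ-< h k)

0<+ : ∀ {a b} → 0ℚ < a → 0ℚ ≤ b → 0ℚ < a + b
0<+ {a} {b} h k = subst (_< a + b) (+-identityˡ 0ℚ) (+-mono-<-≤ h k)

<-≤ : ∀ {a b c} → a < b → b ≤ c → a < c
<-≤ = ℚP.<-≤-trans

≤-< : ∀ {a b c} → a ≤ b → b < c → a < c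
≤-< = ℚP.≤-<-trans

<-irr : ∀ {a} → a < a → ⊥
<-irr = ℚP.<-irrefl refl

<⇒≱ : ∀ {a b} → a < b → b ≤ a → ⊥
<⇒≱ h k = <-irr (<-≤ h k)

inv-pos : ∀ {c d} → 0ℚ < c → c * d ≡ 1ℚ → 0ℚ < d
inv-pos {c} {d} h e with 0ℚ ℚP.<? d
... | yes p = p
... | no n = ⊥-elim (<⇒≱ {0ℚ} {1ℚ} lit< (≤-trans (≤-reflexive (sym e)) (≤-trans (*-monoˡ (<⇒≤ h) (ℚP.≮⇒≥ n)) (≤-reflexive (*-zeroʳ c)))))

≤-sq : ∀ {x y} → 0ℚ ≤ y → x * x ≤ y * y → x ≤ y
≤-sq {x} {y} hy h with x ℚP.≤? y
... | yes p = p
... | no n = ⊥-elim (<⇒≱ (*-monoˡ-< (≤-< hy (ℚP.≰⇒> n)) (ℚP.≰⇒> n))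
    (≤-trans h (*-monoʳ hy (≰⇒≥ n))))

infixr 8 _^_
_^_ : ℚ → ℕ → ℚ
x ^ zero = 1ℚ
x ^ suc n = x * x ^ n

^-+ : ∀ x m n → x ^ (m ℕ.+ n) ≡ x ^ m * x ^ n
^-+ x zero n = sym (*-identityˡ _)
^-+ x (suc m) n = trans (cong (x *_) (^-+ x m n)) (sym (*-assoc x (x ^ m) (x ^ n)))

*-^ : ∀ x y n → (x * y) ^ n ≡ x ^ n * y ^ n
*-^ x y zero = sym (*-identityˡ 1ℚ)
*-^ x y (suc n) = trans (cong (x * y *_) (*-^ x y n))
  (solve 4 (λ x y a b → x :* y :* (a :* b) := x :* a :* (y :* b)) refl x y (x ^ n) (y ^ n))

1^ : ∀ n → 1ℚ ^ n ≡ 1ℚ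
1^ zero = refl
1^ (suc n) = trans (*-identityˡ _) (1^ n)

^-* : ∀ x m n → x ^ (m ℕ.* n) ≡ (x ^ m) ^ n
^-* x m zero = cong (x ^_) (ℕP.*-zeroʳ m)
^-* x m (suc n) = trans (cong (x ^_) (ℕP.*-suc m n)) (trans (^-+ x m (m ℕ.* n)) (cong (x ^ m *_) (^-* x m n)))

0≤^ : ∀ {x} n → 0ℚ ≤ x → 0ℚ ≤ x ^ n
0≤^ zero h = 0≤1
0≤^ (suc n) h = h ⊠ 0≤^ n h

0<^ : ∀ {x} n → 0ℚ < x → 0ℚ < x ^ n
0<^ zero h = lit<
0<^ (suc n) h = 0<* h (0<^ n h)

^-mono : ∀ {x y} n → 0ℚ ≤ x → x ≤ y → x ^ n ≤ y ^ n
^-mono zero h k = ≤-refl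
^-mono (suc n) h k = *-mono h k (0≤^ n h) (^-mono n h k)

^-≤1 : ∀ {x} n → 0ℚ ≤ x → x ≤ 1ℚ → x ^ n ≤ 1ℚ
^-≤1 n h k = ≤-trans (^-mono n h k) (≤-reflexive (1^ n))

1≤^ : ∀ {x} n → 1ℚ ≤ x → 1ℚ ≤ x ^ n
1≤^ n k = ≤-trans (≤-reflexive (sym (1^ n))) (^-mono n 0≤1 k)

^-anti : ∀ {x m n} → 0ℚ ≤ x → x ≤ 1ℚ → m ℕ.≤ n → x ^ n ≤ x ^ m
^-anti {x} {m} {n} h k le = subst (λ z → x ^ z ≤ x ^ m) (ℕP.m+[n∸m]≡n le)
  (≤-trans (≤-reflexive (^-+ x m _)) (≤-trans (*-monoˡ (0≤^ m h) (^-≤1 (n ℕ.∸ m) h k)) (≤-reflexive (*-identityʳ _))))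

^-monoʳ : ∀ {x m n} → 1ℚ ≤ x → m ℕ.≤ n → x ^ m ≤ x ^ n
^-monoʳ {x} {m} {n} k le = subst (λ z → x ^ m ≤ x ^ z) (ℕP.m+[n∸m]≡n le)
  (≤-trans (≤-reflexive (sym (*-identityʳ _))) (≤-trans (*-monoˡ (0≤^ m (≤-trans 0≤1 k)) (1≤^ (n ℕ.∸ m) k)) (≤-reflexive (sym (^-+ x m _)))))

2ℚ : ℚ
2ℚ = 2 ÷ 1

2^½ : ∀ n → 2ℚ ^ n * ½ ^ n ≡ 1ℚ
2^½ n = trans (sym (*-^ 2ℚ ½ n)) (trans (cong (_^ n) (solve 0 (con 2ℚ :* con ½ := con 1ℚ) refl)) (1^ n))

0<½^ : ∀ n → 0ℚ < ½ ^ n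
0<½^ n = 0<^ n lit<

0≤½^ : ∀ n → 0ℚ ≤ ½ ^ n
0≤½^ n = 0≤^ n lit

½^≤1 : ∀ n → ½ ^ n ≤ 1ℚ
½^≤1 n = ^-≤1 n lit lit

ι : ℕ → ℚ
ι zero = 0ℚ
ι (suc n) = 1ℚ + ι n

0≤ι : ∀ n → 0ℚ ≤ ι n
0≤ι zero = ≤-refl
0≤ι (suc n) = _⊞_ {1ℚ} {ι n} 0≤1 (0≤ι n)

0<ι : ∀ n → 0ℚ < ι (suc n)
0<ι n = 0<+ {1ℚ} {ι n} lit< (0≤ι n)

ι-+ : ∀ m n → ι (m ℕ.+ n) ≡ ι m + ι n
ι-+ zero n = sym (+-identityˡ _)
ι-+ (suc m) n = trans (cong (1ℚ +_) (ι-+ m n)) (sym (+-assoc 1ℚ (ι m) (ι n)))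

ι-* : ∀ m n → ι (m ℕ.* n) ≡ ι m * ι n
ι-* zero n = sym (*-zeroˡ (ι n))
ι-* (suc m) n = trans (ι-+ n (m ℕ.* n)) (trans (cong (λ z → ι n + z) (ι-* m n))
  (solve 2 (λ m n → n :+ m :* n := (con 1ℚ :+ m) :* n) refl (ι m) (ι n)))

ι-^ : ∀ m n → ι (m ℕ.^ n) ≡ ι m ^ n
ι-^ m zero = +-identityʳ 1ℚ
ι-^ m (suc n) = trans (ι-* m (m ℕ.^ n)) (cong (λ z → ι m * z) (ι-^ m n))

ι-mono : ∀ {m n} → m ℕ.≤ n → ι m ≤ ι n
ι-mono {n = n} ℕ.z≤n = 0≤ι n
ι-mono {suc m} {suc n} (ℕ.s≤s h) = +-mono (≤-refl {1ℚ}) (ι-mono h)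

ι≤2^ : ∀ n → ι n ≤ 2ℚ ^ n
ι≤2^ zero = lit
ι≤2^ (suc n) = ≤-trans (+-mono (1≤^ n lit) (ι≤2^ n))
  (≤-reflexive (solve 1 (λ x → x :+ x := con 2ℚ :* x) refl (2ℚ ^ n)))

bernoulli : ∀ {x} n → 0ℚ ≤ x → 1ℚ + ι n * x ≤ (1ℚ + x) ^ n
bernoulli {x} zero h = ≤by {0ℚ} ≤-refl (solve 1 (λ x → con 0ℚ := con 1ℚ :- (con 1ℚ :+ con 0ℚ :* x)) refl x)
bernoulli {x} (suc n) h = ≤-trans
  (≤by (0≤ι n ⊠ sq x) (solve 2 (λ x n → n :* (x :* x) := (con 1ℚ :+ x) :* (con 1ℚ :+ n :* x) :- (con 1ℚ :+ (con 1ℚ :+ n) :* x)) refl x (ι n)))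
  (*-monoˡ (0≤1 ⊞ h) (bernoulli n h))

0≤^even : ∀ x n → 0ℚ ≤ x ^ (n ℕ.+ n)
0≤^even x n = subst (0ℚ ≤_) (sym (^-+ x n n)) (sq (x ^ n))

neg^even : ∀ x n → (- x) ^ (n ℕ.+ n) ≡ x ^ (n ℕ.+ n)
neg^even x n = trans (^-+ (- x) n n) (trans (sym (*-^ (- x) (- x) n))
  (trans (cong (_^ n) (solve 1 (λ x → (:- x) :* (:- x) := x :* x) refl x)) (trans (*-^ x x n) (sym (^-+ x n n)))))

^even-mono : ∀ {x y} n → 0ℚ ≤ y → x ≤ y → - y ≤ x → x ^ (n ℕ.+ n) ≤ y ^ (n ℕ.+ n)
^even-mono {x} {y} n hy h k with ℚP.≤-total 0ℚ x
... | inj₁ p = ^-mono (n ℕ.+ n) p h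
... | inj₂ p = subst (_≤ y ^ (n ℕ.+ n)) (neg^even x n) (^-mono (n ℕ.+ n) (0≤neg p)
   (≤by (dif k) (solve 2 (λ x y → x :- :- y := y :- :- x) refl x y)))

cs-+ : ∀ {a b c a' b' c'} → 0ℚ ≤ b → 0ℚ ≤ c → 0ℚ ≤ b' → 0ℚ ≤ c' → a * a ≤ b * c → a' * a' ≤ b' * c' →
  (a + a') * (a + a') ≤ (b + b') * (c + c')
cs-+ {a} {b} {c} {a'} {b'} {c'} hb hc hb' hc' h k =
  ≤by (dif h ⊞ dif k ⊞ dif cross)
    (solve 6 (λ a b c a' b' c' → b :* c :- a :* a :+ (b' :* c' :- a' :* a') :+ (b :* c' :+ b' :* c :- (a :* a' :+ a :* a'))
      := (b :+ b') :* (c :+ c') :- (a :+ a') :* (a :+ a')) refl a b c a' b' c')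
  where
  cross : a * a' + a * a' ≤ b * c' + b' * c
  cross = ≤-sq ((hb ⊠ hc') ⊞ (hb' ⊠ hc)) (≤-trans
    (≤-trans (≤-reflexive (solve 2 (λ a a' → (a :* a' :+ a :* a') :* (a :* a' :+ a :* a') := con (4 ÷ 1) :* ((a :* a) :* (a' :* a'))) refl a a'))
      (*-monoˡ {4 ÷ 1} lit (*-mono (sq a) h (sq a') k)))
    (≤by (sq (b * c' - b' * c)) (solve 4 (λ b c b' c' → (b :* c' :- b' :* c) :* (b :* c' :- b' :* c)
      := (b :* c' :+ b' :* c) :* (b :* c' :+ b' :* c) :- con (4 ÷ 1) :* ((b :* c) :* (b' :* c'))) refl b c b' c')))

cs-* : ∀ {a b c a' b' c'} → a * a ≤ b * c → a' * a' ≤ b' * c' →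
  (a * a') * (a * a') ≤ (b * b') * (c * c')
cs-* {a} {b} {c} {a'} {b'} {c'} h k = subst₂ _≤_
  (solve 2 (λ a a' → (a :* a) :* (a' :* a') := (a :* a') :* (a :* a')) refl a a')
  (solve 4 (λ b c b' c' → (b :* c) :* (b' :* c') := (b :* b') :* (c :* c')) refl b c b' c')
  (*-mono (sq a) h (sq a') k)

-- Averages on 𝔽₂ⁿ

record Mean (A : Set) : Set where
  field
    E      : (A → ℚ) → ℚ
    E-cong : ∀ {f g} → (∀ x → f x ≡ g x) → E f ≡ E g
    E-+    : ∀ f g → E (λ x → f x + g x) ≡ E f + E g
    E-*    : ∀ c f → E (λ x → c * f x) ≡ c * E f
    E-1    : E (λ _ → 1ℚ) ≡ 1ℚ
    E-mono : ∀ {f g} → (∀ x → f x ≤ g x) → E f ≤ E g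

  E-const : ∀ c → E (λ _ → c) ≡ c
  E-const c = trans (E-cong (λ _ → sym (*-identityʳ c))) (trans (E-* c (λ _ → 1ℚ)) (trans (cong (c *_) E-1) (*-identityʳ c)))

  E-*ʳ : ∀ f c → E (λ x → f x * c) ≡ E f * c
  E-*ʳ f c = trans (E-cong (λ x → *-comm (f x) c)) (trans (E-* c f) (*-comm c (E f)))

  E-0≤ : ∀ {f} → (∀ x → 0ℚ ≤ f x) → 0ℚ ≤ E f
  E-0≤ h = ≤-trans (≤-reflexive (sym (E-const 0ℚ))) (E-mono h)

  E-≤ : ∀ {f c} → (∀ x → f x ≤ c) → E f ≤ c
  E-≤ {c = c} h = ≤-trans (E-mono h) (≤-reflexive (E-const c))

  E-neg : ∀ f → E (λ x → - f x) ≡ - E f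
  E-neg f = trans (E-cong (λ x → solve 1 (λ a → :- a := (:- con 1ℚ) :* a) refl (f x)))
    (trans (E-* (- 1ℚ) f) (solve 1 (λ a → (:- con 1ℚ) :* a := :- a) refl (E f)))

  E-- : ∀ f g → E (λ x → f x - g x) ≡ E f - E g
  E-- f g = trans (E-+ f (λ x → - g x)) (cong (E f +_) (E-neg g))

  E-lin : ∀ a f b g → E (λ x → a * f x + b * g x) ≡ a * E f + b * E g
  E-lin a f b g = trans (E-+ _ _) (cong₂ _+_ (E-* a f) (E-* b g))

  E-ex : ∀ {f c} → c < E f → ¬ ¬ Σ A λ x → c < f x
  E-ex {f} {c} h n = <⇒≱ h (E-≤ λ x → ℚP.≮⇒≥ λ k → n (x , k))

  E-pow : ∀ {w f : A → ℚ} m → (∀ x → 0ℚ ≤ w x) → (∀ x → 0ℚ ≤ f x) →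
    E (λ x → w x * f x) ^ suc m ≤ E w ^ m * E (λ x → w x * f x ^ suc m)
  E-pow {w} {f} zero hw hf = ≤-reflexive (trans (*-identityʳ _) (trans (E-cong (λ x → cong (w x *_) (sym (*-identityʳ (f x))))) (sym (*-identityˡ _))))
  E-pow {w} {f} (suc m) hw hf = ≤-trans (*-monoˡ (E-0≤ λ x → hw x ⊠ hf x) (E-pow m hw hf)) step
    where
    W = E w
    S = E (λ x → w x * f x)
    P = E (λ x → w x * f x ^ suc m)
    Q = E (λ x → w x * f x ^ suc (suc m))
    pt : ∀ a b → 0ℚ ≤ a → 0ℚ ≤ b → 0ℚ ≤ (a - b) * (a ^ suc m - b ^ suc m)
    pt a b ha hb with ℚP.≤-total a b
    ... | inj₁ h = subst (0ℚ ≤_) (solve 4 (λ a b c d → (b :- a) :* (d :- c) := (a :- b) :* (c :- d)) refl a b (a ^ suc m) (b ^ suc m))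
                     (dif h ⊠ dif (^-mono (suc m) ha h))
    ... | inj₂ h = dif h ⊠ dif (^-mono (suc m) hb h)
    -- Chebyshev's sum inequality, by averaging over independent pairs.
    cheb : S * P ≤ W * Q
    cheb = ≤by {E (λ x → E (λ y → w x * w y * ((f x - f y) * (f x ^ suc m - f y ^ suc m)))) * ½} ((E-0≤ λ x → E-0≤ λ y → (hw x ⊠ hw y) ⊠ pt (f x) (f y) (hf x) (hf y)) ⊠ 0≤½)
      (trans (cong (_* ½) (trans (E-cong λ x → trans (E-cong λ y → expand (w x) (w y) (f x) (f y) (f x ^ suc m) (f y ^ suc m))
           (trans (E-lin _ w 1ℚ _) (cong₂ _+_ refl (cong (1ℚ *_) (trans (E-lin _ _ 1ℚ _) (cong₂ _+_ refl (cong (1ℚ *_) (E-lin _ _ _ _)))))))) collapse))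
        (solve 4 (λ W Q S P → ((Q :* W :+ (:- P) :* S :+ ((:- S) :* P :+ W :* Q)) :* con ½) := W :* Q :- S :* P) refl W Q S P))
      where
      expand : ∀ wx wy fx fy gx gy → wx * wy * ((fx - fy) * (gx - gy)) ≡
        (wx * (fx * gx)) * wy + 1ℚ * ((- (wx * gx)) * (wy * fy) + 1ℚ * ((- (wx * fx)) * (wy * gy) + wx * (wy * (fy * gy))))
      expand = solve 6 (λ wx wy fx fy gx gy → wx :* wy :* ((fx :- fy) :* (gx :- gy)) :=
        (wx :* (fx :* gx)) :* wy :+ con 1ℚ :* ((:- (wx :* gx)) :* (wy :* fy) :+ con 1ℚ :* ((:- (wx :* fx)) :* (wy :* gy) :+ wx :* (wy :* (fy :* gy))))) refl
      collapse : E (λ x → (w x * (f x * f x ^ suc m)) * W + 1ℚ * ((- (w x * f x ^ suc m)) * S + 1ℚ * ((- (w x * f x)) * P + w x * Q)))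
        ≡ Q * W + (- P) * S + ((- S) * P + W * Q)
      collapse = trans (E-+ _ _) (trans (cong₂ _+_ (E-*ʳ _ W) (trans (E-* 1ℚ _) (cong (1ℚ *_) (trans (E-+ _ _)
        (cong₂ _+_ (trans (E-*ʳ _ S) (cong (_* S) (E-neg _))) (trans (E-* 1ℚ _) (cong (1ℚ *_) (trans (E-+ _ _) (cong₂ _+_ (trans (E-*ʳ _ P) (cong (_* P) (E-neg _))) (E-*ʳ w Q))))))))))
        (solve 4 (λ A B C D → A :+ con 1ℚ :* (B :+ con 1ℚ :* (C :+ D)) := A :+ B :+ (C :+ D)) refl (Q * W) ((- P) * S) ((- S) * P) (W * Q)))
    step : S * (W ^ m * P) ≤ W ^ suc m * Q
    step = ≤-trans (≤-reflexive (solve 3 (λ S V P → S :* (V :* P) := V :* (S :* P)) refl S (W ^ m) P))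
      (≤-trans (*-monoˡ (0≤^ m (E-0≤ hw)) cheb) (≤-reflexive (solve 3 (λ V W Q → V :* (W :* Q) := W :* V :* Q) refl (W ^ m) W Q)))

open Mean

F : ℕ → Set
F n = Vec Bool n

opaque
  𝔼 : ∀ {n} → (F n → ℚ) → ℚ
  𝔼 {zero} f = f []
  𝔼 {suc n} f = ½ * (𝔼 (λ x → f (false ∷ x)) + 𝔼 (λ x → f (true ∷ x)))

private
  ½-+ : ∀ a b c d → ½ * (a + b + (c + d)) ≡ ½ * (a + c) + ½ * (b + d)
  ½-+ = solve 4 (λ a b c d → con ½ :* (a :+ b :+ (c :+ d)) := con ½ :* (a :+ c) :+ con ½ :* (b :+ d)) refl

opaque
  unfolding 𝔼
  𝔼-cong : ∀ {n} {f g : F n → ℚ} → (∀ x → f x ≡ g x) → 𝔼 f ≡ 𝔼 g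
  𝔼-cong {zero} h = h []
  𝔼-cong {suc n} h = cong (½ *_) (cong₂ _+_ (𝔼-cong λ x → h (false ∷ x)) (𝔼-cong λ x → h (true ∷ x)))

  𝔼-+ : ∀ {n} (f g : F n → ℚ) → 𝔼 (λ x → f x + g x) ≡ 𝔼 f + 𝔼 g
  𝔼-+ {zero} f g = refl
  𝔼-+ {suc n} f g = trans (cong (½ *_) (cong₂ _+_ (𝔼-+ {n} _ _) (𝔼-+ {n} _ _))) (½-+ (𝔼 (λ x → f (false ∷ x))) _ _ _)

  𝔼-* : ∀ {n} c (f : F n → ℚ) → 𝔼 (λ x → c * f x) ≡ c * 𝔼 f
  𝔼-* {zero} c f = refl
  𝔼-* {suc n} c f = trans (cong (½ *_) (cong₂ _+_ (𝔼-* {n} c _) (𝔼-* {n} c _)))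
    (solve 3 (λ c a b → con ½ :* (c :* a :+ c :* b) := c :* (con ½ :* (a :+ b))) refl c (𝔼 (λ x → f (false ∷ x))) (𝔼 (λ x → f (true ∷ x))))

  𝔼-1 : ∀ {n} → 𝔼 {n} (λ _ → 1ℚ) ≡ 1ℚ
  𝔼-1 {zero} = refl
  𝔼-1 {suc n} = trans (cong (½ *_) (cong₂ _+_ (𝔼-1 {n}) (𝔼-1 {n}))) (solve 0 (con ½ :* (con 1ℚ :+ con 1ℚ) := con 1ℚ) refl)

  𝔼-mono : ∀ {n} {f g : F n → ℚ} → (∀ x → f x ≤ g x) → 𝔼 f ≤ 𝔼 g
  𝔼-mono {zero} h = h []
  𝔼-mono {suc n} h = *-monoˡ 0≤½ (+-mono (𝔼-mono λ x → h (false ∷ x)) (𝔼-mono λ x → h (true ∷ x)))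

  𝔼-[] : (f : F 0 → ℚ) → 𝔼 f ≡ f []
  𝔼-[] f = refl

  𝔼-∷ : ∀ {n} (f : F (suc n) → ℚ) → 𝔼 f ≡ ½ * (𝔼 (λ x → f (false ∷ x)) + 𝔼 (λ x → f (true ∷ x)))
  𝔼-∷ f = refl

bits : ∀ n → Mean (F n)
bits n = record { E = 𝔼 {n} ; E-cong = 𝔼-cong ; E-+ = 𝔼-+ ; E-* = 𝔼-* ; E-1 = 𝔼-1 {n} ; E-mono = 𝔼-mono }

module 𝔼 {n : ℕ} = Mean (bits n)

opaque
  unfolding 𝔼
  -- Any two averages commute: 𝔼 is an iterated binary average, which linear functionals respect.
  E-swap : ∀ {A n} (M : Mean A) (f : A → F n → ℚ) → M .E (λ a → 𝔼 (f a)) ≡ 𝔼 (λ x → M .E (λ a → f a x))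
  E-swap {n = zero} M f = refl
  E-swap {n = suc n} M f = trans (M .E-* ½ _) (cong (½ *_) (trans (M .E-+ _ _)
    (cong₂ _+_ (E-swap M (λ a x → f a (false ∷ x))) (E-swap M (λ a x → f a (true ∷ x))))))

𝔼-swap : ∀ {m n} (f : F m → F n → ℚ) → 𝔼 (λ a → 𝔼 (f a)) ≡ 𝔼 (λ x → 𝔼 (λ a → f a x))
𝔼-swap {m} f = E-swap (bits m) f

⊕-comm : ∀ {n} (x y : F n) → x ⊕ y ≡ y ⊕ x
⊕-comm [] [] = refl
⊕-comm (a ∷ x) (b ∷ y) = cong₂ _∷_ (𝔹P.xor-comm a b) (⊕-comm x y)

⊕-assoc : ∀ {n} (x y z : F n) → (x ⊕ y) ⊕ z ≡ x ⊕ (y ⊕ z)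
⊕-assoc [] [] [] = refl
⊕-assoc (a ∷ x) (b ∷ y) (c ∷ z) = cong₂ _∷_ (𝔹P.xor-assoc a b c) (⊕-assoc x y z)

⊕-self : ∀ {n} (x : F n) → x ⊕ x ≡ 𝟘
⊕-self [] = refl
⊕-self (a ∷ x) = cong₂ _∷_ (𝔹P.xor-same a) (⊕-self x)

⊕-𝟘 : ∀ {n} (x : F n) → x ⊕ 𝟘 ≡ x
⊕-𝟘 [] = refl
⊕-𝟘 (a ∷ x) = cong₂ _∷_ (𝔹P.xor-identityʳ a) (⊕-𝟘 x)

⊕-cancel : ∀ {n} (x y : F n) → x ⊕ (x ⊕ y) ≡ y
⊕-cancel x y = trans (sym (⊕-assoc x x y)) (trans (cong (_⊕ y) (⊕-self x)) (trans (⊕-comm 𝟘 y) (⊕-𝟘 y)))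

⊕-cancelʳ : ∀ {n} (x y : F n) → (x ⊕ y) ⊕ y ≡ x
⊕-cancelʳ x y = trans (⊕-comm _ y) (trans (cong (y ⊕_) (⊕-comm x y)) (⊕-cancel y x))

opaque
  unfolding 𝔼
  𝔼-shift : ∀ {n} (t : F n) (f : F n → ℚ) → 𝔼 (λ x → f (x ⊕ t)) ≡ 𝔼 f
  𝔼-shift [] f = refl
  𝔼-shift (false ∷ t) f = cong (½ *_) (cong₂ _+_ (𝔼-shift t (λ x → f (false ∷ x))) (𝔼-shift t (λ x → f (true ∷ x))))
  𝔼-shift (true ∷ t) f = trans (cong (½ *_) (cong₂ _+_ (𝔼-shift t (λ x → f (true ∷ x))) (𝔼-shift t (λ x → f (false ∷ x)))))
    (cong (½ *_) (+-comm _ _))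

𝔼-shiftˡ : ∀ {n} (t : F n) (f : F n → ℚ) → 𝔼 (λ x → f (t ⊕ x)) ≡ 𝔼 f
𝔼-shiftˡ t f = trans (𝔼.E-cong λ x → cong f (⊕-comm t x)) (𝔼-shift t f)

tup : ∀ {A} → Mean A → ∀ l → Mean (Vec A l)
tup M zero .E f = f []
tup M (suc l) .E f = M .E λ a → tup M l .E λ v → f (a ∷ v)
tup M zero .E-cong h = h []
tup M (suc l) .E-cong h = M .E-cong λ a → tup M l .E-cong λ v → h (a ∷ v)
tup M zero .E-+ f g = refl
tup M (suc l) .E-+ f g = trans (M .E-cong λ a → tup M l .E-+ _ _) (M .E-+ _ _)
tup M zero .E-* c f = refl
tup M (suc l) .E-* c f = trans (M .E-cong λ a → tup M l .E-* c _) (M .E-* c _)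
tup M zero .E-1 = refl
tup M (suc l) .E-1 = trans (M .E-cong λ a → tup M l .E-1) (M .E-1)
tup M zero .E-mono h = h []
tup M (suc l) .E-mono h = M .E-mono λ a → tup M l .E-mono λ v → h (a ∷ v)

𝟙 : Bool → ℚ
𝟙 false = 0ℚ
𝟙 true = 1ℚ

0≤𝟙 : ∀ b → 0ℚ ≤ 𝟙 b
0≤𝟙 false = ≤-refl
0≤𝟙 true = lit

𝟙≤1 : ∀ b → 𝟙 b ≤ 1ℚ
𝟙≤1 false = lit
𝟙≤1 true = ≤-refl

𝟙-∧ : ∀ a b → 𝟙 (a ∧ b) ≡ 𝟙 a * 𝟙 b
𝟙-∧ false b = sym (*-zeroˡ (𝟙 b))
𝟙-∧ true b = sym (*-identityˡ (𝟙 b))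

𝟙-not : ∀ b → 𝟙 (not b) ≡ 1ℚ - 𝟙 b
𝟙-not false = solve 0 (con 1ℚ := con 1ℚ :- con 0ℚ) refl
𝟙-not true = solve 0 (con 0ℚ := con 1ℚ :- con 1ℚ) refl

𝟙-≤ : ∀ b {x y} → (b ≡ true → x ≤ y) → 𝟙 b * x ≤ 𝟙 b * y
𝟙-≤ false {x} {y} h = ≤-reflexive (trans (*-zeroˡ x) (sym (*-zeroˡ y)))
𝟙-≤ true {x} {y} h = subst₂ _≤_ (sym (*-identityˡ x)) (sym (*-identityˡ y)) (h refl)

𝟙*≤ : ∀ b {x} → 0ℚ ≤ x → 𝟙 b * x ≤ x
𝟙*≤ b {x} h = ≤-trans (*-monoʳ h (𝟙≤1 b)) (≤-reflexive (*-identityˡ x))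

∣_∣ : ∀ {n} → (F n → Bool) → ℚ
∣ X ∣ = 𝔼 (λ x → 𝟙 (X x))

0≤∣∣ : ∀ {n} (X : F n → Bool) → 0ℚ ≤ ∣ X ∣
0≤∣∣ X = 𝔼.E-0≤ λ x → 0≤𝟙 (X x)

∣∣≤1 : ∀ {n} (X : F n → Bool) → ∣ X ∣ ≤ 1ℚ
∣∣≤1 X = 𝔼.E-≤ λ x → 𝟙≤1 (X x)

_≤ᵇ_ : ℚ → ℚ → Bool
x ≤ᵇ y = ⌊ x ℚP.≤? y ⌋

≤ᵇ⇒ : ∀ {x y} → x ≤ᵇ y ≡ true → x ≤ y
≤ᵇ⇒ {x} {y} h with x ℚP.≤? y
... | yes p = p

≰ᵇ⇒ : ∀ {x y} → x ≤ᵇ y ≡ false → y < x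
≰ᵇ⇒ {x} {y} h with x ℚP.≤? y
... | no p = ℚP.≰⇒> p

markov : ∀ {A} (M : Mean A) {f : A → ℚ} {c} → (∀ x → 0ℚ ≤ f x) → M .E (λ x → 𝟙 (c ≤ᵇ f x)) * c ≤ M .E f
markov M {f} {c} h = ≤-trans (≤-reflexive (sym (E-*ʳ M _ c))) (M .E-mono pt)
  where
  pt : ∀ x → 𝟙 (c ≤ᵇ f x) * c ≤ f x
  pt x with c ℚP.≤? f x
  ... | yes p = ≤-trans (≤-reflexive (*-identityˡ c)) p
  ... | no p = ≤-trans (≤-reflexive (*-zeroˡ c)) (h x)

-- Fourier analysis

dot : ∀ {n} → F n → F n → Bool
dot [] [] = false
dot (a ∷ x) (b ∷ y) = (a ∧ b) xor dot x y

sgn : Bool → ℚ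
sgn false = 1ℚ
sgn true = - 1ℚ

sgn-xor : ∀ a b → sgn (a xor b) ≡ sgn a * sgn b
sgn-xor false b = sym (*-identityˡ _)
sgn-xor true false = sym (*-identityʳ _)
sgn-xor true true = solve 0 (con 1ℚ := (:- con 1ℚ) :* (:- con 1ℚ)) refl

sgn² : ∀ a → sgn a * sgn a ≡ 1ℚ
sgn² false = *-identityˡ 1ℚ
sgn² true = solve 0 ((:- con 1ℚ) :* (:- con 1ℚ) := con 1ℚ) refl

χ : ∀ {n} → F n → F n → ℚ
χ ξ x = sgn (dot ξ x)

dot-⊕ : ∀ {n} (ξ x y : F n) → dot ξ (x ⊕ y) ≡ dot ξ x xor dot ξ y
dot-⊕ [] [] [] = refl
dot-⊕ (a ∷ ξ) (b ∷ x) (c ∷ y) rewrite dot-⊕ ξ x y = bool a b c (dot ξ x) (dot ξ y)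
  where
  bool : ∀ a b c d e → (a ∧ (b xor c)) xor (d xor e) ≡ ((a ∧ b) xor d) xor ((a ∧ c) xor e)
  bool false b c d e = refl
  bool true false c false e = refl
  bool true false false true e = refl
  bool true false true true false = refl
  bool true false true true true = refl
  bool true true false false e = refl
  bool true true false true false = refl
  bool true true false true true = refl
  bool true true true false false = refl
  bool true true true false true = refl
  bool true true true true false = refl
  bool true true true true true = refl

χ-⊕ : ∀ {n} (ξ x y : F n) → χ ξ (x ⊕ y) ≡ χ ξ x * χ ξ y
χ-⊕ ξ x y = trans (cong sgn (dot-⊕ ξ x y)) (sgn-xor (dot ξ x) (dot ξ y))

dot-𝟘 : ∀ {n} (x : F n) → dot 𝟘 x ≡ false
dot-𝟘 [] = refl
dot-𝟘 (a ∷ x) = dot-𝟘 x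

hat : ∀ {n} → (F n → ℚ) → F n → ℚ
hat f ξ = 𝔼 (λ x → f x * χ ξ x)

hat-𝟘 : ∀ {n} (f : F n → ℚ) → hat f 𝟘 ≡ 𝔼 f
hat-𝟘 f = 𝔼.E-cong λ x → trans (cong (λ b → f x * sgn b) (dot-𝟘 x)) (*-identityʳ (f x))

hat-cong : ∀ {n} {f g : F n → ℚ} → (∀ x → f x ≡ g x) → ∀ ξ → hat f ξ ≡ hat g ξ
hat-cong h ξ = 𝔼.E-cong λ x → cong (_* χ ξ x) (h x)

hat-false : ∀ {n} (f : F (suc n) → ℚ) ξ → hat f (false ∷ ξ) ≡ ½ * (hat (λ x → f (false ∷ x)) ξ + hat (λ x → f (true ∷ x)) ξ)
hat-false f ξ = 𝔼-∷ _

hat-true : ∀ {n} (f : F (suc n) → ℚ) ξ → hat f (true ∷ ξ) ≡ ½ * (hat (λ x → f (false ∷ x)) ξ - hat (λ x → f (true ∷ x)) ξ)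
hat-true {n} f ξ = trans (𝔼-∷ _) (cong (½ *_) (cong (hat (λ x → f (false ∷ x)) ξ +_) (trans (𝔼.E-cong λ x → trans (cong (f (true ∷ x) *_) (sgn-xor true (dot ξ x)))
  (solve 2 (λ a b → a :* ((:- con 1ℚ) :* b) := :- (a :* b)) refl (f (true ∷ x)) (χ ξ x))) (𝔼.E-neg _))))

opaque
  S : ∀ {n} → (F n → ℚ) → ℚ
  S {zero} f = f []
  S {suc n} f = S (λ x → f (false ∷ x)) + S (λ x → f (true ∷ x))

  S-[] : (f : F 0 → ℚ) → S f ≡ f []
  S-[] f = refl

  S-∷ : ∀ {n} (f : F (suc n) → ℚ) → S f ≡ S (λ x → f (false ∷ x)) + S (λ x → f (true ∷ x))
  S-∷ f = refl

  S-cong : ∀ {n} {f g : F n → ℚ} → (∀ x → f x ≡ g x) → S f ≡ S g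
  S-cong {zero} h = h []
  S-cong {suc n} h = cong₂ _+_ (S-cong λ x → h (false ∷ x)) (S-cong λ x → h (true ∷ x))

  S-mono : ∀ {n} {f g : F n → ℚ} → (∀ x → f x ≤ g x) → S f ≤ S g
  S-mono {zero} h = h []
  S-mono {suc n} h = +-mono (S-mono λ x → h (false ∷ x)) (S-mono λ x → h (true ∷ x))

  S-+ : ∀ {n} (f g : F n → ℚ) → S (λ x → f x + g x) ≡ S f + S g
  S-+ {zero} f g = refl
  S-+ {suc n} f g = trans (cong₂ _+_ (S-+ (λ x → f (false ∷ x)) (λ x → g (false ∷ x))) (S-+ (λ x → f (true ∷ x)) (λ x → g (true ∷ x))))
    (solve 4 (λ a b c d → a :+ b :+ (c :+ d) := a :+ c :+ (b :+ d)) refl (S (λ x → f (false ∷ x))) (S (λ x → g (false ∷ x))) (S (λ x → f (true ∷ x))) (S (λ x → g (true ∷ x))))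

  S-* : ∀ {n} c (f : F n → ℚ) → S (λ x → c * f x) ≡ c * S f
  S-* {zero} c f = refl
  S-* {suc n} c f = trans (cong₂ _+_ (S-* c (λ x → f (false ∷ x))) (S-* c (λ x → f (true ∷ x))))
    (solve 3 (λ c a b → c :* a :+ c :* b := c :* (a :+ b)) refl c (S (λ x → f (false ∷ x))) (S (λ x → f (true ∷ x))))

  S-0≤ : ∀ {n} {f : F n → ℚ} → (∀ x → 0ℚ ≤ f x) → 0ℚ ≤ S f
  S-0≤ {zero} h = h []
  S-0≤ {suc n} h = (S-0≤ λ x → h (false ∷ x)) ⊞ (S-0≤ λ x → h (true ∷ x))

  S-cs : ∀ {n} {a b c : F n → ℚ} → (∀ x → 0ℚ ≤ b x) → (∀ x → 0ℚ ≤ c x) → (∀ x → a x * a x ≤ b x * c x) → S a * S a ≤ S b * S c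
  S-cs {zero} hb hc h = h []
  S-cs {suc n} hb hc h = cs-+ (S-0≤ λ x → hb (false ∷ x)) (S-0≤ λ x → hc (false ∷ x)) (S-0≤ λ x → hb (true ∷ x)) (S-0≤ λ x → hc (true ∷ x))
    (S-cs (λ x → hb (false ∷ x)) (λ x → hc (false ∷ x)) (λ x → h (false ∷ x))) (S-cs (λ x → hb (true ∷ x)) (λ x → hc (true ∷ x)) (λ x → h (true ∷ x)))

hat-* : ∀ {n} (f g : F n → ℚ) ξ → hat (λ x → f x * g x) ξ ≡ S (λ η → hat f η * hat g (ξ ⊕ η))
hat-* {zero} f g [] = trans (𝔼-[] _) (trans (solve 2 (λ a b → a :* b :* con 1ℚ := a :* con 1ℚ :* (b :* con 1ℚ)) refl (f []) (g [])) (sym (trans (S-[] _) (cong₂ _*_ (𝔼-[] _) (𝔼-[] _)))))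
hat-* {suc n} f g (b ∷ ξ) = lem b
  where
  f0 f1 g0 g1 : F n → ℚ
  f0 x = f (false ∷ x)
  f1 x = f (true ∷ x)
  g0 x = g (false ∷ x)
  g1 x = g (true ∷ x)
  pw : ∀ (p q r s : F n → ℚ) → S (λ η → (½ * (p η + q η)) * (½ * (r η + s η))) + S (λ η → (½ * (p η - q η)) * (½ * (r η - s η)))
    ≡ ½ * (S (λ η → p η * r η) + S (λ η → q η * s η))
  pw p q r s = trans (sym (S-+ _ _)) (trans (S-cong λ η → solve 4 (λ p q r s → (con ½ :* (p :+ q)) :* (con ½ :* (r :+ s)) :+ (con ½ :* (p :- q)) :* (con ½ :* (r :- s))
      := con ½ :* (p :* r :+ q :* s)) refl (p η) (q η) (r η) (s η)) (trans (S-* ½ _) (cong (½ *_) (S-+ _ _))))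
  pw' : ∀ (p q r s : F n → ℚ) → S (λ η → (½ * (p η + q η)) * (½ * (r η - s η))) + S (λ η → (½ * (p η - q η)) * (½ * (r η + s η)))
    ≡ ½ * (S (λ η → p η * r η) - S (λ η → q η * s η))
  pw' p q r s = trans (sym (S-+ _ _)) (trans (S-cong λ η → solve 4 (λ p q r s → (con ½ :* (p :+ q)) :* (con ½ :* (r :- s)) :+ (con ½ :* (p :- q)) :* (con ½ :* (r :+ s))
      := con ½ :* (p :* r :+ (:- con 1ℚ) :* (q :* s))) refl (p η) (q η) (r η) (s η)) (trans (S-* ½ _) (cong (½ *_) (trans (S-+ _ _) (cong₂ _+_ refl (trans (S-* (- 1ℚ) _)
        (solve 1 (λ a → (:- con 1ℚ) :* a := :- a) refl (S (λ η → q η * s η)))))))))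
  lem : ∀ b → hat (λ x → f x * g x) (b ∷ ξ) ≡ S (λ η → hat f η * hat g ((b ∷ ξ) ⊕ η))
  lem false = trans (hat-false (λ x → f x * g x) ξ) (trans (cong (½ *_) (cong₂ _+_ (hat-* f0 g0 ξ) (hat-* f1 g1 ξ)))
    (sym (trans (trans (S-∷ _) (cong₂ _+_ (S-cong λ η → cong₂ _*_ (hat-false f η) (hat-false g (ξ ⊕ η))) (S-cong λ η → cong₂ _*_ (hat-true f η) (hat-true g (ξ ⊕ η)))))
      (pw (hat f0) (hat f1) (λ η → hat g0 (ξ ⊕ η)) (λ η → hat g1 (ξ ⊕ η))))))
  lem true = trans (hat-true (λ x → f x * g x) ξ) (trans (cong (½ *_) (cong₂ _-_ (hat-* f0 g0 ξ) (hat-* f1 g1 ξ)))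
    (sym (trans (trans (S-∷ _) (cong₂ _+_ (S-cong λ η → cong₂ _*_ (hat-false f η) (hat-true g (ξ ⊕ η))) (S-cong λ η → cong₂ _*_ (hat-true f η) (hat-false g (ξ ⊕ η)))))
      (pw' (hat f0) (hat f1) (λ η → hat g0 (ξ ⊕ η)) (λ η → hat g1 (ξ ⊕ η))))))

𝟘-⊕ : ∀ {n} (x : F n) → 𝟘 ⊕ x ≡ x
𝟘-⊕ x = trans (⊕-comm 𝟘 x) (⊕-𝟘 x)

parseval : ∀ {n} (f g : F n → ℚ) → 𝔼 (λ x → f x * g x) ≡ S (λ η → hat f η * hat g η)
parseval f g = trans (sym (hat-𝟘 _)) (trans (hat-* f g 𝟘) (S-cong λ η → cong (λ z → hat f η * hat g z) (𝟘-⊕ η)))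

cv : ∀ {n} → (F n → ℚ) → (F n → ℚ) → F n → ℚ
cv f g t = 𝔼 (λ x → f x * g (x ⊕ t))

hat-E : ∀ {A n} (M : Mean A) (f : A → F n → ℚ) ξ → hat (λ x → M .E (λ a → f a x)) ξ ≡ M .E (λ a → hat (f a) ξ)
hat-E M f ξ = let module M = Mean M in trans (𝔼.E-cong λ x → sym (M.E-*ʳ _ _)) (sym (E-swap M _))

hat-cv : ∀ {n} (f g : F n → ℚ) ξ → hat (cv f g) ξ ≡ hat f ξ * hat g ξ
hat-cv f g ξ = trans (hat-E (bits _) (λ x t → f x * g (x ⊕ t)) ξ) (trans (𝔼.E-cong λ x →
    trans (𝔼.E-cong λ t → pt x t) (trans (𝔼.E-* (f x * χ ξ x) _) (cong (f x * χ ξ x *_) (𝔼-shiftˡ x (λ y → g y * χ ξ y)))))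
  (𝔼.E-*ʳ _ _))
  where
  pt : ∀ x t → f x * g (x ⊕ t) * χ ξ t ≡ f x * χ ξ x * (g (x ⊕ t) * χ ξ (x ⊕ t))
  pt x t = trans (solve 4 (λ a b c d → a :* b :* c := a :* b :* (con 1ℚ :* c)) refl (f x) (g (x ⊕ t)) (χ ξ t) (χ ξ x))
    (trans (cong (λ z → f x * g (x ⊕ t) * (z * χ ξ t)) (sym (sgn² (dot ξ x))))
    (trans (solve 4 (λ a b c d → a :* b :* (d :* d :* c) := a :* d :* (b :* (d :* c))) refl (f x) (g (x ⊕ t)) (χ ξ t) (χ ξ x))
      (cong (λ z → f x * χ ξ x * (g (x ⊕ t) * z)) (sym (χ-⊕ ξ x t)))))

hat-+ : ∀ {n} (f g : F n → ℚ) ξ → hat (λ x → f x + g x) ξ ≡ hat f ξ + hat g ξ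
hat-+ f g ξ = trans (𝔼.E-cong λ x → solve 3 (λ a b c → (a :+ b) :* c := a :* c :+ b :* c) refl (f x) (g x) (χ ξ x)) (𝔼.E-+ _ _)

hat-scale : ∀ {n} c (f : F n → ℚ) ξ → hat (λ x → c * f x) ξ ≡ c * hat f ξ
hat-scale c f ξ = trans (𝔼.E-cong λ x → *-assoc c (f x) (χ ξ x)) (𝔼.E-* c _)

𝔼-cs : ∀ {n} {a b c : F n → ℚ} → (∀ x → 0ℚ ≤ b x) → (∀ x → 0ℚ ≤ c x) → (∀ x → a x * a x ≤ b x * c x) → 𝔼 a * 𝔼 a ≤ 𝔼 b * 𝔼 c
𝔼-cs {zero} {a} {b} {c} hb hc h = subst₂ _≤_ (sym (cong₂ _*_ (𝔼-[] a) (𝔼-[] a))) (sym (cong₂ _*_ (𝔼-[] b) (𝔼-[] c))) (h [])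
𝔼-cs {suc n} {a} {b} {c} hb hc h = subst₂ _≤_ (trans (quarter (𝔼 λ x → a (false ∷ x)) (𝔼 λ x → a (true ∷ x)) (𝔼 λ x → a (false ∷ x)) (𝔼 λ x → a (true ∷ x))) (sym (cong₂ _*_ (𝔼-∷ a) (𝔼-∷ a)))) (trans (quarter _ _ _ _) (sym (cong₂ _*_ (𝔼-∷ b) (𝔼-∷ c))))
  (*-monoˡ {½ * ½} (0≤½ ⊠ 0≤½) (cs-+ (𝔼.E-0≤ λ x → hb (false ∷ x)) (𝔼.E-0≤ λ x → hc (false ∷ x)) (𝔼.E-0≤ λ x → hb (true ∷ x)) (𝔼.E-0≤ λ x → hc (true ∷ x))
  (𝔼-cs (λ x → hb (false ∷ x)) (λ x → hc (false ∷ x)) (λ x → h (false ∷ x))) (𝔼-cs (λ x → hb (true ∷ x)) (λ x → hc (true ∷ x)) (λ x → h (true ∷ x)))))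
  where
  quarter : ∀ x y z w → ½ * ½ * ((x + y) * (z + w)) ≡ ½ * (x + y) * (½ * (z + w))
  quarter = solve 4 (λ x y z w → con ½ :* con ½ :* ((x :+ y) :* (z :+ w)) := con ½ :* (x :+ y) :* (con ½ :* (z :+ w))) refl

-- A function on F n dominated, on the Fourier side, by the geometric mean of two positive definite ones.
record Trip {n} (φ φ₁ φ₂ : F n → ℚ) : Set where
  field
    pos₁ : ∀ ξ → 0ℚ ≤ hat φ₁ ξ
    pos₂ : ∀ ξ → 0ℚ ≤ hat φ₂ ξ
    dom  : ∀ ξ → hat φ ξ * hat φ ξ ≤ hat φ₁ ξ * hat φ₂ ξ
open Trip public

Trip-cong : ∀ {n} {φ φ₁ φ₂ ψ ψ₁ ψ₂ : F n → ℚ} → (∀ x → φ x ≡ ψ x) → (∀ x → φ₁ x ≡ ψ₁ x) → (∀ x → φ₂ x ≡ ψ₂ x) → Trip φ φ₁ φ₂ → Trip ψ ψ₁ ψ₂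
Trip-cong e e₁ e₂ T .pos₁ ξ = subst (0ℚ ≤_) (hat-cong e₁ ξ) (T .pos₁ ξ)
Trip-cong e e₁ e₂ T .pos₂ ξ = subst (0ℚ ≤_) (hat-cong e₂ ξ) (T .pos₂ ξ)
Trip-cong e e₁ e₂ T .dom ξ = subst₂ _≤_ (cong (λ z → z * z) (hat-cong e ξ)) (cong₂ _*_ (hat-cong e₁ ξ) (hat-cong e₂ ξ)) (T .dom ξ)

Trip-cv : ∀ {n} (f g : F n → ℚ) → Trip (cv f g) (cv f f) (cv g g)
Trip-cv f g .pos₁ ξ = subst (0ℚ ≤_) (sym (hat-cv f f ξ)) (sq (hat f ξ))
Trip-cv f g .pos₂ ξ = subst (0ℚ ≤_) (sym (hat-cv g g ξ)) (sq (hat g ξ))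
Trip-cv f g .dom ξ = ≤-reflexive (trans (cong (λ z → z * z) (hat-cv f g ξ)) (trans (solve 2 (λ a b → (a :* b) :* (a :* b) := (a :* a) :* (b :* b)) refl (hat f ξ) (hat g ξ))
  (sym (cong₂ _*_ (hat-cv f f ξ) (hat-cv g g ξ)))))

Trip-* : ∀ {n} {φ φ₁ φ₂ ψ ψ₁ ψ₂ : F n → ℚ} → Trip φ φ₁ φ₂ → Trip ψ ψ₁ ψ₂ → Trip (λ x → φ x * ψ x) (λ x → φ₁ x * ψ₁ x) (λ x → φ₂ x * ψ₂ x)
Trip-* T U .pos₁ ξ = subst (0ℚ ≤_) (sym (hat-* _ _ ξ)) (S-0≤ λ η → T .pos₁ η ⊠ U .pos₁ (ξ ⊕ η))
Trip-* T U .pos₂ ξ = subst (0ℚ ≤_) (sym (hat-* _ _ ξ)) (S-0≤ λ η → T .pos₂ η ⊠ U .pos₂ (ξ ⊕ η))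
Trip-* T U .dom ξ = subst₂ _≤_ (sym (cong₂ _*_ (hat-* _ _ ξ) (hat-* _ _ ξ))) (sym (cong₂ _*_ (hat-* _ _ ξ) (hat-* _ _ ξ)))
  (S-cs (λ η → T .pos₁ η ⊠ U .pos₁ (ξ ⊕ η)) (λ η → T .pos₂ η ⊠ U .pos₂ (ξ ⊕ η)) (λ η → cs-* (T .dom η) (U .dom (ξ ⊕ η))))

Trip-1 : ∀ {n} → Trip {n} (λ _ → 1ℚ) (λ _ → 1ℚ) (λ _ → 1ℚ)
Trip-1 {n} = Trip-cong e e e (Trip-cv (λ _ → 1ℚ) (λ _ → 1ℚ))
  where
  e : ∀ (x : F n) → 𝔼 {n} (λ _ → 1ℚ * 1ℚ) ≡ 1ℚ
  e x = trans (𝔼.E-const _) (*-identityˡ 1ℚ)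

Trip-^ : ∀ {n} {φ φ₁ φ₂ : F n → ℚ} k → Trip φ φ₁ φ₂ → Trip (λ x → φ x ^ k) (λ x → φ₁ x ^ k) (λ x → φ₂ x ^ k)
Trip-^ zero T = Trip-1
Trip-^ (suc k) T = Trip-* T (Trip-^ k T)

Trip-𝔼 : ∀ {m n} {φ φ₁ φ₂ : F m → F n → ℚ} → (∀ z → Trip (φ z) (φ₁ z) (φ₂ z)) → Trip (λ x → 𝔼 λ z → φ z x) (λ x → 𝔼 λ z → φ₁ z x) (λ x → 𝔼 λ z → φ₂ z x)
Trip-𝔼 {m} T .pos₁ ξ = subst (0ℚ ≤_) (sym (hat-E (bits m) _ ξ)) (𝔼.E-0≤ λ z → T z .pos₁ ξ)
Trip-𝔼 {m} T .pos₂ ξ = subst (0ℚ ≤_) (sym (hat-E (bits m) _ ξ)) (𝔼.E-0≤ λ z → T z .pos₂ ξ)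
Trip-𝔼 {m} T .dom ξ = subst₂ _≤_ (sym (cong₂ _*_ (hat-E (bits m) _ ξ) (hat-E (bits m) _ ξ))) (sym (cong₂ _*_ (hat-E (bits m) _ ξ) (hat-E (bits m) _ ξ)))
  (𝔼-cs (λ z → T z .pos₁ ξ) (λ z → T z .pos₂ ξ) (λ z → T z .dom ξ))

Trip-mean : ∀ {n} {φ φ₁ φ₂ : F n → ℚ} → Trip φ φ₁ φ₂ → 𝔼 φ * 𝔼 φ ≤ 𝔼 φ₁ * 𝔼 φ₂
Trip-mean {φ = φ} {φ₁} {φ₂} T = subst₂ _≤_ (cong₂ _*_ (hat-𝟘 φ) (hat-𝟘 φ)) (cong₂ _*_ (hat-𝟘 φ₁) (hat-𝟘 φ₂)) (T .dom 𝟘)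

record Maj {n} (φ ψ : F n → ℚ) : Set where
  field
    low : ∀ ξ → 0ℚ ≤ hat φ ξ
    upp : ∀ ξ → hat φ ξ ≤ hat ψ ξ
open Maj public

Maj-* : ∀ {n} {φ ψ φ' ψ' : F n → ℚ} → Maj φ ψ → Maj φ' ψ' → Maj (λ x → φ x * φ' x) (λ x → ψ x * ψ' x)
Maj-* T U .low ξ = subst (0ℚ ≤_) (sym (hat-* _ _ ξ)) (S-0≤ λ η → T .low η ⊠ U .low (ξ ⊕ η))
Maj-* T U .upp ξ = subst₂ _≤_ (sym (hat-* _ _ ξ)) (sym (hat-* _ _ ξ)) (S-mono λ η → *-mono (T .low η) (T .upp η) (U .low (ξ ⊕ η)) (U .upp (ξ ⊕ η)))

Maj-^ : ∀ {n} {φ ψ : F n → ℚ} k → Maj φ ψ → Maj (λ x → φ x ^ k) (λ x → ψ x ^ k)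
Maj-^ zero T .low = Trip-1 .pos₁
Maj-^ zero T .upp ξ = ≤-refl
Maj-^ (suc k) T = Maj-* T (Maj-^ k T)

Maj-mean : ∀ {n} {φ ψ : F n → ℚ} → Maj φ ψ → 𝔼 φ ≤ 𝔼 ψ
Maj-mean {φ = φ} {ψ} T = subst₂ _≤_ (hat-𝟘 φ) (hat-𝟘 ψ) (T .upp 𝟘)

-- Nonzero linear functionals on F (suc n), recorded together with the position of their first 1.
data NZ : ℕ → Set where
  here : ∀ {n} → F n → NZ n
  skip : ∀ {n} → NZ n → NZ (suc n)

vec : ∀ {n} → NZ n → F (suc n)
vec (here ξ) = true ∷ ξ
vec (skip ν) = false ∷ vec ν

nz? : ∀ {n} (ξ : F n) → (ξ ≡ 𝟘) ⊎ (Σ ℕ λ m → Σ (NZ m) λ ν → Σ (n ≡ suc m) λ p → vec ν ≡ subst F p ξ)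
nz? [] = inj₁ refl
nz? (true ∷ ξ) = inj₂ (_ , here ξ , refl , refl)
nz? (false ∷ ξ) with nz? ξ
... | inj₁ refl = inj₁ refl
... | inj₂ (m , ν , refl , refl) = inj₂ (_ , skip ν , refl , refl)

-- The coset {x : ⟨vec ν, x⟩ = c}, parametrised by the coordinates other than the first 1 of ν.
hyp : ∀ {n} → NZ n → Bool → F n → F (suc n)
hyp (here ξ) c y = (c xor dot ξ y) ∷ y
hyp (skip ν) c (b ∷ y) = b ∷ hyp ν c y

xor-4 : ∀ a b c d → (a xor b) xor (c xor d) ≡ (a xor c) xor (b xor d)
xor-4 false b c d = trans (sym (𝔹P.xor-assoc b c d)) (trans (cong (_xor d) (𝔹P.xor-comm b c)) (𝔹P.xor-assoc c b d))
xor-4 true false c d = sym (𝔹P.xor-assoc true c d)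
xor-4 true true false d = sym (𝔹P.not-involutive d)
xor-4 true true true d = refl

hyp-⊕ : ∀ {n} (ν : NZ n) a b (x y : F n) → hyp ν a x ⊕ hyp ν b y ≡ hyp ν (a xor b) (x ⊕ y)
hyp-⊕ (here ξ) a b x y = cong (_∷ x ⊕ y) (trans (xor-4 a (dot ξ x) b (dot ξ y)) (cong ((a xor b) xor_) (sym (dot-⊕ ξ x y))))
hyp-⊕ (skip ν) a b (c ∷ x) (d ∷ y) = cong ((c xor d) ∷_) (hyp-⊕ ν a b x y)

xor-cancel : ∀ a b → (b xor a) xor a ≡ b
xor-cancel a b = trans (𝔹P.xor-assoc b a a) (trans (cong (b xor_) (𝔹P.xor-same a)) (𝔹P.xor-identityʳ b))

dot-hyp : ∀ {n} (ν : NZ n) c y → dot (vec ν) (hyp ν c y) ≡ c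
dot-hyp (here ξ) c y = xor-cancel (dot ξ y) c
dot-hyp (skip ν) c (b ∷ y) = dot-hyp ν c y

hyp-𝟘 : ∀ {n} (ν : NZ n) y → hyp ν false y ≡ 𝟘 → y ≡ 𝟘
hyp-𝟘 (here ξ) y h = cong Data.Vec.tail h
hyp-𝟘 (skip ν) (b ∷ y) h = cong₂ _∷_ (cong Data.Vec.head h) (hyp-𝟘 ν y (cong Data.Vec.tail h))

𝔼-hyp : ∀ {n} (ν : NZ n) (f : F (suc n) → ℚ) → 𝔼 f ≡ ½ * (𝔼 (λ y → f (hyp ν false y)) + 𝔼 (λ y → f (hyp ν true y)))
𝔼-hyp {n} (here ξ) f = trans (𝔼-∷ f) (cong (½ *_) (trans (sym (𝔼.E-+ {n} _ _)) (trans (𝔼.E-cong λ y → pt (dot ξ y) y) (𝔼.E-+ {n} _ _))))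
  where
  pt : ∀ b y → f (false ∷ y) + f (true ∷ y) ≡ f (b ∷ y) + f (not b ∷ y)
  pt false y = refl
  pt true y = +-comm _ _
𝔼-hyp (skip ν) f = trans (𝔼-∷ f) (trans (cong (½ *_) (cong₂ _+_ (𝔼-hyp ν (λ x → f (false ∷ x))) (𝔼-hyp ν (λ x → f (true ∷ x)))))
  (trans (solve 4 (λ a b c d → con ½ :* (con ½ :* (a :+ b) :+ con ½ :* (c :+ d)) := con ½ :* (con ½ :* (a :+ c) :+ con ½ :* (b :+ d))) refl
    (𝔼 (λ y → f (false ∷ hyp ν false y))) _ _ _) (cong (½ *_) (sym (cong₂ _+_ (𝔼-∷ (λ y → f (hyp (skip ν) false y))) (𝔼-∷ (λ y → f (hyp (skip ν) true y))))))))

-- A subspace of codimension r of F n, cut out by successive hyperplanes; its cosets are indexed by F r.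
data Flag : ℕ → ℕ → ℕ → Set where
  nil  : ∀ {n} → Flag 0 n n
  cons : ∀ {r m n} → NZ n → Flag r m n → Flag (suc r) m (suc n)

e : ∀ {r m n} → Flag r m n → F r → F m → F n
e nil c y = y
e (cons ν φ) (c ∷ cs) y = hyp ν c (e φ cs y)

flag-dim : ∀ {r m n} → Flag r m n → r ℕ.+ m ≡ n
flag-dim nil = refl
flag-dim (cons ν φ) = cong suc (flag-dim φ)

e-⊕ : ∀ {r m n} (φ : Flag r m n) a b x y → e φ a x ⊕ e φ b y ≡ e φ (a ⊕ b) (x ⊕ y)
e-⊕ nil a b x y = refl
e-⊕ (cons ν φ) (a ∷ as) (b ∷ bs) x y = trans (hyp-⊕ ν a b _ _) (cong (hyp ν (a xor b)) (e-⊕ φ as bs x y))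

e-𝟘 : ∀ {r m n} (φ : Flag r m n) y → e φ 𝟘 y ≡ 𝟘 → y ≡ 𝟘
e-𝟘 nil y h = h
e-𝟘 (cons ν φ) y h = e-𝟘 φ y (hyp-𝟘 ν _ h)

𝔼-e : ∀ {r m n} (φ : Flag r m n) (f : F n → ℚ) → 𝔼 f ≡ 𝔼 (λ c → 𝔼 (λ y → f (e φ c y)))
𝔼-e nil f = sym (𝔼-[] (λ c → 𝔼 (λ y → f (e nil c y))))
𝔼-e (cons ν φ) f = trans (𝔼-hyp ν f) (trans (cong (½ *_) (cong₂ _+_ (𝔼-e φ (λ y → f (hyp ν false y))) (𝔼-e φ (λ y → f (hyp ν true y))))) (sym (𝔼-∷ (λ c → 𝔼 (λ y → f (e (cons ν φ) c y))))))

_++F_ : ∀ {r m n r' m'} → Flag r m n → Flag r' m' m → Flag (r ℕ.+ r') m' n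
nil ++F ψ = ψ
cons ν φ ++F ψ = cons ν (φ ++F ψ)

e-++ : ∀ {r m n r' m'} (φ : Flag r m n) (ψ : Flag r' m' m) c d y → e (φ ++F ψ) (c ++ d) y ≡ e φ c (e ψ d y)
e-++ nil ψ [] d y = refl
e-++ (cons ν φ) ψ (c ∷ cs) d y = cong (hyp ν c) (e-++ φ ψ cs d y)

Fn : ℕ → Set
Fn n = F n → Bool

_∘e_ : ∀ {n} {A : Set} → (F n → A) → ∀ {r m} → (Flag r m n × F r) → F m → A
(f ∘e (φ , c)) y = f (e φ c y)

Gap : ∀ {n} → Fn n → Set
Gap T = ∀ ξ → ξ ≢ 𝟘 → (2ℚ * hat (λ x → 𝟙 (T x)) ξ) * (2ℚ * hat (λ x → 𝟙 (T x)) ξ) ≤ ∣ T ∣ * ∣ T ∣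

hat-vec : ∀ {n} (ν : NZ n) (f : F (suc n) → ℚ) → hat f (vec ν) ≡ ½ * (𝔼 (λ y → f (hyp ν false y)) - 𝔼 (λ y → f (hyp ν true y)))
hat-vec ν f = trans (𝔼-hyp ν _) (cong (½ *_) (cong₂ _+_
  (𝔼.E-cong λ y → trans (cong (λ b → f (hyp ν false y) * sgn b) (dot-hyp ν false y)) (*-identityʳ _))
  (trans (𝔼.E-cong λ y → trans (cong (λ b → f (hyp ν true y) * sgn b) (dot-hyp ν true y)) (solve 1 (λ a → a :* (:- con 1ℚ) := :- a) refl (f (hyp ν true y)))) (𝔼.E-neg _))))

-- A nontrivial Fourier coefficient above half the trivial one raises the density by a factor 3/2 on a hyperplane.
find-gap : ∀ R {n} (T : Fn n) → (2 ÷ 3) ^ R < ∣ T ∣ →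
  (∀ {r m} (φ : Flag r m n) (c : F r) → r ℕ.≤ R → Gap (T ∘e (φ , c)) → ∣ T ∣ ≤ ∣ T ∘e (φ , c) ∣ → ⊥) → ⊥
find-gap zero T h k = <⇒≱ h (∣∣≤1 T)
find-gap (suc R) {n} T h k = ¬¬em (λ g → k nil [] ℕ.z≤n g ≤-refl) λ ng → ng λ ξ ne → ≤-stable λ bad → step ξ ne (ℚP.≰⇒> bad)
  where
  step : ∀ ξ → ξ ≢ 𝟘 → ∣ T ∣ * ∣ T ∣ < (2ℚ * hat (λ x → 𝟙 (T x)) ξ) * (2ℚ * hat (λ x → 𝟙 (T x)) ξ) → ⊥
  step ξ ne lt with nz? ξ
  ... | inj₁ eq = ne eq
  ... | inj₂ (m , ν , refl , refl) = choose
    where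
    t = ∣ T ∣
    co = 2ℚ * hat (λ x → 𝟙 (T x)) (vec ν)
    T' : Bool → ℚ
    T' b = ∣ T ∘e (cons ν nil , b ∷ []) ∣
    t≡ : t ≡ ½ * (T' false + T' true)
    t≡ = 𝔼-hyp ν _
    co≡ : co ≡ T' false - T' true
    co≡ = trans (cong (2ℚ *_) (hat-vec ν (λ x → 𝟙 (T x)))) (solve 1 (λ a → con 2ℚ :* (con ½ :* a) := a) refl _)
    grow : ∀ b → (3 ÷ 2) * t ≤ T' b → ⊥
    grow b g = find-gap R (T ∘e (cons ν nil , b ∷ [])) (<-≤ big g) λ {r} φ c le gp den →
      k (cons ν φ) (b ∷ c) (ℕ.s≤s le) gp (≤-trans (≤-trans (≤by ((lit {0ℚ} {1 ÷ 2}) ⊠ 0≤∣∣ T) (solve 1 (λ t → con (1 ÷ 2) :* t := con (3 ÷ 2) :* t :- t) refl t)) g) den)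
      where
      big : (2 ÷ 3) ^ R < (3 ÷ 2) * t
      big = subst (_< (3 ÷ 2) * t) (solve 1 (λ x → con (3 ÷ 2) :* (con (2 ÷ 3) :* x) := x) refl ((2 ÷ 3) ^ R)) (*-monoˡ-< (lit< {0ℚ} {3 ÷ 2}) h)
    bound : ∀ b c → t ≡ ½ * (T' b + T' c) → T' b - T' c ≤ t
    bound b c eq = ≤by (lit {0ℚ} {2ℚ} ⊠ dif (≰⇒≥ (grow b)))
      (trans (cong (λ t → 2ℚ * ((3 ÷ 2) * t - T' b)) eq) (trans (solve 2 (λ a b → con 2ℚ :* (con (3 ÷ 2) :* (con ½ :* (a :+ b)) :- a) := con ½ :* (a :+ b) :- (a :- b)) refl (T' b) (T' c))
        (cong (_- (T' b - T' c)) (sym eq))))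
    choose : ⊥
    choose with ℚP.≤-total (T' true) (T' false)
    ... | inj₁ le = <⇒≱ lt (subst (λ z → z * z ≤ t * t) (sym co≡) (*-mono (dif le) u (dif le) u))
      where
      u = bound false true t≡
    ... | inj₂ le = <⇒≱ lt (subst (λ z → z * z ≤ t * t) (sym co≡) (subst (_≤ t * t) (solve 2 (λ a b → (b :- a) :* (b :- a) := (a :- b) :* (a :- b)) refl (T' false) (T' true)) (*-mono (dif le) u (dif le) u)))
      where
      u = bound true false (trans t≡ (cong (½ *_) (+-comm _ _)))

isZ : ∀ {n} → F n → Bool
isZ [] = true
isZ (true ∷ x) = false
isZ (false ∷ x) = isZ x

isZ-true : ∀ {n} (x : F n) → isZ x ≡ true → x ≡ 𝟘
isZ-true [] h = refl
isZ-true (false ∷ x) h = cong (false ∷_) (isZ-true x h)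

isZ-𝟘 : ∀ n → isZ (𝟘 {n}) ≡ true
isZ-𝟘 zero = refl
isZ-𝟘 (suc n) = isZ-𝟘 n

isZ-false : ∀ {n} (x : F n) → isZ x ≡ false → x ≢ 𝟘
isZ-false {n} x h refl with trans (sym h) (isZ-𝟘 n)
... | ()

S-point : ∀ {n} (f : F n → ℚ) → S (λ ξ → 𝟙 (isZ ξ) * f ξ) ≡ f 𝟘
S-point {zero} f = trans (S-[] _) (*-identityˡ _)
S-point {suc n} f = trans (S-∷ _) (trans (cong₂ _+_ (S-point (λ ξ → f (false ∷ ξ))) (S-* 0ℚ (λ ξ → f (true ∷ ξ)))) (solve 2 (λ a b → a :+ con 0ℚ :* b := a) refl _ (S λ ξ → f (true ∷ ξ))))

record Kernel (m : ℕ) : Set where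
  field
    μ    : F m → ℚ
    0≤μ  : ∀ w → 0ℚ ≤ μ w
    𝔼μ   : 𝔼 μ ≡ 1ℚ
    pos  : ∀ ξ → 0ℚ ≤ hat μ ξ
    small : ∀ ξ → ξ ≢ 𝟘 → hat μ ξ ≤ 1 ÷ 4

module Smooth {r m n} (φ : Flag r m n) (κ : Kernel m) where
  open Kernel κ

  P : (F n → ℚ) → F n → ℚ
  P f x = 𝔼 (λ w → μ w * f (x ⊕ e φ 𝟘 w))

  P^ : ℕ → (F n → ℚ) → F n → ℚ
  P^ zero f = f
  P^ (suc i) f = P (P^ i f)

  P-0≤ : ∀ {f} → (∀ x → 0ℚ ≤ f x) → ∀ x → 0ℚ ≤ P f x
  P-0≤ h x = 𝔼.E-0≤ λ w → 0≤μ w ⊠ h _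

  P-≤1 : ∀ {f} → (∀ x → f x ≤ 1ℚ) → ∀ x → P f x ≤ 1ℚ
  P-≤1 h x = ≤-trans (𝔼.E-mono λ w → ≤-trans (*-monoˡ (0≤μ w) (h _)) (≤-reflexive (*-identityʳ (μ w)))) (≤-reflexive 𝔼μ)

  P-adj : ∀ f g → 𝔼 (λ x → P f x * g x) ≡ 𝔼 (λ x → f x * P g x)
  P-adj f g = trans (𝔼.E-cong λ x → sym (𝔼.E-*ʳ _ (g x))) (trans (𝔼-swap _) (trans (𝔼.E-cong λ w →
     trans (sym (𝔼-shift (e φ 𝟘 w) _)) (𝔼.E-cong λ x → trans (cong (λ z → μ w * f z * g (x ⊕ e φ 𝟘 w)) (⊕-cancelʳ x (e φ 𝟘 w)))
        (solve 3 (λ a b c → a :* b :* c := b :* (a :* c)) refl (μ w) (f x) (g (x ⊕ e φ 𝟘 w)))))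
     (trans (𝔼-swap _) (𝔼.E-cong λ x → 𝔼.E-* (f x) _))))

  P-mean : ∀ f → 𝔼 (P f) ≡ 𝔼 f
  P-mean f = trans (𝔼-swap _) (trans (𝔼.E-cong λ w → trans (𝔼.E-* (μ w) _) (cong (μ w *_) (𝔼-shift (e φ 𝟘 w) f)))
    (trans (𝔼.E-*ʳ μ (𝔼 f)) (trans (cong (_* 𝔼 f) 𝔼μ) (*-identityˡ _))))

  P-hat : ∀ f v ξ → hat (P f ∘e (φ , v)) ξ ≡ hat μ ξ * hat (f ∘e (φ , v)) ξ
  P-hat f v ξ = trans (hat-cong (λ y → 𝔼.E-cong λ w → cong (λ z → μ w * f z) (trans (e-⊕ φ v 𝟘 y w) (trans (cong (λ c → e φ c (y ⊕ w)) (⊕-𝟘 v)) (cong (e φ v) (⊕-comm y w))))) ξ)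
    (hat-cv μ (f ∘e (φ , v)) ξ)

  P^-hat : ∀ i f v ξ → hat (P^ i f ∘e (φ , v)) ξ ≡ hat μ ξ ^ i * hat (f ∘e (φ , v)) ξ
  P^-hat zero f v ξ = sym (*-identityˡ _)
  P^-hat (suc i) f v ξ = trans (P-hat (P^ i f) v ξ) (trans (cong (hat μ ξ *_) (P^-hat i f v ξ)) (sym (*-assoc _ _ _)))

  coset : ∀ i f g v → (∀ y → 0ℚ ≤ f y) → (∀ y → f y ≤ 1ℚ) → (∀ y → 0ℚ ≤ g y) → (∀ y → g y ≤ 1ℚ) →
    𝔼 (f ∘e (φ , v)) * 𝔼 (g ∘e (φ , v)) ≤ 𝔼 (λ y → P^ i f (e φ v y) * g (e φ v y)) + (1 ÷ 4) ^ i
  coset i f g v f0 f1 g0 g1 = ≤-trans (≤-reflexive (trans (sym (cong₂ _*_ (hat-𝟘 fv) (hat-𝟘 gv))) (sym (S-point (λ ξ → hat fv ξ * hat gv ξ)))))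
    (≤-trans (S-mono pt) (≤-trans (≤-reflexive (S-+ _ _)) (+-mono main err)))
    where
    fv = f ∘e (φ , v)
    gv = g ∘e (φ , v)
    ε = (1 ÷ 4) ^ i
    0≤ε : 0ℚ ≤ ε
    0≤ε = 0≤^ i lit
    pt : ∀ ξ → 𝟙 (isZ ξ) * (hat fv ξ * hat gv ξ) ≤ (hat μ ξ ^ i * hat fv ξ) * hat gv ξ + (½ * ε) * (hat fv ξ * hat fv ξ + hat gv ξ * hat gv ξ)
    pt ξ with isZ ξ in z
    ... | true rewrite isZ-true ξ z | trans (hat-𝟘 μ) 𝔼μ | 1^ i = ≤by ((0≤½ ⊠ 0≤ε) ⊠ (sq a ⊞ sq b)) (solve 3 (λ a b ε → (con ½ :* ε) :* (a :* a :+ b :* b) := con 1ℚ :* a :* b :+ (con ½ :* ε) :* (a :* a :+ b :* b) :- con 1ℚ :* (a :* b)) refl a b ε)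
      where
      a = hat fv 𝟘
      b = hat gv 𝟘
    ... | false = ≤by ((0≤½ ⊠ dif u≤ε) ⊠ (sq a ⊞ sq b) ⊞ (0≤½ ⊠ 0≤u) ⊠ sq (a + b))
        (solve 4 (λ a b ε u → con ½ :* (ε :- u) :* (a :* a :+ b :* b) :+ con ½ :* u :* ((a :+ b) :* (a :+ b)) := u :* a :* b :+ (con ½ :* ε) :* (a :* a :+ b :* b) :- con 0ℚ :* (a :* b)) refl a b ε u)
      where
      a = hat fv ξ
      b = hat gv ξ
      u = hat μ ξ ^ i
      u≤ε : u ≤ ε
      u≤ε = ^-mono i (pos ξ) (small ξ (isZ-false ξ z))
      0≤u : 0ℚ ≤ u
      0≤u = 0≤^ i (pos ξ)
    main : S (λ ξ → (hat μ ξ ^ i * hat fv ξ) * hat gv ξ) ≤ 𝔼 (λ y → P^ i f (e φ v y) * g (e φ v y))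
    main = ≤-reflexive (trans (S-cong λ ξ → cong (_* hat gv ξ) (sym (P^-hat i f v ξ))) (sym (parseval (P^ i f ∘e (φ , v)) gv)))
    sq1 : ∀ (h : F m → ℚ) → (∀ y → 0ℚ ≤ h y) → (∀ y → h y ≤ 1ℚ) → S (λ ξ → hat h ξ * hat h ξ) ≤ 1ℚ
    sq1 h h0 h1 = ≤-trans (≤-reflexive (sym (parseval h h))) (𝔼.E-≤ λ y → ≤-trans (*-mono (h0 y) (h1 y) (h0 y) (h1 y)) (≤-reflexive (*-identityˡ 1ℚ)))
    err : S (λ ξ → (½ * ε) * (hat fv ξ * hat fv ξ + hat gv ξ * hat gv ξ)) ≤ ε
    err = ≤-trans (≤-reflexive (trans (S-* (½ * ε) _) (cong (½ * ε *_) (S-+ _ _)))) (≤-trans (*-monoˡ (0≤½ ⊠ 0≤ε)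
       (+-mono (sq1 fv (λ y → f0 _) (λ y → f1 _)) (sq1 gv (λ y → g0 _) (λ y → g1 _))))
       (≤-reflexive (solve 1 (λ ε → con ½ :* ε :* (con 1ℚ :+ con 1ℚ) := ε) refl ε)))

  -- If every shift in the support of μ is an approximate period of G, then so is iterated smoothing, with additive losses.
  telescope : ∀ (A G : F n → ℚ) θ ρ i → (∀ x → 0ℚ ≤ A x) → (∀ x → A x ≤ 1ℚ) →
    (∀ w g → μ w ≢ 0ℚ → (∀ x → 0ℚ ≤ g x) → (∀ x → g x ≤ 1ℚ) → 𝔼 (λ x → g x * (G (x ⊕ e φ 𝟘 w) - G x)) ≤ θ * 𝔼 g + ρ) →
    𝔼 (λ x → P^ i A x * G x) ≤ 𝔼 (λ x → A x * G x) + ι i * (θ * 𝔼 A + ρ)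
  telescope A G θ ρ zero a0 a1 per = ≤-reflexive (solve 2 (λ a b → a := a :+ con 0ℚ :* b) refl _ _)
  telescope A G θ ρ (suc i) a0 a1 per = ≤-trans step (≤-trans (+-mono (telescope A G θ ρ i a0 a1 per) ≤-refl)
      (≤-reflexive (solve 3 (λ a b k → a :+ k :* b :+ b := a :+ (con 1ℚ :+ k) :* b) refl _ _ (ι i))))
    where
    B = P^ i A
    bnd : ∀ i → (∀ x → 0ℚ ≤ P^ i A x) × (∀ x → P^ i A x ≤ 1ℚ) × 𝔼 (P^ i A) ≡ 𝔼 A
    bnd zero = a0 , a1 , refl
    bnd (suc i) with bnd i
    ... | p , q , s = P-0≤ p , P-≤1 q , trans (P-mean (P^ i A)) s
    b0 = proj₁ (bnd i)
    b1 = proj₁ (proj₂ (bnd i))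
    one : ∀ w → μ w * 𝔼 (λ x → B x * (G (x ⊕ e φ 𝟘 w) - G x)) ≤ μ w * (θ * 𝔼 A + ρ)
    one w with μ w ℚP.≟ 0ℚ
    ... | yes p = ≤-reflexive (trans (*≡ʳ p) (trans (*-zeroˡ _) (sym (trans (*≡ʳ p) (*-zeroˡ _)))))
    ... | no p = *-monoˡ (0≤μ w) (subst (λ z → 𝔼 (λ x → B x * (G (x ⊕ e φ 𝟘 w) - G x)) ≤ θ * z + ρ) (proj₂ (proj₂ (bnd i))) (per w B p b0 b1))
    diff : 𝔼 (λ x → P B x * G x) - 𝔼 (λ x → B x * G x) ≡ 𝔼 (λ w → μ w * 𝔼 (λ x → B x * (G (x ⊕ e φ 𝟘 w) - G x)))
    diff = trans (cong₂ _-_ (trans (P-adj B G) (trans (𝔼.E-cong λ x → sym (𝔼.E-* (B x) _)) (𝔼-swap _)))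
        (trans (sym (*-identityˡ _)) (trans (*≡ʳ (sym 𝔼μ)) (sym (𝔼.E-*ʳ μ _)))))
      (trans (sym (𝔼.E-- _ _)) (𝔼.E-cong λ w → trans (cong (λ z → 𝔼 (λ x → B x * (μ w * G (x ⊕ e φ 𝟘 w))) - z) (sym (𝔼.E-* (μ w) _))) (trans (sym (𝔼.E-- _ _))
         (trans (𝔼.E-cong λ x → solve 4 (λ b u g h → b :* (u :* g) :- u :* (b :* h) := u :* (b :* (g :- h))) refl (B x) (μ w) _ (G x)) (𝔼.E-* (μ w) _)))))
    step : 𝔼 (λ x → P B x * G x) ≤ 𝔼 (λ x → B x * G x) + (θ * 𝔼 A + ρ)
    step = ≤by (dif (≤-trans (≤-reflexive diff) (≤-trans (𝔼.E-mono one) (≤-reflexive (trans (𝔼.E-*ʳ μ _) (trans (*≡ʳ 𝔼μ) (*-identityˡ _)))))))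
      (solve 3 (λ p b t → t :- (p :- b) := b :+ t :- p) refl _ _ _)

kernel : ∀ {m} (T : Fn m) → Gap T → 0ℚ < ∣ T ∣ → Σ (Kernel m) λ κ → ∀ w → Kernel.μ κ w ≢ 0ℚ → ¬ ¬ Σ (F m) λ s → (T s ≡ true) × (T (s ⊕ w) ≡ true)
kernel {m} T gap pos with inv pos
... | i , ti = record { μ = μ ; 0≤μ = 0≤μ ; 𝔼μ = trans (sym (hat-𝟘 μ)) one ; pos = hpos ; small = hsmall } , supp
  where
  t = ∣ T ∣
  f = λ x → 𝟙 (T x)
  0≤i : 0ℚ ≤ i
  0≤i = <⇒≤ (inv-pos pos ti)
  μ : F m → ℚ
  μ w = (i * i) * cv f f w
  hμ : ∀ ξ → hat μ ξ ≡ (i * hat f ξ) * (i * hat f ξ)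
  hμ ξ = trans (hat-scale (i * i) (cv f f) ξ) (trans (cong (i * i *_) (hat-cv f f ξ)) (solve 2 (λ i a → i :* i :* (a :* a) := (i :* a) :* (i :* a)) refl i (hat f ξ)))
  0≤μ : ∀ w → 0ℚ ≤ μ w
  0≤μ w = (0≤i ⊠ 0≤i) ⊠ 𝔼.E-0≤ λ x → 0≤𝟙 (T x) ⊠ 0≤𝟙 (T (x ⊕ w))
  one : hat μ 𝟘 ≡ 1ℚ
  one = trans (hμ 𝟘) (trans (cong (λ z → (i * z) * (i * z)) (hat-𝟘 f)) (trans (cong (λ z → z * z) (trans (*-comm i t) ti)) (*-identityˡ 1ℚ)))
  hpos : ∀ ξ → 0ℚ ≤ hat μ ξ
  hpos ξ = subst (0ℚ ≤_) (sym (hμ ξ)) (sq _)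
  hsmall : ∀ ξ → ξ ≢ 𝟘 → hat μ ξ ≤ 1 ÷ 4
  hsmall ξ ne = ≤-trans (≤-reflexive (trans (hμ ξ) (solve 2 (λ i a → (i :* a) :* (i :* a) := con (1 ÷ 4) :* ((i :* i) :* ((con 2ℚ :* a) :* (con 2ℚ :* a)))) refl i (hat f ξ))))
    (≤-trans (*-monoˡ (lit {0ℚ} {1 ÷ 4}) (*-monoˡ (0≤i ⊠ 0≤i) (gap ξ ne))) (≤-reflexive (trans (solve 2 (λ i t → con (1 ÷ 4) :* ((i :* i) :* (t :* t)) := con (1 ÷ 4) :* ((t :* i) :* (t :* i))) refl i t)
      (trans (cong (λ z → (1 ÷ 4) * (z * z)) ti) (solve 0 (con (1 ÷ 4) :* (con 1ℚ :* con 1ℚ) := con (1 ÷ 4)) refl)))))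
  supp : ∀ w → μ w ≢ 0ℚ → ¬ ¬ Σ (F m) λ s → (T s ≡ true) × (T (s ⊕ w) ≡ true)
  supp w ne nope = ne (trans (cong (i * i *_) (trans (𝔼.E-cong zz) (𝔼.E-const 0ℚ))) (*-zeroʳ _))
    where
    zz : ∀ x → f x * f (x ⊕ w) ≡ 0ℚ
    zz x with T x in p | T (x ⊕ w) in q
    ... | false | _ = *-zeroˡ _
    ... | true | false = *-zeroʳ _
    ... | true | true = ⊥-elim (nope (x , p , q))

-- Almost periodicity

∏ : ∀ {A : Set} {l} → (A → ℚ) → Vec A l → ℚ
∏ w [] = 1ℚ
∏ w (a ∷ v) = w a * ∏ w v

∏-0≤ : ∀ {A : Set} {l} {w : A → ℚ} → (∀ a → 0ℚ ≤ w a) → (v : Vec A l) → 0ℚ ≤ ∏ w v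
∏-0≤ h [] = 0≤1
∏-0≤ h (a ∷ v) = h a ⊠ ∏-0≤ h v

tup-∏ : ∀ {A} (M : Mean A) l (w : A → ℚ) → tup M l .E (∏ w) ≡ M .E w ^ l
tup-∏ M zero w = refl
tup-∏ M (suc l) w = trans (M .E-cong λ a → trans (tup M l .E-* (w a) _) (cong (w a *_) (tup-∏ M l w))) (E-*ʳ M w _)

∏-mul : ∀ {A : Set} {l} (f g : A → ℚ) (v : Vec A l) → ∏ f v * ∏ g v ≡ ∏ (λ a → f a * g a) v
∏-mul f g [] = *-identityˡ 1ℚ
∏-mul f g (a ∷ v) = trans (solve 4 (λ a b c d → a :* b :* (c :* d) := (a :* c) :* (b :* d)) refl (f a) (∏ f v) (g a) (∏ g v)) (cong (f a * g a *_) (∏-mul f g v))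

∏-≤1 : ∀ {A : Set} {l} {w : A → ℚ} → (∀ a → 0ℚ ≤ w a) → (∀ a → w a ≤ 1ℚ) → (v : Vec A l) → ∏ w v ≤ 1ℚ
∏-≤1 h k [] = ≤-refl
∏-≤1 h k (a ∷ v) = ≤-trans (*-mono (h a) (k a) (∏-0≤ h v) (∏-≤1 h k v)) (≤-reflexive (*-identityˡ 1ℚ))

module Periods {n} (A B : Fn n) (l j : ℕ) (η : ℚ) (0≤η : 0ℚ ≤ η)
  (0<l : 0ℚ < ι l) (big : 64 ÷ 1 ≤ η * η * ι l) (αpos : 0ℚ < ∣ A ∣) where

  α = ∣ A ∣
  0≤α = 0≤∣∣ A

  G : F n → ℚ
  G x = 𝔼 (λ a → 𝟙 (A a) * 𝟙 (B (x ⊕ a)))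

  0≤G : ∀ x → 0ℚ ≤ G x
  0≤G x = 𝔼.E-0≤ λ a → 0≤𝟙 (A a) ⊠ 0≤𝟙 (B (x ⊕ a))

  G≤α : ∀ x → G x ≤ α
  G≤α x = 𝔼.E-mono λ a → ≤-trans (*-monoˡ (0≤𝟙 (A a)) (𝟙≤1 (B (x ⊕ a)))) (≤-reflexive (*-identityʳ _))

  wA : ∀ {l} → Vec (F n) l → ℚ
  wA = ∏ (λ a → 𝟙 (A a))

  X : F n → F n → ℚ
  X x a = α * 𝟙 (B (x ⊕ a)) - G x

  dev : ∀ {l} → F n → Vec (F n) l → ℚ
  dev x [] = 0ℚ
  dev x (a ∷ v) = X x a + dev x v

  T^ : ∀ l → Mean (Vec (F n) l)
  T^ l = tup (bits n) l

  EX : ∀ x → 𝔼 (λ a → 𝟙 (A a) * X x a) ≡ 0ℚ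
  EX x = trans (𝔼.E-cong λ a → solve 4 (λ u al v g → u :* (al :* v :- g) := al :* (u :* v) :+ (:- g) :* u) refl (𝟙 (A a)) α (𝟙 (B (x ⊕ a))) (G x))
    (trans (𝔼.E-lin α _ (- G x) _) (solve 2 (λ g al → al :* g :+ (:- g) :* al := con 0ℚ) refl (G x) α))

  X²≤ : ∀ x a → X x a * X x a ≤ α * α
  X²≤ x a with B (x ⊕ a)
  ... | true = subst₂ _≤_ (solve 2 (λ α g → (α :- g) :* (α :- g) := (α :* con 1ℚ :- g) :* (α :* con 1ℚ :- g)) refl α (G x)) refl
        (*-mono (dif (G≤α x)) (≤by (0≤G x) (solve 2 (λ α g → g := α :- (α :- g)) refl α (G x))) (dif (G≤α x)) (≤by (0≤G x) (solve 2 (λ α g → g := α :- (α :- g)) refl α (G x))))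
  ... | false = subst₂ _≤_ (solve 2 (λ α g → g :* g := (α :* con 0ℚ :- g) :* (α :* con 0ℚ :- g)) refl α (G x)) refl
        (*-mono (0≤G x) (G≤α x) (0≤G x) (G≤α x))

  EX² : ∀ x → 𝔼 (λ a → 𝟙 (A a) * (X x a * X x a)) ≤ α * (α * α)
  EX² x = ≤-trans (𝔼.E-mono λ a → *-monoˡ (0≤𝟙 (A a)) (X²≤ x a)) (≤-reflexive (𝔼.E-*ʳ _ (α * α)))

  E1 : ∀ l x → T^ l .E (λ v → wA v * dev x v) ≡ 0ℚ
  E1 zero x = *-zeroʳ _
  E1 (suc l) x = trans (𝔼.E-cong λ a → trans (T^ l .E-cong λ v → solve 4 (λ u w X d → u :* w :* (X :+ d) := (u :* X) :* w :+ u :* (w :* d)) refl (𝟙 (A a)) (wA v) (X x a) (dev x v))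
      (trans (E-lin (T^ l) (𝟙 (A a) * X x a) _ (𝟙 (A a)) _) (trans (cong₂ _+_ (*≡ˡ (tup-∏ (bits n) l _)) (trans (cong (𝟙 (A a) *_) (E1 l x)) (*-zeroʳ _))) (+-identityʳ _))))
    (trans (𝔼.E-*ʳ _ (α ^ l)) (trans (cong (_* α ^ l) (EX x)) (*-zeroˡ _)))

  -- The variance of a sum of l independent samples is additive.
  E2 : ∀ l x → T^ l .E (λ v → wA v * (dev x v * dev x v)) ≤ ι l * α ^ (2 ℕ.+ l)
  E2 zero x = ≤-reflexive (solve 1 (λ a → con 1ℚ :* (con 0ℚ :* con 0ℚ) := con 0ℚ :* a) refl (α ^ 2))
  E2 (suc l) x = ≤-trans (≤-reflexive (trans (𝔼.E-cong λ a → trans (T^ l .E-cong λ v → solve 4 (λ u w X d → u :* w :* ((X :+ d) :* (X :+ d)) := (u :* (X :* X)) :* w :+ con 1ℚ :* ((con 2ℚ :* (u :* X)) :* (w :* d) :+ u :* (w :* (d :* d)))) refl (𝟙 (A a)) (wA v) (X x a) (dev x v))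
      (trans (E-lin (T^ l) (𝟙 (A a) * (X x a * X x a)) _ 1ℚ _) (cong₂ _+_ (*≡ˡ (tup-∏ (bits n) l _))
        (trans (cong (1ℚ *_) (trans (E-lin (T^ l) (2ℚ * (𝟙 (A a) * X x a)) _ (𝟙 (A a)) _) (trans (cong₂ _+_ (trans (*≡ˡ (E1 l x)) (*-zeroʳ _)) refl) (+-comm _ _)))) (trans (*-identityˡ _) (+-identityʳ _))))))
      (trans (𝔼.E-+ _ _) (cong₂ _+_ (𝔼.E-*ʳ _ (α ^ l)) (𝔼.E-*ʳ _ V)))))
    (≤-trans (+-mono (*-monoʳ (0≤^ l 0≤α) (EX² x)) (*-monoˡ 0≤α (E2 l x)))
      (≤-reflexive (solve 3 (λ a p k → a :* (a :* a) :* p :+ a :* (k :* (a :* (a :* p))) := (con 1ℚ :+ k) :* (a :* (a :* (a :* p)))) refl α (α ^ l) (ι l))))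
    where
    V = T^ l .E (λ v → wA v * (dev x v * dev x v))

  thr : ℚ
  thr = η * ι l * α

  off : F n → Vec (F n) l → Bool
  off x v = (thr * thr) ≤ᵇ (dev x v * dev x v)

  Eoff : ∀ x → T^ l .E (λ v → wA v * 𝟙 (off x v)) ≤ (1 ÷ 64) * α ^ l
  Eoff x = cancelˡ c>0 (≤-trans (≤-reflexive (sym (T^ l .E-* c _))) (≤-trans (T^ l .E-mono pt) (≤-trans (E2 l x) fin)))
    where
    c = thr * thr
    η>0 : 0ℚ < η * η * ι l
    η>0 = <-≤ (lit< {0ℚ} {64 ÷ 1}) big
    ceq : c ≡ (η * η * ι l) * (ι l * (α * α))
    ceq = solve 3 (λ h l a → (h :* l :* a) :* (h :* l :* a) := (h :* h :* l) :* (l :* (a :* a))) refl η (ι l) α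
    c>0 : 0ℚ < c
    c>0 = subst (0ℚ <_) (sym ceq) (0<* η>0 (0<* 0<l (0<* αpos αpos)))
    pt : ∀ v → c * (wA v * 𝟙 (off x v)) ≤ wA v * (dev x v * dev x v)
    pt v with c ℚP.≤? (dev x v * dev x v)
    ... | yes p = ≤-trans (≤-reflexive (solve 2 (λ c w → c :* (w :* con 1ℚ) := w :* c) refl c (wA v))) (*-monoˡ (∏-0≤ (λ a → 0≤𝟙 (A a)) v) p)
    ... | no p = ≤-trans (≤-reflexive (solve 2 (λ c w → c :* (w :* con 0ℚ) := con 0ℚ) refl c (wA v))) (∏-0≤ (λ a → 0≤𝟙 (A a)) v ⊠ sq _)
    fin : ι l * α ^ (2 ℕ.+ l) ≤ c * ((1 ÷ 64) * α ^ l)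
    fin = ≤-trans (≤by (((lit {0ℚ} {1 ÷ 64}) ⊠ dif big) ⊠ (<⇒≤ 0<l ⊠ (0≤α ⊠ (0≤α ⊠ 0≤^ l 0≤α))))
       (solve 4 (λ z k a p → con (1 ÷ 64) :* (z :- con (64 ÷ 1)) :* (k :* (a :* (a :* p))) := (z :* (k :* (a :* a))) :* (con (1 ÷ 64) :* p) :- k :* (a :* (a :* p))) refl (η * η * ι l) (ι l) α (α ^ l)))
       (≤-reflexive (cong (_* ((1 ÷ 64) * α ^ l)) (sym ceq)))

  Ω : Set
  Ω = Vec (Vec (F n) l) j

  MΩ : Mean Ω
  MΩ = tup (T^ l) j

  W : Ω → ℚ
  W = ∏ wA

  nb : ∀ {j} → F n → Vec (Vec (F n) l) j → ℕ
  nb x [] = 0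
  nb x (v ∷ β) = (if off x v then 1 else 0) ℕ.+ nb x β

  bad : F n → Ω → Bool
  bad x β = ⌊ j ℕP.≤? nb x β ℕ.+ nb x β ⌋

  pen : F n → Vec (F n) l → ℚ
  pen x v = 1ℚ + (63 ÷ 1) * 𝟙 (off x v)

  pen-nb : ∀ {j} x (β : Vec (Vec (F n) l) j) → ∏ (pen x) β ≡ (8 ÷ 1) ^ (nb x β ℕ.+ nb x β)
  pen-nb x [] = refl
  pen-nb x (v ∷ β) with off x v
  ... | false = trans (cong (_* ∏ (pen x) β) (solve 0 (con 1ℚ :+ con (63 ÷ 1) :* con 0ℚ := con 1ℚ) refl)) (trans (*-identityˡ _) (pen-nb x β))
  ... | true = trans (cong ((1ℚ + (63 ÷ 1) * 1ℚ) *_) (pen-nb x β)) (trans (solve 1 (λ p → (con 1ℚ :+ con (63 ÷ 1) :* con 1ℚ) :* p := con (8 ÷ 1) :* (con (8 ÷ 1) :* p)) refl _)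
       (cong ((8 ÷ 1) *_) (cong ((8 ÷ 1) ^_) (sym (ℕP.+-suc (nb x β) (nb x β))))))

  -- A majority of deviating groups is unlikely: each deviating group is penalised by 64 = 8².
  bad-pen : ∀ x β → (8 ÷ 1) ^ j * 𝟙 (bad x β) ≤ ∏ (pen x) β
  bad-pen x β with j ℕP.≤? nb x β ℕ.+ nb x β
  ... | yes p = ≤-trans (≤-reflexive (*-identityʳ _)) (≤-trans (^-monoʳ lit p) (≤-reflexive (sym (pen-nb x β))))
  ... | no p = ≤-trans (≤-reflexive (*-zeroʳ _)) (≤-trans (0≤^ (nb x β ℕ.+ nb x β) lit) (≤-reflexive (sym (pen-nb x β))))

  Ebad : ∀ x → MΩ .E (λ β → W β * 𝟙 (bad x β)) ≤ (1 ÷ 4) ^ j * (α ^ l) ^ j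
  Ebad x = cancelˡ (0<^ j (lit< {0ℚ} {8 ÷ 1})) (≤-trans (≤-reflexive (sym (MΩ .E-* _ _)))
    (≤-trans (MΩ .E-mono λ β → ≤-trans (≤-reflexive (solve 3 (λ e w b → e :* (w :* b) := w :* (e :* b)) refl ((8 ÷ 1) ^ j) (W β) (𝟙 (bad x β)))) (*-monoˡ (∏-0≤ (λ v → ∏-0≤ (λ a → 0≤𝟙 (A a)) v) β) (bad-pen x β)))
    (≤-trans (≤-reflexive (trans (MΩ .E-cong (∏-merge)) (tup-∏ (T^ l) j _)))
    (≤-trans (^-mono j (E-0≤ (T^ l) λ v → (∏-0≤ (λ a → 0≤𝟙 (A a)) v) ⊠ (0≤1 ⊞ (lit {0ℚ} {63 ÷ 1} ⊠ 0≤𝟙 (off x v)))) one)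
    (≤-reflexive fin)))))
    where
    ∏-merge : ∀ {j} (β : Vec (Vec (F n) l) j) → ∏ wA β * ∏ (pen x) β ≡ ∏ (λ v → wA v * pen x v) β
    ∏-merge [] = *-identityˡ 1ℚ
    ∏-merge (v ∷ β) = trans (solve 4 (λ a b c d → a :* b :* (c :* d) := (a :* c) :* (b :* d)) refl (wA v) (∏ wA β) (pen x v) (∏ (pen x) β)) (cong (wA v * pen x v *_) (∏-merge β))
    one : T^ l .E (λ v → wA v * pen x v) ≤ 2ℚ * α ^ l
    one = ≤-trans (≤-reflexive (trans (T^ l .E-cong λ v → solve 2 (λ w b → w :* (con 1ℚ :+ con (63 ÷ 1) :* b) := con 1ℚ :* w :+ con (63 ÷ 1) :* (w :* b)) refl (wA v) (𝟙 (off x v)))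
      (trans (E-lin (T^ l) 1ℚ _ (63 ÷ 1) _) (cong (λ z → 1ℚ * z + (63 ÷ 1) * T^ l .E (λ v → wA v * 𝟙 (off x v))) (tup-∏ (bits n) l _)))))
      (≤by ((lit {0ℚ} {63 ÷ 1} ⊠ dif (Eoff x)) ⊞ (lit {0ℚ} {1 ÷ 64} ⊠ 0≤^ l 0≤α)) (solve 2 (λ p o → con (63 ÷ 1) :* (con (1 ÷ 64) :* p :- o) :+ con (1 ÷ 64) :* p := con 2ℚ :* p :- (con 1ℚ :* p :+ con (63 ÷ 1) :* o)) refl (α ^ l) _))
    fin : (2ℚ * α ^ l) ^ j ≡ (8 ÷ 1) ^ j * ((1 ÷ 4) ^ j * (α ^ l) ^ j)
    fin = trans (cong (_^ j) (solve 1 (λ p → con 2ℚ :* p := con (8 ÷ 1) :* (con (1 ÷ 4) :* p)) refl (α ^ l))) (trans (*-^ _ _ j) (cong ((8 ÷ 1) ^ j *_) (*-^ _ _ j)))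

  B̄ : Ω → ℚ
  B̄ β = 𝔼 (λ x → 𝟙 (bad x β))

  ρ : ℚ
  ρ = 2ℚ * (1 ÷ 4) ^ j

  good : Ω → Bool
  good β = B̄ β ≤ᵇ ρ

  0≤W : ∀ β → 0ℚ ≤ W β
  0≤W = ∏-0≤ (λ v → ∏-0≤ (λ a → 0≤𝟙 (A a)) v)

  EW : MΩ .E W ≡ (α ^ l) ^ j
  EW = trans (tup-∏ (T^ l) j _) (cong (_^ j) (tup-∏ (bits n) l _))

  Egood : ½ * (α ^ l) ^ j ≤ MΩ .E (λ β → W β * 𝟙 (good β))
  Egood = cancelˡ (0<* {2ℚ} {q} lit< (0<^ j lit<)) (≤by (dif tot) eq)
    where
    q = (1 ÷ 4) ^ j
    a = (α ^ l) ^ j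
    g = MΩ .E (λ β → W β * 𝟙 (good β))
    swapped : MΩ .E (λ β → W β * B̄ β) ≤ q * a
    swapped = ≤-trans (≤-reflexive (trans (MΩ .E-cong λ β → sym (𝔼.E-* (W β) _)) (E-swap MΩ (λ β x → W β * 𝟙 (bad x β))))) (𝔼.E-≤ Ebad)
    pt : ∀ β → (2ℚ * q) * (W β - W β * 𝟙 (good β)) ≤ W β * B̄ β
    pt β with B̄ β ℚP.≤? ρ
    ... | yes p = ≤-trans (≤-reflexive (solve 2 (λ q w → con 2ℚ :* q :* (w :- w :* con 1ℚ) := con 0ℚ) refl q (W β))) (0≤W β ⊠ 𝔼.E-0≤ λ x → 0≤𝟙 (bad x β))
    ... | no p = ≤-trans (≤-reflexive (solve 2 (λ q w → con 2ℚ :* q :* (w :- w :* con 0ℚ) := w :* (con 2ℚ :* q)) refl q (W β))) (*-monoˡ (0≤W β) (≰⇒≥ p))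
    tot : (2ℚ * q) * (a - g) ≤ q * a
    tot = ≤-trans (≤-reflexive (trans (cong (λ z → 2ℚ * q * (z - g)) (sym EW)) (trans (cong (2ℚ * q *_) (sym (E-- MΩ _ _))) (sym (MΩ .E-* _ _))))) (≤-trans (MΩ .E-mono pt) swapped)
    eq : q * a - (2ℚ * q) * (a - g) ≡ (2ℚ * q) * g - (2ℚ * q) * (½ * a)
    eq = solve 3 (λ q a g → q :* a :- (con 2ℚ :* q) :* (a :- g) := (con 2ℚ :* q) :* g :- (con 2ℚ :* q) :* (con ½ :* a)) refl q a g

  shiftV : ∀ {l} → Vec (F n) l → F n → Vec (F n) l
  shiftV [] t = []
  shiftV (a ∷ v) t = (a ⊕ t) ∷ shiftV v t

  shiftΩ : ∀ {j} → Vec (Vec (F n) l) j → F n → Vec (Vec (F n) l) j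
  shiftΩ [] t = []
  shiftΩ (v ∷ β) t = shiftV v t ∷ shiftΩ β t

  E-shiftV : ∀ l t (f : Vec (F n) l → ℚ) → T^ l .E (λ v → f (shiftV v t)) ≡ T^ l .E f
  E-shiftV zero t f = refl
  E-shiftV (suc l) t f = trans (𝔼.E-cong λ a → E-shiftV l t (λ v → f ((a ⊕ t) ∷ v))) (𝔼-shift t (λ a → T^ l .E (λ v → f (a ∷ v))))

  E-shiftΩ : ∀ j t (f : Vec (Vec (F n) l) j → ℚ) → tup (T^ l) j .E (λ β → f (shiftΩ β t)) ≡ tup (T^ l) j .E f
  E-shiftΩ zero t f = refl
  E-shiftΩ (suc j) t f = trans (T^ l .E-cong λ v → E-shiftΩ j t (λ β → f (shiftV v t ∷ β))) (E-shiftV l t (λ v → tup (T^ l) j .E (λ β → f (v ∷ β))))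

  Tset : Ω → Fn n
  Tset β t = good (shiftΩ β t)

  find : (∀ β → (1 ÷ 4) * (α ^ l) ^ j ≤ ∣ Tset β ∣ → ⊥) → ⊥
  find k = E-ex MΩ {λ β → ∣ Tset β ∣} {(1 ÷ 4) * (α ^ l) ^ j} lt λ { (β , h) → k β (<⇒≤ h) }
    where
    a>0 : 0ℚ < (α ^ l) ^ j
    a>0 = 0<^ j (0<^ l αpos)
    W≤1 : ∀ β → W β * 𝟙 (good β) ≤ 𝟙 (good β)
    W≤1 β = ≤-trans (*-monoʳ (0≤𝟙 (good β)) (∏-≤1 (λ v → ∏-0≤ (λ a → 0≤𝟙 (A a)) v) (λ v → ∏-≤1 (λ a → 0≤𝟙 (A a)) (λ a → 𝟙≤1 (A a)) v) β)) (≤-reflexive (*-identityˡ _))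
    lt : (1 ÷ 4) * (α ^ l) ^ j < MΩ .E (λ β → ∣ Tset β ∣)
    lt = <-≤ (subst₂ _<_ (*-comm _ _) (*-comm _ ½) (*-monoˡ-< a>0 (lit< {1 ÷ 4} {½})))
      (≤-trans Egood (≤-trans (MΩ .E-mono W≤1) (≤-reflexive (sym (trans (E-swap MΩ (λ β t → 𝟙 (good (shiftΩ β t)))) (trans (𝔼.E-cong λ t → E-shiftΩ j t (λ β → 𝟙 (good β))) (𝔼.E-const _)))))))

  dev-shift : ∀ {l} x t (v : Vec (F n) l) → dev x (shiftV v t) + ι l * G x ≡ dev (x ⊕ t) v + ι l * G (x ⊕ t)
  dev-shift x t [] = solve 2 (λ a b → con 0ℚ :+ con 0ℚ :* a := con 0ℚ :+ con 0ℚ :* b) refl (G x) (G (x ⊕ t))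
  dev-shift {suc l} x t (a ∷ v) = trans (cong (λ z → α * 𝟙 (B z) - G x + dev x (shiftV v t) + (1ℚ + ι l) * G x) (trans (cong (x ⊕_) (⊕-comm a t)) (sym (⊕-assoc x t a))))
    (trans (solve 4 (λ b g d k → b :- g :+ d :+ (con 1ℚ :+ k) :* g := b :+ (d :+ k :* g)) refl (α * 𝟙 (B ((x ⊕ t) ⊕ a))) (G x) (dev x (shiftV v t)) (ι l))
    (trans (cong (α * 𝟙 (B ((x ⊕ t) ⊕ a)) +_) (dev-shift x t v))
    (solve 4 (λ b g d k → b :+ (d :+ k :* g) := b :- g :+ d :+ (con 1ℚ :+ k) :* g) refl (α * 𝟙 (B ((x ⊕ t) ⊕ a))) (G (x ⊕ t)) (dev (x ⊕ t) v) (ι l))))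

  near : ∀ x x' t t' v → x ⊕ t ≡ x' ⊕ t' → off x (shiftV v t) ≡ false → off x' (shiftV v t') ≡ false → G x' - G x ≤ 2ℚ * η * α
  near x x' t t' v eq o o' = cancelˡ 0<l (≤-trans (≤-reflexive key) (≤-trans (+-mono (lt1 d (≰ᵇ⇒ o)) (lt2 d' (≰ᵇ⇒ o'))) (≤-reflexive (solve 3 (λ h k a → h :* k :* a :+ h :* k :* a := k :* (con 2ℚ :* h :* a)) refl η (ι l) α))))
    where
    d = dev x (shiftV v t)
    d' = dev x' (shiftV v t')
    0≤thr : 0ℚ ≤ thr
    0≤thr = (0≤η ⊠ <⇒≤ 0<l) ⊠ 0≤α
    lt1 : ∀ d → d * d < thr * thr → d ≤ thr
    lt1 d h = ≤-sq 0≤thr (<⇒≤ h)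
    lt2 : ∀ d → d * d < thr * thr → - d ≤ thr
    lt2 d h = ≤-sq 0≤thr (≤-trans (≤-reflexive (solve 1 (λ d → (:- d) :* (:- d) := d :* d) refl d)) (<⇒≤ h))
    key : ι l * (G x' - G x) ≡ d + - d'
    key = trans (solve 4 (λ k g g' d' → k :* (g' :- g) := d' :+ k :* g' :- d' :- k :* g) refl (ι l) (G x) (G x') d')
       (trans (cong (λ z → z - d' - ι l * G x) (trans (dev-shift x' t' v) (trans (cong (λ y → dev y v + ι l * G y) (sym eq)) (sym (dev-shift x t v)))))
       (solve 3 (λ d d' k → d :+ k :- d' :- k := d :+ :- d') refl d d' (ι l * G x)))

  majority : ∀ {j} x x' t t' (β : Vec (Vec (F n) l) j) → x ⊕ t ≡ x' ⊕ t' →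
    (G x' - G x ≤ 2ℚ * η * α) ⊎ (j ℕ.≤ nb x (shiftΩ β t) ℕ.+ nb x' (shiftΩ β t'))
  majority x x' t t' [] eq = inj₂ ℕ.z≤n
  majority x x' t t' (v ∷ β) eq with off x (shiftV v t) in o | off x' (shiftV v t') in o'
  ... | false | false = inj₁ (near x x' t t' v eq o o')
  ... | true | b with majority x x' t t' β eq
  ...   | inj₁ h = inj₁ h
  ...   | inj₂ h = inj₂ (ℕ.s≤s (ℕP.≤-trans h (ℕP.+-monoʳ-≤ (nb x (shiftΩ β t)) (ℕP.m≤n+m _ _))))
  majority x x' t t' (v ∷ β) eq | false | true with majority x x' t t' β eq
  ... | inj₁ h = inj₁ h
  ... | inj₂ h = inj₂ (ℕP.≤-trans (ℕ.s≤s h) (ℕP.≤-reflexive (sym (ℕP.+-suc _ _))))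

  half : ∀ a b j → j ℕ.≤ a ℕ.+ b → (j ℕ.≤ a ℕ.+ a) ⊎ (j ℕ.≤ b ℕ.+ b)
  half a b j h with ℕP.≤-total a b
  ... | inj₁ le = inj₂ (ℕP.≤-trans h (ℕP.+-monoˡ-≤ b le))
  ... | inj₂ le = inj₁ (ℕP.≤-trans h (ℕP.+-monoʳ-≤ a le))

  period : ∀ β t t' → Tset β t ≡ true → Tset β t' ≡ true → ∀ g → (∀ x → 0ℚ ≤ g x) → (∀ x → g x ≤ 1ℚ) →
    𝔼 (λ x → g x * (G (x ⊕ (t ⊕ t')) - G x)) ≤ (2ℚ * η * α) * 𝔼 g + (4 ÷ 1) * (1 ÷ 4) ^ j
  period β t t' gt gt' g g0 g1 = ≤-trans (𝔼.E-mono pt) (≤-trans (≤-reflexive (trans (𝔼.E-+ _ _) (cong₂ _+_ (𝔼.E-* θ g) (𝔼.E-+ _ _))))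
      (+-mono ≤-refl (≤-trans (+-mono (≤ᵇ⇒ gt) (≤-trans (≤-reflexive (𝔼-shift (t ⊕ t') (λ x → 𝟙 (bad x (shiftΩ β t'))))) (≤ᵇ⇒ gt')))
        (≤-reflexive (solve 1 (λ q → con 2ℚ :* q :+ con 2ℚ :* q := con (4 ÷ 1) :* q) refl _)))))
    where
    θ = 2ℚ * η * α
    0≤θ : 0ℚ ≤ θ
    0≤θ = (lit {0ℚ} {2ℚ} ⊠ 0≤η) ⊠ 0≤α
    pt : ∀ x → g x * (G (x ⊕ (t ⊕ t')) - G x) ≤ θ * g x + (𝟙 (bad x (shiftΩ β t)) + 𝟙 (bad (x ⊕ (t ⊕ t')) (shiftΩ β t')))
    pt x with majority x (x ⊕ (t ⊕ t')) t t' β (sym (trans (cong (_⊕ t') (sym (⊕-assoc x t t'))) (⊕-cancelʳ (x ⊕ t) t')))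
    ... | inj₁ h = ≤-trans (*-monoˡ (g0 x) h) (≤by (0≤𝟙 (bad x (shiftΩ β t)) ⊞ 0≤𝟙 (bad (x ⊕ (t ⊕ t')) (shiftΩ β t'))) (solve 4 (λ g th a b → a :+ b := th :* g :+ (a :+ b) :- g :* th) refl (g x) θ (𝟙 (bad x (shiftΩ β t))) (𝟙 (bad (x ⊕ (t ⊕ t')) (shiftΩ β t')))))
    ... | inj₂ h = ≤-trans trivial (≤-trans one (≤by (0≤θ ⊠ g0 x) (solve 3 (λ a b c → a := a :+ (b :+ c) :- (b :+ c)) refl (θ * g x) _ _)))
      where
      trivial : g x * (G (x ⊕ (t ⊕ t')) - G x) ≤ 1ℚ
      trivial = ≤-trans (*-monoˡ (g0 x) (≤-trans (≤by (0≤G x) (solve 2 (λ a b → b := a :- (a :- b)) refl _ (G x))) (≤-trans (G≤α _) (∣∣≤1 A)))) (≤-trans (≤-reflexive (*-identityʳ _)) (g1 x))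
      one : 1ℚ ≤ 𝟙 (bad x (shiftΩ β t)) + 𝟙 (bad (x ⊕ (t ⊕ t')) (shiftΩ β t'))
      one with j ℕP.≤? nb x (shiftΩ β t) ℕ.+ nb x (shiftΩ β t) | j ℕP.≤? nb (x ⊕ (t ⊕ t')) (shiftΩ β t') ℕ.+ nb (x ⊕ (t ⊕ t')) (shiftΩ β t')
      ... | yes _ | yes _ = ≤by (0≤1) (solve 0 (con 1ℚ := con 1ℚ :+ con 1ℚ :- con 1ℚ) refl)
      ... | yes _ | no _ = ≤-reflexive (sym (+-identityʳ 1ℚ))
      ... | no _ | yes _ = ≤-reflexive (sym (+-identityˡ 1ℚ))
      ... | no p | no q with half (nb x (shiftΩ β t)) (nb (x ⊕ (t ⊕ t')) (shiftΩ β t')) j h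
      ...   | inj₁ r = ⊥-elim (p r)
      ...   | inj₂ r = ⊥-elim (q r)

_⋆_ : ∀ {n} → Fn n → Fn n → F n → ℚ
(A ⋆ B) x = 𝔼 (λ a → 𝟙 (A a) * 𝟙 (B (x ⊕ a)))

coset-mean : ∀ {r m n} (φ : Flag r m n) (A B : Fn n) δ → (∀ c → δ ≤ ∣ B ∘e (φ , c) ∣) → ∀ v → ∣ A ∣ * δ ≤ 𝔼 ((A ⋆ B) ∘e (φ , v))
coset-mean φ A B δ h v = ≤-trans (≤-reflexive (trans (sym (𝔼.E-*ʳ _ δ)) (𝔼-e φ _))) (≤-trans (𝔼.E-mono λ c → 𝔼.E-mono λ y' → pt c y')
    (≤-reflexive (trans (sym (𝔼-e φ _)) (trans (𝔼.E-cong λ a → sym (𝔼.E-* (𝟙 (A a)) _)) (𝔼-swap _)))))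
  where
  pt : ∀ c y' → 𝟙 (A (e φ c y')) * δ ≤ 𝟙 (A (e φ c y')) * 𝔼 (λ y → 𝟙 (B (e φ v y ⊕ e φ c y')))
  pt c y' = *-monoˡ (0≤𝟙 (A (e φ c y'))) (≤-trans (h (v ⊕ c)) (≤-reflexive (trans (sym (𝔼-shift y' _)) (𝔼.E-cong λ y → cong (λ z → 𝟙 (B z)) (sym (e-⊕ φ v c y y'))))))

½^-+ : ∀ a b → ½ ^ a * ½ ^ b ≡ ½ ^ (a ℕ.+ b)
½^-+ a b = sym (^-+ ½ a b)

½^-mono : ∀ {a b} → a ℕ.≤ b → ½ ^ b ≤ ½ ^ a
½^-mono = ^-anti lit lit

½^-≤ : ∀ {a b x y} → ½ ^ a ≤ x → ½ ^ b ≤ y → ½ ^ (a ℕ.+ b) ≤ x * y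
½^-≤ {a} {b} h k = ≤-trans (≤-reflexive (^-+ ½ a b)) (*-mono (0≤½^ a) h (0≤½^ b) k)

½^-^ : ∀ {a x} k → ½ ^ a ≤ x → ½ ^ (k ℕ.* a) ≤ x ^ k
½^-^ {a} zero h = ≤-refl
½^-^ {a} (suc k) h = ½^-≤ {a} {k ℕ.* a} h (½^-^ k h)

¼^ : ∀ i → (1 ÷ 4) ^ i ≡ ½ ^ (i ℕ.+ i)
¼^ i = trans (cong (_^ i) (solve 0 (con (1 ÷ 4) := con ½ :* con ½) refl)) (trans (*-^ ½ ½ i) (½^-+ i i))

module APparams (h s : ℕ) where
  i q l j H R : ℕ
  i = suc (s ℕ.+ h)
  q = i ℕ.* 2 ℕ.^ (3 ℕ.+ s)
  l = 64 ℕ.* (q ℕ.* q)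
  j = i ℕ.+ (s ℕ.+ h ℕ.+ 2)
  H = 2 ℕ.+ j ℕ.* (l ℕ.* h)
  R = suc (H ℕ.+ H)

-- Opaque, because unfolding these numbers is infeasible.
opaque
  RAP : ℕ → ℕ → ℕ
  RAP h s = APparams.R h s

  RAP-def : ∀ h s → RAP h s ≡ APparams.R h s
  RAP-def h s = refl

-- Random samples of A show that many t are approximate periods of A ⋆ B; smoothing along them makes A ⋆ B close to its
-- mean on a coset, which is large by hypothesis.
module AP {n} (A B : Fn n) (h s : ℕ) (dens : ½ ^ h ≤ ∣ A ∣)
  (hit : ∀ {r m} (φ : Flag r m n) c → r ℕ.≤ RAP h s → 2ℚ * ½ ^ s ≤ ∣ B ∘e (φ , c) ∣) where
  open APparams h s

  α = ∣ A ∣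
  δ = ½ ^ s
  G = A ⋆ B

  0<α : 0ℚ < α
  0<α = <-≤ (0<½^ h) dens

  0<q : 0ℚ < ι q
  0<q = subst (0ℚ <_) (sym (ι-* i (2 ℕ.^ (3 ℕ.+ s)))) (0<* (0<ι (s ℕ.+ h)) (subst (0ℚ <_) (sym (ι-^ 2 (3 ℕ.+ s))) (0<^ (3 ℕ.+ s) (0<ι 1))))

  η = proj₁ (inv 0<q)
  ηq = proj₂ (inv 0<q)
  0<η = inv-pos 0<q ηq

  ι64 : ι 64 ≡ 64 ÷ 1
  ι64 = trans (ι-^ 2 6) (trans (cong (_^ 6) ι2) (solve 0 (con 2ℚ :* (con 2ℚ :* (con 2ℚ :* (con 2ℚ :* (con 2ℚ :* (con 2ℚ :* con 1ℚ))))) := con (64 ÷ 1)) refl))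
    where
    ι2 : ι 2 ≡ 2ℚ
    ι2 = solve 0 (con 1ℚ :+ (con 1ℚ :+ con 0ℚ) := con 2ℚ) refl

  ηl : η * η * ι l ≡ 64 ÷ 1
  ηl = trans (cong (η * η *_) (trans (ι-* 64 (q ℕ.* q)) (cong₂ _*_ ι64 (ι-* q q)))) (trans (solve 2 (λ h q → h :* h :* (con (64 ÷ 1) :* (q :* q)) := con (64 ÷ 1) :* ((q :* h) :* (q :* h))) refl η (ι q))
    (trans (cong (λ z → (64 ÷ 1) * (z * z)) ηq) (solve 0 (con (64 ÷ 1) :* (con 1ℚ :* con 1ℚ) := con (64 ÷ 1)) refl)))

  0<l : 0ℚ < ι l
  0<l = ℚP.≰⇒> λ le → <⇒≱ {0ℚ} {64 ÷ 1} lit< (≤-trans (≤-reflexive (sym ηl)) (≤-trans (*-monoˡ (<⇒≤ 0<η ⊠ <⇒≤ 0<η) le) (≤-reflexive (*-zeroʳ _))))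

  open Periods A B l j η (<⇒≤ 0<η) 0<l (≤-reflexive (sym ηl)) 0<α using (Tset; find; period)

  two3 : (2 ÷ 3) ^ R < ½ ^ H
  two3 = subst₂ _<_ (cong ((2 ÷ 3) *_) (sym (^-+ (2 ÷ 3) H H))) (*-identityˡ _) (≤-< (*-monoˡ (lit {0ℚ} {2 ÷ 3}) (≤-trans (≤-reflexive (sym (*-^ _ _ H)))
    (^-mono H (lit {0ℚ} {2 ÷ 3} ⊠ lit {0ℚ} {2 ÷ 3}) (≤by (lit {0ℚ} {1 ÷ 18}) (solve 0 (con (1 ÷ 18) := con ½ :- con (2 ÷ 3) :* con (2 ÷ 3)) refl)))))
    (subst₂ _<_ (*-comm _ _) (*-comm _ _) (*-monoˡ-< (0<½^ H) (lit< {2 ÷ 3} {1ℚ}))))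

  ap : δ * (α * α) ≤ 𝔼 (λ x → 𝟙 (A x) * G x)
  ap = ≤-stable λ nope → find λ β dβ → find-gap R (Tset β) (<-≤ two3 (≤-trans (dT) dβ)) λ {r} {m} φ c r≤R gap den →
      nope (main β φ c r≤R gap (<-≤ (<-≤ (0<½^ H) (≤-trans dT dβ)) den))
    where
    dT : ½ ^ H ≤ (1 ÷ 4) * (α ^ l) ^ j
    dT = ½^-≤ {2} {j ℕ.* (l ℕ.* h)} (≤-reflexive (solve 0 (con ½ :* (con ½ :* con 1ℚ) := con (1 ÷ 4)) refl)) (½^-^ {l ℕ.* h} j (½^-^ {h} l dens))
    main : ∀ β {r m} (φ : Flag r m n) c → r ℕ.≤ R → Gap (Tset β ∘e (φ , c)) → 0ℚ < ∣ Tset β ∘e (φ , c) ∣ → δ * (α * α) ≤ 𝔼 (λ x → 𝟙 (A x) * G x)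
    main β {r} {m} φ c r≤R gap pos = conclude
      where
      T1 = Tset β ∘e (φ , c)
      κ = proj₁ (kernel T1 gap pos)
      open Smooth φ κ using (P^; coset; telescope)
      a = λ x → 𝟙 (A x)
      per : ∀ w g → Kernel.μ κ w ≢ 0ℚ → (∀ x → 0ℚ ≤ g x) → (∀ x → g x ≤ 1ℚ) → 𝔼 (λ x → g x * (G (x ⊕ e φ 𝟘 w) - G x)) ≤ (2ℚ * η * α) * 𝔼 g + (4 ÷ 1) * (1 ÷ 4) ^ j
      per w g ne g0 g1 = ≤-stable λ nope → proj₂ (kernel T1 gap pos) w ne λ { (s , ts , tsw) → nope
        (subst (λ u → 𝔼 (λ x → g x * (G (x ⊕ u) - G x)) ≤ (2ℚ * η * α) * 𝔼 g + (4 ÷ 1) * (1 ÷ 4) ^ j)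
          (trans (e-⊕ φ c c s (s ⊕ w)) (cong₂ (e φ) (⊕-self c) (⊕-cancel s w))) (period β (e φ c s) (e φ c (s ⊕ w)) ts tsw g g0 g1)) }
      f0 : ∀ x → 0ℚ ≤ a x
      f0 x = 0≤𝟙 (A x)
      f1 : ∀ x → a x ≤ 1ℚ
      f1 x = 𝟙≤1 (A x)
      G0 : ∀ x → 0ℚ ≤ G x
      G0 x = 𝔼.E-0≤ λ y → 0≤𝟙 (A y) ⊠ 0≤𝟙 (B (x ⊕ y))
      G1 : ∀ x → G x ≤ 1ℚ
      G1 x = 𝔼.E-≤ λ y → ≤-trans (𝟙*≤ (A y) (0≤𝟙 (B (x ⊕ y)))) (𝟙≤1 (B (x ⊕ y)))
      top : (2ℚ * δ) * (α * α) ≤ 𝔼 (λ x → P^ i a x * G x) + (1 ÷ 4) ^ i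
      top = ≤-trans (≤-reflexive (trans (solve 2 (λ d α → (con 2ℚ :* d) :* (α :* α) := α :* (α :* (con 2ℚ :* d))) refl δ α)
            (trans (sym (𝔼.E-*ʳ a (α * (2ℚ * δ)))) (trans (𝔼-e φ _) (𝔼.E-cong λ v → 𝔼.E-*ʳ _ _)))))
        (≤-trans (𝔼.E-mono λ v → ≤-trans (*-monoˡ (0≤∣∣ (A ∘e (φ , v))) (coset-mean φ A B (2ℚ * δ) (λ c' → hit φ c' (subst (r ℕ.≤_) (sym (RAP-def h s)) r≤R)) v)) (coset i a G v f0 f1 G0 G1))
          (≤-reflexive (trans (𝔼.E-+ _ _) (cong₂ _+_ (sym (𝔼-e φ _)) (𝔼.E-const _)))))
      tel = telescope a G (2ℚ * η * α) ((4 ÷ 1) * (1 ÷ 4) ^ j) i f0 f1 per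
      ααd : ½ ^ (s ℕ.+ (h ℕ.+ h)) ≤ δ * (α * α)
      ααd = ½^-≤ {s} {h ℕ.+ h} ≤-refl (½^-≤ {h} {h} dens dens)
      e1 : (1 ÷ 4) ^ i ≤ (1 ÷ 4) * (δ * (α * α))
      e1 = ≤-trans (≤-reflexive (¼^ i)) (≤-trans (½^-mono (ar)) (≤-trans (≤-reflexive (^-+ ½ 2 (s ℕ.+ (h ℕ.+ h)))) (≤-trans (*-monoˡ (0≤½^ 2) ααd)
            (≤-reflexive (cong (_* (δ * (α * α))) (solve 0 (con ½ :* (con ½ :* con 1ℚ) := con (1 ÷ 4)) refl))))))
        where
        open ℕP.≤-Reasoning
        ar : 2 ℕ.+ (s ℕ.+ (h ℕ.+ h)) ℕ.≤ i ℕ.+ i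
        ar = begin
          2 ℕ.+ (s ℕ.+ (h ℕ.+ h)) ≤⟨ ℕP.m≤n+m _ s ⟩
          s ℕ.+ (2 ℕ.+ (s ℕ.+ (h ℕ.+ h))) ≡⟨ ℕS.solve 2 (λ s h → s ℕS.:+ (ℕS.con 2 ℕS.:+ (s ℕS.:+ (h ℕS.:+ h))) ℕS.:= (ℕS.con 1 ℕS.:+ (s ℕS.:+ h)) ℕS.:+ (ℕS.con 1 ℕS.:+ (s ℕS.:+ h))) refl s h ⟩
          i ℕ.+ i ∎
      e2 : ι i * ((2ℚ * η * α) * α) ≡ (1 ÷ 4) * (δ * (α * α))
      e2 = trans (solve 3 (λ i h a → i :* ((con 2ℚ :* h :* a) :* a) := (i :* h) :* (con 2ℚ :* (a :* a))) refl (ι i) η α) (trans (cong (_* (2ℚ * (α * α))) ih)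
          (solve 2 (λ d a → (con (1 ÷ 8) :* d) :* (con 2ℚ :* (a :* a)) := con (1 ÷ 4) :* (d :* (a :* a))) refl δ α))
        where
        two = 2ℚ ^ s
        qe : ι q ≡ ι i * ((8 ÷ 1) * two)
        qe = trans (ι-* i (2 ℕ.^ (3 ℕ.+ s))) (cong (ι i *_) (trans (ι-^ 2 (3 ℕ.+ s)) (trans (cong (_^ (3 ℕ.+ s)) (solve 0 (con 1ℚ :+ (con 1ℚ :+ con 0ℚ) := con 2ℚ) refl))
           (solve 1 (λ t → con 2ℚ :* (con 2ℚ :* (con 2ℚ :* t)) := con (8 ÷ 1) :* t) refl two))))
        ih : ι i * η ≡ (1 ÷ 8) * δ
        ih = trans (solve 2 (λ a b → a :* b := a :* b :* con 1ℚ) refl (ι i) η) (trans (cong (ι i * η *_) (sym (2^½ s)))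
             (trans (solve 4 (λ i h t d → i :* h :* (t :* d) := ((i :* (con (8 ÷ 1) :* t)) :* h) :* (con (1 ÷ 8) :* d)) refl (ι i) η two δ)
             (trans (cong (λ z → z * η * ((1 ÷ 8) * δ)) (sym qe)) (trans (cong (_* ((1 ÷ 8) * δ)) ηq) (*-identityˡ _)))))
      e3 : ι i * ((4 ÷ 1) * (1 ÷ 4) ^ j) ≤ (1 ÷ 4) * (δ * (α * α))
      e3 = ≤-trans (*-monoʳ (lit {0ℚ} {4 ÷ 1} ⊠ 0≤^ j lit) (ι≤2^ i)) (≤-trans (≤-reflexive (cong (λ z → 2ℚ ^ i * ((4 ÷ 1) * z)) (trans (¼^ j) (trans (cong (½ ^_) jj) (trans (^-+ ½ i _) (cong (½ ^ i *_) (^-+ ½ 4 (i ℕ.+ (s ℕ.+ h ℕ.+ (s ℕ.+ h))))))))))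
          (≤-trans (≤-reflexive (trans (solve 3 (λ t u w → t :* (con (4 ÷ 1) :* (u :* ((con ½ :* (con ½ :* (con ½ :* (con ½ :* con 1ℚ)))) :* w))) := (t :* u) :* (con (1 ÷ 4) :* w)) refl (2ℚ ^ i) (½ ^ i) (½ ^ (i ℕ.+ (s ℕ.+ h ℕ.+ (s ℕ.+ h)))))
              (trans (*≡ʳ (2^½ i)) (*-identityˡ _))))
            (*-monoˡ (lit {0ℚ} {1 ÷ 4}) (≤-trans (½^-mono (ℕP.≤-trans (ℕP.≤-trans (ℕP.+-monoʳ-≤ s (ℕP.+-monoʳ-≤ h (ℕP.m≤n+m h s))) (ℕP.≤-reflexive (sym (ℕP.+-assoc s h (s ℕ.+ h))))) (ℕP.m≤n+m _ i))) ααd))))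
        where
        jj : j ℕ.+ j ≡ i ℕ.+ (4 ℕ.+ (i ℕ.+ (s ℕ.+ h ℕ.+ (s ℕ.+ h))))
        jj = ℕS.solve 2 (λ i u → (i ℕS.:+ (u ℕS.:+ ℕS.con 2)) ℕS.:+ (i ℕS.:+ (u ℕS.:+ ℕS.con 2)) ℕS.:= i ℕS.:+ (ℕS.con 4 ℕS.:+ (i ℕS.:+ (u ℕS.:+ u)))) refl i (s ℕ.+ h)
      conclude : δ * (α * α) ≤ 𝔼 (λ x → a x * G x)
      conclude = ≤by ((dif top ⊞ dif tel ⊞ dif e1 ⊞ dif e3) ⊞ (lit {0ℚ} {1 ÷ 4} ⊠ (0≤½^ s ⊠ (<⇒≤ 0<α ⊠ <⇒≤ 0<α))))
        (trans (solve 8 (λ M E1 D a N k t E3 → (M :+ E1 :- con 2ℚ :* D :* a :+ (N :+ k :* (t :+ E3) :- M) :+ (con (1 ÷ 4) :* (D :* a) :- E1) :+ (con (1 ÷ 4) :* (D :* a) :- k :* E3)) :+ con (1 ÷ 4) :* (D :* a) := N :- D :* a :+ (k :* t :- con (1 ÷ 4) :* (D :* a))) refl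
            M E1 δ (α * α) N0 (ι i) ((2ℚ * η * α) * α) E3) (trans (cong (λ z → N0 - d + (z - (1 ÷ 4) * d)) e2) (solve 2 (λ N d → N :- d :+ (con (1 ÷ 4) :* d :- con (1 ÷ 4) :* d) := N :- d) refl N0 d)))
        where
        d = δ * (α * α)
        M = 𝔼 (λ x → P^ i a x * G x)
        E1 = (1 ÷ 4) ^ i
        N0 = 𝔼 (λ x → a x * G x)
        E3 = (4 ÷ 1) * (1 ÷ 4) ^ j

-- Spread sets

Bounded : ∀ {n} → ℕ → ℚ → Fn n → Set
Bounded {n} R b X = ∀ {r m} (φ : Flag r m n) c → r ℕ.≤ R → ∣ X ∘e (φ , c) ∣ ≤ b

Spread : ∀ {n} → ℕ → ℚ → Fn n → Set
Spread R κ X = Bounded R ((1ℚ + κ) * ∣ X ∣) X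

_∘∘_ : ∀ {n} → Fn n → Fn n → F n → ℚ
X ∘∘ Y = cv (λ x → 𝟙 (X x)) (λ x → 𝟙 (Y x))

cv-E : ∀ {n} (f g : F n → ℚ) → 𝔼 (cv f g) ≡ 𝔼 f * 𝔼 g
cv-E f g = trans (𝔼-swap _) (trans (𝔼.E-cong λ x → trans (𝔼.E-* (f x) _) (cong (f x *_) (𝔼-shiftˡ x g))) (𝔼.E-*ʳ f _))

coset-cv : ∀ {r m n} (φ : Flag r m n) c (f g : F n → ℚ) →
  𝔼 (λ w → cv f g (e φ c w)) ≡ 𝔼 (λ v → 𝔼 (λ y → f (e φ v y)) * 𝔼 (λ y → g (e φ (v ⊕ c) y)))
coset-cv φ c f g = trans (𝔼.E-cong λ w → 𝔼-e φ _) (trans (𝔼-swap _) (𝔼.E-cong λ v →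
  trans (𝔼.E-cong λ w → 𝔼.E-cong λ y → cong (λ z → f (e φ v y) * g z) (e-⊕ φ v c y w)) (cv-E (λ y → f (e φ v y)) (λ y → g (e φ (v ⊕ c) y)))))

module BKMparams (H L s : ℕ) where
  l h R : ℕ
  l = 2 ℕ.^ s ℕ.* (H ℕ.+ s ℕ.+ 2)
  h = suc (H ℕ.+ l ℕ.* L)
  R = RAP h (suc s)

opaque
  RBKM : ℕ → ℕ → ℕ → ℕ
  RBKM H L s = BKMparams.R H L s

  RBKM-def : ∀ H L s → RBKM H L s ≡ BKMparams.R H L s
  RBKM-def H L s = refl

-- Sifting: intersections of random translates of Y put most weight on differences where Y ∘ Y is large, whereas by
-- almost periodicity they have many differences in Rest, where it is not.
module BKM {n} (Y : Fn n) (H L s : ℕ) (κ≤½ : ½ ^ s ≤ ½) (dens : ½ ^ L ≤ ∣ Y ∣)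
  (spread : Spread (RBKM H L s) (½ ^ s) Y) where
  open BKMparams H L s

  κ = ½ ^ s
  β = ∣ Y ∣
  0<κ : 0ℚ < κ
  0<κ = 0<½^ s
  0≤κ = <⇒≤ 0<κ

  0<β : 0ℚ < β
  0<β = <-≤ (0<½^ L) dens

  YY = Y ∘∘ Y

  lo hi : ℚ
  lo = (1ℚ + (4 ÷ 1) * κ) * (β * β)
  hi = (1ℚ + (8 ÷ 1) * κ) * (β * β)

  0≤YY : ∀ t → 0ℚ ≤ YY t
  0≤YY t = 𝔼.E-0≤ λ x → 0≤𝟙 (Y x) ⊠ 0≤𝟙 (Y (x ⊕ t))

  Big Rest : Fn n
  Big t = hi ≤ᵇ YY t
  Rest t = not (lo ≤ᵇ YY t)

  hit : ∀ {r m} (φ : Flag r m n) c → r ℕ.≤ R → 2ℚ * ½ ^ suc s ≤ ∣ Rest ∘e (φ , c) ∣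
  hit φ c le = ≤-stable λ nope → contra (ℚP.≰⇒> nope)
    where
    σ = 𝔼 (λ w → 𝟙 (lo ≤ᵇ YY (e φ c w)))
    rest : ∣ Rest ∘e (φ , c) ∣ ≡ 1ℚ - σ
    rest = trans (𝔼.E-cong λ w → 𝟙-not (lo ≤ᵇ YY (e φ c w))) (trans (𝔼.E-- _ _) (cong (_- σ) (𝔼.E-const 1ℚ)))
    mk : σ * lo ≤ (1ℚ + κ) * β * β
    mk = ≤-trans (markov (bits _) (λ w → 0≤YY (e φ c w))) (≤-trans (≤-reflexive (coset-cv φ c (λ x → 𝟙 (Y x)) (λ x → 𝟙 (Y x))))
      (≤-trans (𝔼.E-mono λ v → *-monoʳ (0≤∣∣ (Y ∘e (φ , v ⊕ c))) (spread φ v (subst (_ ℕ.≤_) (sym (RBKM-def H L s)) le))) (≤-reflexive (trans (𝔼.E-* _ _) (cong ((1ℚ + κ) * β *_) (trans (𝔼-shift c (λ v → ∣ Y ∘e (φ , v) ∣)) (sym (𝔼-e φ _))))))))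
    contra : ∣ Rest ∘e (φ , c) ∣ < 2ℚ * ½ ^ suc s → ⊥
    contra lt = <⇒≱ (0<* {β * β} {κ * (1ℚ + (4 ÷ 1) * κ)} (0<* 0<β 0<β) (0<* 0<κ (0<+ lit< (lit {0ℚ} {4 ÷ 1} ⊠ 0≤κ)))) fin
      where
      1-σ<κ : 1ℚ - σ < κ
      1-σ<κ = subst₂ _<_ rest (solve 1 (λ k → con 2ℚ :* (con ½ :* k) := k) refl κ) lt
      fin : β * β * (κ * (1ℚ + (4 ÷ 1) * κ)) ≤ 0ℚ
      fin = ⊥-elim (<⇒≱ strict mk)
        where
        strict : (1ℚ + κ) * β * β < σ * lo
        strict = ≤-< a (subst₂ _<_ (*-comm _ _) (*-comm _ _) (*-monoˡ-< (0<* (0<+ lit< (lit {0ℚ} {4 ÷ 1} ⊠ 0≤κ)) (0<* 0<β 0<β)) 1-κ<σ))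
          where
          1-κ<σ : 1ℚ - κ < σ
          1-κ<σ = subst₂ _<_ (solve 2 (λ s k → (con 1ℚ :- s) :+ (s :- k) := con 1ℚ :- k) refl σ κ) (solve 2 (λ s k → k :+ (s :- k) := s) refl σ κ) (+-mono-<-≤ 1-σ<κ (≤-refl {σ - κ}))
          a : (1ℚ + κ) * β * β ≤ (1ℚ - κ) * lo
          a = ≤by ((lit {0ℚ} {4 ÷ 1} ⊠ (0≤κ ⊠ dif κ≤½)) ⊠ (<⇒≤ 0<β ⊠ <⇒≤ 0<β)) (solve 2 (λ k b → con (4 ÷ 1) :* (k :* (con ½ :- k)) :* (b :* b) := (con 1ℚ :- k) :* ((con 1ℚ :+ con (4 ÷ 1) :* k) :* (b :* b)) :- (con 1ℚ :+ k) :* b :* b) refl κ β)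

  T^ : Mean (Vec (F n) l)
  T^ = tup (bits n) l

  Int : ∀ {l} → Vec (F n) l → Fn n
  Int [] x = true
  Int (a ∷ v) x = Y (x ⊕ a) ∧ Int v x

  Int-∏ : ∀ {l} (v : Vec (F n) l) x → 𝟙 (Int v x) ≡ ∏ (λ a → 𝟙 (Y (x ⊕ a))) v
  Int-∏ [] x = refl
  Int-∏ (a ∷ v) x = trans (𝟙-∧ (Y (x ⊕ a)) (Int v x)) (cong (𝟙 (Y (x ⊕ a)) *_) (Int-∏ v x))

  pairs : ∀ x x' → T^ .E (λ v → 𝟙 (Int v x) * 𝟙 (Int v x')) ≡ YY (x ⊕ x') ^ l
  pairs x x' = trans (T^ .E-cong λ v → trans (cong₂ _*_ (Int-∏ v x) (Int-∏ v x')) (∏-mul _ _ v)) (trans (tup-∏ (bits n) l _) (cong (_^ l)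
     (trans (𝔼.E-cong λ a → cong (λ z → 𝟙 (Y (x ⊕ a)) * 𝟙 (Y z)) (sym (trans (cong (_⊕ (x ⊕ x')) (⊕-comm x a)) (trans (⊕-assoc a x (x ⊕ x')) (trans (cong (a ⊕_) (⊕-cancel x x')) (⊕-comm a x'))))))
       (𝔼-shiftˡ x (λ z → 𝟙 (Y z) * 𝟙 (Y (z ⊕ (x ⊕ x'))))))))

  weighted : ∀ (g : F n → ℚ) → T^ .E (λ v → 𝔼 (λ x → 𝔼 (λ x' → 𝟙 (Int v x) * 𝟙 (Int v x') * g (x ⊕ x')))) ≡ 𝔼 (λ t → YY t ^ l * g t)
  weighted g = trans (E-swap T^ _) (trans (𝔼.E-cong λ x → trans (E-swap T^ _) (trans (𝔼.E-cong λ x' → trans (E-*ʳ T^ _ _) (cong (_* g (x ⊕ x')) (pairs x x')))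
      (𝔼-shiftˡ x (λ t → YY t ^ l * g t)))) (𝔼.E-const _))

  sizes : T^ .E (λ v → ∣ Int v ∣ * ∣ Int v ∣) ≡ 𝔼 (λ t → YY t ^ l * 1ℚ)
  sizes = trans (T^ .E-cong λ v → trans (sym (𝔼.E-*ʳ _ _)) (𝔼.E-cong λ x → trans (sym (𝔼.E-* _ _)) (𝔼.E-cong λ x' → sym (*-identityʳ _)))) (weighted (λ _ → 1ℚ))

  badpairs : T^ .E (λ v → 𝔼 (λ x → 𝟙 (Int v x) * (Int v ⋆ Rest) x)) ≡ 𝔼 (λ t → YY t ^ l * 𝟙 (Rest t))
  badpairs = trans (T^ .E-cong λ v → 𝔼.E-cong λ x → trans (sym (𝔼.E-* _ _)) (𝔼.E-cong λ x' → sym (*-assoc _ _ _))) (weighted (λ t → 𝟙 (Rest t)))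

  Q P : ℚ
  Q = T^ .E (λ v → ∣ Int v ∣ * ∣ Int v ∣)
  P = T^ .E (λ v → 𝔼 (λ x → 𝟙 (Int v x) * (Int v ⋆ Rest) x))

  each : ∀ (v : Vec (F n) l) → (½ * κ) * (∣ Int v ∣ * ∣ Int v ∣) ≤ 𝔼 (λ x → 𝟙 (Int v x) * (Int v ⋆ Rest) x) + (½ * κ) * (½ ^ h * ½ ^ h)
  each v with ½ ^ h ℚP.≤? ∣ Int v ∣
  ... | yes d = ≤-trans (AP.ap (Int v) Rest h (suc s) d hit) (≤by ((0≤½ ⊠ 0≤κ) ⊠ (0≤½^ h ⊠ 0≤½^ h)) (solve 2 (λ a b → b := a :+ b :- a) refl _ _))
  ... | no d = ≤-trans (*-monoˡ (0≤½ ⊠ 0≤κ) (*-mono (0≤∣∣ (Int v)) (≰⇒≥ d) (0≤∣∣ (Int v)) (≰⇒≥ d)))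
      (≤by (𝔼.E-0≤ λ x → 0≤𝟙 (Int v x) ⊠ 𝔼.E-0≤ λ y → 0≤𝟙 (Int v y) ⊠ 0≤𝟙 (Rest (x ⊕ y))) (solve 2 (λ a b → b := b :+ a :- a) refl ((½ * κ) * (½ ^ h * ½ ^ h)) _))

  total : (½ * κ) * Q ≤ P + (½ * κ) * (½ ^ h * ½ ^ h)
  total = subst₂ _≤_ (T^ .E-* (½ * κ) _) (trans (T^ .E-+ _ _) (cong (P +_) (E-const T^ _))) (T^ .E-mono each)

  0≤lo : 0ℚ ≤ lo
  0≤lo = (0≤1 ⊞ (lit {0ℚ} {4 ÷ 1} ⊠ 0≤κ)) ⊠ (<⇒≤ 0<β ⊠ <⇒≤ 0<β)

  P≤ : P ≤ lo ^ l
  P≤ = ≤-trans (≤-reflexive badpairs) (𝔼.E-≤ pt)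
    where
    pt : ∀ t → YY t ^ l * 𝟙 (Rest t) ≤ lo ^ l
    pt t with lo ℚP.≤? YY t
    ... | yes _ = ≤-trans (≤-reflexive (*-zeroʳ (YY t ^ l))) (0≤^ l 0≤lo)
    ... | no p = ≤-trans (≤-reflexive (*-identityʳ (YY t ^ l))) (^-mono l (0≤YY t) (≰⇒≥ p))

  Q≥ : ∣ Big ∣ * hi ^ l ≤ Q
  Q≥ = ≤-trans (≤-reflexive (sym (𝔼.E-*ʳ (λ t → 𝟙 (Big t)) (hi ^ l)))) (≤-trans (𝔼.E-mono pt) (≤-reflexive (sym sizes)))
    where
    pt : ∀ t → 𝟙 (Big t) * hi ^ l ≤ YY t ^ l * 1ℚ
    pt t with hi ℚP.≤? YY t
    ... | yes p = ≤-trans (≤-reflexive (*-identityˡ _)) (≤-trans (^-mono l ((0≤1 ⊞ (lit {0ℚ} {8 ÷ 1} ⊠ 0≤κ)) ⊠ (<⇒≤ 0<β ⊠ <⇒≤ 0<β)) p) (≤-reflexive (sym (*-identityʳ _))))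
    ... | no _ = ≤-trans (≤-reflexive (*-zeroˡ _)) (0≤^ l (0≤YY t) ⊠ 0≤1)

  -- (1 + κ)^(1/κ) ≥ 2, so l rounds gain a factor 2^(H+s+2).
  gain : 2ℚ ^ (H ℕ.+ s ℕ.+ 2) * lo ^ l ≤ hi ^ l
  gain = ≤-trans (*-monoʳ (0≤^ l 0≤lo) (≤-trans (^-mono (H ℕ.+ s ℕ.+ 2) lit two) (≤-reflexive (sym (^-* (1ℚ + κ) (2 ℕ.^ s) _)))))
    (≤-trans (≤-reflexive (sym (*-^ (1ℚ + κ) lo l))) (^-mono l ((0≤1 ⊞ 0≤κ) ⊠ 0≤lo)
      (≤by ((0≤κ ⊠ (lit {0ℚ} {1ℚ} ⊞ (lit {0ℚ} {4 ÷ 1} ⊠ dif κ≤½))) ⊠ (<⇒≤ 0<β ⊠ <⇒≤ 0<β)) (solve 2 (λ k b → k :* (con 1ℚ :+ con (4 ÷ 1) :* (con ½ :- k)) :* (b :* b) := (con 1ℚ :+ con (8 ÷ 1) :* k) :* (b :* b) :- (con 1ℚ :+ k) :* ((con 1ℚ :+ con (4 ÷ 1) :* k) :* (b :* b))) refl κ β))))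
    where
    two : 2ℚ ≤ (1ℚ + κ) ^ (2 ℕ.^ s)
    two = ≤-trans (≤-reflexive (sym (trans (cong (λ z → 1ℚ + z * κ) (trans (ι-^ 2 s) (cong (_^ s) (solve 0 (con 1ℚ :+ (con 1ℚ :+ con 0ℚ) := con 2ℚ) refl)))) (trans (cong (1ℚ +_) (2^½ s)) (solve 0 (con 1ℚ :+ con 1ℚ := con 2ℚ) refl)))))
      (bernoulli (2 ℕ.^ s) 0≤κ)

  bkm : ∣ Big ∣ ≤ ½ ^ H
  bkm = ≤-stable λ nope → contra (ℚP.≰⇒> nope)
    where
    contra : ½ ^ H < ∣ Big ∣ → ⊥
    contra lt = <⇒≱ small (≤-trans step (≤-reflexive refl))
      where
      0≤hi^ : 0ℚ ≤ hi ^ l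
      0≤hi^ = 0≤^ l ((0≤1 ⊞ (lit {0ℚ} {8 ÷ 1} ⊠ 0≤κ)) ⊠ (<⇒≤ 0<β ⊠ <⇒≤ 0<β))
      u = ½ ^ H * hi ^ l
      u≤Q : u ≤ Q
      u≤Q = ≤-trans (*-monoʳ 0≤hi^ (<⇒≤ lt)) Q≥
      P≤u : P ≤ (1 ÷ 4) * κ * u
      P≤u = ≤-trans P≤ (≤-trans (≤-reflexive (trans (sym (*-identityˡ _)) (trans (*≡ʳ (trans (sym (2^½ (H ℕ.+ s ℕ.+ 2))) (*-comm _ _))) (*-assoc _ _ _))))
         (≤-trans (*-monoˡ (0≤½^ (H ℕ.+ s ℕ.+ 2)) gain) (≤-reflexive (trans (*≡ʳ (trans (^-+ ½ (H ℕ.+ s) 2) (*≡ʳ (^-+ ½ H s))))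
           (solve 3 (λ a k c → a :* k :* (con ½ :* (con ½ :* con 1ℚ)) :* c := con (1 ÷ 4) :* k :* (a :* c)) refl (½ ^ H) κ (hi ^ l))))))
      step : ½ * u ≤ ½ ^ h * ½ ^ h
      step = cancelˡ (0<* {½} {κ} lit< 0<κ) (≤by (dif total ⊞ dif P≤u ⊞ ((0≤½ ⊠ 0≤κ) ⊠ dif u≤Q))
        (solve 5 (λ k Q P z u → P :+ (con ½ :* k) :* z :- (con ½ :* k) :* Q :+ (con (1 ÷ 4) :* k :* u :- P) :+ con ½ :* k :* (Q :- u) := con ½ :* k :* z :- con ½ :* k :* (con ½ :* u)) refl κ Q P (½ ^ h * ½ ^ h) u))
      ββ : ½ ^ (l ℕ.* (L ℕ.+ L)) ≤ hi ^ l
      ββ = ½^-^ {L ℕ.+ L} l (≤-trans (½^-≤ {L} {L} dens dens) (≤by ((lit {0ℚ} {8 ÷ 1} ⊠ 0≤κ) ⊠ (<⇒≤ 0<β ⊠ <⇒≤ 0<β)) (solve 2 (λ k b → con (8 ÷ 1) :* k :* (b :* b) := (con 1ℚ :+ con (8 ÷ 1) :* k) :* (b :* b) :- b :* b) refl κ β)))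
      X = ½ ^ (H ℕ.+ l ℕ.* (L ℕ.+ L))
      hh : ½ ^ h * ½ ^ h ≡ ½ * (½ * ½ ^ (H ℕ.+ (H ℕ.+ l ℕ.* (L ℕ.+ L))))
      hh = trans (½^-+ h h) (cong (½ ^_) (ℕS.solve 3 (λ H a L → (ℕS.con 1 ℕS.:+ (H ℕS.:+ a ℕS.:* L)) ℕS.:+ (ℕS.con 1 ℕS.:+ (H ℕS.:+ a ℕS.:* L)) ℕS.:= ℕS.con 1 ℕS.:+ (ℕS.con 1 ℕS.:+ (H ℕS.:+ (H ℕS.:+ a ℕS.:* (L ℕS.:+ L))))) refl H l L))
      small : ½ ^ h * ½ ^ h < ½ * u
      small = ≤-< (≤-reflexive hh) (≤-< (*-monoˡ 0≤½ (*-monoˡ 0≤½ (½^-mono (ℕP.m≤n+m (H ℕ.+ l ℕ.* (L ℕ.+ L)) H))))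
        (<-≤ (*-monoˡ-< lit< (subst (½ * X <_) (*-identityˡ X) (subst₂ _<_ (*-comm X ½) (*-comm X 1ℚ) (*-monoˡ-< (0<½^ (H ℕ.+ l ℕ.* (L ℕ.+ L))) lit<))))
          (*-monoˡ 0≤½ (≤-trans (≤-reflexive (^-+ ½ H (l ℕ.* (L ℕ.+ L)))) (*-monoˡ (0≤½^ H) ββ)))))

odd-moment : ∀ {n} (Fn' : F n → ℚ) (T : Fn n) (s : ℚ) e → 0ℚ ≤ s → s ≤ 1ℚ → (∀ k → 0ℚ ≤ 𝔼 (λ t → Fn' t ^ k)) →
  (∀ t → Fn' t ≤ 1ℚ) → (∀ t → - 1ℚ ≤ Fn' t) → (∀ t → T t ≡ false → Fn' t ≤ s) →
  s * 𝔼 (λ t → Fn' t ^ (e ℕ.+ e)) ≤ 2ℚ * (s * s ^ (e ℕ.+ e)) + 2ℚ * ∣ T ∣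
odd-moment f T s e' 0≤s s≤1 pos up low off = ≤-trans (≤by (pos (suc p)) (trans (solve 3 (λ a b s → b := b :+ s :* a :- s :* a) refl (𝔼 (λ t → f t ^ p)) (𝔼 (λ t → f t ^ suc p)) s)
     (cong (_- s * 𝔼 (λ t → f t ^ p)) (sym split)))) (≤-trans (𝔼.E-mono pt) (≤-reflexive (trans (𝔼.E-+ _ _) (cong₂ _+_ (𝔼.E-const _) (𝔼.E-* 2ℚ _)))))
  where
  p = e' ℕ.+ e'
  split : 𝔼 (λ t → f t ^ p * (f t + s)) ≡ 𝔼 (λ t → f t ^ suc p) + s * 𝔼 (λ t → f t ^ p)
  split = trans (𝔼.E-cong λ t → solve 3 (λ a b s → b :* (a :+ s) := a :* b :+ s :* b) refl (f t) (f t ^ p) s) (trans (𝔼.E-+ _ _) (+≡ˡ (𝔼.E-* s _)))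
  z≤ : ∀ {a b} → 0ℚ ≤ a → 0ℚ ≤ b → 0ℚ ≤ 2ℚ * a + 2ℚ * b
  z≤ h k = (lit {0ℚ} {2ℚ} ⊠ h) ⊞ (lit {0ℚ} {2ℚ} ⊠ k)
  pt : ∀ t → f t ^ p * (f t + s) ≤ 2ℚ * (s * s ^ p) + 2ℚ * 𝟙 (T t)
  pt t with ℚP.≤-total (f t) (- s) | T t in eq
  ... | inj₁ h | b = ≤-trans (≤by (0≤^even (f t) e' ⊠ dif h) (solve 3 (λ x a s → a :* (:- s :- x) := con 0ℚ :- a :* (x :+ s)) refl (f t) (f t ^ p) s)) (z≤ (0≤s ⊠ 0≤^ p 0≤s) (0≤𝟙 b))
  ... | inj₂ h | true = ≤-trans (*-mono (0≤^even (f t) e') (≤-trans (^even-mono e' 0≤1 (up t) (low t)) (≤-reflexive (1^ p))) (≤by (dif h) (solve 2 (λ x s → x :- :- s := x :+ s :- con 0ℚ) refl (f t) s)) (+-mono (up t) s≤1))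
       (≤by (lit {0ℚ} {2ℚ} ⊠ (0≤s ⊠ 0≤^ p 0≤s)) (solve 1 (λ a → con 2ℚ :* a := con 2ℚ :* a :+ con 2ℚ :* con 1ℚ :- con 1ℚ :* (con 1ℚ :+ con 1ℚ)) refl (s * s ^ p)))
  ... | inj₂ h | false = ≤-trans (*-mono (0≤^even (f t) e') (^even-mono e' 0≤s (off t eq) h) (≤by (dif h) (solve 2 (λ x s → x :- :- s := x :+ s :- con 0ℚ) refl (f t) s)) (+-mono (off t eq) ≤-refl))
       (≤-reflexive (solve 2 (λ s a → a :* (s :+ s) := con 2ℚ :* (s :* a) :+ con 2ℚ :* con 0ℚ) refl s (s ^ p)))

bal : ∀ {n} → Fn n → F n → ℚ
bal X x = 𝟙 (X x) - ∣ X ∣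

cv-bal : ∀ {n} (X Y : Fn n) t → cv (bal X) (bal Y) t ≡ (X ∘∘ Y) t - ∣ X ∣ * ∣ Y ∣
cv-bal X Y t = trans (𝔼.E-cong λ x → solve 4 (λ x y a b → (x :- a) :* (y :- b) := x :* y :+ ((:- b) :* x :+ ((:- a) :* y :+ a :* b))) refl (𝟙 (X x)) (𝟙 (Y (x ⊕ t))) ∣ X ∣ ∣ Y ∣)
  (trans (𝔼.E-+ _ _) (trans (+≡ˡ (trans (𝔼.E-+ _ _) (cong₂ _+_ (𝔼.E-* (- ∣ Y ∣) _) (trans (𝔼.E-+ _ _) (cong₂ _+_ (trans (𝔼.E-* (- ∣ X ∣) _) (cong (- ∣ X ∣ *_) (𝔼-shift t _))) (𝔼.E-const _))))))
  (solve 3 (λ c a b → c :+ ((:- b) :* a :+ ((:- a) :* b :+ a :* b)) := c :- a :* b) refl ((X ∘∘ Y) t) ∣ X ∣ ∣ Y ∣)))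

module TSparams (H L u : ℕ) where
  s e' p H₂ R : ℕ
  s = 5 ℕ.+ u
  e' = H ℕ.+ 2
  p = e' ℕ.+ e'
  H₂ = H ℕ.+ 4 ℕ.+ suc p ℕ.* (u ℕ.+ (L ℕ.+ L))
  R = RBKM H₂ L s

opaque
  RTS : ℕ → ℕ → ℕ → ℕ
  RTS H L u = TSparams.R H L u

  RTS-def : ∀ H L u → RTS H L u ≡ TSparams.R H L u
  RTS-def H L u = refl

module TSone {n} (X : Fn n) (H L u : ℕ) (dens : ½ ^ L ≤ ∣ X ∣) (spread : Spread (RTS H L u) (½ ^ (5 ℕ.+ u)) X) where
  open TSparams H L u
  open BKM X H₂ L s (≤-trans (½^-mono {1} {s} (ℕ.s≤s ℕ.z≤n)) (≤-reflexive (*-identityʳ ½))) dens (subst (λ R → Spread R (½ ^ s) X) (RTS-def H L u) spread) using (Big; bkm; hi)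
  α = ∣ X ∣
  0≤α = 0≤∣∣ X
  f = λ t → cv (bal X) (bal X) t
  θ = ½ ^ u * (α * α)
  σ = ½ * θ
  0≤θ : 0ℚ ≤ θ
  0≤θ = 0≤½^ u ⊠ (0≤α ⊠ 0≤α)
  α²≤1 : α * α ≤ 1ℚ
  α²≤1 = ≤-trans (*-mono 0≤α (∣∣≤1 X) 0≤α (∣∣≤1 X)) (≤-reflexive (*-identityˡ 1ℚ))
  θ≤1 : θ ≤ 1ℚ
  θ≤1 = ≤-trans (*-mono (0≤½^ u) (½^≤1 u) (0≤α ⊠ 0≤α) α²≤1) (≤-reflexive (*-identityˡ 1ℚ))
  0≤c : ∀ t → 0ℚ ≤ (X ∘∘ X) t
  0≤c t = 𝔼.E-0≤ λ x → 0≤𝟙 (X x) ⊠ 0≤𝟙 (X (x ⊕ t))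
  c≤1 : ∀ t → (X ∘∘ X) t ≤ 1ℚ
  c≤1 t = 𝔼.E-≤ λ x → ≤-trans (𝟙*≤ (X x) (0≤𝟙 (X (x ⊕ t)))) (𝟙≤1 (X (x ⊕ t)))
  moment : 𝔼 (λ t → f t ^ p) ≤ ½ ^ suc H * θ ^ p
  moment = cancelˡ 0<σ (≤-trans (odd-moment f Big σ e' (0≤½ ⊠ 0≤θ) (≤-trans (*-mono 0≤½ (lit {½} {1ℚ}) 0≤θ θ≤1) (≤-reflexive (*-identityˡ 1ℚ)))
      (λ k → subst (0ℚ ≤_) (hat-𝟘 (λ t → f t ^ k)) (Trip-^ k (Trip-cv (bal X) (bal X)) .pos₁ 𝟘)) up ≥-1 off) fin)
    where
    0<σ : 0ℚ < σ
    0<σ = 0<* {½} lit< (0<* (0<½^ u) (0<* (<-≤ (0<½^ L) dens) (<-≤ (0<½^ L) dens)))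
    up : ∀ t → f t ≤ 1ℚ
    up t = ≤-trans (≤-reflexive (cv-bal X X t)) (≤-trans (≤by (0≤α ⊠ 0≤α) (solve 2 (λ c a → a := c :- (c :- a)) refl ((X ∘∘ X) t) (α * α))) (c≤1 t))
    ≥-1 : ∀ t → - 1ℚ ≤ f t
    ≥-1 t = ≤-trans (≤by (0≤c t ⊞ dif α²≤1) (solve 2 (λ c a → c :+ (con 1ℚ :- a) := c :- a :- :- con 1ℚ) refl ((X ∘∘ X) t) (α * α))) (≤-reflexive (sym (cv-bal X X t)))
    off : ∀ t → Big t ≡ false → f t ≤ σ
    off t eq = ≤-trans (≤-reflexive (cv-bal X X t)) (≤by (dif (<⇒≤ (≰ᵇ⇒ eq)) ⊞ (lit {0ℚ} {1 ÷ 4} ⊠ 0≤θ))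
      (solve 3 (λ c a u → (con 1ℚ :+ con (8 ÷ 1) :* (con ½ :* (con ½ :* (con ½ :* (con ½ :* (con ½ :* u)))))) :* a :- c :+ con (1 ÷ 4) :* (u :* a) := con ½ :* (u :* a) :- (c :- a)) refl ((X ∘∘ X) t) (α * α) (½ ^ u)))
    θ≥ : ½ ^ (u ℕ.+ (L ℕ.+ L)) ≤ θ
    θ≥ = ½^-≤ {u} {L ℕ.+ L} ≤-refl (½^-≤ {L} {L} dens dens)
    t1 : 2ℚ * (σ * σ ^ p) ≤ ½ * (σ * (½ ^ suc H * θ ^ p))
    t1 = ≤-trans (≤-reflexive (trans (cong (λ z → 2ℚ * (σ * z)) (*-^ ½ θ p)) (solve 3 (λ s h t → con 2ℚ :* (s :* (h :* t)) := s :* ((con 2ℚ :* h) :* t)) refl σ (½ ^ p) (θ ^ p))))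
       (≤-trans (*-monoˡ (<⇒≤ 0<σ) (*-monoʳ (0≤^ p 0≤θ) small)) (≤-reflexive (solve 3 (λ s h t → s :* ((con ½ :* h) :* t) := con ½ :* (s :* (h :* t))) refl σ (½ ^ suc H) (θ ^ p))))
      where
      small : 2ℚ * ½ ^ p ≤ ½ * ½ ^ suc H
      small = ≤-trans (*-monoˡ (lit {0ℚ} {2ℚ}) (½^-mono {3 ℕ.+ H} {p} ar)) (≤-reflexive (solve 1 (λ h → con 2ℚ :* (con ½ :* (con ½ :* (con ½ :* h))) := con ½ :* (con ½ :* h)) refl (½ ^ H)))
        where
        ar : 3 ℕ.+ H ℕ.≤ p
        ar = ℕP.≤-trans (ℕP.≤-reflexive (ℕP.+-comm 3 H)) (ℕP.≤-trans (ℕP.+-monoʳ-≤ H (ℕP.m≤n+m 3 (suc H))) (ℕP.≤-reflexive (trans (cong (H ℕ.+_) (trans (ℕP.+-comm (suc H) 3) (cong (λ z → suc (suc z)) (sym (trans (ℕP.+-comm H 2) refl))))) (sym (ℕP.+-assoc H 2 (H ℕ.+ 2))))))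
    t2 : 2ℚ * ∣ Big ∣ ≤ ½ * (σ * (½ ^ suc H * θ ^ p))
    t2 = ≤-trans (*-monoˡ (lit {0ℚ} {2ℚ}) bkm) (≤-trans (≤-reflexive (trans (cong (2ℚ *_) (trans (cong (½ ^_) (cong (ℕ._+ (suc p ℕ.* (u ℕ.+ (L ℕ.+ L)))) (ℕP.+-comm H 4))) (^-+ ½ (4 ℕ.+ H) _)))
        (solve 2 (λ h t → con 2ℚ :* (con ½ :* (con ½ :* (con ½ :* (con ½ :* h))) :* t) := con ½ :* (con ½ :* (con ½ :* h) :* t)) refl (½ ^ H) (½ ^ (suc p ℕ.* (u ℕ.+ (L ℕ.+ L)))))))
      (*-monoˡ 0≤½ (≤-trans (*-monoˡ (0≤½ ⊠ 0≤½^ (suc H)) (½^-^ {u ℕ.+ (L ℕ.+ L)} (suc p) θ≥)) (≤-reflexive (solve 3 (λ h t q → con ½ :* h :* (t :* q) := (con ½ :* t) :* (h :* q)) refl (½ ^ suc H) θ (θ ^ p))))))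
    fin : 2ℚ * (σ * σ ^ p) + 2ℚ * ∣ Big ∣ ≤ σ * (½ ^ suc H * θ ^ p)
    fin = ≤-trans (+-mono t1 t2) (≤-reflexive (solve 1 (λ a → con ½ :* a :+ con ½ :* a := a) refl _))

module TS {n} (X Y : Fn n) (H L u : ℕ) (dX : ½ ^ L ≤ ∣ X ∣) (dY : ½ ^ L ≤ ∣ Y ∣)
  (sX : Spread (RTS H L u) (½ ^ (5 ℕ.+ u)) X) (sY : Spread (RTS H L u) (½ ^ (5 ℕ.+ u)) Y) where
  open TSparams H L u
  module MX = TSone X H L u dX sX
  module MY = TSone Y H L u dY sY
  α = ∣ X ∣
  β = ∣ Y ∣
  0<α = <-≤ (0<½^ L) dX
  0<β = <-≤ (0<½^ L) dY
  θ = ½ ^ u * (α * β)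
  0<θ = 0<* (0<½^ u) (0<* 0<α 0<β)

  Bad : Fn n
  Bad t = (θ * θ) ≤ᵇ (((X ∘∘ Y) t - α * β) * ((X ∘∘ Y) t - α * β))

  f = λ t → cv (bal X) (bal Y) t
  Φ = 𝔼 (λ t → f t ^ p)

  Φ≤ : Φ ≤ ½ ^ suc H * θ ^ p
  Φ≤ = ≤-sq (0≤½^ (suc H) ⊠ 0≤^ p (<⇒≤ 0<θ)) (≤-trans (Trip-mean (Trip-^ p (Trip-cv (bal X) (bal Y))))
     (≤-trans (*-mono (e0 X (bal X)) MX.moment (e0 Y (bal Y)) MY.moment)
      (≤-reflexive (trans (solve 3 (λ h a b → h :* a :* (h :* b) := (h :* h) :* (a :* b)) refl (½ ^ suc H) (MX.θ ^ p) (MY.θ ^ p))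
        (trans (*≡ˡ (trans (sym (*-^ MX.θ MY.θ p)) (trans (cong (_^ p) (solve 3 (λ u a b → u :* (a :* a) :* (u :* (b :* b)) := (u :* (a :* b)) :* (u :* (a :* b))) refl (½ ^ u) α β)) (*-^ θ θ p))))
          (solve 2 (λ h a → (h :* h) :* (a :* a) := (h :* a) :* (h :* a)) refl (½ ^ suc H) (θ ^ p)))))))
    where
    e0 : ∀ (Z : Fn n) (g : F n → ℚ) → 0ℚ ≤ 𝔼 (λ t → cv g g t ^ p)
    e0 Z g = 𝔼.E-0≤ λ t → 0≤^even (cv g g t) e'

  ts : ∣ Bad ∣ ≤ ½ ^ H
  ts = cancelʳ (0<^ p 0<θ) (≤-trans (≤-trans (≤-reflexive (sym (𝔼.E-*ʳ _ _))) (𝔼.E-mono pt)) (≤-trans Φ≤ (≤by (0≤½^ (suc H) ⊠ 0≤^ p (<⇒≤ 0<θ)) (solve 2 (λ h a → con ½ :* h :* a := h :* a :- con ½ :* h :* a) refl (½ ^ H) (θ ^ p)))))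
    where
    pt : ∀ t → 𝟙 (Bad t) * θ ^ p ≤ f t ^ p
    pt t with Bad t in eq
    ... | false = ≤-trans (≤-reflexive (*-zeroˡ (θ ^ p))) (0≤^even (f t) e')
    ... | true = ≤-trans (≤-reflexive (trans (*-identityˡ _) (trans (^-+ θ e' e') (sym (*-^ θ θ e'))))) (≤-trans (^-mono e' (sq θ) (≤ᵇ⇒ eq))
        (≤-reflexive (trans (cong (λ z → (z * z) ^ e') (sym (cv-bal X Y t))) (trans (*-^ (f t) (f t) e') (sym (^-+ (f t) e' e'))))))

  upper : ∀ t → Bad t ≡ false → (X ∘∘ Y) t ≤ (1ℚ + ½ ^ u) * (α * β)
  upper t eq = ≤by (dif (≤-sq {(X ∘∘ Y) t - α * β} (<⇒≤ 0<θ) (<⇒≤ (≰ᵇ⇒ eq)))) (solve 3 (λ c u a → u :* a :- (c :- a) := (con 1ℚ :+ u) :* a :- c) refl ((X ∘∘ Y) t) (½ ^ u) (α * β))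

  lower : ∀ t → Bad t ≡ false → (1ℚ - ½ ^ u) * (α * β) ≤ (X ∘∘ Y) t
  lower t eq = ≤by (dif (≤-sq {α * β - (X ∘∘ Y) t} (<⇒≤ 0<θ) (≤-trans (≤-reflexive (solve 2 (λ c a → (a :- c) :* (a :- c) := (c :- a) :* (c :- a)) refl ((X ∘∘ Y) t) (α * β))) (<⇒≤ (≰ᵇ⇒ eq)))))
     (solve 3 (λ c u a → u :* a :- (a :- c) := c :- (con 1ℚ :- u) :* a) refl ((X ∘∘ Y) t) (½ ^ u) (α * β))

inv-≤ : ∀ {κ} N → κ * ι N ≡ 1ℚ → 0ℚ < κ
inv-≤ {κ} zero h = ⊥-elim (<⇒≱ {0ℚ} {1ℚ} lit< (≤-reflexive (trans (sym h) (*-zeroʳ κ))))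
inv-≤ (suc N) h = inv-pos (0<ι N) (trans (*-comm _ _) h)

two≤ : ∀ {κ} N → κ * ι N ≡ 1ℚ → 2ℚ ≤ (1ℚ + κ) ^ N
two≤ {κ} N h = ≤-trans (≤-reflexive (trans (solve 0 (con 2ℚ := con 1ℚ :+ con 1ℚ) refl) (cong (1ℚ +_) (trans (sym h) (*-comm κ (ι N))))))
  (bernoulli N (<⇒≤ (inv-≤ N h)))

½^2^ : ∀ s → ½ ^ s * ι (2 ℕ.^ s) ≡ 1ℚ
½^2^ s = trans (cong (½ ^ s *_) (trans (ι-^ 2 s) (cong (_^ s) (solve 0 (con 1ℚ :+ (con 1ℚ :+ con 0ℚ) := con 2ℚ) refl)))) (trans (*-comm _ _) (2^½ s))

bound-rounds : ∀ {κ b} N T → κ * ι N ≡ 1ℚ → ½ ^ T ≤ b → 1ℚ < (1ℚ + κ) ^ suc (N ℕ.* T) * b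
bound-rounds {κ} {b} N T h k = <-≤ (subst (1ℚ <_) (sym (*-identityʳ _)) (subst (_< 1ℚ + κ) (+-identityʳ 1ℚ) (subst₂ _<_ (+-comm 0ℚ 1ℚ) (+-comm κ 1ℚ) (+-mono-<-≤ 0<κ (≤-refl {1ℚ})))))
  (≤-trans (*-monoˡ 0≤1κ (≤-trans (≤-reflexive (sym (2^½ T))) (*-mono (0≤^ T lit) (≤-trans (^-mono T lit (two≤ N h)) (≤-reflexive (sym (^-* (1ℚ + κ) N T)))) (0≤½^ T) k)))
    (≤-reflexive (sym (*-assoc _ _ b))))
  where
  0<κ = inv-≤ N h
  0≤1κ : 0ℚ ≤ 1ℚ + κ
  0≤1κ = 0≤1 ⊞ <⇒≤ 0<κ

∣∣-cong : ∀ {n} {X Y : Fn n} → (∀ x → X x ≡ Y x) → ∣ X ∣ ≡ ∣ Y ∣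
∣∣-cong h = 𝔼.E-cong λ x → cong 𝟙 (h x)

Bounded-cong : ∀ {n R b} {X Y : Fn n} → (∀ x → X x ≡ Y x) → Bounded R b X → Bounded R b Y
Bounded-cong h s φ c le = subst (_≤ _) (∣∣-cong λ x → h (e φ c x)) (s φ c le)

Spread-cong : ∀ {n R κ} {X Y : Fn n} → (∀ x → X x ≡ Y x) → Spread R κ X → Spread R κ Y
Spread-cong {R = R} {κ} {X} {Y} h s = Bounded-cong {X = X} {Y} h (λ {r} {m} → subst (λ z → Bounded R ((1ℚ + κ) * z) X) (∣∣-cong h) (λ {r} {m} → s {r} {m}) {r} {m})

find-spread : ∀ {r κ} → 0ℚ ≤ κ → ∀ i {n} (X : Fn n) → 1ℚ < (1ℚ + κ) ^ i * ∣ X ∣ →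
  (∀ {ρ m} (φ : Flag ρ m n) (c : F ρ) → ρ ℕ.≤ i ℕ.* r → Spread r κ (X ∘e (φ , c)) → ∣ X ∣ ≤ ∣ X ∘e (φ , c) ∣ → ⊥) → ⊥
find-spread 0≤κ zero X h k = <⇒≱ h (≤-trans (≤-reflexive (*-identityˡ _)) (∣∣≤1 X))
find-spread {r} {κ} 0≤κ (suc i) X h k = ¬¬em {P = Spread r κ X} (λ s → k nil [] ℕ.z≤n s ≤-refl)
  λ ns → ns λ φ c le → ≤-stable λ bad → step φ c le (ℚP.≰⇒> bad)
  where
  step : ∀ {ρ m} (φ : Flag ρ m _) c → ρ ℕ.≤ r → (1ℚ + κ) * ∣ X ∣ < ∣ X ∘e (φ , c) ∣ → ⊥
  step φ c le lt = find-spread 0≤κ i (X ∘e (φ , c)) big λ ψ d le' s den →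
      k (φ ++F ψ) (c ++ d) (ℕP.+-mono-≤ le le') (Spread-cong (eq ψ d) s) (≤-trans (≤-trans grow den) (≤-reflexive (∣∣-cong (eq ψ d))))
    where
    eq : ∀ {ρ m} (ψ : Flag ρ m _) d y → X (e φ c (e ψ d y)) ≡ X (e (φ ++F ψ) (c ++ d) y)
    eq ψ d y = cong X (sym (e-++ φ ψ c d y))
    grow : ∣ X ∣ ≤ ∣ X ∘e (φ , c) ∣
    grow = ≤-trans (≤by (0≤κ ⊠ 0≤∣∣ X) (solve 2 (λ κ x → κ :* x := (con 1ℚ :+ κ) :* x :- x) refl κ ∣ X ∣)) (<⇒≤ lt)
    big : 1ℚ < (1ℚ + κ) ^ i * ∣ X ∘e (φ , c) ∣
    big = <-≤ h (≤-trans (≤-reflexive (solve 3 (λ a b c → a :* b :* c := b :* (a :* c)) refl (1ℚ + κ) ((1ℚ + κ) ^ i) ∣ X ∣)) (*-monoˡ (0≤^ i (0≤1 ⊞ 0≤κ)) (<⇒≤ lt)))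

unhyp : ∀ {n} → NZ n → F (suc n) → F n
unhyp (here ξ) (b ∷ y) = y
unhyp (skip ν) (b ∷ y) = b ∷ unhyp ν y

unhyp-hyp : ∀ {n} (ν : NZ n) c y → unhyp ν (hyp ν c y) ≡ y
unhyp-hyp (here ξ) c y = refl
unhyp-hyp (skip ν) c (b ∷ y) = cong (b ∷_) (unhyp-hyp ν c y)

coord : ∀ {r m n} → Flag r m n → F n → F r
coord nil x = []
coord (cons ν φ) x = dot (vec ν) x ∷ coord φ (unhyp ν x)

coord-e : ∀ {r m n} (φ : Flag r m n) c y → coord φ (e φ c y) ≡ c
coord-e nil [] y = refl
coord-e (cons ν φ) (c ∷ cs) y = cong₂ _∷_ (dot-hyp ν c _) (trans (cong (coord φ) (unhyp-hyp ν c _)) (coord-e φ cs y))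

𝔼-zero : ∀ {n} (f : F n → ℚ) → 𝔼 (λ x → 𝟙 (isZ x) * f x) ≡ ½ ^ n * f 𝟘
𝔼-zero {zero} f = 𝔼-[] _
𝔼-zero {suc n} f = trans (𝔼-∷ _) (trans (cong (½ *_) (cong₂ _+_ (𝔼-zero (λ x → f (false ∷ x))) (𝔼.E-* 0ℚ (λ x → f (true ∷ x)))))
  (solve 3 (λ a b c → con ½ :* (a :* b :+ con 0ℚ :* c) := con ½ :* a :* b) refl (½ ^ n) (f 𝟘) (𝔼 (λ x → f (true ∷ x)))))

at : ∀ {r m n} → Flag r m n → F r → Fn n
at φ c x = isZ (c ⊕ coord φ x)

𝔼-at : ∀ {r m n} (φ : Flag r m n) c (f : F n → ℚ) → 𝔼 (λ x → 𝟙 (at φ c x) * f x) ≡ ½ ^ r * 𝔼 (λ y → f (e φ c y))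
𝔼-at {r} φ c f = trans (𝔼-e φ _) (trans (𝔼.E-cong λ d → trans (𝔼.E-cong λ y → cong (λ z → 𝟙 (isZ (c ⊕ z)) * f (e φ d y)) (coord-e φ d y)) (𝔼.E-* _ _))
  (trans (sym (𝔼-shiftˡ c _)) (trans (𝔼.E-cong λ d → cong (λ z → 𝟙 (isZ z) * 𝔼 (λ y → f (e φ (c ⊕ d) y))) (⊕-cancel c d))
    (trans (𝔼-zero (λ d → 𝔼 (λ y → f (e φ (c ⊕ d) y)))) (cong (λ z → ½ ^ r * 𝔼 (λ y → f (e φ z y))) (⊕-𝟘 c))))))

-- A set is decomposed greedily into spread pieces on cosets. The pieces removed while the density lies in [b, 2b]
-- sit on cosets of total measure at most 2.
module Extract {n} (r : ℕ) (κ : ℚ) (N T : ℕ) (κN : κ * ι N ≡ 1ℚ) (v : F n → ℚ) (v≤1 : ∀ x → v x ≤ 1ℚ) (B : ℚ) (0≤B : 0ℚ ≤ B)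
  (piece : ∀ {ρ m} (φ : Flag ρ m n) c (X : Fn m) → ρ ℕ.≤ suc (N ℕ.* T) ℕ.* r → Spread r κ X → ½ ^ T ≤ ∣ X ∣ →
    𝔼 (λ y → 𝟙 (X y) * v (e φ c y)) ≤ B) where

  R : ℕ
  R = suc (N ℕ.* T) ℕ.* r

  ⟪_⟫ : Fn n → ℚ
  ⟪ X ⟫ = 𝔼 (λ x → 𝟙 (X x) * v x)

  without : ∀ {ρ m} → Fn n → Flag ρ m n → F ρ → Fn n
  without X φ c x = X x ∧ not (at φ c x)

  split : ∀ {ρ m} (X : Fn n) (φ : Flag ρ m n) c (f : F n → ℚ) →
    𝔼 (λ x → 𝟙 (X x) * f x) ≡ 𝔼 (λ x → 𝟙 (without X φ c x) * f x) + ½ ^ ρ * 𝔼 (λ y → 𝟙 (X (e φ c y)) * f (e φ c y))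
  split X φ c f = sym (trans (cong (𝔼 (λ x → 𝟙 (without X φ c x) * f x) +_) (sym (𝔼-at φ c _))) (trans (sym (𝔼.E-+ _ _)) (𝔼.E-cong λ x → trans (cong (λ z → z * f x + 𝟙 (at φ c x) * (𝟙 (X x) * f x)) (trans (𝟙-∧ (X x) _) (cong (𝟙 (X x) *_) (𝟙-not (at φ c x)))))
     (solve 3 (λ X a f → X :* (con 1ℚ :- a) :* f :+ a :* (X :* f) := X :* f) refl (𝟙 (X x)) (𝟙 (at φ c x)) (f x)))))

  mass : (X : Fn n) → 𝔼 (λ x → 𝟙 (X x) * 1ℚ) ≡ ∣ X ∣
  mass X = 𝔼.E-cong λ x → *-identityʳ _

  inner : ∀ {b ρ} → ½ ^ T ≤ b → 0ℚ ≤ ρ → (∀ X → ∣ X ∣ ≤ b → ⟪ X ⟫ ≤ ρ) →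
    ∀ k X → ∣ X ∣ ≤ b + ι k * (½ ^ R * b) → b * ⟪ X ⟫ ≤ ∣ X ∣ * B + b * ρ
  inner {b} {ρ} Tb 0≤ρ small k X h = by-cases (∣ X ∣ ≤ b) (done k X) (λ n → large k X h (≰⇒≥ n))
    where
    0≤b : 0ℚ ≤ b
    0≤b = ≤-trans (0≤½^ T) Tb
    done : ∀ k X → ∣ X ∣ ≤ b → b * ⟪ X ⟫ ≤ ∣ X ∣ * B + b * ρ
    done k X le = ≤-trans (*-monoˡ 0≤b (small X le)) (≤by (0≤∣∣ X ⊠ 0≤B) (solve 2 (λ a c → a := a :+ c :- c) refl _ (b * ρ)))
    large : ∀ k X → ∣ X ∣ ≤ b + ι k * (½ ^ R * b) → b ≤ ∣ X ∣ → b * ⟪ X ⟫ ≤ ∣ X ∣ * B + b * ρ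
    large zero X h le = done 0 X (≤-trans h (≤-reflexive (solve 2 (λ b a → b :+ con 0ℚ :* a := b) refl b _)))
    large (suc k) X h le = ≤-stable λ nope → find-spread {r} {κ} (<⇒≤ (inv-≤ N κN)) (suc (N ℕ.* T)) X (bound-rounds N T κN (≤-trans Tb le)) λ {ρ'} φ c cod s den →
      nope (go φ c cod s den)
      where
      go : ∀ {ρ' m} (φ : Flag ρ' m n) c → ρ' ℕ.≤ R → Spread r κ (X ∘e (φ , c)) → ∣ X ∣ ≤ ∣ X ∘e (φ , c) ∣ → b * ⟪ X ⟫ ≤ ∣ X ∣ * B + b * ρ
      go {ρ'} φ c cod s den = ≤by (dif rec ⊞ ((0≤b ⊠ 0≤½^ ρ') ⊠ dif pc) ⊞ ((0≤½^ ρ' ⊠ 0≤B) ⊠ dif (≤-trans le den)))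
          (trans (solve 9 (λ b P d B u x1 r s1 q → x1 :* B :+ b :* r :- b :* s1 :+ (b :* u) :* (B :- P) :+ (u :* B) :* (d :- b) := (x1 :+ u :* d) :* B :+ b :* r :- b :* (s1 :+ u :* P)) refl
              b P d B (½ ^ ρ') ∣ X1 ∣ ρ ⟪ X1 ⟫ b) (cong₂ (λ y z → y * B + b * ρ - b * z) (sym m1) (sym (split X φ c v))))
        where
        X1 = without X φ c
        d = ∣ X ∘e (φ , c) ∣
        P = 𝔼 (λ y → 𝟙 (X (e φ c y)) * v (e φ c y))
        m1 : ∣ X ∣ ≡ ∣ X1 ∣ + ½ ^ ρ' * d
        m1 = trans (sym (mass X)) (trans (split X φ c (λ _ → 1ℚ)) (cong₂ _+_ (mass X1) (cong (½ ^ ρ' *_) (𝔼.E-cong λ y → *-identityʳ _))))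
        pc : P ≤ B
        pc = piece φ c (X ∘e (φ , c)) cod s (≤-trans (≤-trans Tb le) den)
        rec : b * ⟪ X1 ⟫ ≤ ∣ X1 ∣ * B + b * ρ
        rec = inner Tb 0≤ρ small k X1 (≤by (dif h ⊞ dif (*-mono (0≤½^ R) (½^-mono cod) 0≤b (≤-trans le den)))
          (trans (cong (λ z → b + ι (suc k) * (½ ^ R * b) - z + (½ ^ ρ' * d - ½ ^ R * b)) m1)
            (solve 5 (λ b k u x w → b :+ (con 1ℚ :+ k) :* u :- (x :+ w) :+ (w :- u) := b :+ k :* u :- x) refl b (ι k) (½ ^ R * b) ∣ X1 ∣ (½ ^ ρ' * d))))

  outer : ∀ i X → ∣ X ∣ ≤ 2ℚ ^ i * ½ ^ T → ⟪ X ⟫ ≤ ι i * (2ℚ * B) + ½ ^ T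
  outer zero X h = ≤-trans (𝔼.E-mono λ x → *-monoˡ (0≤𝟙 (X x)) (v≤1 x)) (≤-trans (≤-reflexive (mass X)) (≤-trans h (≤-reflexive (solve 2 (λ t b → con 1ℚ :* t := con 0ℚ :* b :+ t) refl (½ ^ T) (2ℚ * B)))))
  outer (suc i) X h = cancelˡ 0<b (≤-trans (inner Tb 0≤ρ (outer i) (2 ℕ.^ R) X (≤-trans h (≤-reflexive eq)))
      (≤by (dif (*-monoʳ 0≤B h)) (solve 6 (λ t u x B k r → con 2ℚ :* t :* u :* B :- x :* B := t :* u :* ((con 1ℚ :+ k) :* (con 2ℚ :* B) :+ r) :- (x :* B :+ t :* u :* (k :* (con 2ℚ :* B) :+ r))) refl (2ℚ ^ i) (½ ^ T) ∣ X ∣ B (ι i) (½ ^ T))))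
    where
    b = 2ℚ ^ i * ½ ^ T
    0<b : 0ℚ < b
    0<b = 0<* (0<^ i lit<) (0<½^ T)
    Tb : ½ ^ T ≤ b
    Tb = ≤-trans (≤-reflexive (sym (*-identityˡ _))) (*-monoʳ (0≤½^ T) (1≤^ i lit))
    0≤ρ : 0ℚ ≤ ι i * (2ℚ * B) + ½ ^ T
    0≤ρ = (0≤ι i ⊠ (lit {0ℚ} {2ℚ} ⊠ 0≤B)) ⊞ 0≤½^ T
    eq : 2ℚ * 2ℚ ^ i * ½ ^ T ≡ b + ι (2 ℕ.^ R) * (½ ^ R * b)
    eq = trans (solve 2 (λ t u → con 2ℚ :* t :* u := t :* u :+ con 1ℚ :* (t :* u)) refl (2ℚ ^ i) (½ ^ T)) (cong (b +_) (trans (*≡ʳ (sym (½^2^ R))) (solve 3 (λ u k b → u :* k :* b := k :* (u :* b)) refl (½ ^ R) (ι (2 ℕ.^ R)) b)))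

  extract : ∀ X → ⟪ X ⟫ ≤ ι T * (2ℚ * B) + ½ ^ T
  extract X = outer T X (≤-trans (∣∣≤1 X) (≤-reflexive (sym (2^½ T))))

≤ᵇ-elim : ∀ {l} (P : Bool → Set l) x y → (x ≤ y → P true) → (y < x → P false) → P (x ≤ᵇ y)
≤ᵇ-elim P x y f g with x ℚP.≤? y
... | yes p = f p
... | no p = g (ℚP.≰⇒> p)

𝔹-elim : ∀ {l} (P : Bool → Set l) b → (b ≡ true → P true) → (b ≡ false → P false) → P b
𝔹-elim P true f g = f refl
𝔹-elim P false f g = g refl

form : ∀ {n} → (F n → F n → ℚ) → Fn n → Fn n → ℚ
form w X Y = 𝔼 (λ x → 𝔼 (λ y → 𝟙 (X x) * 𝟙 (Y y) * w x y))

form-x : ∀ {n} (w : F n → F n → ℚ) X Y → form w X Y ≡ 𝔼 (λ x → 𝟙 (X x) * 𝔼 (λ y → 𝟙 (Y y) * w x y))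
form-x w X Y = 𝔼.E-cong λ x → trans (𝔼.E-cong λ y → *-assoc _ _ _) (𝔼.E-* (𝟙 (X x)) _)

form-y : ∀ {n} (w : F n → F n → ℚ) X Y → form w X Y ≡ 𝔼 (λ y → 𝟙 (Y y) * 𝔼 (λ x → 𝟙 (X x) * w x y))
form-y w X Y = trans (𝔼-swap _) (𝔼.E-cong λ y → trans (𝔼.E-cong λ x → solve 3 (λ a b c → a :* b :* c := b :* (a :* c)) refl (𝟙 (X x)) (𝟙 (Y y)) (w x y)) (𝔼.E-* (𝟙 (Y y)) _))

form-cong : ∀ {n} {w w' : F n → F n → ℚ} X Y → (∀ x y → w x y ≡ w' x y) → form w X Y ≡ form w' X Y
form-cong X Y h = 𝔼.E-cong λ x → 𝔼.E-cong λ y → cong (𝟙 (X x) * 𝟙 (Y y) *_) (h x y)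

res : ∀ {r m n} {A : Set} → (F n → F n → A) → Flag r m n → F r → F r → F m → F m → A
res w φ a b x y = w (e φ a x) (e φ b y)

res-++ : ∀ {r m n r' m'} {A : Set} (w : F n → F n → A) (φ : Flag r m n) a b (ψ : Flag r' m' m) c d x y →
  res w (φ ++F ψ) (a ++ c) (b ++ d) x y ≡ res (res w φ a b) ψ c d x y
res-++ w φ a b ψ c d x y = cong₂ w (e-++ φ ψ a c x) (e-++ φ ψ b d y)

Small : ∀ {n} → (r : ℕ) (κ δ : ℚ) (R : ℕ) → ℚ → (F n → F n → ℚ) → Set
Small {n} r κ δ R ε w = ∀ {ρ m} (φ : Flag ρ m n) a b (X Y : Fn m) → ρ ℕ.≤ R → Spread r κ X → Spread r κ Y →
  δ ≤ ∣ X ∣ → δ ≤ ∣ Y ∣ → form (res w φ a b) X Y ≤ ε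

module SPparams (r k I : ℕ) where
  T N N₁ R₂ r₁ R₁ R : ℕ
  T = 8 ℕ.+ (I ℕ.+ I)
  N = 2 ℕ.^ k
  N₁ = 32 ℕ.* (T ℕ.* T) ℕ.* N
  R₂ = suc (N ℕ.* T) ℕ.* r
  r₁ = R₂ ℕ.+ r
  R₁ = suc (N₁ ℕ.* T) ℕ.* r₁
  R = R₁ ℕ.+ R₂

opaque
  RSP : ℕ → ℕ → ℕ → ℕ
  RSP r k I = I ℕ.* SPparams.R r k I

  RSP-def : ∀ r k I → RSP r k I ≡ I ℕ.* SPparams.R r k I
  RSP-def r k I = refl

δSP : ℕ → ℚ
δSP I = ½ ^ suc (8 ℕ.+ (I ℕ.+ I))

module SP (r k I : ℕ) (1≤k : 1 ℕ.≤ k) (ε : ℚ) (0≤ε : 0ℚ ≤ ε)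
  (small : (16 ÷ 1) * (ι (8 ℕ.+ (I ℕ.+ I)) * ι (8 ℕ.+ (I ℕ.+ I))) * ε ≤ ½ ^ I) where
  open SPparams r k I

  κ = ½ ^ k
  0<κ = 0<½^ k
  κ≤½ : κ ≤ ½
  κ≤½ = ≤-trans (½^-mono 1≤k) (≤-reflexive (*-identityʳ ½))

  ι32 : ι 32 ≡ 32 ÷ 1
  ι32 = trans (ι-^ 2 5) (trans (cong (_^ 5) (solve 0 (con 1ℚ :+ (con 1ℚ :+ con 0ℚ) := con 2ℚ) refl)) (solve 0 (con 2ℚ :* (con 2ℚ :* (con 2ℚ :* (con 2ℚ :* (con 2ℚ :* con 1ℚ)))) := con (32 ÷ 1)) refl))

  t = ι T
  0<t : 0ℚ < t
  0<t = 0<ι (7 ℕ.+ (I ℕ.+ I))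

  0<n₁ : 0ℚ < (32 ÷ 1) * (t * t)
  0<n₁ = 0<* lit< (0<* 0<t 0<t)

  z = proj₁ (inv 0<n₁)
  z≡ : (32 ÷ 1) * (t * t) * z ≡ 1ℚ
  z≡ = proj₂ (inv 0<n₁)
  κ₁ = z * κ
  0<z = inv-pos 0<n₁ z≡
  0<κ₁ : 0ℚ < κ₁
  0<κ₁ = 0<* 0<z 0<κ

  κ₁N : κ₁ * ι N₁ ≡ 1ℚ
  κ₁N = trans (cong (κ₁ *_) (trans (ι-* (32 ℕ.* (T ℕ.* T)) N) (cong (_* ι N) (trans (ι-* 32 (T ℕ.* T)) (cong₂ _*_ ι32 (ι-* T T))))))
    (trans (solve 4 (λ z κ a n → z :* κ :* (a :* n) := (a :* z) :* (κ :* n)) refl z κ ((32 ÷ 1) * (t * t)) (ι N)) (trans (cong₂ _*_ z≡ (½^2^ k)) (*-identityˡ 1ℚ)))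

  8≤t : (8 ÷ 1) ≤ t
  8≤t = ≤-trans (≤-reflexive (sym (trans (ι-^ 2 3) (trans (cong (_^ 3) (solve 0 (con 1ℚ :+ (con 1ℚ :+ con 0ℚ) := con 2ℚ) refl)) (solve 0 (con 2ℚ :* (con 2ℚ :* (con 2ℚ :* con 1ℚ)) := con (8 ÷ 1)) refl))))) (ι-mono (ℕP.m≤m+n 8 (I ℕ.+ I)))

  z≤ : z ≤ ½ * ½
  z≤ = cancelˡ 0<n₁ (≤-trans (≤-reflexive z≡) (≤by (lit {0ℚ} {8 ÷ 1} ⊠ dif (*-mono (lit {0ℚ} {8 ÷ 1}) 8≤t (lit {0ℚ} {8 ÷ 1}) 8≤t) ⊞ lit {0ℚ} {511 ÷ 1})
    (solve 1 (λ a → con (8 ÷ 1) :* (a :- con (8 ÷ 1) :* con (8 ÷ 1)) :+ con (511 ÷ 1) := con (32 ÷ 1) :* a :* (con ½ :* con ½) :- con 1ℚ) refl (t * t))))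

  κ₁≤ : κ₁ ≤ ½ * ½ * κ
  κ₁≤ = *-monoʳ (<⇒≤ 0<κ) z≤

  -- On most subcosets a very spread set keeps nearly its full density, hence is still spread there.
  module Sub {n} (X : Fn n) (s : Spread r₁ κ₁ X) (0<X : 0ℚ < ∣ X ∣) {ρ m} (φ : Flag ρ m n) (le : ρ ℕ.≤ R₂) where
    lo = (1ℚ - ½ * κ) * ∣ X ∣
    thin : F ρ → Bool
    thin a = ∣ X ∘e (φ , a) ∣ ≤ᵇ lo

    rare : (16 ÷ 1) * (t * t) * ∣ thin ∣ ≤ 1ℚ
    rare = ≤-trans (*-monoˡ (lit {0ℚ} {16 ÷ 1} ⊠ (<⇒≤ 0<t ⊠ <⇒≤ 0<t)) f≤) (≤-reflexive (trans (solve 2 (λ a z → con (16 ÷ 1) :* a :* (con 2ℚ :* z) := con (32 ÷ 1) :* a :* z) refl (t * t) z) z≡))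
      where
      pt : ∀ a → ∣ X ∘e (φ , a) ∣ ≤ (1ℚ + κ₁) * ∣ X ∣ - 𝟙 (thin a) * ((κ₁ + ½ * κ) * ∣ X ∣)
      pt a = ≤ᵇ-elim (λ b → ∣ X ∘e (φ , a) ∣ ≤ (1ℚ + κ₁) * ∣ X ∣ - 𝟙 b * ((κ₁ + ½ * κ) * ∣ X ∣)) _ lo
        (λ p → ≤-trans p (≤-reflexive (solve 3 (λ k l x → (con 1ℚ :- con ½ :* k) :* x := (con 1ℚ :+ l) :* x :- con 1ℚ :* ((l :+ con ½ :* k) :* x)) refl κ κ₁ ∣ X ∣)))
        (λ _ → ≤-trans (s φ a (ℕP.≤-trans le (ℕP.m≤m+n R₂ r))) (≤-reflexive (solve 2 (λ a b → a := a :- con 0ℚ :* b) refl _ _)))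
      f≤ : ∣ thin ∣ ≤ 2ℚ * z
      f≤ = cancelˡ (0<* {½ * κ} {∣ X ∣} (0<* lit< 0<κ) 0<X) (≤by (dif (≤-trans (≤-reflexive (𝔼-e φ _)) (≤-trans (𝔼.E-mono pt) (≤-reflexive (trans (𝔼.E-- _ _) (cong₂ _-_ (𝔼.E-const _) (𝔼.E-*ʳ _ _)))))) ⊞ ((<⇒≤ 0<κ₁ ⊠ 0≤∣∣ thin) ⊠ 0≤∣∣ X))
        (solve 4 (λ κ z f x → (con 1ℚ :+ z :* κ) :* x :- f :* ((z :* κ :+ con ½ :* κ) :* x) :- x :+ z :* κ :* f :* x := con ½ :* κ :* x :* (con 2ℚ :* z) :- con ½ :* κ :* x :* f) refl κ z ∣ thin ∣ ∣ X ∣))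

    keep : ∀ a → thin a ≡ false → Spread r κ (X ∘e (φ , a))
    keep a h ψ c le' = ≤-trans (≤-reflexive (∣∣-cong λ y → cong X (sym (e-++ φ ψ a c y)))) (≤-trans (s (φ ++F ψ) (a ++ c) (ℕP.+-mono-≤ le le'))
      (≤-trans (*-monoʳ (0≤∣∣ X) κκ) (≤-trans (≤-reflexive (*-assoc (1ℚ + κ) (1ℚ - ½ * κ) ∣ X ∣)) (*-monoˡ (0≤1 ⊞ <⇒≤ 0<κ) (<⇒≤ (≰ᵇ⇒ h))))))
      where
      κκ : 1ℚ + κ₁ ≤ (1ℚ + κ) * (1ℚ - ½ * κ)
      κκ = ≤by (dif κ₁≤ ⊞ ((0≤½ ⊠ <⇒≤ 0<κ) ⊠ dif κ≤½)) (solve 2 (λ κ l → con ½ :* con ½ :* κ :- l :+ con ½ :* κ :* (con ½ :- κ) := (con 1ℚ :+ κ) :* (con 1ℚ :- con ½ :* κ) :- (con 1ℚ :+ l)) refl κ κ₁)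

    dense : ∀ a → thin a ≡ false → ½ ^ T ≤ ∣ X ∣ → δSP I ≤ ∣ X ∘e (φ , a) ∣
    dense a h d = ≤-trans (*-mono 0≤½ (≤by (0≤½ ⊠ dif (≤-trans κ≤½ (lit {½} {1ℚ}))) (solve 1 (λ k → con ½ :* (con 1ℚ :- k) := con 1ℚ :- con ½ :* k :- con ½) refl κ)) (0≤½^ T) d) (<⇒≤ (≰ᵇ⇒ h))

  Goal : ℕ → Set
  Goal i = ∀ {n} (w : F n → F n → ℚ) → (∀ x y → w x y ≤ 1ℚ) → Small r κ (δSP I) (i ℕ.* R) ε w → ∀ X Y → form w X Y ≤ ½ ^ i

  form≤1 : ∀ {n} (w : F n → F n → ℚ) → (∀ x y → w x y ≤ 1ℚ) → ∀ X Y → form w X Y ≤ 1ℚ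
  form≤1 w h X Y = 𝔼.E-≤ λ x → 𝔼.E-≤ λ y → ≤-trans (*-monoˡ (0≤𝟙 (X x) ⊠ 0≤𝟙 (Y y)) (h x y)) (≤-trans (≤-reflexive (*-identityʳ _)) (≤-trans (*-mono (0≤𝟙 (X x)) (𝟙≤1 (X x)) (0≤𝟙 (Y y)) (𝟙≤1 (Y y))) (≤-reflexive (*-identityˡ 1ℚ))))

  Small-res : ∀ {n s' R' R''} {w : F n → F n → ℚ} → Small s' κ (δSP I) R' ε w → ∀ {ρ m} (φ : Flag ρ m n) a b → ρ ℕ.+ R'' ℕ.≤ R' →
    Small s' κ (δSP I) R'' ε (res w φ a b)
  Small-res {w = w} h φ a b le ψ c d X Y le' sX sY dX dY = ≤-trans (≤-reflexive (form-cong X Y λ x y → sym (res-++ w φ a b ψ c d x y)))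
    (h (φ ++F ψ) (a ++ c) (b ++ d) X Y (ℕP.≤-trans (ℕP.+-monoʳ-≤ _ le') le) sX sY dX dY)

  tail : (4 ÷ 1) * ((1ℚ + 2ℚ * t) * ½ ^ T) ≤ ½ ^ I
  tail = cancelˡ (0<^ T (lit< {0ℚ} {2ℚ})) (≤-trans (≤-trans (≤-reflexive (trans (solve 3 (λ q t h → q :* (con (4 ÷ 1) :* ((con 1ℚ :+ con 2ℚ :* t) :* h)) := (q :* h) :* (con (4 ÷ 1) :* (con 1ℚ :+ con 2ℚ :* t))) refl (2ℚ ^ T) t (½ ^ T)) (trans (*≡ʳ (2^½ T)) (*-identityˡ _)))) lin) (≤-reflexive (sym pw)))
    where
    u = ι I
    p = 2ℚ ^ I
    tt : t ≡ (8 ÷ 1) + (u + u)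
    tt = trans (ι-+ 8 (I ℕ.+ I)) (cong₂ _+_ (solve 0 (con 1ℚ :+ (con 1ℚ :+ (con 1ℚ :+ (con 1ℚ :+ (con 1ℚ :+ (con 1ℚ :+ (con 1ℚ :+ (con 1ℚ :+ con 0ℚ))))))) := con (8 ÷ 1)) refl) (ι-+ I I))
    pw : 2ℚ ^ T * ½ ^ I ≡ (256 ÷ 1) * p
    pw = trans (cong (λ z → z * ½ ^ I) (trans (^-+ 2ℚ 8 (I ℕ.+ I)) (cong (2ℚ ^ 8 *_) (^-+ 2ℚ I I)))) (trans (solve 2 (λ p h → con 2ℚ :* (con 2ℚ :* (con 2ℚ :* (con 2ℚ :* (con 2ℚ :* (con 2ℚ :* (con 2ℚ :* (con 2ℚ :* con 1ℚ))))))) :* (p :* p) :* h := con (256 ÷ 1) :* p :* (p :* h)) refl p (½ ^ I))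
       (trans (cong ((256 ÷ 1) * p *_) (2^½ I)) (*-identityʳ _)))
    lin : (4 ÷ 1) * (1ℚ + 2ℚ * t) ≤ (256 ÷ 1) * p
    lin = ≤-trans (≤-reflexive (cong (λ z → (4 ÷ 1) * (1ℚ + 2ℚ * z)) tt)) (≤by ((lit {0ℚ} {68 ÷ 1} ⊠ dif (1≤^ I (lit {1ℚ} {2ℚ}))) ⊞ (lit {0ℚ} {16 ÷ 1} ⊠ dif (ι≤2^ I)) ⊞ (lit {0ℚ} {172 ÷ 1} ⊠ 0≤^ I (lit {0ℚ} {2ℚ})))
       (solve 2 (λ u p → con (68 ÷ 1) :* (p :- con 1ℚ) :+ con (16 ÷ 1) :* (p :- u) :+ con (172 ÷ 1) :* p := con (256 ÷ 1) :* p :- con (4 ÷ 1) :* (con 1ℚ :+ con 2ℚ :* (con (8 ÷ 1) :+ (u :+ u)))) refl u p))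

  round : ∀ i → suc i ℕ.≤ I → Goal i → Goal (suc i)
  round i i<I ih {n} w w≤1 sm X Y = ≤-trans (≤-reflexive (form-x w X Y)) (≤-trans (Extract.extract r₁ κ₁ N₁ T κ₁N v v≤1 B₁ 0≤B₁ piece₁ X) fin)
    where
    V = ½ ^ i
    0≤V = 0≤½^ i
    y16 = proj₁ (inv (0<* {16 ÷ 1} {t * t} lit< (0<* 0<t 0<t)))
    y16≡ : (16 ÷ 1) * (t * t) * y16 ≡ 1ℚ
    y16≡ = proj₂ (inv (0<* {16 ÷ 1} {t * t} lit< (0<* 0<t 0<t)))
    0≤y : 0ℚ ≤ y16
    0≤y = <⇒≤ (inv-pos (0<* {16 ÷ 1} {t * t} lit< (0<* 0<t 0<t)) y16≡)
    B₂ = ε + V * y16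
    0≤B₂ : 0ℚ ≤ B₂
    0≤B₂ = 0≤ε ⊞ (0≤V ⊠ 0≤y)
    B₁ = t * (2ℚ * B₂) + ½ ^ T
    0≤B₁ : 0ℚ ≤ B₁
    0≤B₁ = (<⇒≤ 0<t ⊠ (lit {0ℚ} {2ℚ} ⊠ 0≤B₂)) ⊞ 0≤½^ T
    v : F n → ℚ
    v x = 𝔼 (λ y → 𝟙 (Y y) * w x y)
    avg≤1 : ∀ {m} (Z : Fn m) (f : F m → ℚ) → (∀ y → f y ≤ 1ℚ) → 𝔼 (λ y → 𝟙 (Z y) * f y) ≤ 1ℚ
    avg≤1 Z f h = 𝔼.E-≤ λ y → ≤-trans (*-monoˡ (0≤𝟙 (Z y)) (h y)) (≤-trans (≤-reflexive (*-identityʳ _)) (𝟙≤1 (Z y)))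
    v≤1 : ∀ x → v x ≤ 1ℚ
    v≤1 x = avg≤1 Y _ (w≤1 x)
    piece₁ : ∀ {ρ m} (φ : Flag ρ m n) a (X' : Fn m) → ρ ℕ.≤ R₁ → Spread r₁ κ₁ X' → ½ ^ T ≤ ∣ X' ∣ → 𝔼 (λ x → 𝟙 (X' x) * v (e φ a x)) ≤ B₁
    piece₁ {ρ} {m} φ a X' le sX dX = ≤-trans (≤-reflexive (trans (𝔼.E-cong λ x → trans (cong (𝟙 (X' x) *_) (𝔼-e φ _)) (sym (𝔼.E-* _ _))) (trans (𝔼-swap _)
        (𝔼.E-cong λ b → trans (sym (form-x (res w φ a b) X' (Y ∘e (φ , b)))) (form-y (res w φ a b) X' (Y ∘e (φ , b))))))) (𝔼.E-≤ each)
      where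
      each : ∀ b → 𝔼 (λ y → 𝟙 (Y (e φ b y)) * 𝔼 (λ x → 𝟙 (X' x) * w (e φ a x) (e φ b y))) ≤ B₁
      each b = Extract.extract r κ N T (½^2^ k) v₂ v₂≤1 B₂ 0≤B₂ piece₂ (Y ∘e (φ , b))
        where
        v₂ : F m → ℚ
        v₂ y = 𝔼 (λ x → 𝟙 (X' x) * w (e φ a x) (e φ b y))
        v₂≤1 : ∀ y → v₂ y ≤ 1ℚ
        v₂≤1 y = avg≤1 X' _ (λ x → w≤1 _ _)
        piece₂ : ∀ {ρ' m'} (ψ : Flag ρ' m' m) d (Y' : Fn m') → ρ' ℕ.≤ R₂ → Spread r κ Y' → ½ ^ T ≤ ∣ Y' ∣ → 𝔼 (λ y → 𝟙 (Y' y) * v₂ (e ψ d y)) ≤ B₂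
        piece₂ {ρ'} {m'} ψ d Y' le' sY dY = ≤-trans (≤-reflexive (trans (𝔼.E-cong λ y → trans (cong (𝟙 (Y' y) *_) (𝔼-e ψ _)) (sym (𝔼.E-* _ _))) (trans (𝔼-swap _)
             (𝔼.E-cong λ c → sym (form-y (w' c) (X' ∘e (ψ , c)) Y'))))) (≤-trans (𝔼.E-mono each') (≤-trans (≤-reflexive (trans (𝔼.E-+ _ _) (cong₂ _+_ (𝔼.E-const ε) (𝔼.E-* V _))))
               (+-mono (≤-refl {ε}) (*-monoˡ 0≤V rare'))))
          where
          w' : F ρ' → F m' → F m' → ℚ
          w' c = res (res w φ a b) ψ c d
          0<X : 0ℚ < ∣ X' ∣
          0<X = <-≤ (0<½^ T) dX
          open Sub X' sX 0<X ψ le'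
          cod : ρ ℕ.+ ρ' ℕ.≤ R
          cod = ℕP.+-mono-≤ le le'
          rare' : ∣ thin ∣ ≤ y16
          rare' = cancelˡ (0<* {16 ÷ 1} {t * t} lit< (0<* 0<t 0<t)) (≤-trans rare (≤-reflexive (sym y16≡)))
          each' : ∀ c → form (w' c) (X' ∘e (ψ , c)) Y' ≤ ε + V * 𝟙 (thin c)
          each' c = 𝔹-elim (λ z → form (w' c) (X' ∘e (ψ , c)) Y' ≤ ε + V * 𝟙 z) (thin c)
            (λ _ → ≤-trans (ih (w' c) (λ x y → w≤1 _ _) (Small-res {w = res w φ a b} (Small-res {w = w} sm φ a b (ℕP.≤-trans (ℕP.≤-reflexive (sym (ℕP.+-assoc ρ ρ' (i ℕ.* R)))) (ℕP.+-monoˡ-≤ (i ℕ.* R) cod))) ψ c d ℕP.≤-refl) (X' ∘e (ψ , c)) Y')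
                (≤by 0≤ε (solve 2 (λ ε V → ε := ε :+ V :* con 1ℚ :- V) refl ε V)))
            (λ eq → ≤-trans (≤-reflexive (form-cong (X' ∘e (ψ , c)) Y' λ x y → sym (res-++ w φ a b ψ c d x y)))
                (≤-trans (sm (φ ++F ψ) (a ++ c) (b ++ d) (X' ∘e (ψ , c)) Y' (ℕP.≤-trans cod (ℕP.m≤m+n R (i ℕ.* R))) (keep c eq) sY (dense c eq dX)
                   (≤-trans (½^-mono (ℕP.n≤1+n T)) dY)) (≤-reflexive (solve 2 (λ ε V → ε := ε :+ V :* con 0ℚ) refl ε V))))
    IV : ½ ^ I ≤ ½ * V
    IV = ½^-mono i<I
    fin : t * (2ℚ * B₁) + ½ ^ T ≤ ½ ^ suc i
    fin = ≤by ((lit {0ℚ} {1 ÷ 4} ⊠ dif small) ⊞ (lit {0ℚ} {1 ÷ 4} ⊠ dif tail) ⊞ (0≤½ ⊠ dif IV))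
      (trans (solve 5 (λ t ε V h I → con (1 ÷ 4) :* (I :- con (16 ÷ 1) :* (t :* t) :* ε) :+ con (1 ÷ 4) :* (I :- con (4 ÷ 1) :* ((con 1ℚ :+ con 2ℚ :* t) :* h)) :+ con ½ :* (con ½ :* V :- I)
           := con ½ :* V :- (con (4 ÷ 1) :* (t :* t) :* ε :+ con (1 ÷ 4) :* V :* con 1ℚ :+ (con 1ℚ :+ con 2ℚ :* t) :* h)) refl t ε V (½ ^ T) (½ ^ I))
        (cong (λ u → ½ * V - u) (trans (cong (λ z → (4 ÷ 1) * (t * t) * ε + (1 ÷ 4) * V * z + (1ℚ + 2ℚ * t) * ½ ^ T) (sym y16≡))
          (solve 5 (λ t ε V y h → con (4 ÷ 1) :* (t :* t) :* ε :+ con (1 ÷ 4) :* V :* (con (16 ÷ 1) :* (t :* t) :* y) :+ (con 1ℚ :+ con 2ℚ :* t) :* h := t :* (con 2ℚ :* (t :* (con 2ℚ :* (ε :+ V :* y)) :+ h)) :+ h) refl t ε V y16 (½ ^ T)))))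

  goal : ∀ i → i ℕ.≤ I → Goal i
  goal zero le w w≤1 sm X Y = form≤1 w w≤1 X Y
  goal (suc i) le w w≤1 sm X Y = round i le (goal i (ℕP.≤-trans (ℕP.n≤1+n i) le)) w w≤1 sm X Y

  sp : ∀ {n} (w : F n → F n → ℚ) → (∀ x y → w x y ≤ 1ℚ) → Small r κ (δSP I) (RSP r k I) ε w → ∀ X Y → form w X Y ≤ ½ ^ I
  sp w w≤1 sm = goal I ℕP.≤-refl w w≤1 (subst (λ R → Small r κ (δSP I) R ε w) (RSP-def r k I) sm)

form-⊕ : ∀ {n} (X Y : Fn n) (q : F n → ℚ) → form (λ x y → q (x ⊕ y)) X Y ≡ 𝔼 (λ t → q t * (X ∘∘ Y) t)
form-⊕ X Y q = trans (𝔼.E-cong λ x → trans (sym (𝔼-shiftˡ x _)) (𝔼.E-cong λ t → trans (cong (λ z → 𝟙 (X x) * 𝟙 (Y (x ⊕ t)) * q z) (⊕-cancel x t)) (*-comm _ _)))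
  (trans (𝔼-swap _) (𝔼.E-cong λ t → 𝔼.E-* (q t) _))

form-const : ∀ {n} (X Y : Fn n) c → form (λ _ _ → c) X Y ≡ c * (∣ X ∣ * ∣ Y ∣)
form-const X Y c = trans (𝔼.E-cong λ x → trans (𝔼.E-cong λ y → solve 3 (λ a b c → a :* b :* c := c :* a :* b) refl (𝟙 (X x)) (𝟙 (Y y)) c) (𝔼.E-* (c * 𝟙 (X x)) _))
  (trans (𝔼.E-*ʳ _ ∣ Y ∣) (trans (*≡ʳ (𝔼.E-* c _)) (*-assoc c ∣ X ∣ ∣ Y ∣)))

form-lin : ∀ {n} (X Y : Fn n) (w w' : F n → F n → ℚ) c → form (λ x y → w x y - c * w' x y) X Y ≡ form w X Y - c * form w' X Y
form-lin X Y w w' c = trans (𝔼.E-cong λ x → trans (𝔼.E-cong λ y → solve 4 (λ a w c w' → a :* (w :- c :* w') := a :* w :+ (:- c) :* (a :* w')) refl (𝟙 (X x) * 𝟙 (Y y)) (w x y) c (w' x y))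
    (trans (𝔼.E-+ _ _) (cong (𝔼 (λ y → 𝟙 (X x) * 𝟙 (Y y) * w x y) +_) (𝔼.E-* (- c) _)))) (trans (𝔼.E-+ _ _) (trans (cong (form w X Y +_) (𝔼.E-* (- c) _))
    (solve 3 (λ a b c → a :+ (:- c) :* b := a :- c :* b) refl (form w X Y) (form w' X Y) c)))

tri : ∀ {n} → Fn n → Fn n → Fn n → ℚ
tri X Y Q = form (λ x y → 𝟙 (Q (x ⊕ y))) X Y

tri-spread : ∀ {n} (X Y Q : Fn n) (H L u : ℕ) → ½ ^ L ≤ ∣ X ∣ → ½ ^ L ≤ ∣ Y ∣ → Spread (RTS H L u) (½ ^ (5 ℕ.+ u)) X → Spread (RTS H L u) (½ ^ (5 ℕ.+ u)) Y →
  (tri X Y Q ≤ (1ℚ + ½ ^ u) * (∣ X ∣ * ∣ Y ∣) * ∣ Q ∣ + ½ ^ H) × ((1ℚ - ½ ^ u) * (∣ X ∣ * ∣ Y ∣) * (∣ Q ∣ - ½ ^ H) ≤ tri X Y Q)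
tri-spread {n} X Y Q H L u dX dY sX sY = ≤-trans (≤-reflexive (form-⊕ X Y (λ t → 𝟙 (Q t)))) (≤-trans (𝔼.E-mono up) (≤-trans (≤-reflexive (trans (𝔼.E-+ _ _) (cong (_+ ∣ Bad ∣) (𝔼.E-*ʳ _ c)))) (+-mono (≤-reflexive (*-comm _ c)) ts)))
  , ≤-trans (≤-trans (*-monoˡ 0≤d (+-mono (≤-refl {∣ Q ∣}) (neg-anti ts))) (≤-trans (≤-reflexive (trans (cong (d *_) (sym (𝔼.E-- _ _))) (sym (𝔼.E-* d _)))) (𝔼.E-mono dn))) (≤-reflexive (sym (form-⊕ X Y (λ t → 𝟙 (Q t)))))
  where
  open TS X Y H L u dX dY sX sY using (Bad; ts; upper; lower)
  c = (1ℚ + ½ ^ u) * (∣ X ∣ * ∣ Y ∣)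
  d = (1ℚ - ½ ^ u) * (∣ X ∣ * ∣ Y ∣)
  0≤c : 0ℚ ≤ c
  0≤c = (0≤1 ⊞ 0≤½^ u) ⊠ (0≤∣∣ X ⊠ 0≤∣∣ Y)
  0≤d : 0ℚ ≤ d
  0≤d = dif (½^≤1 u) ⊠ (0≤∣∣ X ⊠ 0≤∣∣ Y)
  0≤XY : ∀ t → 0ℚ ≤ (X ∘∘ Y) t
  0≤XY t = 𝔼.E-0≤ λ x → 0≤𝟙 (X x) ⊠ 0≤𝟙 (Y (x ⊕ t))
  XY≤1 : ∀ t → (X ∘∘ Y) t ≤ 1ℚ
  XY≤1 t = 𝔼.E-≤ λ x → ≤-trans (𝟙*≤ (X x) (0≤𝟙 (Y (x ⊕ t)))) (𝟙≤1 (Y (x ⊕ t)))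
  up : ∀ t → 𝟙 (Q t) * (X ∘∘ Y) t ≤ 𝟙 (Q t) * c + 𝟙 (Bad t)
  up t = 𝔹-elim (λ b → 𝟙 (Q t) * (X ∘∘ Y) t ≤ 𝟙 (Q t) * c + 𝟙 b) (Bad t)
    (λ _ → ≤-trans (𝟙*≤ (Q t) (0≤XY t)) (≤-trans (XY≤1 t) (≤by (0≤𝟙 (Q t) ⊠ 0≤c) (solve 1 (λ a → a := a :+ con 1ℚ :- con 1ℚ) refl (𝟙 (Q t) * c)))))
    (λ h → ≤-trans (*-monoˡ (0≤𝟙 (Q t)) (upper t h)) (≤-reflexive (sym (+-identityʳ _))))
  dn : ∀ t → d * (𝟙 (Q t) - 𝟙 (Bad t)) ≤ 𝟙 (Q t) * (X ∘∘ Y) t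
  dn t = 𝔹-elim (λ b → d * (𝟙 (Q t) - 𝟙 b) ≤ 𝟙 (Q t) * (X ∘∘ Y) t) (Bad t)
    (λ _ → ≤-trans (≤by (0≤d ⊠ dif (𝟙≤1 (Q t))) (solve 2 (λ d q → d :* (con 1ℚ :- q) := con 0ℚ :- d :* (q :- con 1ℚ)) refl d (𝟙 (Q t)))) (0≤𝟙 (Q t) ⊠ 0≤XY t))
    (λ h → ≤-trans (≤-reflexive (solve 2 (λ d q → d :* (q :- con 0ℚ) := q :* d) refl d (𝟙 (Q t)))) (*-monoˡ (0≤𝟙 (Q t)) (lower t h)))

opaque
  RUL : ℕ → ℕ → ℕ
  RUL h u = RSP (RTS (h ℕ.+ (4 ℕ.+ ((8 ℕ.+ (h ℕ.+ h)) ℕ.+ (8 ℕ.+ (h ℕ.+ h))))) (suc (8 ℕ.+ (h ℕ.+ h))) u) (5 ℕ.+ u) h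

  RUL-def : ∀ h u → RUL h u ≡ RSP (RTS (h ℕ.+ (4 ℕ.+ ((8 ℕ.+ (h ℕ.+ h)) ℕ.+ (8 ℕ.+ (h ℕ.+ h))))) (suc (8 ℕ.+ (h ℕ.+ h))) u) (5 ℕ.+ u) h
  RUL-def h u = refl

sq-small : ∀ T → (16 ÷ 1) * (ι T * ι T) * ½ ^ (4 ℕ.+ (T ℕ.+ T)) ≤ 1ℚ
sq-small T = ≤-trans (≤-reflexive (trans (cong (λ z → (16 ÷ 1) * (ι T * ι T) * z) (^-+ ½ 4 (T ℕ.+ T))) (trans (cong (λ z → (16 ÷ 1) * (ι T * ι T) * (½ ^ 4 * z)) (^-+ ½ T T))
    (solve 2 (λ t h → con (16 ÷ 1) :* (t :* t) :* ((con ½ :* (con ½ :* (con ½ :* (con ½ :* con 1ℚ)))) :* (h :* h)) := (t :* h) :* (t :* h)) refl (ι T) (½ ^ T)))))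
  (≤-trans (*-mono 0≤th th≤1 0≤th th≤1) (≤-reflexive (*-identityˡ 1ℚ)))
  where
  0≤th : 0ℚ ≤ ι T * ½ ^ T
  0≤th = 0≤ι T ⊠ 0≤½^ T
  th≤1 : ι T * ½ ^ T ≤ 1ℚ
  th≤1 = ≤-trans (*-monoʳ (0≤½^ T) (ι≤2^ T)) (≤-reflexive (2^½ T))

sum-bound : ∀ {n} h u (Q : Fn n) b → 0ℚ ≤ b → Bounded (RUL h u) b Q → ∀ H P → tri H P Q ≤ (1ℚ + ½ ^ u) * b * (∣ H ∣ * ∣ P ∣) + ½ ^ h
sum-bound {n} h u Q b 0≤b bd H P = ≤-trans (≤by (dif (SP.sp r (5 ℕ.+ u) h (ℕ.s≤s ℕ.z≤n) ε (0≤½^ Hε) small w w≤1 sm H P)) (trans (cong (λ z → ½ ^ h - z) val) (solve 3 (λ h t c → h :- (t :- c) := c :+ h :- t) refl (½ ^ h) (tri H P Q) (c * (∣ H ∣ * ∣ P ∣))))) ≤-refl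
  where
  T Hε L r : ℕ
  T = 8 ℕ.+ (h ℕ.+ h)
  Hε = h ℕ.+ (4 ℕ.+ (T ℕ.+ T))
  L = suc T
  r = RTS Hε L u
  ε = ½ ^ Hε
  c = (1ℚ + ½ ^ u) * b
  0≤c : 0ℚ ≤ c
  0≤c = (0≤1 ⊞ 0≤½^ u) ⊠ 0≤b
  w : F n → F n → ℚ
  w x y = 𝟙 (Q (x ⊕ y)) - c * 1ℚ
  w≤1 : ∀ x y → w x y ≤ 1ℚ
  w≤1 x y = ≤-trans (≤by 0≤c (solve 2 (λ q c → c := q :- (q :- c :* con 1ℚ)) refl (𝟙 (Q (x ⊕ y))) c)) (𝟙≤1 (Q (x ⊕ y)))
  value : ∀ {m} (X Y Z : Fn m) → form (λ x y → 𝟙 (Z (x ⊕ y)) - c * 1ℚ) X Y ≡ tri X Y Z - c * (∣ X ∣ * ∣ Y ∣)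
  value X Y Z = trans (form-lin X Y (λ x y → 𝟙 (Z (x ⊕ y))) (λ _ _ → 1ℚ) c) (cong (λ z → tri X Y Z - c * z) (trans (form-const X Y 1ℚ) (*-identityˡ _)))
  val = value H P Q
  small : (16 ÷ 1) * (ι T * ι T) * ε ≤ ½ ^ h
  small = ≤-trans (≤-reflexive (trans (cong ((16 ÷ 1) * (ι T * ι T) *_) (^-+ ½ h _)) (solve 3 (λ a h z → a :* (h :* z) := h :* (a :* z)) refl _ (½ ^ h) _)))
    (≤-trans (*-monoˡ (0≤½^ h) (sq-small T)) (≤-reflexive (*-identityʳ _)))
  sm : Small r (½ ^ (5 ℕ.+ u)) (δSP h) (RSP r (5 ℕ.+ u) h) ε w
  sm φ a d X Y le sX sY dX dY = ≤-trans (≤-reflexive (trans (form-cong X Y λ x y → cong (λ z → 𝟙 (Q z) - c * 1ℚ) (e-⊕ φ a d x y)) (value X Y Q')))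
      (≤by (dif (proj₁ (tri-spread X Y Q' Hε L u dX dY sX sY)) ⊞ (((0≤1 ⊞ 0≤½^ u) ⊠ (0≤∣∣ X ⊠ 0≤∣∣ Y)) ⊠ dif (bd φ (a ⊕ d) (subst (_ ℕ.≤_) (sym (RUL-def h u)) le))))
        (solve 6 (λ v xy q ε t b → (con 1ℚ :+ v) :* xy :* q :+ ε :- t :+ (con 1ℚ :+ v) :* xy :* (b :- q) := ε :- (t :- (con 1ℚ :+ v) :* b :* xy)) refl (½ ^ u) (∣ X ∣ * ∣ Y ∣) ∣ Q' ∣ ε (tri X Y Q') b))
    where
    Q' = Q ∘e (φ , a ⊕ d)

-- Codegrees

den : ∀ {m n} → Fn m → Fn n → (F m → F n → Bool) → ℚ
den H Z f = 𝔼 (λ y → 𝟙 (H y) * 𝔼 (λ z → 𝟙 (Z z) * 𝟙 (f y z)))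

opaque
  recip : ℚ → ℚ
  recip x with 0ℚ ℚP.<? x
  ... | yes h = proj₁ (inv h)
  ... | no _ = 0ℚ

  recip-* : ∀ {x} → 0ℚ < x → x * recip x ≡ 1ℚ
  recip-* {x} h with 0ℚ ℚP.<? x
  ... | yes k = proj₂ (inv k)
  ... | no n = ⊥-elim (n h)

  0≤recip : ∀ x → 0ℚ ≤ recip x
  0≤recip x with 0ℚ ℚP.<? x
  ... | yes k = <⇒≤ (inv-pos k (proj₂ (inv k)))
  ... | no n = ≤-refl

  ϖ : ℚ
  ϖ = 257 ÷ 256

  1≤ϖ : 1ℚ ≤ ϖ
  1≤ϖ = lit

  ϖ³≤ : ϖ * (ϖ * ϖ) ≤ 65 ÷ 64
  ϖ³≤ = ≤by (lit {0ℚ} {(65 ÷ 64) ℚ.- (ϖ ℚ.* (ϖ ℚ.* ϖ))}) (solve 0 (con ((65 ÷ 64) ℚ.- (ϖ ℚ.* (ϖ ℚ.* ϖ))) := con (65 ÷ 64) :- con ϖ :* (con ϖ :* con ϖ)) refl)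

  ϖ≡ : ϖ ≡ 1ℚ + ½ ^ 8
  ϖ≡ = solve 0 (con ϖ := con 1ℚ :+ con ½ :* (con ½ :* (con ½ :* (con ½ :* (con ½ :* (con ½ :* (con ½ :* (con ½ :* con 1ℚ)))))))) refl

  ϖ-tail : ∀ {x e} → x * ϖ ≤ (513 ÷ 512) * x + e → x ≤ (512 ÷ 1) * e
  ϖ-tail {x} {e} h = ≤by (lit {0ℚ} {512 ÷ 1} ⊠ dif h) (solve 2 (λ B e → con (512 ÷ 1) :* (con (513 ÷ 512) :* B :+ e :- B :* con (257 ÷ 256)) := con (512 ÷ 1) :* e :- B) refl x e)

0≤ϖ : 0ℚ ≤ ϖ
0≤ϖ = ≤-trans 0≤1 1≤ϖ

-- Tested on the set where the excess is positive, the hypothesis bounds the positive part of the excess.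
weighted-den : ∀ {m n} (P : F m → F n → Bool) b ε V → 0ℚ ≤ ε → 0ℚ ≤ V → (∀ H Z → den H Z P ≤ b * (∣ H ∣ * ∣ Z ∣) + ε) →
  ∀ (w : F m → ℚ) Z → (∀ y → 0ℚ ≤ w y) → (∀ y → w y ≤ V) → 𝔼 (λ y → w y * 𝔼 (λ z → 𝟙 (Z z) * 𝟙 (P y z))) ≤ b * (𝔼 w * ∣ Z ∣) + V * ε
weighted-den {m} P b ε V 0≤ε 0≤V U w Z w0 wV = ≤by (dif main ⊞ (0≤V ⊠ dif (U H Z)))
    (trans (cong (λ z → V * den H Z P - V * (c * ∣ H ∣) - (Σw - c * 𝔼 w) + V * (z + ε - den H Z P)) (solve 3 (λ b h z → b :* (h :* z) := (b :* z) :* h) refl b ∣ H ∣ ∣ Z ∣))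
      (solve 9 (λ V d b z h ε S w c → V :* d :- V :* (c :* h) :- (S :- c :* w) :+ V :* (c :* h :+ ε :- d) := c :* w :+ V :* ε :- S) refl V (den H Z P) b ∣ Z ∣ ∣ H ∣ ε Σw (𝔼 w) c ∙ cong (λ z → z + V * ε - Σw) (solve 3 (λ b z w → b :* z :* w := b :* (w :* z)) refl b ∣ Z ∣ (𝔼 w))))
  where
  infixr 2 _∙_
  _∙_ : ∀ {x y z : ℚ} → x ≡ y → y ≡ z → x ≡ z
  _∙_ = trans
  g : F m → ℚ
  g y = 𝔼 (λ z → 𝟙 (Z z) * 𝟙 (P y z))
  c = b * ∣ Z ∣
  Σw = 𝔼 (λ y → w y * g y)
  H : Fn m
  H y = c ≤ᵇ g y
  pt : ∀ y → w y * g y - c * w y ≤ V * (𝟙 (H y) * g y) - V * (c * 𝟙 (H y))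
  pt y = ≤ᵇ-elim (λ h → w y * g y - c * w y ≤ V * (𝟙 h * g y) - V * (c * 𝟙 h)) c (g y)
    (λ h → ≤by (dif (wV y) ⊠ dif h) (solve 4 (λ V w g c → (V :- w) :* (g :- c) := V :* (con 1ℚ :* g) :- V :* (c :* con 1ℚ) :- (w :* g :- c :* w)) refl V (w y) (g y) c))
    (λ h → ≤by (w0 y ⊠ dif (<⇒≤ h)) (solve 4 (λ V w g c → w :* (c :- g) := V :* (con 0ℚ :* g) :- V :* (c :* con 0ℚ) :- (w :* g :- c :* w)) refl V (w y) (g y) c))
  main : Σw - c * 𝔼 w ≤ V * den H Z P - V * (c * ∣ H ∣)
  main = subst₂ _≤_ (trans (𝔼.E-- _ _) (cong (λ z → Σw - z) (𝔼.E-* c w)))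
    (trans (𝔼.E-- _ _) (cong₂ _-_ (𝔼.E-* V _) (trans (𝔼.E-* V _) (cong (V *_) (𝔼.E-* c _))))) (𝔼.E-mono pt)

Com : ∀ {m n l} → (F m → F n → Bool) → Fn n → Vec (F m) l → Fn n
Com f D [] z = D z
Com f D (y ∷ v) z = f y z ∧ Com f D v z

𝟙-Com : ∀ {m n l} (f : F m → F n → Bool) D (v : Vec (F m) l) z → 𝟙 (Com f D v z) ≡ 𝟙 (D z) * ∏ (λ y → 𝟙 (f y z)) v
𝟙-Com f D [] z = sym (*-identityʳ _)
𝟙-Com f D (y ∷ v) z = trans (𝟙-∧ (f y z) _) (trans (cong (𝟙 (f y z) *_) (𝟙-Com f D v z)) (solve 3 (λ a b c → a :* (b :* c) := b :* (a :* c)) refl (𝟙 (f y z)) (𝟙 (D z)) _))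

-- The graphs f, g stand for A in the coordinates (x, z), on two cosets. Their expected density is a / (αγ), so κ is the
-- codegree divided by its expected value a² / (α²γ).
module Codegree {m n} (f g P P' : F m → F n → Bool) (A A' : Fn m) (D : Fn n) (α β γ a : ℚ)
  (fP : ∀ y z → 𝟙 (f y z) ≤ 𝟙 (D z) * 𝟙 (P y z)) (gP : ∀ y z → 𝟙 (g y z) ≤ 𝟙 (D z) * 𝟙 (P' y z)) (γ≡ : ∣ D ∣ ≡ γ)
  (L d : ℕ) (Lα : ½ ^ L ≤ α) (Lβ : ½ ^ L ≤ β) (Lγ : ½ ^ L ≤ γ) (La : ½ ^ L ≤ a) (α≤1 : α ≤ 1ℚ) (β≤1 : β ≤ 1ℚ) (γ≤1 : γ ≤ 1ℚ) (da : α * β * γ ≤ 2ℚ ^ d * a)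
  (K hG : ℕ) (A≤ : ∣ A ∣ ≤ 2ℚ * α) (A'≤ : ∣ A' ∣ ≤ 2ℚ * α)
  (Rf : ∀ H Z → (α * γ) * den H Z f ≤ a * ((513 ÷ 512) * (∣ H ∣ * ∣ Z ∣) + (α * γ) * ½ ^ K))
  (Rg : ∀ H Z → (α * γ) * den H Z g ≤ a * ((513 ÷ 512) * (∣ H ∣ * ∣ Z ∣) + (α * γ) * ½ ^ K))
  (Uf : ∀ H Z → den H Z P ≤ ((4 ÷ 1) * β) * (∣ H ∣ * ∣ Z ∣) + ½ ^ hG)
  (Ug : ∀ H Z → den H Z P' ≤ ((4 ÷ 1) * β) * (∣ H ∣ * ∣ Z ∣) + ½ ^ hG) where

  0<α : 0ℚ < α
  0<α = <-≤ (0<½^ L) Lα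
  0<β : 0ℚ < β
  0<β = <-≤ (0<½^ L) Lβ
  0<γ : 0ℚ < γ
  0<γ = <-≤ (0<½^ L) Lγ
  0<a : 0ℚ < a
  0<a = <-≤ (0<½^ L) La

  i s c κ₀ : ℚ
  i = recip a
  s = α * γ * i
  c = α * i
  κ₀ = s * c

  ai : a * i ≡ 1ℚ
  ai = recip-* 0<a
  0≤i : 0ℚ ≤ i
  0≤i = 0≤recip a
  0<i : 0ℚ < i
  0<i = inv-pos 0<a ai
  0<s : 0ℚ < s
  0<s = 0<* (0<* 0<α 0<γ) 0<i
  0≤s = <⇒≤ 0<s
  0<c : 0ℚ < c
  0<c = 0<* 0<α 0<i
  0≤c = <⇒≤ 0<c

  i≤ : i ≤ 2ℚ ^ L
  i≤ = cancelˡ (0<½^ L) (≤-trans (*-monoʳ 0≤i La) (≤-reflexive (trans ai (sym (trans (*-comm _ _) (2^½ L))))))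

  s≤ : s ≤ 2ℚ ^ L
  s≤ = ≤-trans (*-monoʳ 0≤i (≤-trans (*-mono (<⇒≤ 0<α) α≤1 (<⇒≤ 0<γ) γ≤1) (≤-reflexive (*-identityˡ 1ℚ)))) (≤-trans (≤-reflexive (*-identityˡ i)) i≤)

  βs≤ : β * s ≤ 2ℚ ^ d
  βs≤ = ≤-trans (≤-reflexive (solve 4 (λ a b c i → b :* (a :* c :* i) := (a :* b :* c) :* i) refl α β γ i)) (≤-trans (*-monoʳ 0≤i da) (≤-reflexive (trans (*-assoc _ a i) (trans (cong (2ℚ ^ d *_) ai) (*-identityʳ _)))))

  R' : ∀ (f : F m → F n → Bool) → (∀ H Z → (α * γ) * den H Z f ≤ a * ((513 ÷ 512) * (∣ H ∣ * ∣ Z ∣) + (α * γ) * ½ ^ K)) →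
    ∀ H Z → s * den H Z f ≤ (513 ÷ 512) * (∣ H ∣ * ∣ Z ∣) + (α * γ) * ½ ^ K
  R' f R H Z = ≤-trans (≤-reflexive (solve 4 (λ a g i d → a :* g :* i :* d := i :* (a :* g :* d)) refl α γ i (den H Z f))) (≤-trans (*-monoˡ 0≤i (R H Z))
    (≤-reflexive (trans (sym (*-assoc i a _)) (trans (*≡ʳ (trans (*-comm i a) ai)) (*-identityˡ _)))))

  k κ : F m → F m → ℚ
  k y y' = 𝔼 (λ z → 𝟙 (f y z) * 𝟙 (g y' z))
  κ y y' = κ₀ * k y y'

  0≤k : ∀ y y' → 0ℚ ≤ k y y'
  0≤k y y' = 𝔼.E-0≤ λ z → 0≤𝟙 (f y z) ⊠ 0≤𝟙 (g y' z)

  0≤κ₀ : 0ℚ ≤ κ₀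
  0≤κ₀ = 0≤s ⊠ 0≤c

  0≤κ : ∀ y y' → 0ℚ ≤ κ y y'
  0≤κ y y' = 0≤κ₀ ⊠ 0≤k y y'

  k≤1 : ∀ y y' → k y y' ≤ 1ℚ
  k≤1 y y' = 𝔼.E-≤ λ z → ≤-trans (*-mono (0≤𝟙 (f y z)) (𝟙≤1 (f y z)) (0≤𝟙 (g y' z)) (𝟙≤1 (g y' z))) (≤-reflexive (*-identityˡ 1ℚ))

  κ≤ : ∀ y y' → κ y y' ≤ 2ℚ ^ L * 2ℚ ^ L
  κ≤ y y' = ≤-trans (*-monoˡ 0≤κ₀ (k≤1 y y')) (≤-trans (≤-reflexive (*-identityʳ _)) (*-mono 0≤s s≤ 0≤c (≤-trans (*-monoʳ 0≤i α≤1) (≤-trans (≤-reflexive (*-identityˡ i)) i≤))))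

  ρ : F m → ℚ
  ρ y' = 𝔼 (λ z → 𝟙 (g y' z))

  module Popular (k₂ l₀ : ℕ) (K≡ : K ≡ (2 ℕ.+ k₂) ℕ.+ (10 ℕ.+ suc l₀ ℕ.* (4 ℕ.+ d))) (gain : 2ℚ ^ (4 ℕ.+ d) ≤ ϖ ^ suc l₀)
    (hG≥ : suc l₀ ℕ.* (L ℕ.+ (L ℕ.+ (2 ℕ.+ k₂))) ℕ.+ (k₂ ℕ.+ (4 ℕ.* L ℕ.+ 4)) ℕ.≤ hG) where
    l : ℕ
    l = suc l₀

    opaque
      T : F m → F m → Bool
      T y y' = A y ∧ (A' y' ∧ ((65 ÷ 64) ≤ᵇ κ y y'))

      T-def : ∀ y y' → T y y' ≡ A y ∧ (A' y' ∧ ((65 ÷ 64) ≤ᵇ κ y y'))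
      T-def y y' = refl

    p : F m → ℚ
    p y' = 𝔼 (λ y → 𝟙 (T y y'))

    p₀ : ℚ
    p₀ = ½ ^ (2 ℕ.+ k₂) * α

    0<p₀ : 0ℚ < p₀
    0<p₀ = 0<* (0<½^ (2 ℕ.+ k₂)) 0<α

    j : F m → ℚ
    j y' = recip (p y')

    b : F m → F n → ℚ
    b y' z = s * j y' * 𝔼 (λ y → 𝟙 (T y y') * 𝟙 (f y z))

    0≤b : ∀ y' z → 0ℚ ≤ b y' z
    0≤b y' z = (0≤s ⊠ 0≤recip (p y')) ⊠ 𝔼.E-0≤ λ y → 0≤𝟙 (T y y') ⊠ 0≤𝟙 (f y z)

    Zb : (Z : Fn n) (y' : F m) → 𝔼 (λ z → 𝟙 (Z z) * b y' z) ≡ s * j y' * den (λ y → T y y') Z f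
    Zb Z y' = trans (𝔼.E-cong λ z → solve 3 (λ a b c → a :* (b :* c) := b :* (a :* c)) refl (𝟙 (Z z)) (s * j y') _) (trans (𝔼.E-* _ _) (cong (s * j y' *_)
      (trans (𝔼.E-cong λ z → trans (sym (𝔼.E-* _ _)) (𝔼.E-cong λ y → solve 3 (λ a b c → a :* (b :* c) := b :* (a :* c)) refl (𝟙 (Z z)) (𝟙 (T y y')) (𝟙 (f y z)))) (trans (𝔼-swap _) (𝔼.E-cong λ y → 𝔼.E-* _ _)))))

    module Row (y' : F m) (pp : p₀ ≤ p y') where
      jp : p y' * j y' ≡ 1ℚ
      jp = recip-* (<-≤ 0<p₀ pp)
      0≤j = 0≤recip (p y')
      H : Fn m
      H y = T y y'

      avg : ∀ Z → 𝔼 (λ z → 𝟙 (Z z) * b y' z) ≤ (513 ÷ 512) * ∣ Z ∣ + γ * ½ ^ (10 ℕ.+ l ℕ.* (4 ℕ.+ d))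
      avg Z = ≤-trans (≤-reflexive (trans (Zb Z y') (solve 3 (λ s j d → s :* j :* d := j :* (s :* d)) refl s (j y') (den H Z f)))) (≤-trans (*-monoˡ 0≤j (R' f Rf H Z))
          (≤-trans (≤-reflexive (solve 6 (λ j p z a g k → j :* (con (513 ÷ 512) :* (p :* z) :+ (a :* g) :* k) := con (513 ÷ 512) :* ((p :* j) :* z) :+ g :* (j :* (a :* k))) refl (j y') (p y') ∣ Z ∣ α γ (½ ^ K)))
          (+-mono (≤-reflexive (cong ((513 ÷ 512) *_) (trans (*≡ʳ jp) (*-identityˡ _)))) (*-monoˡ (<⇒≤ 0<γ)
            (≤-trans (≤-reflexive (trans (cong (λ z → j y' * (α * z)) (trans (cong (½ ^_) K≡) (^-+ ½ (2 ℕ.+ k₂) _))) (solve 4 (λ j a h e → j :* (a :* (h :* e)) := (h :* a) :* j :* e) refl (j y') α (½ ^ (2 ℕ.+ k₂)) _)))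
              (≤-trans (*-monoʳ (0≤½^ (10 ℕ.+ l ℕ.* (4 ℕ.+ d))) (≤-trans (*-monoʳ 0≤j pp) (≤-reflexive jp))) (≤-reflexive (*-identityˡ _))))))))

      b≤s : ∀ z → b y' z ≤ s
      b≤s z = ≤-trans (*-monoˡ (0≤s ⊠ 0≤j) (𝔼.E-mono λ y → ≤-trans (*-monoˡ (0≤𝟙 (T y y')) (𝟙≤1 (f y z))) (≤-reflexive (*-identityʳ _)))) (≤-reflexive (trans (solve 3 (λ s j p → s :* j :* p := s :* (p :* j)) refl s (j y') (p y')) (trans (cong (s *_) jp) (*-identityʳ s))))

      j≤ : j y' ≤ 2ℚ ^ (L ℕ.+ (2 ℕ.+ k₂))
      j≤ = cancelˡ (0<½^ (L ℕ.+ (2 ℕ.+ k₂))) (≤-trans (*-monoʳ 0≤j (≤-trans (≤-trans (≤-reflexive (trans (^-+ ½ L _) (*-comm _ _))) (*-monoˡ (0≤½^ (2 ℕ.+ k₂)) Lα)) pp)) (≤-reflexive (trans jp (sym (trans (*-comm _ _) (2^½ (L ℕ.+ (2 ℕ.+ k₂))))))))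

      Bad Exc : Fn n
      Bad z = D z ∧ (ϖ ≤ᵇ b y' z)
      Exc z = (2ℚ ^ (4 ℕ.+ d)) ≤ᵇ b y' z

      W = 2ℚ ^ (4 ℕ.+ d)

      mono-∧ : ∀ (Z B : Bool) x y → (B ≡ true → x ≤ y) → 𝟙 (Z ∧ B) * x ≤ 𝟙 (Z ∧ B) * y
      mono-∧ true B x y h = 𝟙-≤ B h
      mono-∧ false B x y h = ≤-reflexive (trans (*-zeroˡ x) (sym (*-zeroˡ y)))

      bad≤ : ∣ Bad ∣ ≤ (512 ÷ 1) * (γ * ½ ^ (10 ℕ.+ l ℕ.* (4 ℕ.+ d)))
      bad≤ = ϖ-tail (≤-trans (≤-trans (≤-reflexive (sym (𝔼.E-*ʳ _ ϖ))) (𝔼.E-mono λ z → mono-∧ (D z) (ϖ ≤ᵇ b y' z) ϖ (b y' z) ≤ᵇ⇒)) (avg Bad))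

      fP' : ∀ Z → den H Z f ≤ ((4 ÷ 1) * β) * (p y' * ∣ Z ∣) + ½ ^ hG
      fP' Z = ≤-trans (𝔼.E-mono λ y → *-monoˡ (0≤𝟙 (H y)) (𝔼.E-mono λ z → *-monoˡ (0≤𝟙 (Z z)) (≤-trans (fP y z) (≤-trans (*-monoʳ (0≤𝟙 (P y z)) (𝟙≤1 (D z))) (≤-reflexive (*-identityˡ _)))))) (Uf H Z)

      exc≤ : ∣ Exc ∣ ≤ s * j y' * ½ ^ hG
      exc≤ = ≤-trans (≤by (dif W1 ⊠ 0≤∣∣ Exc) (solve 2 (λ W e → (W :- con 1ℚ) :* e := W :* e :- e) refl (2ℚ ^ d) ∣ Exc ∣))
        (≤by (dif (≤-trans (≤-trans (≤-reflexive (sym (𝔼.E-*ʳ _ W))) (𝔼.E-mono λ z → 𝟙-≤ (Exc z) ≤ᵇ⇒)) (≤-trans (≤-reflexive (Zb Exc y')) (*-monoˡ (0≤s ⊠ 0≤j) (fP' Exc))))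
          ⊞ ((lit {0ℚ} {4 ÷ 1} ⊠ dif βs≤) ⊠ 0≤∣∣ Exc) ⊞ ((lit {0ℚ} {11 ÷ 1} ⊠ 0≤^ d (lit {0ℚ} {2ℚ})) ⊠ 0≤∣∣ Exc))
          (trans (solve 8 (λ s j b p e h t q → s :* j :* (con (4 ÷ 1) :* b :* (p :* e) :+ h) :- e :* (con 2ℚ :* (con 2ℚ :* (con 2ℚ :* (con 2ℚ :* t)))) :+ con (4 ÷ 1) :* (t :- b :* s) :* e :+ con (11 ÷ 1) :* t :* e
             := s :* j :* h :- t :* e :+ con (4 ÷ 1) :* b :* s :* e :* (p :* j :- con 1ℚ)) refl s (j y') β (p y') ∣ Exc ∣ (½ ^ hG) (2ℚ ^ d) 0ℚ)
             (trans (cong (λ z → s * j y' * ½ ^ hG - 2ℚ ^ d * ∣ Exc ∣ + (4 ÷ 1) * β * s * ∣ Exc ∣ * (z - 1ℚ)) jp) (solve 2 (λ a b → a :+ b :* (con 1ℚ :- con 1ℚ) := a) refl _ _))))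
        where
        W1 : 1ℚ ≤ 2ℚ ^ d
        W1 = 1≤^ d lit

      moment : 𝔼 (λ z → 𝟙 (D z) * b y' z ^ l) ≤ 2ℚ * (ϖ ^ l * γ)
      moment = ≤-trans (𝔼.E-mono pt) (≤-trans (≤-reflexive (trans (𝔼.E-+ _ _) (cong₂ _+_ (trans (𝔼.E-+ _ _) (cong₂ _+_ (trans (𝔼.E-*ʳ _ _) (trans (cong (_* ϖ ^ l) γ≡) (*-comm γ _))) (𝔼.E-*ʳ _ _))) (𝔼.E-*ʳ _ _))))
          (≤by (dif t1 ⊞ dif t2 ⊞ (dif (1≤^ l 1≤ϖ) ⊠ <⇒≤ 0<γ)) (solve 4 (λ x y u g → con ½ :* g :- x :+ (con ½ :* g :- y) :+ (u :- con 1ℚ) :* g := con 2ℚ :* (u :* g) :- (u :* g :+ x :+ y)) refl (∣ Bad ∣ * W ^ l) (∣ Exc ∣ * s ^ l) (ϖ ^ l) γ)))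
        where
        pt : ∀ z → 𝟙 (D z) * b y' z ^ l ≤ 𝟙 (D z) * ϖ ^ l + 𝟙 (Bad z) * W ^ l + 𝟙 (Exc z) * s ^ l
        pt z = 𝔹-elim (λ D → 𝟙 D * x ^ l ≤ 𝟙 D * ϖ ^ l + 𝟙 (D ∧ (ϖ ≤ᵇ x)) * W ^ l + 𝟙 (Exc z) * s ^ l) (D z) (λ _ →
            ≤-trans (≤-reflexive (*-identityˡ _)) (≤ᵇ-elim (λ E → x ^ l ≤ 1ℚ * ϖ ^ l + 𝟙 (ϖ ≤ᵇ x) * W ^ l + 𝟙 E * s ^ l) W x
              (λ _ → ≤-trans (^-mono l (0≤b y' z) (b≤s z)) (≤by ((0≤1 ⊠ 0≤^ l 0≤ϖ) ⊞ (0≤𝟙 (ϖ ≤ᵇ x) ⊠ 0≤^ l (0≤^ (4 ℕ.+ d) (lit {0ℚ} {2ℚ})))) (solve 3 (λ a b c → a :+ b := a :+ b :+ con 1ℚ :* c :- c) refl (1ℚ * ϖ ^ l) _ (s ^ l))))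
              (λ x<W → ≤ᵇ-elim (λ E → x ^ l ≤ 1ℚ * ϖ ^ l + 𝟙 E * W ^ l + 0ℚ * s ^ l) ϖ x
                (λ _ → ≤-trans (^-mono l (0≤b y' z) (<⇒≤ x<W)) (≤by (0≤^ l 0≤ϖ) (solve 3 (λ a b c → a := con 1ℚ :* a :+ con 1ℚ :* b :+ con 0ℚ :* c :- b) refl (ϖ ^ l) (W ^ l) (s ^ l))))
                (λ x<ϖ → ≤-trans (^-mono l (0≤b y' z) (<⇒≤ x<ϖ)) (≤-reflexive (solve 3 (λ a b c → a := con 1ℚ :* a :+ con 0ℚ :* b :+ con 0ℚ :* c) refl (ϖ ^ l) (W ^ l) (s ^ l)))))))
            (λ _ → ≤by (0≤𝟙 (Exc z) ⊠ 0≤^ l 0≤s) (solve 4 (λ a b c d → d := con 0ℚ :* b :+ con 0ℚ :* c :+ d :- con 0ℚ :* a) refl (x ^ l) (ϖ ^ l) (W ^ l) (𝟙 (Exc z) * s ^ l)))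
          where
          x = b y' z
        t1 : ∣ Bad ∣ * W ^ l ≤ ½ * γ
        t1 = ≤-trans (*-monoʳ (0≤^ l (0≤^ (4 ℕ.+ d) (lit {0ℚ} {2ℚ}))) bad≤) (≤-reflexive (trans (cong₂ (λ x y → (512 ÷ 1) * (γ * x) * y) (^-+ ½ 10 (l ℕ.* (4 ℕ.+ d))) (trans (sym (^-* 2ℚ (4 ℕ.+ d) l)) (cong (2ℚ ^_) (ℕP.*-comm (4 ℕ.+ d) l))))
          (trans (solve 3 (λ g h t → con (512 ÷ 1) :* (g :* ((con ½ :* (con ½ :* (con ½ :* (con ½ :* (con ½ :* (con ½ :* (con ½ :* (con ½ :* (con ½ :* (con ½ :* con 1ℚ)))))))))) :* h)) :* t := con ½ :* g :* (t :* h)) refl γ (½ ^ (l ℕ.* (4 ℕ.+ d))) (2ℚ ^ (l ℕ.* (4 ℕ.+ d))))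
          (trans (cong (½ * γ *_) (2^½ (l ℕ.* (4 ℕ.+ d)))) (*-identityʳ _)))))
        E₀ : ℕ
        E₀ = L ℕ.+ (L ℕ.+ (2 ℕ.+ k₂)) ℕ.+ l ℕ.* L
        t2 : ∣ Exc ∣ * s ^ l ≤ ½ * γ
        t2 = ≤-trans (*-mono (0≤∣∣ Exc) exc≤ (0≤^ l 0≤s) (^-mono l 0≤s s≤)) (≤-trans (*-mono ((0≤s ⊠ 0≤j) ⊠ 0≤½^ hG) (*-monoʳ (0≤½^ hG) (*-mono 0≤s s≤ 0≤j j≤)) (0≤^ l (0≤^ L (lit {0ℚ} {2ℚ}))) ≤-refl)
          (≤-trans (≤-reflexive (trans (solve 4 (λ a b h c → a :* b :* h :* c := a :* b :* c :* h) refl (2ℚ ^ L) (2ℚ ^ (L ℕ.+ (2 ℕ.+ k₂))) (½ ^ hG) ((2ℚ ^ L) ^ l))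
             (cong (_* ½ ^ hG) (trans (cong₂ _*_ (sym (^-+ 2ℚ L _)) (trans (sym (^-* 2ℚ L l)) (cong (2ℚ ^_) (ℕP.*-comm L l)))) (sym (^-+ 2ℚ (L ℕ.+ (L ℕ.+ (2 ℕ.+ k₂))) (l ℕ.* L)))))))
            (≤-trans (*-monoˡ (0≤^ E₀ (lit {0ℚ} {2ℚ})) (½^-mono ar)) (≤-trans (≤-reflexive (trans (cong (2ℚ ^ E₀ *_) (^-+ ½ E₀ (1 ℕ.+ L))) (trans (sym (*-assoc _ _ _)) (trans (*≡ʳ (2^½ E₀)) (*-identityˡ _)))))
              (*-monoˡ 0≤½ Lγ)))))
          where
          ar : E₀ ℕ.+ (1 ℕ.+ L) ℕ.≤ hG
          ar = ℕP.≤-trans (ℕP.≤-trans (ℕP.m≤m+n _ (l₀ ℕ.* (L ℕ.+ (2 ℕ.+ k₂)) ℕ.+ (k₂ ℕ.+ (2 ℕ.* L ℕ.+ 3))))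
            (ℕP.≤-reflexive (ℕS.solve 3 (λ L k l → L ℕS.:+ (L ℕS.:+ (ℕS.con 2 ℕS.:+ k)) ℕS.:+ (ℕS.con 1 ℕS.:+ l) ℕS.:* L ℕS.:+ (ℕS.con 1 ℕS.:+ L) ℕS.:+ (l ℕS.:* (L ℕS.:+ (ℕS.con 2 ℕS.:+ k)) ℕS.:+ (k ℕS.:+ (ℕS.con 2 ℕS.:* L ℕS.:+ ℕS.con 3)))
                 ℕS.:= (ℕS.con 1 ℕS.:+ l) ℕS.:* (L ℕS.:+ (L ℕS.:+ (ℕS.con 2 ℕS.:+ k))) ℕS.:+ (k ℕS.:+ (ℕS.con 4 ℕS.:* L ℕS.:+ ℕS.con 4))) refl L k₂ l₀))) hG≥

    Φ : F m → ℚ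
    Φ y' = 𝔼 (λ z → 𝟙 (g y' z) * b y' z ^ l)

    lower : ∀ y' → p₀ ≤ p y' → c * ρ y' ≤ ϖ → (65 ÷ 64) ^ l ≤ ϖ ^ l * (c * Φ y')
    lower y' pp ρ≤ = ≤-trans (^-mono l (lit {0ℚ} {65 ÷ 64}) cx) (≤-trans (≤-reflexive (*-^ c x l)) (≤-trans (*-monoˡ (0≤^ l 0≤c) (𝔼.E-pow l₀ (λ z → 0≤𝟙 (g y' z)) (0≤b y')))
      (≤-trans (≤-reflexive (trans (solve 4 (λ c e r f → c :* e :* (r :* f) := (e :* r) :* (c :* f)) refl c (c ^ l₀) (ρ y' ^ l₀) (Φ y')) (*≡ʳ (sym (*-^ c (ρ y') l₀)))))
        (*-monoʳ (0≤c ⊠ 0≤Φ) (≤-trans (^-mono l₀ (0≤c ⊠ 𝔼.E-0≤ λ z → 0≤𝟙 (g y' z)) ρ≤) (^-monoʳ 1≤ϖ (ℕP.n≤1+n l₀)))))))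
      where
      open Row y' pp
      0≤Φ : 0ℚ ≤ Φ y'
      0≤Φ = 𝔼.E-0≤ λ z → 0≤𝟙 (g y' z) ⊠ 0≤^ l (0≤b y' z)
      x = 𝔼 (λ z → 𝟙 (g y' z) * b y' z)
      x≡ : x ≡ s * j y' * 𝔼 (λ y → 𝟙 (T y y') * k y y')
      x≡ = trans (Zb (g y') y') (cong (s * j y' *_) (𝔼.E-cong λ y → cong (𝟙 (T y y') *_) (𝔼.E-cong λ z → *-comm _ _)))
      tk : ∀ A A' x → 𝟙 (A ∧ (A' ∧ ((65 ÷ 64) ≤ᵇ x))) * (65 ÷ 64) ≤ 𝟙 (A ∧ (A' ∧ ((65 ÷ 64) ≤ᵇ x))) * x
      tk true true x = 𝟙-≤ ((65 ÷ 64) ≤ᵇ x) ≤ᵇ⇒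
      tk true false x = ≤-reflexive (trans (*-zeroˡ _) (sym (*-zeroˡ x)))
      tk false A' x = ≤-reflexive (trans (*-zeroˡ _) (sym (*-zeroˡ x)))
      cx : 65 ÷ 64 ≤ c * x
      cx = ≤-trans (≤-reflexive (trans (sym (*-identityʳ _)) (trans (cong ((65 ÷ 64) *_) (sym jp)) (solve 2 (λ p j → con (65 ÷ 64) :* (p :* j) := j :* (p :* con (65 ÷ 64))) refl (p y') (j y')))))
        (≤-trans (*-monoˡ 0≤j (≤-trans (≤-reflexive (sym (𝔼.E-*ʳ _ _))) (𝔼.E-mono λ y → subst (λ t → 𝟙 t * (65 ÷ 64) ≤ 𝟙 t * κ y y') (sym (T-def y y')) (tk (A y) (A' y') (κ y y')))))
        (≤-reflexive (trans (cong (j y' *_) (trans (𝔼.E-cong λ y → solve 3 (λ t a b → t :* (a :* b) := a :* (t :* b)) refl (𝟙 (T y y')) κ₀ (k y y')) (𝔼.E-* κ₀ _)))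
          (trans (solve 4 (λ j s c e → j :* ((s :* c) :* e) := c :* (s :* j :* e)) refl (j y') s c _) (cong (c *_) (sym x≡))))))

    opaque
      T^ : Mean (Vec (F m) l)
      T^ = tup (bits m) l

      T^-∏ : ∀ u → T^ .E (∏ u) ≡ 𝔼 u ^ l
      T^-∏ = tup-∏ (bits m) l

    P₁ P₀ : Fn m
    P₁ y' = (p₀ ≤ᵇ p y') ∧ not (ϖ ≤ᵇ (c * ρ y'))
    P₀ y' = ϖ ≤ᵇ (c * ρ y')

    P₁⇒ : ∀ y' → P₁ y' ≡ true → (p₀ ≤ p y') × (c * ρ y' ≤ ϖ)
    P₁⇒ y' = go (p₀ ≤ᵇ p y') (ϖ ≤ᵇ (c * ρ y')) ≤ᵇ⇒ (λ h → <⇒≤ (≰ᵇ⇒ h))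
      where
      go : ∀ {x y : Set} a b → (a ≡ true → x) → (b ≡ false → y) → a ∧ not b ≡ true → x × y
      go true false f g h = f refl , g refl

    ω : F m → ℚ
    ω y' = 𝟙 (P₁ y') * j y' ^ l

    V₀ : ℚ
    V₀ = (2ℚ ^ (L ℕ.+ (2 ℕ.+ k₂))) ^ l

    0≤V₀ : 0ℚ ≤ V₀
    0≤V₀ = 0≤^ l (0≤^ (L ℕ.+ (2 ℕ.+ k₂)) (lit {0ℚ} {2ℚ}))

    ω≤ : ∀ y' → ω y' ≤ V₀
    ω≤ y' = 𝔹-elim (λ b → 𝟙 b * j y' ^ l ≤ V₀) (P₁ y') (λ h → ≤-trans (≤-reflexive (*-identityˡ _)) (^-mono l (0≤recip _) (Row.j≤ y' (proj₁ (P₁⇒ y' h))))) (λ _ → ≤-trans (≤-reflexive (*-zeroˡ _)) 0≤V₀)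

    0≤ω : ∀ y' → 0ℚ ≤ ω y'
    0≤ω y' = 0≤𝟙 (P₁ y') ⊠ 0≤^ l (0≤recip (p y'))

    -- The l-th power of b as an average over l-tuples; the common neighbourhoods that appear do not depend on y'.
    b^ : ∀ (Z : F n → ℚ) y' z → Z z * (𝟙 (D z) * (𝟙 (P₁ y') * b y' z ^ l)) ≡ T^ .E (λ v → s ^ l * ((ω y' * ∏ (λ y → 𝟙 (T y y')) v) * (𝟙 (Com f D v z) * Z z)))
    b^ Z y' z = sym (trans (T^ .E-cong λ v → trans (cong (λ u → s ^ l * ((ω y' * ∏ (λ y → 𝟙 (T y y')) v) * (u * Z z))) (𝟙-Com f D v z))
        (trans (solve 6 (λ s o t d e z → s :* ((o :* t) :* (d :* e :* z)) := s :* o :* d :* z :* (t :* e)) refl (s ^ l) (ω y') (∏ (λ y → 𝟙 (T y y')) v) (𝟙 (D z)) (∏ (λ y → 𝟙 (f y z)) v) (Z z)) (cong (s ^ l * ω y' * 𝟙 (D z) * Z z *_) (∏-mul _ _ v))))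
      (trans (T^ .E-* _ _) (trans (cong (s ^ l * ω y' * 𝟙 (D z) * Z z *_) (T^-∏ _))
        (trans (solve 6 (λ s p j d z e → s :* (p :* j) :* d :* z :* e := z :* (d :* (p :* (s :* j :* e)))) refl (s ^ l) (𝟙 (P₁ y')) (j y' ^ l) (𝟙 (D z)) (Z z) (𝔼 (λ y → 𝟙 (T y y') * 𝟙 (f y z)) ^ l))
          (cong (λ u → Z z * (𝟙 (D z) * (𝟙 (P₁ y') * u))) (sym (trans (*-^ (s * j y') _ l) (*≡ʳ (*-^ s (j y') l)))))))))

    WT : Vec (F m) l → F m → ℚ
    WT v y' = ω y' * ∏ (λ y → 𝟙 (T y y')) v

    swap-out : ∀ (Z : F m → F n → ℚ) → 𝔼 (λ y' → 𝔼 (λ z → Z y' z * (𝟙 (D z) * (𝟙 (P₁ y') * b y' z ^ l)))) ≡ s ^ l * T^ .E (λ v → 𝔼 (λ y' → WT v y' * 𝔼 (λ z → 𝟙 (Com f D v z) * Z y' z)))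
    swap-out Z = trans (𝔼.E-cong λ y' → trans (𝔼.E-cong λ z → trans (b^ (Z y') y' z) (T^ .E-* _ _)) (trans (𝔼.E-* (s ^ l) _) (cong (s ^ l *_) (trans (sym (E-swap T^ _)) (T^ .E-cong λ v → 𝔼.E-* _ _)))))
      (trans (𝔼.E-* (s ^ l) _) (cong (s ^ l *_) (sym (E-swap T^ _))))

    upper : 𝔼 (λ y' → 𝟙 (P₁ y') * Φ y') ≤ ((4 ÷ 1) * β) * (2ℚ * (ϖ ^ l * γ) * ∣ P₁ ∣) + s ^ l * V₀ * ½ ^ hG
    upper = ≤-trans (𝔼.E-mono λ y' → ≤-trans (≤-reflexive (sym (𝔼.E-* _ _))) (𝔼.E-mono λ z → ≤-trans (*-monoˡ (0≤𝟙 (P₁ y')) (*-monoʳ (0≤^ l (0≤b y' z)) (gP y' z)))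
        (≤-reflexive (solve 4 (λ p d q e → p :* (d :* q :* e) := q :* (d :* (p :* e))) refl (𝟙 (P₁ y')) (𝟙 (D z)) (𝟙 (P' y' z)) (b y' z ^ l)))))
      (≤-trans (≤-reflexive (swap-out (λ y' z → 𝟙 (P' y' z)))) (≤-trans (*-monoˡ (0≤^ l 0≤s) (T^ .E-mono each)) (≤-trans (≤-reflexive out) (+-mono (*-monoˡ (lit {0ℚ} {4 ÷ 1} ⊠ <⇒≤ 0<β) mom) ≤-refl))))
      where
      ∏T≤1 : ∀ v y' → 0ℚ ≤ ∏ (λ y → 𝟙 (T y y')) v × ∏ (λ y → 𝟙 (T y y')) v ≤ 1ℚ
      ∏T≤1 v y' = ∏-0≤ (λ y → 0≤𝟙 (T y y')) v , ∏-≤1 (λ y → 0≤𝟙 (T y y')) (λ y → 𝟙≤1 (T y y')) v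
      each : ∀ v → 𝔼 (λ y' → WT v y' * 𝔼 (λ z → 𝟙 (Com f D v z) * 𝟙 (P' y' z))) ≤ ((4 ÷ 1) * β) * (𝔼 (λ y' → WT v y' * 𝔼 (λ z → 𝟙 (Com f D v z) * 1ℚ))) + V₀ * ½ ^ hG
      each v = ≤-trans (weighted-den P' ((4 ÷ 1) * β) (½ ^ hG) V₀ (0≤½^ hG) 0≤V₀ Ug (WT v) (Com f D v) (λ y' → 0≤ω y' ⊠ proj₁ (∏T≤1 v y'))
          (λ y' → ≤-trans (*-monoˡ (0≤ω y') (proj₂ (∏T≤1 v y'))) (≤-trans (≤-reflexive (*-identityʳ _)) (ω≤ y'))))
        (≤-reflexive (cong (λ u → ((4 ÷ 1) * β) * u + V₀ * ½ ^ hG) (trans (sym (𝔼.E-*ʳ _ _)) (𝔼.E-cong λ y' → cong (WT v y' *_) (𝔼.E-cong λ z → sym (*-identityʳ _))))))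
      Ψ = λ v → 𝔼 (λ y' → WT v y' * 𝔼 (λ z → 𝟙 (Com f D v z) * 1ℚ))
      out : s ^ l * T^ .E (λ v → ((4 ÷ 1) * β) * Ψ v + V₀ * ½ ^ hG) ≡ ((4 ÷ 1) * β) * 𝔼 (λ y' → 𝔼 (λ z → 1ℚ * (𝟙 (D z) * (𝟙 (P₁ y') * b y' z ^ l)))) + s ^ l * V₀ * ½ ^ hG
      out = trans (cong (s ^ l *_) (trans (T^ .E-+ _ _) (cong₂ _+_ (T^ .E-* _ _) (E-const T^ _)))) (trans (solve 5 (λ s q e v h → s :* (q :* e :+ v :* h) := q :* (s :* e) :+ s :* v :* h) refl (s ^ l) ((4 ÷ 1) * β) (T^ .E Ψ) V₀ (½ ^ hG))
        (cong (λ u → ((4 ÷ 1) * β) * u + s ^ l * V₀ * ½ ^ hG) (sym (swap-out (λ _ _ → 1ℚ)))))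
      mom : 𝔼 (λ y' → 𝔼 (λ z → 1ℚ * (𝟙 (D z) * (𝟙 (P₁ y') * b y' z ^ l)))) ≤ 2ℚ * (ϖ ^ l * γ) * ∣ P₁ ∣
      mom = ≤-trans (𝔼.E-mono λ y' → ≤-trans (≤-reflexive (trans (𝔼.E-cong λ z → solve 3 (λ d p e → con 1ℚ :* (d :* (p :* e)) := p :* (d :* e)) refl (𝟙 (D z)) (𝟙 (P₁ y')) (b y' z ^ l)) (𝔼.E-* _ _)))
          (𝟙-≤ (P₁ y') λ h → Row.moment y' (proj₁ (P₁⇒ y' h)))) (≤-reflexive (trans (𝔼.E-*ʳ _ _) (*-comm _ _)))

    P₁≤ : ∣ P₁ ∣ ≤ ½ ^ (3 ℕ.+ k₂) * α
    P₁≤ = ≤-trans (≤-trans fin small) (*-monoˡ (0≤½^ (3 ℕ.+ k₂)) Lα)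
      where
      x = ∣ P₁ ∣
      0≤x = 0≤∣∣ P₁
      W = ϖ ^ l
      1≤W : 1ℚ ≤ W
      1≤W = 1≤^ l 1≤ϖ
      0≤W = ≤-trans 0≤1 1≤W
      e₁ = s ^ l * V₀ * ½ ^ hG
      0≤e₁ : 0ℚ ≤ e₁
      0≤e₁ = (0≤^ l 0≤s ⊠ 0≤V₀) ⊠ 0≤½^ hG
      t = 2ℚ ^ d
      lo : (65 ÷ 64) ^ l * x ≤ W * (c * (((4 ÷ 1) * β) * (2ℚ * (W * γ) * x) + e₁))
      lo = ≤-trans (≤-reflexive (sym (trans (𝔼.E-*ʳ _ _) (*-comm _ _)))) (≤-trans (𝔼.E-mono λ y' → 𝟙-≤ (P₁ y') λ h → lower y' (proj₁ (P₁⇒ y' h)) (proj₂ (P₁⇒ y' h)))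
        (≤-trans (≤-reflexive (trans (𝔼.E-cong λ y' → solve 4 (λ p W c f → p :* (W :* (c :* f)) := W :* c :* (p :* f)) refl (𝟙 (P₁ y')) W c (Φ y')) (trans (𝔼.E-* (W * c) _) (*-assoc W c _))))
          (*-monoˡ 0≤W (*-monoˡ 0≤c upper))))
      u≥ : W * (W * W) ≤ (65 ÷ 64) ^ l
      u≥ = ≤-trans (≤-reflexive (trans (cong (W *_) (sym (*-^ ϖ ϖ l))) (sym (*-^ ϖ (ϖ * ϖ) l)))) (^-mono l (0≤ϖ ⊠ (0≤ϖ ⊠ 0≤ϖ)) ϖ³≤)
      cβγ : c * β * γ ≤ t
      cβγ = ≤-trans (≤-reflexive (solve 4 (λ a i b g → a :* i :* b :* g := b :* (a :* g :* i)) refl α i β γ)) βs≤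
      W16 : (16 ÷ 1) * t ≤ W
      W16 = ≤-trans (≤-reflexive (solve 1 (λ t → con (16 ÷ 1) :* t := con 2ℚ :* (con 2ℚ :* (con 2ℚ :* (con 2ℚ :* t)))) refl t)) gain
      1≤t : 1ℚ ≤ t
      1≤t = 1≤^ d lit
      fin : x ≤ c * e₁
      fin = cancelˡ (0<* {W} {W} (<-≤ (lit< {0ℚ} {1ℚ}) 1≤W) (<-≤ (lit< {0ℚ} {1ℚ}) 1≤W)) (≤by
         ((dif lo ⊞ (0≤x ⊠ dif u≥)) ⊞ ((0≤W ⊠ 0≤W) ⊠ (0≤x ⊠ dif W16)) ⊞ (((0≤W ⊠ 0≤W) ⊠ 0≤x) ⊠ (lit {0ℚ} {8 ÷ 1} ⊠ dif cβγ)) ⊞ (((0≤W ⊠ 0≤W) ⊠ 0≤x) ⊠ (lit {0ℚ} {8 ÷ 1} ⊠ dif 1≤t)) ⊞ (((0≤W ⊠ 0≤W) ⊠ 0≤x) ⊠ (lit {0ℚ} {7 ÷ 1})) ⊞ ((0≤W ⊠ dif 1≤W) ⊠ (0≤c ⊠ 0≤e₁)))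
         (solve 8 (λ u x W c b g e t → W :* (c :* ((con (4 ÷ 1) :* b) :* (con 2ℚ :* (W :* g) :* x) :+ e)) :- u :* x :+ x :* (u :- W :* (W :* W)) :+ W :* W :* (x :* (W :- con (16 ÷ 1) :* t)) :+ W :* W :* x :* (con (8 ÷ 1) :* (t :- c :* b :* g))
             :+ W :* W :* x :* (con (8 ÷ 1) :* (t :- con 1ℚ)) :+ W :* W :* x :* con (7 ÷ 1) :+ W :* (W :- con 1ℚ) :* (c :* e) := W :* W :* (c :* e) :- W :* W :* x) refl ((65 ÷ 64) ^ l) x W c β γ e₁ t))
      E₁ : ℕ
      E₁ = L ℕ.+ (l ℕ.* L ℕ.+ l ℕ.* (L ℕ.+ (2 ℕ.+ k₂)))
      small : c * e₁ ≤ ½ ^ (3 ℕ.+ k₂) * ½ ^ L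
      small = ≤-trans (*-mono 0≤c (≤-trans (*-monoʳ 0≤i α≤1) (≤-trans (≤-reflexive (*-identityˡ i)) i≤)) 0≤e₁ (*-mono (0≤^ l 0≤s ⊠ 0≤V₀) (*-monoʳ 0≤V₀ (^-mono l 0≤s s≤)) (0≤½^ hG) (½^-mono ar)))
        (≤-reflexive (trans (cong₂ (λ a b → 2ℚ ^ L * (a * b)) (trans (cong₂ _*_ (trans (sym (^-* 2ℚ L l)) (cong (2ℚ ^_) (ℕP.*-comm L l))) (trans (sym (^-* 2ℚ (L ℕ.+ (2 ℕ.+ k₂)) l)) (cong (2ℚ ^_) (ℕP.*-comm (L ℕ.+ (2 ℕ.+ k₂)) l)))) (sym (^-+ 2ℚ (l ℕ.* L) (l ℕ.* (L ℕ.+ (2 ℕ.+ k₂)))))) (^-+ ½ E₁ (3 ℕ.+ k₂ ℕ.+ L)))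
          (trans (trans (sym (*-assoc _ _ _)) (trans (*≡ʳ (sym (^-+ 2ℚ L (l ℕ.* L ℕ.+ l ℕ.* (L ℕ.+ (2 ℕ.+ k₂)))))) (trans (sym (*-assoc _ _ _)) (trans (*≡ʳ (2^½ E₁)) (*-identityˡ _))))) (^-+ ½ (3 ℕ.+ k₂) L))))
        where
        ar : E₁ ℕ.+ (3 ℕ.+ k₂ ℕ.+ L) ℕ.≤ hG
        ar = ℕP.≤-trans (ℕP.≤-trans (ℕP.m≤m+n _ (2 ℕ.* L ℕ.+ 1)) (ℕP.≤-reflexive (ℕS.solve 3 (λ L k l → L ℕS.:+ (l ℕS.:* L ℕS.:+ l ℕS.:* (L ℕS.:+ (ℕS.con 2 ℕS.:+ k))) ℕS.:+ (ℕS.con 3 ℕS.:+ k ℕS.:+ L) ℕS.:+ (ℕS.con 2 ℕS.:* L ℕS.:+ ℕS.con 1)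
           ℕS.:= l ℕS.:* (L ℕS.:+ (L ℕS.:+ (ℕS.con 2 ℕS.:+ k))) ℕS.:+ (k ℕS.:+ (ℕS.con 4 ℕS.:* L ℕS.:+ ℕS.con 4))) refl L k₂ l))) hG≥

    P₀≤ : ∣ P₀ ∣ ≤ ½ ^ (3 ℕ.+ k₂) * α
    P₀≤ = ≤-trans (ϖ-tail main)
        (≤-trans (*-monoˡ (lit {0ℚ} {512 ÷ 1}) (*-monoˡ (<⇒≤ 0<α) (½^-mono {9 ℕ.+ (3 ℕ.+ k₂)} (subst (12 ℕ.+ k₂ ℕ.≤_) (sym K≡) ar))))
          (≤-reflexive (trans (cong (λ z → (512 ÷ 1) * (α * z)) (^-+ ½ 9 (3 ℕ.+ k₂))) (solve 2 (λ a h → con (512 ÷ 1) :* (a :* ((con ½ :* (con ½ :* (con ½ :* (con ½ :* (con ½ :* (con ½ :* (con ½ :* (con ½ :* (con ½ :* con 1ℚ))))))))) :* h)) := h :* a) refl α (½ ^ (3 ℕ.+ k₂))))))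
      where
      ar : 12 ℕ.+ k₂ ℕ.≤ (2 ℕ.+ k₂) ℕ.+ (10 ℕ.+ l ℕ.* (4 ℕ.+ d))
      ar = ℕP.≤-trans (ℕP.m≤m+n (12 ℕ.+ k₂) (l ℕ.* (4 ℕ.+ d))) (ℕP.≤-reflexive (ℕS.solve 2 (λ k e → ℕS.con 12 ℕS.:+ k ℕS.:+ e ℕS.:= (ℕS.con 2 ℕS.:+ k) ℕS.:+ (ℕS.con 10 ℕS.:+ e)) refl k₂ (l ℕ.* (4 ℕ.+ d))))
      gD : ∀ y' → 𝔼 (λ z → 𝟙 (D z) * 𝟙 (g y' z)) ≡ ρ y'
      gD y' = 𝔼.E-cong λ z → dg (D z) (g y' z) (≤-trans (gP y' z) (≤-trans (*-monoˡ (0≤𝟙 (D z)) (𝟙≤1 (P' y' z))) (≤-reflexive (*-identityʳ _))))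
        where
        dg : ∀ D g → 𝟙 g ≤ 𝟙 D → 𝟙 D * 𝟙 g ≡ 𝟙 g
        dg true g h = *-identityˡ _
        dg false false h = *-zeroˡ _
        dg false true h = ⊥-elim (<⇒≱ (lit< {0ℚ} {1ℚ}) h)
      main : ∣ P₀ ∣ * ϖ ≤ (513 ÷ 512) * ∣ P₀ ∣ + α * ½ ^ K
      main = cancelˡ 0<γ (≤-trans (*-monoˡ (<⇒≤ 0<γ) (≤-trans (≤-reflexive (sym (𝔼.E-*ʳ _ ϖ))) (𝔼.E-mono λ y' → 𝟙-≤ (P₀ y') ≤ᵇ⇒)))
        (≤-trans (≤-reflexive (trans (sym (𝔼.E-* γ _)) (trans (𝔼.E-cong λ y' → trans (solve 5 (λ g p a i r → g :* (p :* (a :* i :* r)) := a :* g :* i :* (p :* r)) refl γ (𝟙 (P₀ y')) α i (ρ y')) (cong (λ z → s * (𝟙 (P₀ y') * z)) (sym (gD y')))) (𝔼.E-* s _))))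
        (≤-trans (R' g Rg P₀ D) (≤-reflexive (trans (cong (λ z → (513 ÷ 512) * (∣ P₀ ∣ * z) + (α * γ) * ½ ^ K) γ≡) (solve 4 (λ p g a k → con (513 ÷ 512) :* (p :* g) :+ a :* g :* k := g :* (con (513 ÷ 512) :* p :+ a :* k)) refl ∣ P₀ ∣ γ α (½ ^ K)))))))

    popular : 𝔼 (λ y → 𝔼 (λ y' → 𝟙 (T y y'))) ≤ α * α * ½ ^ k₂
    popular = ≤-trans (≤-reflexive (𝔼-swap _)) (≤-trans (𝔼.E-mono row) (≤-trans (≤-reflexive (trans (𝔼.E-+ _ _) (cong₂ _+_ (𝔼.E-*ʳ _ p₀) (trans (𝔼.E-*ʳ _ _) (*≡ʳ (𝔼.E-+ _ _))))))
      (≤by ((dif A'≤ ⊠ <⇒≤ 0<p₀) ⊞ ((dif P₁≤ ⊞ dif P₀≤) ⊠ (lit {0ℚ} {2ℚ} ⊠ <⇒≤ 0<α)))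
        (solve 5 (λ a h A x y → (con 2ℚ :* a :- A) :* (con ½ :* (con ½ :* h) :* a) :+ (con ½ :* (con ½ :* (con ½ :* h)) :* a :- x :+ (con ½ :* (con ½ :* (con ½ :* h)) :* a :- y)) :* (con 2ℚ :* a) := a :* a :* h :- (A :* (con ½ :* (con ½ :* h) :* a) :+ (x :+ y) :* (con 2ℚ :* a))) refl α (½ ^ k₂) (∣ A' ∣) (∣ P₁ ∣) (∣ P₀ ∣)))))
      where
      bool : ∀ a b → 𝟙 a ≤ 𝟙 (a ∧ not b) + 𝟙 b
      bool false b = ≤-trans (0≤𝟙 b) (≤-reflexive (sym (+-identityˡ _)))
      bool true false = ≤-reflexive (sym (+-identityʳ _))
      bool true true = ≤-reflexive (sym (+-identityˡ _))
      pA : ∀ y' → p y' ≤ 𝟙 (A' y') * p y'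
      pA y' = go (A' y') refl
        where
        go : ∀ B → A' y' ≡ B → p y' ≤ 𝟙 B * p y'
        go true e = ≤-reflexive (sym (*-identityˡ _))
        go false e = ≤-trans (𝔼.E-≤ λ y → ≤-reflexive (cong 𝟙 (trans (trans (T-def y y') (cong (λ B → A y ∧ (B ∧ ((65 ÷ 64) ≤ᵇ κ y y'))) e)) (𝔹P.∧-zeroʳ (A y))))) (≤-reflexive (sym (*-zeroˡ _)))
      p≤ : ∀ y' → p y' ≤ 2ℚ * α
      p≤ y' = ≤-trans (𝔼.E-mono λ y → ≤-trans (≤-reflexive (trans (cong 𝟙 (T-def y y')) (𝟙-∧ (A y) _))) (≤-trans (*-monoˡ (0≤𝟙 (A y)) (𝟙≤1 (A' y' ∧ ((65 ÷ 64) ≤ᵇ κ y y')))) (≤-reflexive (*-identityʳ _)))) A≤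
      row : ∀ y' → p y' ≤ 𝟙 (A' y') * p₀ + (𝟙 (P₁ y') + 𝟙 (P₀ y')) * (2ℚ * α)
      row y' = ≤ᵇ-elim (λ q → 𝟙 q ≤ 𝟙 (P₁ y') + 𝟙 (P₀ y') → p y' ≤ 𝟙 (A' y') * p₀ + (𝟙 (P₁ y') + 𝟙 (P₀ y')) * (2ℚ * α)) p₀ (p y')
        (λ _ h → ≤-trans (p≤ y') (≤by (dif h ⊠ 0≤2α ⊞ (0≤𝟙 (A' y') ⊠ <⇒≤ 0<p₀)) (solve 3 (λ u v a → (v :- con 1ℚ) :* a :+ u := u :+ v :* a :- a) refl (𝟙 (A' y') * p₀) (𝟙 (P₁ y') + 𝟙 (P₀ y')) (2ℚ * α))))
        (λ lt _ → ≤-trans (pA y') (≤-trans (*-monoˡ (0≤𝟙 (A' y')) (<⇒≤ lt)) (≤by ((0≤𝟙 (P₁ y') ⊞ 0≤𝟙 (P₀ y')) ⊠ 0≤2α) (solve 2 (λ u v → v := u :+ v :- u) refl (𝟙 (A' y') * p₀) _))))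
        (bool (p₀ ≤ᵇ p y') (P₀ y'))
        where
        0≤2α : 0ℚ ≤ 2ℚ * α
        0≤2α = lit {0ℚ} {2ℚ} ⊠ <⇒≤ 0<α

  module Exceptional (hx : ℕ) (hG≥ : hx ℕ.+ 3 ℕ.* L ℕ.≤ hG) where
    t = 2ℚ ^ d
    θ : ℚ
    θ = (64 ÷ 1) * (t * t)

    Exc : F m → F m → Bool
    Exc y y' = θ ≤ᵇ κ y y'

    Γ : F m → Fn n
    Γ y z = D z ∧ P y z

    Heavy : Fn m
    Heavy y = ((8 ÷ 1) * (β * γ)) ≤ᵇ ∣ Γ y ∣

    0<βγ = 0<* 0<β 0<γ

    heavy≤ : (4 ÷ 1) * (β * γ) * ∣ Heavy ∣ ≤ ½ ^ hG
    heavy≤ = ≤by (dif (≤-trans (≤-reflexive (sym (𝔼.E-*ʳ _ _))) (≤-trans (𝔼.E-mono λ y → ≤-trans (𝟙-≤ (Heavy y) ≤ᵇ⇒) (≤-reflexive (cong (𝟙 (Heavy y) *_) (𝔼.E-cong λ z → 𝟙-∧ (D z) (P y z))))) (≤-trans (Uf Heavy D) (≤-reflexive (cong (λ z → ((4 ÷ 1) * β) * (∣ Heavy ∣ * z) + ½ ^ hG) γ≡))))))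
      (solve 4 (λ b g h e → (con (4 ÷ 1) :* b) :* (h :* g) :+ e :- h :* (con (8 ÷ 1) :* (b :* g)) := e :- con (4 ÷ 1) :* (b :* g) :* h) refl β γ ∣ Heavy ∣ (½ ^ hG))

    k≤Γ : ∀ y y' → k y y' ≤ 𝔼 (λ z → 𝟙 (Γ y z) * 𝟙 (P' y' z))
    k≤Γ y y' = 𝔼.E-mono λ z → *-mono (0≤𝟙 (f y z)) (≤-trans (fP y z) (≤-reflexive (sym (𝟙-∧ (D z) (P y z))))) (0≤𝟙 (g y' z)) (≤-trans (gP y' z) (≤-trans (*-monoʳ (0≤𝟙 (P' y' z)) (𝟙≤1 (D z))) (≤-reflexive (*-identityˡ _))))

    big-k : ∀ y y' → θ ≤ κ y y' → (64 ÷ 1) * (β * (β * γ)) ≤ k y y'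
    big-k y y' h = cancelˡ (0<* 0<s 0<c) (≤-trans (≤-trans (≤-reflexive (solve 4 (λ α γ i b → α :* γ :* i :* (α :* i) :* (con (64 ÷ 1) :* (b :* (b :* γ))) := con (64 ÷ 1) :* ((b :* (α :* γ :* i)) :* (b :* (α :* γ :* i)))) refl α γ i β))
       (*-monoˡ (lit {0ℚ} {64 ÷ 1}) (*-mono (<⇒≤ 0<β ⊠ 0≤s) βs≤ (<⇒≤ 0<β ⊠ 0≤s) βs≤))) h)

    light : ∀ y → Heavy y ≡ false → (32 ÷ 1) * (β * (β * γ)) * ∣ Exc y ∣ ≤ ½ ^ hG
    light y h = ≤by (dif (≤-trans (≤-reflexive (sym (𝔼.E-*ʳ _ _))) (≤-trans (𝔼.E-mono λ y' → ≤-trans (𝟙-≤ (Exc y y') λ e → big-k y y' (≤ᵇ⇒ e)) (*-monoˡ (0≤𝟙 (Exc y y')) (k≤Γ y y'))) (Ug (Exc y) (Γ y))))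
        ⊞ (((lit {0ℚ} {4 ÷ 1} ⊠ <⇒≤ 0<β) ⊠ 0≤∣∣ (Exc y)) ⊠ dif (<⇒≤ (≰ᵇ⇒ h))))
      (solve 5 (λ b g x G e → (con (4 ÷ 1) :* b) :* (x :* G) :+ e :- x :* (con (64 ÷ 1) :* (b :* (b :* g))) :+ (con (4 ÷ 1) :* b) :* x :* (con (8 ÷ 1) :* (b :* g) :- G) := e :- con (32 ÷ 1) :* (b :* (b :* g)) :* x) refl β γ ∣ Exc y ∣ ∣ Γ y ∣ (½ ^ hG))

    exceptional : 𝔼 (λ y → ∣ Exc y ∣) ≤ ½ ^ hx
    exceptional = cancelˡ 0<b (≤-trans (≤-trans (≤-trans (≤-reflexive (sym (𝔼.E-* _ _))) (𝔼.E-mono row)) (≤-reflexive (trans (𝔼.E-+ _ _) (cong₂ _+_ (𝔼.E-*ʳ _ _) (𝔼.E-const _)))))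
       (≤-trans fin (≤-trans (½^-mono hG≥) (≤-trans (≤-reflexive (trans (^-+ ½ hx _) (*-comm _ _))) (*-monoʳ (0≤½^ hx) (≤-trans (½^-≤ {L} {2 ℕ.* L} Lβ (½^-≤ {L} {1 ℕ.* L} Lβ (≤-trans (≤-reflexive (cong (½ ^_) (ℕP.+-identityʳ L))) Lγ))) ≤-refl))))))
      where
      b = β * (β * γ)
      0<b : 0ℚ < b
      0<b = 0<* 0<β 0<βγ
      β≤1' : ∣ Heavy ∣ * b ≤ (1 ÷ 4) * ½ ^ hG * β
      β≤1' = ≤by ((lit {0ℚ} {1 ÷ 4} ⊠ dif heavy≤) ⊠ <⇒≤ 0<β) (solve 4 (λ e b g h → con (1 ÷ 4) :* (e :- con (4 ÷ 1) :* (b :* g) :* h) :* b := con (1 ÷ 4) :* e :* b :- h :* (b :* (b :* g))) refl (½ ^ hG) β γ ∣ Heavy ∣)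
      row : ∀ y → b * ∣ Exc y ∣ ≤ 𝟙 (Heavy y) * b + (1 ÷ 32) * ½ ^ hG
      row y = 𝔹-elim (λ H → b * ∣ Exc y ∣ ≤ 𝟙 H * b + (1 ÷ 32) * ½ ^ hG) (Heavy y)
        (λ _ → ≤-trans (*-monoˡ (<⇒≤ 0<b) (∣∣≤1 (Exc y))) (≤by (lit {0ℚ} {1 ÷ 32} ⊠ 0≤½^ hG) (solve 2 (λ b e → e := con 1ℚ :* b :+ e :- b :* con 1ℚ) refl b _)))
        (λ h → ≤by (lit {0ℚ} {1 ÷ 32} ⊠ dif (light y h)) (solve 3 (λ b x e → con (1 ÷ 32) :* (e :- con (32 ÷ 1) :* b :* x) := con 0ℚ :* b :+ con (1 ÷ 32) :* e :- b :* x) refl b ∣ Exc y ∣ (½ ^ hG)))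
      fin : ∣ Heavy ∣ * b + (1 ÷ 32) * ½ ^ hG ≤ ½ ^ hG
      fin = ≤-trans (+-mono (≤-trans β≤1' (≤-trans (*-monoˡ (lit {0ℚ} {1 ÷ 4} ⊠ 0≤½^ hG) β≤1) (≤-reflexive (*-identityʳ _)))) ≤-refl) (≤by (lit {0ℚ} {23 ÷ 32} ⊠ 0≤½^ hG) (solve 1 (λ e → con (23 ÷ 32) :* e := e :- (con (1 ÷ 4) :* e :+ con (1 ÷ 32) :* e)) refl (½ ^ hG)))

  -- Off the exceptional and the popular pairs the normalised codegree is below 65/64.
  codegree-moment : ∀ q k₂ l₀ hx → k₂ ≡ 6 ℕ.+ (6 ℕ.+ (d ℕ.+ d)) ℕ.* q → hx ≡ 6 ℕ.+ (L ℕ.+ L) ℕ.* q ℕ.+ (L ℕ.+ L) → (256 ÷ 1) * (65 ÷ 64) ^ q ≤ (33 ÷ 32) ^ q →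
    K ≡ (2 ℕ.+ k₂) ℕ.+ (10 ℕ.+ suc l₀ ℕ.* (4 ℕ.+ d)) → 2ℚ ^ (4 ℕ.+ d) ≤ ϖ ^ suc l₀ →
    suc l₀ ℕ.* (L ℕ.+ (L ℕ.+ (2 ℕ.+ k₂))) ℕ.+ (k₂ ℕ.+ (4 ℕ.* L ℕ.+ 4)) ℕ.≤ hG → hx ℕ.+ 3 ℕ.* L ℕ.≤ hG →
    𝔼 (λ y → 𝔼 (λ y' → 𝟙 (A y) * 𝟙 (A' y') * κ y y' ^ q)) ≤ (1 ÷ 16) * (α * α * (33 ÷ 32) ^ q)
  codegree-moment q k₂ l₀ hx k₂≡ hx≡ qg K≡ gain hG≥ hG≥' = ≤-trans (𝔼.E-mono λ y → 𝔼.E-mono λ y' → pt y y')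
      (≤-trans (≤-reflexive (trans (𝔼.E-cong λ y → trans (𝔼.E-+ _ _) (cong₂ _+_ (trans (𝔼.E-+ _ _) (cong₂ _+_ (trans (𝔼.E-*ʳ _ _) (*≡ʳ (𝔼.E-* _ _))) (𝔼.E-*ʳ _ _))) (𝔼.E-*ʳ _ _)))
         (trans (𝔼.E-+ _ _) (cong₂ _+_ (trans (𝔼.E-+ _ _) (cong₂ _+_ (trans (𝔼.E-*ʳ _ _) (*≡ʳ (𝔼.E-*ʳ _ _))) (𝔼.E-*ʳ _ _))) (𝔼.E-*ʳ _ _)))))
      (≤-trans (+-mono (+-mono t1 t2) t3) (≤by (lit {0ℚ} {1 ÷ 64} ⊠ (0≤α² ⊠ 0≤V)) (solve 1 (λ x → con (1 ÷ 64) :* x := con (1 ÷ 16) :* x :- (con (1 ÷ 64) :* x :+ con (1 ÷ 64) :* x :+ con (1 ÷ 64) :* x)) refl (α * α * V)))))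
    where
    open Popular k₂ l₀ K≡ gain hG≥ using (T; T-def; popular)
    open Exceptional hx hG≥' using (Exc; exceptional; θ)
    V U Θ M : ℚ
    V = (33 ÷ 32) ^ q
    U = (65 ÷ 64) ^ q
    Θ = θ ^ q
    M = (2ℚ ^ L * 2ℚ ^ L) ^ q
    0≤α² : 0ℚ ≤ α * α
    0≤α² = <⇒≤ 0<α ⊠ <⇒≤ 0<α
    0≤V : 0ℚ ≤ V
    0≤V = 0≤^ q (lit {0ℚ} {33 ÷ 32})
    1≤V : 1ℚ ≤ V
    1≤V = 1≤^ q (lit {1ℚ} {33 ÷ 32})
    0≤Θ : 0ℚ ≤ Θ
    0≤Θ = 0≤^ q (lit {0ℚ} {64 ÷ 1} ⊠ sq (2ℚ ^ d))
    0≤M : 0ℚ ≤ M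
    0≤M = 0≤^ q (sq (2ℚ ^ L))
    pt : ∀ y y' → 𝟙 (A y) * 𝟙 (A' y') * κ y y' ^ q ≤ 𝟙 (A y) * 𝟙 (A' y') * U + 𝟙 (T y y') * Θ + 𝟙 (Exc y y') * M
    pt y y' = subst (λ T → 𝟙 (A y) * 𝟙 (A' y') * x ^ q ≤ 𝟙 (A y) * 𝟙 (A' y') * U + 𝟙 T * Θ + 𝟙 (Exc y y') * M) (sym (T-def y y')) (go (A y) (A' y'))
      where
      x = κ y y'
      zero' : 0ℚ * x ^ q ≤ 0ℚ * U + 0ℚ * Θ + 𝟙 (Exc y y') * M
      zero' = ≤by (0≤𝟙 (Exc y y') ⊠ 0≤M) (solve 4 (λ a u t e → e := con 0ℚ :* u :+ con 0ℚ :* t :+ e :- con 0ℚ :* a) refl (x ^ q) U Θ (𝟙 (Exc y y') * M))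
      go : ∀ a a' → 𝟙 a * 𝟙 a' * x ^ q ≤ 𝟙 a * 𝟙 a' * U + 𝟙 (a ∧ (a' ∧ ((65 ÷ 64) ≤ᵇ x))) * Θ + 𝟙 (Exc y y') * M
      go false a' = ≤-trans (≤-reflexive (*≡ʳ (*-zeroˡ _))) (≤-trans zero' (≤-reflexive (cong (λ z → z * U + 0ℚ * Θ + 𝟙 (Exc y y') * M) (sym (*-zeroˡ _)))))
      go true false = ≤-trans (≤-reflexive (*≡ʳ (*-zeroʳ 1ℚ))) (≤-trans zero' (≤-reflexive (cong (λ z → z * U + 0ℚ * Θ + 𝟙 (Exc y y') * M) (sym (*-zeroʳ 1ℚ)))))
      go true true = ≤-trans (≤-reflexive (trans (*≡ʳ (*-identityˡ 1ℚ)) (*-identityˡ _))) (≤ᵇ-elim (λ E → x ^ q ≤ 1ℚ * 1ℚ * U + 𝟙 ((65 ÷ 64) ≤ᵇ x) * Θ + 𝟙 E * M) θ x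
        (λ _ → ≤-trans (^-mono q (0≤κ y y') (κ≤ y y')) (≤by (0≤U ⊞ (0≤𝟙 ((65 ÷ 64) ≤ᵇ x) ⊠ 0≤Θ)) (solve 3 (λ u b e → u :+ b := con 1ℚ :* con 1ℚ :* u :+ b :+ con 1ℚ :* e :- e) refl U (𝟙 ((65 ÷ 64) ≤ᵇ x) * Θ) M)))
        (λ lt → ≤ᵇ-elim (λ B → x ^ q ≤ 1ℚ * 1ℚ * U + 𝟙 B * Θ + 0ℚ * M) (65 ÷ 64) x
          (λ _ → ≤-trans (^-mono q (0≤κ y y') (<⇒≤ lt)) (≤by 0≤U (solve 3 (λ u t e → u := con 1ℚ :* con 1ℚ :* u :+ con 1ℚ :* t :+ con 0ℚ :* e :- t) refl U Θ M)))
          (λ lt' → ≤-trans (^-mono q (0≤κ y y') (<⇒≤ lt')) (≤-reflexive (solve 3 (λ u t e → u := con 1ℚ :* con 1ℚ :* u :+ con 0ℚ :* t :+ con 0ℚ :* e) refl U Θ M)))))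
        where
        0≤U : 0ℚ ≤ U
        0≤U = 0≤^ q (lit {0ℚ} {65 ÷ 64})
    t1 : ∣ A ∣ * ∣ A' ∣ * U ≤ (1 ÷ 64) * (α * α * V)
    t1 = ≤-trans (*-monoʳ (0≤^ q (lit {0ℚ} {65 ÷ 64})) (*-mono (0≤∣∣ A) A≤ (0≤∣∣ A') A'≤)) (≤by ((lit {0ℚ} {1 ÷ 64} ⊠ 0≤α²) ⊠ dif qg) (solve 3 (λ a u v → con (1 ÷ 64) :* (a :* a) :* (v :- con (256 ÷ 1) :* u) := con (1 ÷ 64) :* (a :* a :* v) :- (con 2ℚ :* a) :* (con 2ℚ :* a) :* u) refl α U V))
    t2 : 𝔼 (λ y → 𝔼 (λ y' → 𝟙 (T y y'))) * Θ ≤ (1 ÷ 64) * (α * α * V)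
    t2 = ≤-trans (*-monoʳ 0≤Θ popular) (≤-trans (≤-reflexive (trans (cong₂ (λ h t → α * α * ½ ^ h * t) k₂≡ Θ≡) (trans (cong (λ z → α * α * z * 2ℚ ^ N₂) (^-+ ½ 6 N₂)) (trans (solve 3 (λ a h t → a :* ((con ½ :* (con ½ :* (con ½ :* (con ½ :* (con ½ :* (con ½ :* con 1ℚ)))))) :* h) :* t := con (1 ÷ 64) :* a :* (t :* h)) refl (α * α) (½ ^ N₂) (2ℚ ^ N₂)) (cong ((1 ÷ 64) * (α * α) *_) (2^½ N₂))))))
       (≤by ((lit {0ℚ} {1 ÷ 64} ⊠ 0≤α²) ⊠ dif 1≤V) (solve 2 (λ a v → con (1 ÷ 64) :* a :* (v :- con 1ℚ) := con (1 ÷ 64) :* (a :* v) :- con (1 ÷ 64) :* a :* con 1ℚ) refl (α * α) V)))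
      where
      N₂ : ℕ
      N₂ = (6 ℕ.+ (d ℕ.+ d)) ℕ.* q
      Θ≡ : Θ ≡ 2ℚ ^ N₂
      Θ≡ = trans (cong (_^ q) (trans (cong ((64 ÷ 1) *_) (sym (^-+ 2ℚ d d))) (solve 1 (λ t → con (64 ÷ 1) :* t := con 2ℚ :* (con 2ℚ :* (con 2ℚ :* (con 2ℚ :* (con 2ℚ :* (con 2ℚ :* t)))))) refl (2ℚ ^ (d ℕ.+ d))))) (sym (^-* 2ℚ (6 ℕ.+ (d ℕ.+ d)) q))
    t3 : 𝔼 (λ y → ∣ Exc y ∣) * M ≤ (1 ÷ 64) * (α * α * V)
    t3 = ≤-trans (*-monoʳ 0≤M exceptional) (≤-trans (≤-reflexive (trans (cong₂ (λ h t → ½ ^ h * t) hx≡ (trans (cong (_^ q) (sym (^-+ 2ℚ L L))) (sym (^-* 2ℚ (L ℕ.+ L) q)))) (trans (cong (_* 2ℚ ^ N₂) (trans (^-+ ½ (6 ℕ.+ N₂) (L ℕ.+ L)) (cong₂ _*_ (^-+ ½ 6 N₂) (^-+ ½ L L))))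
         (trans (solve 3 (λ h t l → (con ½ :* (con ½ :* (con ½ :* (con ½ :* (con ½ :* (con ½ :* con 1ℚ)))))) :* h :* (l :* l) :* t := con (1 ÷ 64) :* (l :* l) :* (t :* h)) refl (½ ^ N₂) (2ℚ ^ N₂) (½ ^ L)) (trans (cong ((1 ÷ 64) * (½ ^ L * ½ ^ L) *_) (2^½ N₂)) (*-identityʳ _))))))
       (*-monoˡ (lit {0ℚ} {1 ÷ 64}) (≤-trans (*-mono (0≤½^ L) Lα (0≤½^ L) Lα) (≤-trans (≤-reflexive (sym (*-identityʳ _))) (*-monoˡ 0≤α² 1≤V)))))
      where
      N₂ : ℕ
      N₂ = (L ℕ.+ L) ℕ.* q

module Deviation {n} (D : Fn n) (γ : ℚ) (γ≡ : ∣ D ∣ ≡ γ) where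
  deg : (F n → F n → Bool) → F n → ℚ
  deg h x = 𝔼 (λ z → 𝟙 (h x z))

  codeg : (F n → F n → Bool) → (F n → F n → Bool) → F n → F n → ℚ
  codeg h g x y = 𝔼 (λ z → 𝟙 (h x z) * 𝟙 (g y z))

  dev : (F n → F n → Bool) → F n → F n → ℚ
  dev h x z = 𝟙 (D z) * (γ * 𝟙 (h x z) - deg h x)

  cross : ∀ h g x y → (∀ z → 𝟙 (h x z) ≤ 𝟙 (D z)) → (∀ z → 𝟙 (g y z) ≤ 𝟙 (D z)) →
    𝔼 (λ z → dev h x z * dev g y z) ≡ γ * (γ * codeg h g x y - deg h x * deg g y)
  cross h g x y hD gD = trans (𝔼.E-cong λ z → pt (D z) (h x z) (g y z) (hD z) (gD z)) (trans (𝔼.E-lin (γ * γ) _ 1ℚ _) (trans (cong (λ u → γ * γ * codeg h g x y + 1ℚ * u)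
      (trans (𝔼.E-lin (- (γ * rg)) _ 1ℚ _) (cong (λ u → - (γ * rg) * rh + 1ℚ * u) (trans (𝔼.E-lin (- (γ * rh)) _ (rh * rg) _) (cong (λ u → - (γ * rh) * rg + rh * rg * u) γ≡)))))
    (solve 4 (λ g k a b → g :* g :* k :+ con 1ℚ :* ((:- (g :* b)) :* a :+ con 1ℚ :* ((:- (g :* a)) :* b :+ a :* b :* g)) := g :* (g :* k :- a :* b)) refl γ (codeg h g x y) rh rg)))
    where
    rh = deg h x
    rg = deg g y
    pt : ∀ D h g → 𝟙 h ≤ 𝟙 D → 𝟙 g ≤ 𝟙 D → (𝟙 D * (γ * 𝟙 h - rh)) * (𝟙 D * (γ * 𝟙 g - rg)) ≡
      γ * γ * (𝟙 h * 𝟙 g) + 1ℚ * (- (γ * rg) * 𝟙 h + 1ℚ * (- (γ * rh) * 𝟙 g + rh * rg * 𝟙 D))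
    pt true h g _ _ = solve 5 (λ γ h g a b → (con 1ℚ :* (γ :* h :- a)) :* (con 1ℚ :* (γ :* g :- b)) := γ :* γ :* (h :* g) :+ con 1ℚ :* (:- (γ :* b) :* h :+ con 1ℚ :* (:- (γ :* a) :* g :+ a :* b :* con 1ℚ))) refl γ (𝟙 h) (𝟙 g) rh rg
    pt false true g h _ = ⊥-elim (<⇒≱ (lit< {0ℚ} {1ℚ}) h)
    pt false false true _ h = ⊥-elim (<⇒≱ (lit< {0ℚ} {1ℚ}) h)
    pt false false false _ _ = solve 3 (λ γ a b → (con 0ℚ :* (γ :* con 0ℚ :- a)) :* (con 0ℚ :* (γ :* con 0ℚ :- b)) := γ :* γ :* (con 0ℚ :* con 0ℚ) :+ con 1ℚ :* (:- (γ :* b) :* con 0ℚ :+ con 1ℚ :* (:- (γ :* a) :* con 0ℚ :+ a :* b :* con 0ℚ))) refl γ rh rg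

block : ∀ {l n} → Fn n → (F n → F n → ℚ) → Vec (F n) l → F n → ℚ
block o f v x = 𝟙 (o x) * ∏ (f x) v

pow-cv : ∀ {n} k (o o' : Fn n) (f f' : F n → F n → ℚ) r t →
  𝔼 (λ x → 𝟙 (o x) * 𝟙 (o' (x ⊕ t)) * (r * 𝔼 (λ z → f x z * f' (x ⊕ t) z)) ^ k) ≡ r ^ k * tup (bits n) k .E (λ v → cv (block o f v) (block o' f' v) t)
pow-cv {n} k o o' f f' r t = sym (trans (cong (r ^ k *_) (E-swap T^ _)) (trans (sym (𝔼.E-* _ _)) (𝔼.E-cong λ x → trans (cong (r ^ k *_) (trans (T^ .E-cong λ v →
    trans (solve 4 (λ a b c d → a :* b :* (c :* d) := a :* c :* (b :* d)) refl (𝟙 (o x)) _ (𝟙 (o' (x ⊕ t))) _) (cong (𝟙 (o x) * 𝟙 (o' (x ⊕ t)) *_) (∏-mul _ _ v))) (trans (T^ .E-* _ _) (cong (𝟙 (o x) * 𝟙 (o' (x ⊕ t)) *_) (tup-∏ (bits n) k _)))))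
    (trans (solve 4 (λ r a b e → r :* (a :* b :* e) := a :* b :* (r :* e)) refl (r ^ k) (𝟙 (o x)) (𝟙 (o' (x ⊕ t))) _) (cong (𝟙 (o x) * 𝟙 (o' (x ⊕ t)) *_) (sym (*-^ r _ k)))))))
  where
  T^ = tup (bits n) k

^odd-mono : ∀ {x y} k → 0ℚ ≤ y → x ≤ y → x ^ suc (k ℕ.+ k) ≤ y ^ suc (k ℕ.+ k)
^odd-mono {x} {y} k hy h with ℚP.≤-total 0ℚ x
... | inj₁ p = ^-mono (suc (k ℕ.+ k)) p h
... | inj₂ p = ≤-trans (≤by (0≤neg p ⊠ 0≤^even x k) (solve 2 (λ x e → :- x :* e := con 0ℚ :- x :* e) refl x (x ^ (k ℕ.+ k)))) (0≤^ (suc (k ℕ.+ k)) hy)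

-- Deviations G = κ - r above 1/8 force a codegree κ ≥ 17/16; the rest is negligible.
excess : ∀ {κ r} e q' → 0ℚ ≤ κ → (63 ÷ 64) * (63 ÷ 64) ≤ r →
  (κ - r) ^ (e ℕ.+ e) * ((8 ÷ 1) * (κ - r) + 1ℚ) ≤ 2ℚ * (1 ÷ 8) ^ (e ℕ.+ e) + (16 ÷ 1) * ((16 ÷ 17) ^ q' * κ ^ (suc (e ℕ.+ e) ℕ.+ q'))
excess {κ} {r} e q' 0≤κ hr = by-cases (G ≤ 1 ÷ 8) (λ h → by-cases (- (1 ÷ 8) ≤ G) (mid h) (λ k → below (≰⇒≥ k))) (λ h → high (≰⇒≥ h))
  where
  p = e ℕ.+ e
  G = κ - r
  u = (16 ÷ 17) ^ q' * κ ^ (suc p ℕ.+ q')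
  0≤u : 0ℚ ≤ u
  0≤u = 0≤^ q' lit ⊠ 0≤^ (suc p ℕ.+ q') 0≤κ
  0≤t : 0ℚ ≤ (1 ÷ 8) ^ p
  0≤t = 0≤^ p lit
  below : G ≤ - (1 ÷ 8) → G ^ p * ((8 ÷ 1) * G + 1ℚ) ≤ 2ℚ * (1 ÷ 8) ^ p + (16 ÷ 1) * u
  below h = ≤by (((lit {0ℚ} {8 ÷ 1} ⊠ 0≤^even G e) ⊠ dif h) ⊞ (lit {0ℚ} {2ℚ} ⊠ 0≤t) ⊞ (lit {0ℚ} {16 ÷ 1} ⊠ 0≤u))
    (solve 4 (λ G P t u → con (8 ÷ 1) :* P :* (:- con (1 ÷ 8) :- G) :+ con 2ℚ :* t :+ con (16 ÷ 1) :* u := con 2ℚ :* t :+ con (16 ÷ 1) :* u :- P :* (con (8 ÷ 1) :* G :+ con 1ℚ)) refl G (G ^ p) ((1 ÷ 8) ^ p) u)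
  mid : G ≤ 1 ÷ 8 → - (1 ÷ 8) ≤ G → G ^ p * ((8 ÷ 1) * G + 1ℚ) ≤ 2ℚ * (1 ÷ 8) ^ p + (16 ÷ 1) * u
  mid h k = ≤-trans (*-mono (0≤^even G e) (^even-mono e (lit {0ℚ} {1 ÷ 8}) h k) (subst (0ℚ ≤_) (solve 1 (λ G → con (8 ÷ 1) :* (G :- :- con (1 ÷ 8)) := con (8 ÷ 1) :* G :+ con 1ℚ) refl G) (lit {0ℚ} {8 ÷ 1} ⊠ dif k))
      (≤by (lit {0ℚ} {8 ÷ 1} ⊠ dif h) (solve 1 (λ G → con (8 ÷ 1) :* (con (1 ÷ 8) :- G) := con 2ℚ :- (con (8 ÷ 1) :* G :+ con 1ℚ)) refl G)))
    (≤by (lit {0ℚ} {16 ÷ 1} ⊠ 0≤u) (solve 2 (λ t u → u := con 2ℚ :* t :+ u :- t :* con 2ℚ) refl ((1 ÷ 8) ^ p) ((16 ÷ 1) * u)))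
  high : 1 ÷ 8 ≤ G → G ^ p * ((8 ÷ 1) * G + 1ℚ) ≤ 2ℚ * (1 ÷ 8) ^ p + (16 ÷ 1) * u
  high h = ≤-trans (≤by ((lit {0ℚ} {8 ÷ 1} ⊠ 0≤^even G e) ⊠ dif h) (solve 2 (λ G P → con (8 ÷ 1) :* P :* (G :- con (1 ÷ 8)) := con (16 ÷ 1) :* (G :* P) :- P :* (con (8 ÷ 1) :* G :+ con 1ℚ)) refl G (G ^ p)))
      (≤-trans (*-monoˡ (lit {0ℚ} {16 ÷ 1}) (≤-trans (^-mono (suc p) (≤-trans (lit {0ℚ} {1 ÷ 8}) h) G≤κ) κu)) (≤by (lit {0ℚ} {2ℚ} ⊠ 0≤t) (solve 2 (λ t u → t := t :+ u :- u) refl (2ℚ * (1 ÷ 8) ^ p) ((16 ÷ 1) * u))))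
    where
    G≤κ : G ≤ κ
    G≤κ = ≤by (≤-trans (lit {0ℚ} {(63 ÷ 64) ℚ.* (63 ÷ 64)}) (≤-trans (≤-reflexive (con-* (63 ÷ 64) (63 ÷ 64))) hr)) (solve 2 (λ κ r → r := κ :- (κ :- r)) refl κ r)
    κ≥ : 17 ÷ 16 ≤ κ
    κ≥ = ≤by (dif h ⊞ dif hr ⊞ lit {0ℚ} {129 ÷ 4096}) (solve 2 (λ κ r → κ :- r :- con (1 ÷ 8) :+ (r :- con (63 ÷ 64) :* con (63 ÷ 64)) :+ con (129 ÷ 4096) := κ :- con (17 ÷ 16)) refl κ r)
    κu : κ ^ suc p ≤ u
    κu = ≤-trans (≤-reflexive (trans (sym (*-identityˡ _)) (*≡ʳ (trans (sym (1^ q')) (trans (cong (_^ q') (solve 0 (con 1ℚ := con (16 ÷ 17) :* con (17 ÷ 16)) refl)) (*-^ (16 ÷ 17) (17 ÷ 16) q'))))))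
      (≤-trans (*-monoʳ (0≤^ (suc p) 0≤κ) (*-monoˡ (0≤^ q' (lit {0ℚ} {16 ÷ 17})) (^-mono q' (lit {0ℚ} {17 ÷ 16}) κ≥))) (≤-reflexive (trans (solve 3 (λ a b c → a :* b :* c := a :* (c :* b)) refl ((16 ÷ 17) ^ q') (κ ^ q') (κ ^ suc p)) (cong ((16 ÷ 17) ^ q' *_) (sym (^-+ κ (suc p) q'))))))

module Side {n} (h : F n → F n → Bool) (X Y D : Fn n) (a : ℚ)
  (sub : ∀ x z → 𝟙 (h x z) ≤ 𝟙 (D z) * 𝟙 (Y (x ⊕ z)))
  (L d : ℕ) (Lα : ½ ^ L ≤ ∣ X ∣) (Lβ : ½ ^ L ≤ ∣ Y ∣) (Lγ : ½ ^ L ≤ ∣ D ∣) (La : ½ ^ L ≤ a) (da : ∣ X ∣ * ∣ Y ∣ * ∣ D ∣ ≤ 2ℚ ^ d * a)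
  (pe me q' k₂ l₀ hx K hG H₁ h₄ : ℕ) where
  α β γ : ℚ
  α = ∣ X ∣
  β = ∣ Y ∣
  γ = ∣ D ∣
  p q m R₄ : ℕ
  p = pe ℕ.+ pe
  q = suc p ℕ.+ q'
  m = suc (me ℕ.+ me)
  R₄ = suc (1 ℕ.* suc H₁) ℕ.* RUL h₄ 0

  0<α : 0ℚ < α
  0<α = <-≤ (0<½^ L) Lα
  0<γ : 0ℚ < γ
  0<γ = <-≤ (0<½^ L) Lγ
  0<a : 0ℚ < a
  0<a = <-≤ (0<½^ L) La

  i s c κ₀ : ℚ
  i = recip a
  s = α * γ * i
  c = α * i
  κ₀ = s * c

  i≤ : i ≤ 2ℚ ^ L
  i≤ = cancelˡ (0<½^ L) (≤-trans (*-monoʳ (0≤recip a) La) (≤-reflexive (trans (recip-* 0<a) (sym (trans (*-comm _ _) (2^½ L))))))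
  0≤s : 0ℚ ≤ s
  0≤s = (0≤∣∣ X ⊠ 0≤∣∣ D) ⊠ 0≤recip a
  0≤c : 0ℚ ≤ c
  0≤c = 0≤∣∣ X ⊠ 0≤recip a
  c≤ : c ≤ 2ℚ ^ L
  c≤ = ≤-trans (*-monoʳ (0≤recip a) (∣∣≤1 X)) (≤-trans (≤-reflexive (*-identityˡ i)) i≤)
  s≤ : s ≤ 2ℚ ^ L
  s≤ = ≤-trans (*-monoʳ (0≤recip a) (≤-trans (*-mono (0≤∣∣ X) (∣∣≤1 X) (0≤∣∣ D) (∣∣≤1 D)) (≤-reflexive (*-identityˡ 1ℚ)))) (≤-trans (≤-reflexive (*-identityˡ i)) i≤)
  0≤κ₀ : 0ℚ ≤ κ₀
  0≤κ₀ = 0≤s ⊠ 0≤c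
  κ₀≤ : κ₀ ≤ 2ℚ ^ L * 2ℚ ^ L
  κ₀≤ = *-mono 0≤s s≤ 0≤c c≤

  open Deviation D γ refl

  hD : ∀ x z → 𝟙 (h x z) ≤ 𝟙 (D z)
  hD x z = ≤-trans (sub x z) (≤-trans (*-monoˡ (0≤𝟙 (D z)) (𝟙≤1 (Y (x ⊕ z)))) (≤-reflexive (*-identityʳ _)))

  κ : F n → F n → ℚ
  κ x x' = κ₀ * codeg h h x x'

  0≤k : ∀ x x' → 0ℚ ≤ codeg h h x x'
  0≤k x x' = 𝔼.E-0≤ λ z → 0≤𝟙 (h x z) ⊠ 0≤𝟙 (h x' z)

  0≤κ : ∀ x x' → 0ℚ ≤ κ x x'
  0≤κ x x' = 0≤κ₀ ⊠ 0≤k x x'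

  κ≤ : ∀ x x' → κ x x' ≤ 2ℚ ^ L * 2ℚ ^ L
  κ≤ x x' = ≤-trans (*-monoˡ 0≤κ₀ (𝔼.E-≤ λ z → ≤-trans (𝟙*≤ (h x z) (0≤𝟙 (h x' z))) (𝟙≤1 (h x' z)))) (≤-trans (≤-reflexive (*-identityʳ _)) κ₀≤)

  V M : ℚ
  V = (33 ÷ 32) ^ q
  M = (2ℚ ^ L * 2ℚ ^ L) ^ q

  ω : F n → F n → ℚ
  ω x x' = 𝟙 (X x) * 𝟙 (X x') * κ x x' ^ q

  W : F n → ℚ
  W t = 𝔼 (λ x → ω x (x ⊕ t))

  Rich : Fn n
  Rich t = (α * α * V) ≤ᵇ W t

  opaque
    T^ : Mean (Vec (F n) q)
    T^ = tup (bits n) q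

    T^-∏ : ∀ u → T^ .E (∏ u) ≡ 𝔼 u ^ q
    T^-∏ = tup-∏ (bits n) q

  Rows : Vec (F n) q → Fn n
  Rows = Com (λ z x → h x z) X

  ω-rows : ∀ x x' → ω x x' ≡ κ₀ ^ q * T^ .E (λ v → 𝟙 (Rows v x) * 𝟙 (Rows v x'))
  ω-rows x x' = sym (trans (cong (κ₀ ^ q *_) (trans (T^ .E-cong λ v → trans (cong₂ _*_ (𝟙-Com _ X v x) (𝟙-Com _ X v x')) (trans (solve 4 (λ a b c d → a :* b :* (c :* d) := a :* c :* (b :* d)) refl (𝟙 (X x)) _ (𝟙 (X x')) _) (cong (𝟙 (X x) * 𝟙 (X x') *_) (∏-mul _ _ v))))
      (trans (T^ .E-* _ _) (cong (𝟙 (X x) * 𝟙 (X x') *_) (T^-∏ _)))))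
    (trans (solve 4 (λ k a b e → k :* (a :* b :* e) := a :* b :* (k :* e)) refl (κ₀ ^ q) (𝟙 (X x)) (𝟙 (X x')) (codeg h h x x' ^ q)) (cong (𝟙 (X x) * 𝟙 (X x') *_) (sym (*-^ κ₀ _ q)))))

  -- A power of the codegree is an average over tuples of indicators of rectangles.
  ω-form : ∀ {ρ m} (φ : Flag ρ m n) u u' (w : F m → F m → ℚ) →
    𝔼 (λ y → 𝔼 (λ y' → w y y' * ω (e φ u y) (e φ u' y'))) ≡ κ₀ ^ q * T^ .E (λ v → form w (Rows v ∘e (φ , u)) (Rows v ∘e (φ , u')))
  ω-form φ u u' w = trans (𝔼.E-cong λ y → trans (𝔼.E-cong λ y' → trans (cong (w y y' *_) (ω-rows _ _)) (trans (solve 3 (λ a b c → a :* (b :* c) := b :* (a :* c)) refl (w y y') (κ₀ ^ q) _)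
      (cong (κ₀ ^ q *_) (trans (sym (T^ .E-* _ _)) (T^ .E-cong λ v → *-comm _ _))))) (trans (𝔼.E-* _ _) (cong (κ₀ ^ q *_) (sym (E-swap T^ _)))))
    (trans (𝔼.E-* _ _) (cong (κ₀ ^ q *_) (sym (E-swap T^ _))))

  module Numbers
    (k₂≡ : k₂ ≡ 6 ℕ.+ (6 ℕ.+ (d ℕ.+ d)) ℕ.* q) (hx≡ : hx ≡ 6 ℕ.+ (L ℕ.+ L) ℕ.* q ℕ.+ (L ℕ.+ L)) (qg : (256 ÷ 1) * (65 ÷ 64) ^ q ≤ (33 ÷ 32) ^ q)
    (K≡ : K ≡ (2 ℕ.+ k₂) ℕ.+ (10 ℕ.+ suc l₀ ℕ.* (4 ℕ.+ d))) (gain : 2ℚ ^ (4 ℕ.+ d) ≤ ϖ ^ suc l₀)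
    (hG≥ : suc l₀ ℕ.* (L ℕ.+ (L ℕ.+ (2 ℕ.+ k₂))) ℕ.+ (k₂ ℕ.+ (4 ℕ.* L ℕ.+ 4)) ℕ.≤ hG) (hG≥' : hx ℕ.+ 3 ℕ.* L ℕ.≤ hG)
    (h₄≡ : h₄ ≡ (L ℕ.+ L) ℕ.* q ℕ.+ (suc H₁ ℕ.+ (1 ℕ.+ (L ℕ.+ L)))) (H₁≡ : H₁ ≡ 2 ℕ.+ (p ℕ.+ (2 ℕ.+ d) ℕ.+ (L ℕ.+ L) ℕ.+ (5 ℕ.+ (L ℕ.+ L) ℕ.* q)) ℕ.* m)
    (n1 : (16 ÷ 1) * (1 ÷ 8) ^ p ≤ ½ ^ (p ℕ.+ (2 ℕ.+ d))) (n2 : (64 ÷ 1) * ((16 ÷ 17) ^ q' * (33 ÷ 32) ^ q) ≤ ½ ^ (p ℕ.+ (2 ℕ.+ d)))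
    (RH : ∀ {ρ m} (φ : Flag ρ m n) u → ρ ℕ.≤ R₄ → ∀ H Z → (α * γ) * den H Z (λ y z → h (e φ u y) z) ≤ a * ((513 ÷ 512) * (∣ H ∣ * ∣ Z ∣) + (α * γ) * ½ ^ K))
    (UH : ∀ {ρ m} (φ : Flag ρ m n) u → ρ ℕ.≤ R₄ → ∀ H Z → den H Z (λ y z → Y (e φ u y ⊕ z)) ≤ ((4 ÷ 1) * β) * (∣ H ∣ * ∣ Z ∣) + ½ ^ hG)
    (XB : ∀ {ρ m} (φ : Flag ρ m n) u → ρ ℕ.≤ R₄ → ∣ X ∘e (φ , u) ∣ ≤ 2ℚ * α)
    (XX : ∣ (λ t → (2ℚ * (α * α)) ≤ᵇ (X ∘∘ X) t) ∣ ≤ ½ ^ suc H₁) where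

    1≤V : 1ℚ ≤ V
    1≤V = 1≤^ q (lit {1ℚ} {33 ÷ 32})
    0≤V = ≤-trans 0≤1 1≤V
    0≤M : 0ℚ ≤ M
    0≤M = 0≤^ q (sq (2ℚ ^ L))
    0≤α² : 0ℚ ≤ α * α
    0≤α² = 0≤∣∣ X ⊠ 0≤∣∣ X

    small : ∀ {ρ m} (φ : Flag ρ m n) u u' → ρ ℕ.≤ R₄ → 𝔼 (λ y → 𝔼 (λ y' → ω (e φ u y) (e φ u' y'))) ≤ (1 ÷ 16) * (α * α * V)
    small φ u u' le = Codegree.codegree-moment (λ y z → h (e φ u y) z) (λ y z → h (e φ u' y) z) (λ y z → Y (e φ u y ⊕ z)) (λ y z → Y (e φ u' y ⊕ z))
      (X ∘e (φ , u)) (X ∘e (φ , u')) D α β γ a (λ y z → sub _ z) (λ y z → sub _ z) refl L d Lα Lβ Lγ La (∣∣≤1 X) (∣∣≤1 Y) (∣∣≤1 D) da K hG (XB φ u le) (XB φ u' le)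
      (RH φ u le) (RH φ u' le) (UH φ u le) (UH φ u' le) q k₂ l₀ hx k₂≡ hx≡ qg K≡ gain hG≥ hG≥'

    M½ : M * ½ ^ ((L ℕ.+ L) ℕ.* q) ≡ 1ℚ
    M½ = trans (*≡ʳ (trans (cong (_^ q) (sym (^-+ 2ℚ L L))) (sym (^-* 2ℚ (L ℕ.+ L) q)))) (2^½ ((L ℕ.+ L) ℕ.* q))

    rich≤ : ∣ Rich ∣ ≤ ½ ^ suc H₁
    rich≤ = ≤-stable λ nope → find-spread {RUL h₄ 0} {1ℚ} 0≤1 (suc (1 ℕ.* suc H₁)) Rich (bound-rounds {1ℚ} 1 (suc H₁) (solve 0 (con 1ℚ :* (con 1ℚ :+ con 0ℚ) := con 1ℚ) refl) (≰⇒≥ nope))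
      λ φ c le sp den → contra φ c le sp (≤-trans (≰⇒≥ nope) den)
      where
      contra : ∀ {ρ m} (φ : Flag ρ m n) c → ρ ℕ.≤ R₄ → Spread (RUL h₄ 0) 1ℚ (Rich ∘e (φ , c)) → ½ ^ suc H₁ ≤ ∣ Rich ∘e (φ , c) ∣ → ⊥
      contra {ρ} {m} φ c le sp D₁ = <⇒≱ (0<* {δ} {α * α} 0<δ (0<* 0<α 0<α)) (≤by (lit {0ℚ} {4 ÷ 1} ⊠ (dif fin ⊞ (((lit {0ℚ} {3 ÷ 4} ⊠ <⇒≤ 0<δ) ⊠ 0≤α²) ⊠ dif 1≤V)))
          (solve 3 (λ d a v → con (4 ÷ 1) :* (d :* (a :* v) :* con (1 ÷ 4) :+ con ½ :* (d :* a) :- d :* (a :* v) :+ con (3 ÷ 4) :* d :* a :* (v :- con 1ℚ)) := con 0ℚ :- d :* a) refl δ (α * α) V))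
        where
        D' = Rich ∘e (φ , c)
        δ = ∣ D' ∣
        0<δ : 0ℚ < δ
        0<δ = <-≤ (0<½^ (suc H₁)) D₁
        J : F ρ → ℚ
        J v = 𝔼 (λ y → 𝔼 (λ y' → 𝟙 (D' (y ⊕ y')) * ω (e φ v y) (e φ (v ⊕ c) y')))
        unfold : 𝔼 (λ s → 𝟙 (D' s) * W (e φ c s)) ≡ 𝔼 J
        unfold = trans (𝔼.E-cong λ s → trans (cong (𝟙 (D' s) *_) (𝔼-e φ _)) (sym (𝔼.E-* _ _))) (trans (𝔼-swap _) (𝔼.E-cong λ v → trans (𝔼.E-cong λ s → sym (𝔼.E-* _ _)) (trans (𝔼-swap _)
          (𝔼.E-cong λ y → trans (𝔼.E-cong λ s → cong₂ (λ a b → 𝟙 (D' a) * ω (e φ v y) b) (sym (⊕-cancel y s)) (e-⊕ φ v c y s)) (𝔼-shiftˡ y (λ y' → 𝟙 (D' (y ⊕ y')) * ω (e φ v y) (e φ (v ⊕ c) y')))))))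
        each : ∀ v → J v ≤ (4 ÷ 1) * δ * ((1 ÷ 16) * (α * α * V)) + κ₀ ^ q * ½ ^ h₄
        each v = ≤-trans (≤-reflexive (ω-form φ v (v ⊕ c) (λ y y' → 𝟙 (D' (y ⊕ y'))))) (≤-trans (*-monoˡ (0≤^ q 0≤κ₀) (T^ .E-mono λ r →
              ≤-trans (sum-bound h₄ 0 D' (2ℚ * δ) (lit {0ℚ} {2ℚ} ⊠ <⇒≤ 0<δ) (subst (λ z → Bounded (RUL h₄ 0) (z * δ) D') (solve 0 (con 1ℚ :+ con 1ℚ := con 2ℚ) refl) sp) (Rows r ∘e (φ , v)) (Rows r ∘e (φ , v ⊕ c)))
                (≤-reflexive (trans (solve 3 (λ d x h → (con 1ℚ :+ con 1ℚ) :* (con 2ℚ :* d) :* x :+ h := con (4 ÷ 1) :* d :* x :+ h) refl δ _ (½ ^ h₄)) (cong (λ z → (4 ÷ 1) * δ * z + ½ ^ h₄) (sym (trans (form-const (Rows r ∘e (φ , v)) (Rows r ∘e (φ , v ⊕ c)) 1ℚ) (*-identityˡ _))))))))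
            (≤-trans (≤-reflexive (trans (cong (κ₀ ^ q *_) (trans (T^ .E-+ _ _) (cong₂ _+_ (T^ .E-* _ _) (E-const T^ _)))) (solve 4 (λ k d x h → k :* (con (4 ÷ 1) :* d :* x :+ h) := con (4 ÷ 1) :* d :* (k :* x) :+ k :* h) refl (κ₀ ^ q) δ _ (½ ^ h₄))))
              (+-mono (*-monoˡ (lit {0ℚ} {4 ÷ 1} ⊠ <⇒≤ 0<δ) (≤-trans (≤-reflexive (trans (sym (ω-form φ v (v ⊕ c) (λ _ _ → 1ℚ))) (𝔼.E-cong λ y → 𝔼.E-cong λ y' → *-identityˡ _))) (small φ v (v ⊕ c) le))) ≤-refl)))
        tiny : κ₀ ^ q * ½ ^ h₄ ≤ ½ * (δ * (α * α))
        tiny = ≤-trans (*-monoʳ (0≤½^ h₄) (^-mono q 0≤κ₀ κ₀≤)) (≤-trans (≤-reflexive (trans (cong (λ z → M * ½ ^ z) h₄≡) (trans (cong (M *_) (^-+ ½ ((L ℕ.+ L) ℕ.* q) _)) (trans (sym (*-assoc M _ _)) (trans (*≡ʳ M½) (trans (*-identityˡ _)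
            (trans (^-+ ½ (suc H₁) _) (trans (cong (λ z → ½ ^ suc H₁ * (½ * z)) (^-+ ½ L L)) (solve 2 (λ h l → h :* (con ½ :* (l :* l)) := con ½ :* (h :* (l :* l))) refl (½ ^ suc H₁) (½ ^ L)))))))))) (*-monoˡ 0≤½ (*-mono (0≤½^ (suc H₁)) D₁ (0≤½^ L ⊠ 0≤½^ L) (*-mono (0≤½^ L) Lα (0≤½^ L) Lα))))
        fin : δ * (α * α * V) ≤ δ * (α * α * V) * (1 ÷ 4) + ½ * (δ * (α * α))
        fin = ≤-trans (≤-reflexive (sym (𝔼.E-*ʳ _ _))) (≤-trans (𝔼.E-mono λ s → 𝟙-≤ (D' s) ≤ᵇ⇒) (≤-trans (≤-reflexive unfold) (≤-trans (𝔼.E-≤ each)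
          (+-mono (≤-reflexive (solve 2 (λ d x → con (4 ÷ 1) :* d :* (con (1 ÷ 16) :* x) := d :* x :* con (1 ÷ 4)) refl δ (α * α * V))) tiny))))

    G : F n → F n → ℚ
    G x x' = κ x x' - c * deg h x * (c * deg h x')

    ok : Fn n
    ok x = X x ∧ ((63 ÷ 64) ≤ᵇ (c * deg h x))

    Q : ℕ → F n → ℚ
    Q k t = 𝔼 (λ x → 𝟙 (ok x) * 𝟙 (ok (x ⊕ t)) * G x (x ⊕ t) ^ k)

    G-dev : ∀ x x' → G x x' ≡ recip γ * 𝔼 (λ z → c * dev h x z * (c * dev h x' z))
    G-dev x x' = sym (trans (cong (recip γ *_) (trans (𝔼.E-cong λ z → solve 3 (λ c a b → c :* a :* (c :* b) := c :* c :* (a :* b)) refl c (dev h x z) (dev h x' z)) (trans (𝔼.E-* _ _) (cong (c * c *_) (cross h h x x' (hD x) (hD x'))))))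
      (trans (solve 6 (λ r α i γ k u → r :* (α :* i :* (α :* i) :* (γ :* (γ :* k :- u))) := (γ :* r) :* (α :* γ :* i :* (α :* i) :* k :- α :* i :* (α :* i) :* u)) refl (recip γ) α i γ (codeg h h x x') (deg h x * deg h x'))
        (trans (*≡ʳ (recip-* 0<γ)) (trans (*-identityˡ _) (cong (λ z → κ x x' - z) (solve 3 (λ c a b → c :* c :* (a :* b) := c :* a :* (c :* b)) refl c (deg h x) (deg h x')))))))

    Q-cv : ∀ k t → Q k t ≡ recip γ ^ k * tup (bits n) k .E (λ v → cv (block ok (λ x z → c * dev h x z) v) (block ok (λ x z → c * dev h x z) v) t)
    Q-cv k t = trans (𝔼.E-cong λ x → cong (λ u → 𝟙 (ok x) * 𝟙 (ok (x ⊕ t)) * u ^ k) (G-dev x (x ⊕ t))) (pow-cv k ok ok (λ x z → c * dev h x z) (λ x z → c * dev h x z) (recip γ) t)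

    Q-hat : ∀ k ξ → 0ℚ ≤ hat (Q k) ξ
    Q-hat k ξ = subst (0ℚ ≤_) (sym (trans (hat-cong (Q-cv k) ξ) (trans (hat-scale _ _ ξ) (cong (recip γ ^ k *_) (trans (hat-E (tup (bits n) k) (λ v → cv (B v) (B v)) ξ) (tup (bits n) k .E-cong λ v → hat-cv (B v) (B v) ξ))))))
        (0≤^ k (0≤recip γ) ⊠ E-0≤ (tup (bits n) k) λ v → sq (hat (B v) ξ))
      where
      B = block {k} ok (λ x z → c * dev h x z)

    R : F n → ℚ
    R t = (8 ÷ 1) * Q (suc p) t + Q p t

    Q≤R : 𝔼 (λ t → Q p t ^ m) ≤ 𝔼 (λ t → R t ^ m)
    Q≤R = Maj-mean (Maj-^ m maj)
      where
      maj : Maj (Q p) R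
      maj .low ξ = Q-hat p ξ
      maj .upp ξ = ≤-trans (≤by (lit {0ℚ} {8 ÷ 1} ⊠ Q-hat (suc p) ξ) (solve 2 (λ a b → a := a :+ b :- b) refl _ (hat (Q p) ξ))) (≤-reflexive (sym (trans (hat-+ _ (Q p) ξ) (cong (_+ hat (Q p) ξ) (hat-scale (8 ÷ 1) (Q (suc p)) ξ)))))

    R≤ : ∀ t → R t ≤ 2ℚ * (1 ÷ 8) ^ p * (X ∘∘ X) t + (16 ÷ 1) * (16 ÷ 17) ^ q' * W t
    R≤ t = ≤-trans (≤-reflexive (trans (cong (_+ Q p t) (sym (𝔼.E-* _ _))) (sym (𝔼.E-+ _ _)))) (≤-trans (𝔼.E-mono λ x → pt x (x ⊕ t)) (≤-reflexive (trans (𝔼.E-+ _ _) (cong₂ _+_ (𝔼.E-* _ _) (𝔼.E-* _ _)))))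
      where
      bool : ∀ b b' x y {o} → 0ℚ ≤ y → ((b ≡ true → b' ≡ true → o ≤ y)) → x ≡ 𝟙 b * 𝟙 b' → x * o ≤ x * y
      bool true true x y 0≤y f e = subst (λ x → x * _ ≤ x * y) (trans (sym (*-identityˡ 1ℚ)) (sym e)) (subst₂ _≤_ (sym (*-identityˡ _)) (sym (*-identityˡ _)) (f refl refl))
      bool true false x y 0≤y f e = ≤-reflexive (trans (*≡ʳ (trans e (*-zeroʳ 1ℚ))) (trans (*-zeroˡ _) (sym (trans (*≡ʳ (trans e (*-zeroʳ 1ℚ))) (*-zeroˡ _)))))
      bool false b' x y 0≤y f e = ≤-reflexive (trans (*≡ʳ (trans e (*-zeroˡ _))) (trans (*-zeroˡ _) (sym (trans (*≡ʳ (trans e (*-zeroˡ _))) (*-zeroˡ _)))))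
      ok⇒ : ∀ A x → A ∧ ((63 ÷ 64) ≤ᵇ x) ≡ true → 63 ÷ 64 ≤ x
      ok⇒ true x h = ≤ᵇ⇒ h
      ok≤ : ∀ x → 𝟙 (ok x) ≤ 𝟙 (X x)
      ok≤ x = ≤-trans (≤-reflexive (𝟙-∧ (X x) _)) (≤-trans (*-monoˡ (0≤𝟙 (X x)) (𝟙≤1 ((63 ÷ 64) ≤ᵇ (c * deg h x)))) (≤-reflexive (*-identityʳ _)))
      pt : ∀ x x' → (8 ÷ 1) * (𝟙 (ok x) * 𝟙 (ok x') * G x x' ^ suc p) + 𝟙 (ok x) * 𝟙 (ok x') * G x x' ^ p ≤
        2ℚ * (1 ÷ 8) ^ p * (𝟙 (X x) * 𝟙 (X x')) + (16 ÷ 1) * (16 ÷ 17) ^ q' * ω x x'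
      pt x x' = ≤-trans (≤-reflexive (solve 3 (λ o g e → con (8 ÷ 1) :* (o :* (g :* e)) :+ o :* e := o :* (e :* (con (8 ÷ 1) :* g :+ con 1ℚ))) refl (𝟙 (ok x) * 𝟙 (ok x')) (G x x') (G x x' ^ p)))
        (≤-trans (bool (ok x) (ok x') (𝟙 (ok x) * 𝟙 (ok x')) bd 0≤bd (λ o o' → excess pe q' (0≤κ x x') (*-mono (lit {0ℚ} {63 ÷ 64}) (ok⇒ (X x) _ o) (lit {0ℚ} {63 ÷ 64}) (ok⇒ (X x') _ o'))) refl)
        (≤-trans (*-monoʳ 0≤bd (*-mono (0≤𝟙 (ok x)) (ok≤ x) (0≤𝟙 (ok x')) (ok≤ x'))) (≤-reflexive (solve 5 (λ a b t u k → a :* b :* (con 2ℚ :* t :+ con (16 ÷ 1) :* (u :* k)) := con 2ℚ :* t :* (a :* b) :+ con (16 ÷ 1) :* u :* (a :* b :* k)) refl (𝟙 (X x)) (𝟙 (X x')) ((1 ÷ 8) ^ p) ((16 ÷ 17) ^ q') (κ x x' ^ q)))))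
        where
        bd = 2ℚ * (1 ÷ 8) ^ p + (16 ÷ 1) * ((16 ÷ 17) ^ q' * κ x x' ^ q)
        0≤bd : 0ℚ ≤ bd
        0≤bd = (lit {0ℚ} {2ℚ} ⊠ 0≤^ p (lit {0ℚ} {1 ÷ 8})) ⊞ (lit {0ℚ} {16 ÷ 1} ⊠ (0≤^ q' (lit {0ℚ} {16 ÷ 17}) ⊠ 0≤^ q (0≤κ x x')))

    T₁ N₁ : ℚ
    T₁ = ½ ^ (p ℕ.+ (2 ℕ.+ d)) * (α * α)
    N₁ = (32 ÷ 1) * M

    0<T₁ : 0ℚ < T₁
    0<T₁ = 0<* (0<½^ (p ℕ.+ (2 ℕ.+ d))) (0<* 0<α 0<α)

    1≤M : 1ℚ ≤ M
    1≤M = 1≤^ q (≤-trans (≤-reflexive (sym (*-identityˡ 1ℚ))) (*-mono 0≤1 (1≤^ L (lit {1ℚ} {2ℚ})) 0≤1 (1≤^ L (lit {1ℚ} {2ℚ}))))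

    Dup : Fn n
    Dup t = (2ℚ * (α * α)) ≤ᵇ (X ∘∘ X) t

    R-good : ∀ t → (X ∘∘ X) t < 2ℚ * (α * α) → W t < α * α * V → R t ≤ ½ * T₁
    R-good t hX hW = ≤-trans (R≤ t) (≤-trans (+-mono (*-monoˡ (lit {0ℚ} {2ℚ} ⊠ 0≤^ p (lit {0ℚ} {1 ÷ 8})) (<⇒≤ hX)) (*-monoˡ (lit {0ℚ} {16 ÷ 1} ⊠ 0≤^ q' (lit {0ℚ} {16 ÷ 17})) (<⇒≤ hW)))
      (≤by ((lit {0ℚ} {1 ÷ 4} ⊠ (dif n1 ⊞ dif n2)) ⊠ 0≤α²) (solve 5 (λ t u v h a → con (1 ÷ 4) :* (h :- con (16 ÷ 1) :* t :+ (h :- con (64 ÷ 1) :* (u :* v))) :* a := con ½ :* (h :* a) :- (con 2ℚ :* t :* (con 2ℚ :* a) :+ con (16 ÷ 1) :* u :* (a :* v))) refl ((1 ÷ 8) ^ p) ((16 ÷ 17) ^ q') V (½ ^ (p ℕ.+ (2 ℕ.+ d))) (α * α))))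

    R-any : ∀ t → R t ≤ N₁
    R-any t = ≤-trans (R≤ t) (≤-trans (+-mono (*-mono (lit {0ℚ} {2ℚ} ⊠ 0≤^ p (lit {0ℚ} {1 ÷ 8})) (*-monoˡ (lit {0ℚ} {2ℚ}) (^-≤1 p (lit {0ℚ} {1 ÷ 8}) (lit {1 ÷ 8} {1ℚ}))) (0≤XX) (𝔼.E-≤ λ x → ≤-trans (𝟙*≤ (X x) (0≤𝟙 (X (x ⊕ t)))) (𝟙≤1 (X (x ⊕ t)))))
        (*-mono (lit {0ℚ} {16 ÷ 1} ⊠ 0≤^ q' (lit {0ℚ} {16 ÷ 17})) (*-monoˡ (lit {0ℚ} {16 ÷ 1}) (^-≤1 q' (lit {0ℚ} {16 ÷ 17}) (lit {16 ÷ 17} {1ℚ}))) 0≤W (𝔼.E-≤ λ x → ≤-trans (*-monoˡ (0≤𝟙 (X x) ⊠ 0≤𝟙 (X (x ⊕ t))) (^-mono q (0≤κ _ _) (κ≤ _ _))) (≤-trans (*-monoʳ 0≤M (≤-trans (𝟙*≤ (X x) (0≤𝟙 (X (x ⊕ t)))) (𝟙≤1 (X (x ⊕ t))))) (≤-reflexive (*-identityˡ M))))))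
      (≤by ((lit {0ℚ} {2ℚ} ⊠ dif 1≤M) ⊞ (lit {0ℚ} {14 ÷ 1} ⊠ 0≤M)) (solve 1 (λ M → con 2ℚ :* (M :- con 1ℚ) :+ con (14 ÷ 1) :* M := con (32 ÷ 1) :* M :- (con 2ℚ :* con 1ℚ :* con 1ℚ :+ con (16 ÷ 1) :* con 1ℚ :* M)) refl M)))
      where
      0≤XX : 0ℚ ≤ (X ∘∘ X) t
      0≤XX = 𝔼.E-0≤ λ x → 0≤𝟙 (X x) ⊠ 0≤𝟙 (X (x ⊕ t))
      0≤W : 0ℚ ≤ W t
      0≤W = 𝔼.E-0≤ λ x → (0≤𝟙 (X x) ⊠ 0≤𝟙 (X (x ⊕ t))) ⊠ 0≤^ q (0≤κ _ _)

    absurd : T₁ ^ m ≤ 𝔼 (λ t → Q p t ^ m) → ⊥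
    absurd h = <⇒≱ (0<^ m 0<T₁) (≤by ((lit {0ℚ} {4 ÷ 1} ⊠ (dif tot ⊞ dif half ⊞ (((dif rich≤ ⊞ dif XX) ⊠ 0≤^ m 0≤N₁))  ⊞ dif small')))
        (solve 6 (λ T U r x N s → con (4 ÷ 1) :* (U :+ (r :+ x) :* N :- T :+ (con ½ :* T :- U) :+ (s :- r :+ (s :- x)) :* N :+ (con ½ :* (con ½ :* T) :- (s :+ s) :* N)) := con 0ℚ :- T) refl (T₁ ^ m) ((½ * T₁) ^ m) (∣ Rich ∣) (∣ Dup ∣) (N₁ ^ m) (½ ^ suc H₁)))
      where
      0≤N₁ : 0ℚ ≤ N₁
      0≤N₁ = lit {0ℚ} {32 ÷ 1} ⊠ 0≤M
      0≤T₁ = <⇒≤ 0<T₁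
      pt : ∀ t → R t ^ m ≤ (½ * T₁) ^ m + (𝟙 (Rich t) + 𝟙 (Dup t)) * N₁ ^ m
      pt t = ≤ᵇ-elim (λ r → R t ^ m ≤ (½ * T₁) ^ m + (𝟙 r + 𝟙 (Dup t)) * N₁ ^ m) (α * α * V) (W t)
        (λ _ → ≤-trans any (≤by (0≤^ m (0≤½ ⊠ 0≤T₁) ⊞ (0≤𝟙 (Dup t) ⊠ 0≤^ m 0≤N₁)) (solve 3 (λ u b N → u :+ b :* N := u :+ (con 1ℚ :+ b) :* N :- N) refl ((½ * T₁) ^ m) (𝟙 (Dup t)) (N₁ ^ m))))
        (λ hW → ≤ᵇ-elim (λ r → R t ^ m ≤ (½ * T₁) ^ m + (0ℚ + 𝟙 r) * N₁ ^ m) (2ℚ * (α * α)) ((X ∘∘ X) t)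
          (λ _ → ≤-trans any (≤by (0≤^ m (0≤½ ⊠ 0≤T₁)) (solve 2 (λ u N → u := u :+ (con 0ℚ :+ con 1ℚ) :* N :- N) refl ((½ * T₁) ^ m) (N₁ ^ m))))
          (λ hX → ≤-trans (^odd-mono me (0≤½ ⊠ 0≤T₁) (R-good t hX hW)) (≤-reflexive (solve 2 (λ u N → u := u :+ (con 0ℚ :+ con 0ℚ) :* N) refl ((½ * T₁) ^ m) (N₁ ^ m)))))
        where
        any : R t ^ m ≤ N₁ ^ m
        any = ^odd-mono me 0≤N₁ (R-any t)
      tot : T₁ ^ m ≤ (½ * T₁) ^ m + (∣ Rich ∣ + ∣ Dup ∣) * N₁ ^ m
      tot = ≤-trans h (≤-trans Q≤R (≤-trans (𝔼.E-mono pt) (≤-reflexive (trans (𝔼.E-+ _ _) (cong₂ _+_ (𝔼.E-const _) (trans (𝔼.E-*ʳ _ _) (*≡ʳ (𝔼.E-+ _ _))))))))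
      half : (½ * T₁) ^ m ≤ ½ * T₁ ^ m
      half = ≤-trans (≤-reflexive (*-^ ½ T₁ m)) (*-monoʳ (0≤^ m 0≤T₁) (≤-trans (*-monoˡ 0≤½ (½^≤1 (me ℕ.+ me))) (≤-reflexive (*-identityʳ ½))))
      E₁ = p ℕ.+ (2 ℕ.+ d) ℕ.+ (L ℕ.+ L) ℕ.+ (5 ℕ.+ (L ℕ.+ L) ℕ.* q)
      small' : (½ ^ suc H₁ + ½ ^ suc H₁) * N₁ ^ m ≤ ½ * (½ * T₁ ^ m)
      small' = ≤-trans (≤-reflexive (trans (cong (_* N₁ ^ m) (trans (solve 1 (λ h → con ½ :* h :+ con ½ :* h := h) refl (½ ^ H₁)) (trans (cong (½ ^_) H₁≡) (cong (λ z → ½ * (½ * z)) (^-* ½ E₁ m)))))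
          (trans (solve 2 (λ a b → con ½ :* (con ½ :* a) :* b := con ½ :* (con ½ :* (a :* b))) refl ((½ ^ E₁) ^ m) (N₁ ^ m)) (cong (λ z → ½ * (½ * z)) (sym (*-^ (½ ^ E₁) N₁ m))))))
        (*-monoˡ 0≤½ (*-monoˡ 0≤½ (^-mono m (0≤½^ E₁ ⊠ 0≤N₁) (≤-trans (≤-reflexive EN) (*-monoˡ (0≤½^ (p ℕ.+ (2 ℕ.+ d))) (*-mono (0≤½^ L) Lα (0≤½^ L) Lα))))))
        where
        EN : ½ ^ E₁ * N₁ ≡ ½ ^ (p ℕ.+ (2 ℕ.+ d)) * (½ ^ L * ½ ^ L)
        EN = trans (*≡ʳ (trans (^-+ ½ (p ℕ.+ (2 ℕ.+ d) ℕ.+ (L ℕ.+ L)) _) (cong₂ _*_ (trans (^-+ ½ (p ℕ.+ (2 ℕ.+ d)) (L ℕ.+ L)) (cong (½ ^ (p ℕ.+ (2 ℕ.+ d)) *_) (^-+ ½ L L))) (^-+ ½ 5 ((L ℕ.+ L) ℕ.* q)))))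
          (trans (solve 3 (λ a h M → a :* ((con ½ :* (con ½ :* (con ½ :* (con ½ :* (con ½ :* con 1ℚ))))) :* h) :* (con (32 ÷ 1) :* M) := a :* (M :* h)) refl (½ ^ (p ℕ.+ (2 ℕ.+ d)) * (½ ^ L * ½ ^ L)) (½ ^ ((L ℕ.+ L) ℕ.* q)) M)
            (trans (cong (½ ^ (p ℕ.+ (2 ℕ.+ d)) * (½ ^ L * ½ ^ L) *_) M½) (*-identityʳ _)))

    -- No set of rows is much richer than average, so few can be poorer.
    poor-rows : 12 ℕ.≤ K → (∀ x z → 𝟙 (h x z) ≤ 𝟙 (X x)) → 𝔼 (deg h) ≡ a → 𝔼 (λ x → 𝟙 (not (ok x)) * deg h x) ≤ (1 ÷ 8) * a
    poor-rows K≥ hX total = cancelˡ 0<c (≤-trans lower (≤-trans (≤by (lit {0ℚ} {63 ÷ 64} ⊠ dif few ⊞ lit {0ℚ} {1 ÷ 512} ⊠ 0≤∣∣ X) (solve 2 (λ a l → con (63 ÷ 64) :* (con (1 ÷ 8) :* a :- l) :+ con (1 ÷ 512) :* a := con (1 ÷ 8) :* a :- con (63 ÷ 64) :* l) refl α ∣ Low ∣))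
        (≤-reflexive (trans (cong ((1 ÷ 8) *_) (sym ca)) (solve 2 (λ c a → con (1 ÷ 8) :* (c :* a) := c :* (con (1 ÷ 8) :* a)) refl c a)))))
      where
      0<c : 0ℚ < c
      0<c = 0<* 0<α (inv-pos 0<a (recip-* 0<a))
      ca : c * a ≡ α
      ca = trans (*-assoc α i a) (trans (cong (α *_) (trans (*-comm i a) (recip-* 0<a))) (*-identityʳ α))
      Low : Fn n
      Low x = X x ∧ not ((63 ÷ 64) ≤ᵇ (c * deg h x))
      parts : ∣ ok ∣ + ∣ Low ∣ ≡ α
      parts = trans (sym (𝔼.E-+ _ _)) (𝔼.E-cong λ x → pt (X x) ((63 ÷ 64) ≤ᵇ (c * deg h x)))
        where
        pt : ∀ a b → 𝟙 (a ∧ b) + 𝟙 (a ∧ not b) ≡ 𝟙 a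
        pt true true = +-identityʳ _
        pt true false = +-identityˡ _
        pt false b = +-identityʳ _
      deg≤X : ∀ x → deg h x ≤ 𝟙 (X x)
      deg≤X x = 𝔼.E-≤ (hX x)
      notok : ∀ x → 𝟙 (not (ok x)) * (c * deg h x) ≤ 𝟙 (Low x) * (63 ÷ 64)
      notok x = go (X x) (deg≤X x)
        where
        go : ∀ a → deg h x ≤ 𝟙 a → 𝟙 (not (a ∧ ((63 ÷ 64) ≤ᵇ (c * deg h x)))) * (c * deg h x) ≤ 𝟙 (a ∧ not ((63 ÷ 64) ≤ᵇ (c * deg h x))) * (63 ÷ 64)
        go false le = ≤-trans (*-monoˡ 0≤1 (*-monoˡ 0≤c le)) (≤-reflexive (solve 2 (λ c a → con 1ℚ :* (c :* con 0ℚ) := con 0ℚ :* a) refl c (63 ÷ 64)))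
        go true le = ≤ᵇ-elim (λ b → 𝟙 (not b) * (c * deg h x) ≤ 𝟙 (not b) * (63 ÷ 64)) (63 ÷ 64) (c * deg h x) (λ _ → ≤-reflexive (trans (*-zeroˡ _) (sym (*-zeroˡ _)))) (λ lt → *-monoˡ 0≤1 (<⇒≤ lt))
      lower : c * 𝔼 (λ x → 𝟙 (not (ok x)) * deg h x) ≤ (63 ÷ 64) * ∣ Low ∣
      lower = ≤-trans (≤-reflexive (trans (sym (𝔼.E-* c _)) (𝔼.E-cong λ x → solve 3 (λ c b d → c :* (b :* d) := b :* (c :* d)) refl c (𝟙 (not (ok x))) (deg h x)))) (≤-trans (𝔼.E-mono notok) (≤-reflexive (trans (𝔼.E-*ʳ _ _) (*-comm _ _))))
      dD : ∀ x → 𝔼 (λ z → 𝟙 (D z) * 𝟙 (h x z)) ≡ deg h x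
      dD x = 𝔼.E-cong λ z → go (D z) (h x z) (hD x z)
        where
        go : ∀ D g → 𝟙 g ≤ 𝟙 D → 𝟙 D * 𝟙 g ≡ 𝟙 g
        go true g h = *-identityˡ _
        go false false h = *-zeroˡ _
        go false true h = ⊥-elim (<⇒≱ (lit< {0ℚ} {1ℚ}) h)
      den≡ : den ok D h ≡ 𝔼 (λ x → 𝟙 (ok x) * deg h x)
      den≡ = 𝔼.E-cong λ x → cong (𝟙 (ok x) *_) (dD x)
      upper : c * 𝔼 (λ x → 𝟙 (ok x) * deg h x) ≤ (513 ÷ 512) * ∣ ok ∣ + α * ½ ^ K
      upper = cancelˡ (0<* {γ} {a} 0<γ 0<a) (≤-trans (≤-reflexive (trans (cong (λ z → γ * a * (c * z)) (sym den≡)) (trans (solve 5 (λ γ a α i d → γ :* a :* (α :* i :* d) := (a :* i) :* (α :* γ :* d)) refl γ a α i (den ok D h)) (trans (*≡ʳ (recip-* 0<a)) (*-identityˡ _)))))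
        (≤-trans (RH nil [] ℕ.z≤n ok D) (≤-reflexive (solve 5 (λ a o g α k → a :* (con (513 ÷ 512) :* (o :* g) :+ (α :* g) :* k) := g :* a :* (con (513 ÷ 512) :* o :+ α :* k)) refl a ∣ ok ∣ γ α (½ ^ K)))))
      K≤ : ½ ^ K ≤ 1 ÷ 4096
      K≤ = ≤-trans (½^-mono K≥) (≤-reflexive (solve 0 (con ½ :* (con ½ :* (con ½ :* (con ½ :* (con ½ :* (con ½ :* (con ½ :* (con ½ :* (con ½ :* (con ½ :* (con ½ :* (con ½ :* con 1ℚ))))))))))) := con (1 ÷ 4096)) refl))
      all : c * 𝔼 (λ x → 𝟙 (ok x) * deg h x) + c * 𝔼 (λ x → 𝟙 (not (ok x)) * deg h x) ≡ α
      all = trans (sym (trans (cong (c *_) (trans (𝔼.E-cong λ x → go (ok x) (deg h x)) (𝔼.E-+ _ _))) (solve 3 (λ c a b → c :* (a :+ b) := c :* a :+ c :* b) refl c _ _))) (trans (cong (c *_) total) ca)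
        where
        go : ∀ b d → d ≡ 𝟙 b * d + 𝟙 (not b) * d
        go true d = solve 1 (λ d → d := con 1ℚ :* d :+ con 0ℚ :* d) refl d
        go false d = solve 1 (λ d → d := con 0ℚ :* d :+ con 1ℚ :* d) refl d
      few : ∣ Low ∣ ≤ (1 ÷ 8) * α
      few = ≤by (lit {0ℚ} {512 ÷ 9} ⊠ (dif upper ⊞ dif lower ⊞ 0≤∣∣ X ⊠ dif K≤))
        (trans (solve 6 (λ u o α k v l → con (512 ÷ 9) :* (con (513 ÷ 512) :* o :+ α :* k :- u :+ (con (63 ÷ 64) :* l :- v) :+ α :* (con (1 ÷ 4096) :- k)) := con (512 ÷ 9) :* (con (513 ÷ 512) :* (o :+ l) :- con (9 ÷ 512) :* l :+ con (1 ÷ 4096) :* α :- (u :+ v))) refl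
            (c * 𝔼 (λ x → 𝟙 (ok x) * deg h x)) (∣ ok ∣) α (½ ^ K) (c * 𝔼 (λ x → 𝟙 (not (ok x)) * deg h x)) (∣ Low ∣))
          (trans (cong₂ (λ y z → (512 ÷ 9) * ((513 ÷ 512) * y - (9 ÷ 512) * ∣ Low ∣ + (1 ÷ 4096) * α - z)) parts all)
            (solve 2 (λ α l → con (512 ÷ 9) :* (con (513 ÷ 512) :* α :- con (9 ÷ 512) :* l :+ con (1 ÷ 4096) :* α :- α) := con (1 ÷ 8) :* α :- l) refl α ∣ Low ∣)))

Trip-tup : ∀ l {m n} {φ φ₁ φ₂ : Vec (F m) l → F n → ℚ} → (∀ v → Trip (φ v) (φ₁ v) (φ₂ v)) →
  Trip (λ x → tup (bits m) l .E (λ v → φ v x)) (λ x → tup (bits m) l .E (λ v → φ₁ v x)) (λ x → tup (bits m) l .E (λ v → φ₂ v x))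
Trip-tup zero T = T []
Trip-tup (suc l) T = Trip-𝔼 λ a → Trip-tup l λ v → T (a ∷ v)

Trip-scale : ∀ {n} {φ φ₁ φ₂ : F n → ℚ} k → 0ℚ ≤ k → Trip φ φ₁ φ₂ → Trip (λ x → k * φ x) (λ x → k * φ₁ x) (λ x → k * φ₂ x)
Trip-scale k h T .pos₁ ξ = subst (0ℚ ≤_) (sym (hat-scale k _ ξ)) (h ⊠ T .pos₁ ξ)
Trip-scale k h T .pos₂ ξ = subst (0ℚ ≤_) (sym (hat-scale k _ ξ)) (h ⊠ T .pos₂ ξ)
Trip-scale {φ = φ} {φ₁} {φ₂} k h T .dom ξ = subst₂ _≤_ (trans (solve 2 (λ k a → (k :* k) :* (a :* a) := (k :* a) :* (k :* a)) refl k (hat φ ξ)) (cong (λ z → z * z) (sym (hat-scale k φ ξ))))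
  (trans (solve 3 (λ k a b → (k :* k) :* (a :* b) := (k :* a) :* (k :* b)) refl k (hat φ₁ ξ) (hat φ₂ ξ)) (cong₂ _*_ (sym (hat-scale k φ₁ ξ)) (sym (hat-scale k φ₂ ξ)))) (*-monoˡ (h ⊠ h) (T .dom ξ))

-- p and m are the exponents of the two moments taken, q that of the codegree, ½^K the relative error allowed for
-- rectangles, and the remaining numbers are exponents of exceptional densities and, for R₄, a codimension.
module Derived (L d pe me q' l₀ : ℕ) where
  p q m k₂ hx K hG H₁ h₄ R₄ : ℕ
  p = pe ℕ.+ pe
  q = suc p ℕ.+ q'
  m = suc (me ℕ.+ me)
  k₂ = 6 ℕ.+ (6 ℕ.+ (d ℕ.+ d)) ℕ.* q
  hx = 6 ℕ.+ (L ℕ.+ L) ℕ.* q ℕ.+ (L ℕ.+ L)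
  K = (2 ℕ.+ k₂) ℕ.+ (10 ℕ.+ suc l₀ ℕ.* (4 ℕ.+ d))
  hG = suc l₀ ℕ.* (L ℕ.+ (L ℕ.+ (2 ℕ.+ k₂))) ℕ.+ (k₂ ℕ.+ (4 ℕ.* L ℕ.+ 4)) ℕ.+ (hx ℕ.+ 3 ℕ.* L)
  H₁ = 2 ℕ.+ (p ℕ.+ (2 ℕ.+ d) ℕ.+ (L ℕ.+ L) ℕ.+ (5 ℕ.+ (L ℕ.+ L) ℕ.* q)) ℕ.* m
  h₄ = (L ℕ.+ L) ℕ.* q ℕ.+ (suc H₁ ℕ.+ (1 ℕ.+ (L ℕ.+ L)))
  R₄ = suc (1 ℕ.* suc H₁) ℕ.* RUL h₄ 0

record Par (L d : ℕ) : Set where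
  field
    pe me q' l₀ : ℕ
    qg : (256 ÷ 1) * (65 ÷ 64) ^ (suc (pe ℕ.+ pe) ℕ.+ q') ≤ (33 ÷ 32) ^ (suc (pe ℕ.+ pe) ℕ.+ q')
    gain : 2ℚ ^ (4 ℕ.+ d) ≤ ϖ ^ suc l₀
    n1 : (16 ÷ 1) * (1 ÷ 8) ^ (pe ℕ.+ pe) ≤ ½ ^ (pe ℕ.+ pe ℕ.+ (2 ℕ.+ d))
    n2 : (64 ÷ 1) * ((16 ÷ 17) ^ q' * (33 ÷ 32) ^ (suc (pe ℕ.+ pe) ℕ.+ q')) ≤ ½ ^ (pe ℕ.+ pe ℕ.+ (2 ℕ.+ d))
    L≤m : L ℕ.≤ suc (me ℕ.+ me)
  open Derived L d pe me q' l₀ public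

-- The part of A in X × Y × D, in the coordinates (x, y), (x, x + y) and (y, x + y).
part : ∀ {n} → (F n → F n → Bool) → Fn n → Fn n → Fn n → F n → F n → Bool
part A X Y D x y = A x y ∧ (X x ∧ (Y y ∧ D (x ⊕ y)))

hₓ hᵧ : ∀ {n} → (F n → F n → Bool) → F n → F n → Bool
hₓ B x z = B x (x ⊕ z)
hᵧ B y z = B (y ⊕ z) y

mean : ∀ {n} → (F n → F n → Bool) → ℚ
mean B = 𝔼 (λ x → 𝔼 (λ y → 𝟙 (B x y)))

part-≤ : ∀ {n} (A : F n → F n → Bool) X Y D x y → (𝟙 (part A X Y D x y) ≤ 𝟙 (X x)) × (𝟙 (part A X Y D x y) ≤ 𝟙 (D (x ⊕ y)) * 𝟙 (Y y))
part-≤ A X Y D x y = go (A x y) (X x) (Y y) (D (x ⊕ y))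
  where
  go : ∀ a b c d → (𝟙 (a ∧ (b ∧ (c ∧ d))) ≤ 𝟙 b) × (𝟙 (a ∧ (b ∧ (c ∧ d))) ≤ 𝟙 d * 𝟙 c)
  go false b c d = 0≤𝟙 b , 0≤𝟙 d ⊠ 0≤𝟙 c
  go true false c d = ≤-refl , 0≤𝟙 d ⊠ 0≤𝟙 c
  go true true false d = lit , 0≤𝟙 d ⊠ lit
  go true true true false = lit , ≤-reflexive (sym (*-zeroˡ _))
  go true true true true = ≤-refl , ≤-reflexive (sym (*-identityˡ _))

part-≤' : ∀ {n} (A : F n → F n → Bool) X Y D x y → (𝟙 (part A X Y D x y) ≤ 𝟙 (Y y)) × (𝟙 (part A X Y D x y) ≤ 𝟙 (D (x ⊕ y)) * 𝟙 (X x))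
part-≤' A X Y D x y = go (A x y) (X x) (Y y) (D (x ⊕ y))
  where
  go : ∀ a b c d → (𝟙 (a ∧ (b ∧ (c ∧ d))) ≤ 𝟙 c) × (𝟙 (a ∧ (b ∧ (c ∧ d))) ≤ 𝟙 d * 𝟙 b)
  go false b c d = 0≤𝟙 c , 0≤𝟙 d ⊠ 0≤𝟙 b
  go true false c d = 0≤𝟙 c , 0≤𝟙 d ⊠ lit
  go true true false d = ≤-refl , 0≤𝟙 d ⊠ lit
  go true true true false = lit , ≤-reflexive (sym (*-zeroˡ _))
  go true true true true = ≤-refl , ≤-reflexive (sym (*-identityˡ _))

module Corner {n} (A : F n → F n → Bool) (cf : CornerFree A) (X Y D : Fn n) (L d : ℕ) (P : Par L d) where
  open Par P
  B = part A X Y D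
  h g : F n → F n → Bool
  h = hₓ B
  g = hᵧ B
  a α β γ : ℚ
  a = mean B
  α = ∣ X ∣
  β = ∣ Y ∣
  γ = ∣ D ∣

  Rectangles : (F n → F n → Bool) → ℚ → Set
  Rectangles h α = ∀ {ρ m} (φ : Flag ρ m n) u → ρ ℕ.≤ R₄ → ∀ H Z → (α * γ) * den H Z (λ y z → h (e φ u y) z) ≤ a * ((513 ÷ 512) * (∣ H ∣ * ∣ Z ∣) + (α * γ) * ½ ^ K)

  Sums : Fn n → Set
  Sums Y = ∀ {ρ m} (φ : Flag ρ m n) u → ρ ℕ.≤ R₄ → ∀ H Z → den H Z (λ y z → Y (e φ u y ⊕ z)) ≤ ((4 ÷ 1) * ∣ Y ∣) * (∣ H ∣ * ∣ Z ∣) + ½ ^ hG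

  Doubled : Fn n → Set
  Doubled X = ∀ {ρ m} (φ : Flag ρ m n) u → ρ ℕ.≤ R₄ → ∣ X ∘e (φ , u) ∣ ≤ 2ℚ * ∣ X ∣

  Square : Fn n → Set
  Square X = ∣ (λ t → (2ℚ * (∣ X ∣ * ∣ X ∣)) ≤ᵇ (X ∘∘ X) t) ∣ ≤ ½ ^ suc H₁

  module Contradiction (Lα : ½ ^ L ≤ α) (Lβ : ½ ^ L ≤ β) (Lγ : ½ ^ L ≤ γ) (La : ½ ^ L ≤ a) (da : α * β * γ ≤ 2ℚ ^ d * a)
    (Rₓ : Rectangles h α) (Rᵧ : Rectangles g β) (Uₓ : Sums X) (Uᵧ : Sums Y) (Bₓ : Doubled X) (Bᵧ : Doubled Y) (Sₓ : Square X) (Sᵧ : Square Y)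
    (n≥ : 2 ℕ.+ (L ℕ.+ L) ℕ.≤ n) where

    hD : ∀ x z → 𝟙 (h x z) ≤ 𝟙 (D z) * 𝟙 (Y (x ⊕ z))
    hD x z = subst (λ u → 𝟙 (h x z) ≤ 𝟙 (D u) * 𝟙 (Y (x ⊕ z))) (⊕-cancel x z) (proj₂ (part-≤ A X Y D x (x ⊕ z)))
    gD : ∀ y z → 𝟙 (g y z) ≤ 𝟙 (D z) * 𝟙 (X (y ⊕ z))
    gD y z = subst (λ u → 𝟙 (g y z) ≤ 𝟙 (D u) * 𝟙 (X (y ⊕ z))) (trans (⊕-comm (y ⊕ z) y) (⊕-cancel y z)) (proj₂ (part-≤' A X Y D (y ⊕ z) y))

    module 𝕏 = Side h X Y D a hD L d Lα Lβ Lγ La da pe me q' k₂ l₀ hx K hG H₁ h₄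
    module 𝕐 = Side g Y X D a gD L d Lβ Lα Lγ La (subst (λ z → z * γ ≤ 2ℚ ^ d * a) (*-comm α β) da) pe me q' k₂ l₀ hx K hG H₁ h₄
    module ℍ = 𝕏.Numbers refl refl qg refl gain (ℕP.m≤m+n _ _) (ℕP.m≤n+m _ _) refl refl n1 n2 Rₓ Uᵧ Bₓ Sₓ
    module 𝔾 = 𝕐.Numbers refl refl qg refl gain (ℕP.m≤m+n _ _) (ℕP.m≤n+m _ _) refl refl n1 n2 Rᵧ Uₓ Bᵧ Sᵧ
    open Deviation D γ refl

    totalₓ : 𝔼 (deg h) ≡ a
    totalₓ = 𝔼.E-cong λ x → 𝔼-shiftˡ x (λ y → 𝟙 (B x y))
    totalᵧ : 𝔼 (deg g) ≡ a
    totalᵧ = trans (𝔼.E-cong λ y → 𝔼-shiftˡ y (λ x → 𝟙 (B x y))) (𝔼-swap _)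

    K≥ : 12 ℕ.≤ K
    K≥ = ℕP.≤-trans (ℕP.+-mono-≤ {2} {2 ℕ.+ k₂} {10} {10 ℕ.+ suc l₀ ℕ.* (4 ℕ.+ d)} (ℕP.m≤m+n 2 k₂) (ℕP.m≤m+n 10 (suc l₀ ℕ.* (4 ℕ.+ d)))) ℕP.≤-refl

    poorₓ : 𝔼 (λ x → 𝟙 (not (ℍ.ok x)) * deg h x) ≤ (1 ÷ 8) * a
    poorₓ = ℍ.poor-rows K≥ (λ x z → proj₁ (part-≤ A X Y D x (x ⊕ z))) totalₓ
    poorᵧ : 𝔼 (λ y → 𝟙 (not (𝔾.ok y)) * deg g y) ≤ (1 ÷ 8) * a
    poorᵧ = 𝔾.poor-rows K≥ (λ y z → proj₁ (part-≤' A X Y D (y ⊕ z) y)) totalᵧ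

    Core : F n → F n → ℚ
    Core x y = 𝟙 (B x y) * (𝟙 (ℍ.ok x) * 𝟙 (𝔾.ok y))

    core : (3 ÷ 4) * a ≤ 𝔼 (λ x → 𝔼 (Core x))
    core = ≤by (dif poorₓ ⊞ dif poorᵧ ⊞ dif cover) (solve 4 (λ a x y k → con (1 ÷ 8) :* a :- x :+ (con (1 ÷ 8) :* a :- y) :+ (k :+ x :+ y :- a) := k :- con (3 ÷ 4) :* a) refl a _ _ (𝔼 (λ x → 𝔼 (Core x))))
      where
      bool : ∀ b o o' → 𝟙 b ≤ 𝟙 b * (𝟙 o * 𝟙 o') + 𝟙 (not o) * 𝟙 b + 𝟙 (not o') * 𝟙 b
      bool false o o' = ≤-reflexive (solve 3 (λ a b c → con 0ℚ := con 0ℚ :* a :+ b :* con 0ℚ :+ c :* con 0ℚ) refl (𝟙 o * 𝟙 o') (𝟙 (not o)) (𝟙 (not o')))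
      bool true true true = ≤-reflexive (solve 0 (con 1ℚ := con 1ℚ :* (con 1ℚ :* con 1ℚ) :+ con 0ℚ :* con 1ℚ :+ con 0ℚ :* con 1ℚ) refl)
      bool true true false = ≤-reflexive (solve 0 (con 1ℚ := con 1ℚ :* (con 1ℚ :* con 0ℚ) :+ con 0ℚ :* con 1ℚ :+ con 1ℚ :* con 1ℚ) refl)
      bool true false true = ≤-reflexive (solve 0 (con 1ℚ := con 1ℚ :* (con 0ℚ :* con 1ℚ) :+ con 1ℚ :* con 1ℚ :+ con 0ℚ :* con 1ℚ) refl)
      bool true false false = ≤by (lit {0ℚ} {1ℚ}) (solve 0 (con 1ℚ := con 1ℚ :* (con 0ℚ :* con 0ℚ) :+ con 1ℚ :* con 1ℚ :+ con 1ℚ :* con 1ℚ :- con 1ℚ) refl)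
      cover : a ≤ 𝔼 (λ x → 𝔼 (Core x)) + 𝔼 (λ x → 𝟙 (not (ℍ.ok x)) * deg h x) + 𝔼 (λ y → 𝟙 (not (𝔾.ok y)) * deg g y)
      cover = ≤-trans (𝔼.E-mono λ x → 𝔼.E-mono λ y → bool (B x y) (ℍ.ok x) (𝔾.ok y)) (≤-reflexive (trans (𝔼.E-cong λ x → trans (𝔼.E-+ _ _) (cong (_+ 𝔼 (λ y → 𝟙 (not (𝔾.ok y)) * 𝟙 (B x y))) (𝔼.E-+ _ _)))
        (trans (𝔼.E-+ _ _) (cong₂ _+_ (trans (𝔼.E-+ _ _) (cong (𝔼 (λ x → 𝔼 (Core x)) +_) (𝔼.E-cong λ x → trans (𝔼.E-* _ _) (cong (𝟙 (not (ℍ.ok x)) *_) (sym (𝔼-shiftˡ x (λ y → 𝟙 (B x y))))))))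
          (trans (𝔼-swap _) (𝔼.E-cong λ y → trans (𝔼.E-* _ _) (cong (𝟙 (not (𝔾.ok y)) *_) (sym (𝔼-shiftˡ y (λ x → 𝟙 (B x y)))))))))))

    -- Corner-freeness: the two neighbourhoods of a point of A share only the trivial corner.
    no-corner : ∀ x y → B x y ≡ true → codeg h g x y ≤ ½ ^ n
    no-corner x y bxy = ≤-trans (≤-reflexive (sym (𝔼-shiftˡ (x ⊕ y) _))) (≤-trans (𝔼.E-mono pt) (≤-reflexive (trans (𝔼-zero (λ _ → 1ℚ)) (*-identityʳ _))))
      where
      A⇒ : ∀ a b → a ∧ b ≡ true → a ≡ true
      A⇒ true b h = refl
      pt : ∀ w → 𝟙 (h x ((x ⊕ y) ⊕ w)) * 𝟙 (g y ((x ⊕ y) ⊕ w)) ≤ 𝟙 (isZ w) * 1ℚ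
      pt w = subst₂ (λ u v → 𝟙 (B x u) * 𝟙 (B v y) ≤ 𝟙 (isZ w) * 1ℚ) (sym (trans (cong (x ⊕_) (⊕-assoc x y w)) (⊕-cancel x (y ⊕ w))))
          (sym (trans (cong (λ u → y ⊕ (u ⊕ w)) (⊕-comm x y)) (trans (cong (y ⊕_) (⊕-assoc y x w)) (⊕-cancel y (x ⊕ w))))) (go (B x (y ⊕ w)) (B (x ⊕ w) y) (isZ w) refl refl refl)
        where
        go : ∀ b b' i → B x (y ⊕ w) ≡ b → B (x ⊕ w) y ≡ b' → isZ w ≡ i → 𝟙 b * 𝟙 b' ≤ 𝟙 i * 1ℚ
        go false b' i _ _ _ = ≤-trans (≤-reflexive (*-zeroˡ _)) (0≤𝟙 i ⊠ 0≤1)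
        go true false i _ _ _ = ≤-trans (≤-reflexive (*-zeroʳ _)) (0≤𝟙 i ⊠ 0≤1)
        go true true true _ _ _ = ≤-refl
        go true true false u v z = ⊥-elim (cf x y w (isZ-false w z) (A⇒ _ _ bxy , A⇒ _ _ v , A⇒ _ _ u))

    r : ℚ
    r = recip γ
    0≤r = 0≤recip γ

    U : F n → F n → ℚ
    U x y = r * 𝔼 (λ z → 𝕏.c * dev h x z * (𝕐.c * dev g y z))

    U≡ : ∀ x y → U x y ≡ 𝕏.c * 𝕐.c * γ * codeg h g x y - 𝕏.c * deg h x * (𝕐.c * deg g y)
    U≡ x y = trans (cong (r *_) (trans (𝔼.E-cong λ z → solve 4 (λ c k a b → c :* a :* (k :* b) := c :* k :* (a :* b)) refl 𝕏.c 𝕐.c (dev h x z) (dev g y z)) (trans (𝔼.E-* _ _) (cong (𝕏.c * 𝕐.c *_) (cross h g x y (𝕏.hD x) (𝕐.hD y))))))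
      (trans (solve 7 (λ r c k γ u v w → r :* (c :* k :* (γ :* (γ :* u :- v :* w))) := (γ :* r) :* (c :* k :* γ :* u :- c :* v :* (k :* w))) refl r 𝕏.c 𝕐.c γ (codeg h g x y) (deg h x) (deg g y)) (trans (*≡ʳ (recip-* 𝕏.0<γ)) (*-identityˡ _)))

    ok⇒ : ∀ A x → A ∧ ((63 ÷ 64) ≤ᵇ x) ≡ true → 63 ÷ 64 ≤ x
    ok⇒ true x h = ≤ᵇ⇒ h

    U-low : ∀ x y → B x y ≡ true → ℍ.ok x ≡ true → 𝔾.ok y ≡ true → ½ ≤ - U x y
    U-low x y b o o' = subst (λ u → ½ ≤ - u) (sym (U≡ x y)) (≤by (dif (*-mono (lit {0ℚ} {63 ÷ 64}) (ok⇒ (X x) _ o) (lit {0ℚ} {63 ÷ 64}) (ok⇒ (Y y) _ o')) ⊞ dif tiny ⊞ lit {0ℚ} {897 ÷ 4096})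
        (solve 2 (λ u t → t :- con (63 ÷ 64) :* con (63 ÷ 64) :+ (con (1 ÷ 4) :- u) :+ con (897 ÷ 4096) := :- (u :- t) :- con ½) refl _ _))
      where
      tiny : 𝕏.c * 𝕐.c * γ * codeg h g x y ≤ 1 ÷ 4
      tiny = ≤-trans (*-mono ((𝕏.0≤c ⊠ 𝕐.0≤c) ⊠ 0≤∣∣ D) (*-mono (𝕏.0≤c ⊠ 𝕐.0≤c) (*-mono 𝕏.0≤c 𝕏.c≤ 𝕐.0≤c 𝕐.c≤) (0≤∣∣ D) (∣∣≤1 D)) (𝔼.E-0≤ λ z → 0≤𝟙 (h x z) ⊠ 0≤𝟙 (g y z)) (≤-trans (no-corner x y b) (½^-mono n≥)))
        (≤-reflexive (trans (cong (λ z → 2ℚ ^ L * 2ℚ ^ L * 1ℚ * z) (trans (^-+ ½ 2 (L ℕ.+ L)) (cong (½ ^ 2 *_) (^-+ ½ L L)))) (trans (solve 2 (λ t h → t :* t :* con 1ℚ :* (con ½ :* (con ½ :* con 1ℚ) :* (h :* h)) := con (1 ÷ 4) :* ((t :* h) :* (t :* h))) refl (2ℚ ^ L) (½ ^ L))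
          (trans (cong (λ z → (1 ÷ 4) * (z * z)) (2^½ L)) (solve 0 (con (1 ÷ 4) :* (con 1ℚ :* con 1ℚ) := con (1 ÷ 4)) refl)))))

    Q : F n → ℚ
    Q t = 𝔼 (λ x → 𝟙 (ℍ.ok x) * 𝟙 (𝔾.ok (x ⊕ t)) * U x (x ⊕ t) ^ p)

    0≤Q : ∀ t → 0ℚ ≤ Q t
    0≤Q t = 𝔼.E-0≤ λ x → (0≤𝟙 (ℍ.ok x) ⊠ 0≤𝟙 (𝔾.ok (x ⊕ t))) ⊠ 0≤^even (U x (x ⊕ t)) pe

    average : ½ ^ p * ((3 ÷ 4) * a) ≤ 𝔼 (λ t → 𝟙 (D t) * Q t)
    average = ≤-trans (*-monoˡ (0≤½^ p) core) (≤-trans (≤-reflexive (trans (cong (½ ^ p *_) (trans (𝔼.E-cong λ x → sym (𝔼-shiftˡ x (Core x))) (𝔼-swap _))) (trans (sym (𝔼.E-* _ _)) (𝔼.E-cong λ t → sym (𝔼.E-* _ _)))))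
      (≤-trans (𝔼.E-mono λ t → 𝔼.E-mono λ x → pt x t) (≤-reflexive (𝔼.E-cong λ t → 𝔼.E-* _ _))))
      where
      pt : ∀ x t → ½ ^ p * Core x (x ⊕ t) ≤ 𝟙 (D t) * (𝟙 (ℍ.ok x) * 𝟙 (𝔾.ok (x ⊕ t)) * U x (x ⊕ t) ^ p)
      pt x t = ≤-trans (go (B x (x ⊕ t)) (ℍ.ok x) (𝔾.ok (x ⊕ t)) refl refl refl) (*-monoʳ (((0≤𝟙 (ℍ.ok x) ⊠ 0≤𝟙 (𝔾.ok (x ⊕ t))) ⊠ 0≤^even (U x (x ⊕ t)) pe)) (𝕏.hD x t))
        where
        y = x ⊕ t
        go : ∀ b o o' → B x y ≡ b → ℍ.ok x ≡ o → 𝔾.ok y ≡ o' → ½ ^ p * (𝟙 b * (𝟙 o * 𝟙 o')) ≤ 𝟙 b * (𝟙 o * 𝟙 o' * U x y ^ p)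
        go true true true e1 e2 e3 = ≤-trans (≤-reflexive (solve 1 (λ h → h :* (con 1ℚ :* (con 1ℚ :* con 1ℚ)) := con 1ℚ :* (con 1ℚ :* con 1ℚ) :* h) refl (½ ^ p))) (≤-trans (*-monoˡ (lit {0ℚ} {1ℚ ℚ.* (1ℚ ℚ.* 1ℚ)} ⟨≡⟩ con-3) (≤-trans (^-mono p 0≤½ (U-low x y e1 e2 e3)) (≤-reflexive (neg^even (U x y) pe))))
           (≤-reflexive (solve 1 (λ h → con 1ℚ :* (con 1ℚ :* con 1ℚ) :* h := con 1ℚ :* (con 1ℚ :* con 1ℚ :* h)) refl (U x y ^ p))))
          where
          infixl 5 _⟨≡⟩_
          _⟨≡⟩_ : ∀ {x y z : ℚ} → x ≤ y → y ≡ z → x ≤ z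
          _⟨≡⟩_ = λ { h refl → h }
          con-3 : 1ℚ ℚ.* (1ℚ ℚ.* 1ℚ) ≡ 1ℚ * (1ℚ * 1ℚ)
          con-3 = solve 0 (con (1ℚ ℚ.* (1ℚ ℚ.* 1ℚ)) := con 1ℚ :* (con 1ℚ :* con 1ℚ)) refl
        go false o o' _ _ _ = ≤-reflexive (solve 3 (λ h a b → h :* (con 0ℚ :* a) := con 0ℚ :* b) refl (½ ^ p) (𝟙 o * 𝟙 o') _)
        go true false o' _ _ _ = ≤-reflexive (solve 3 (λ h a u → h :* (con 1ℚ :* (con 0ℚ :* a)) := con 1ℚ :* (con 0ℚ :* a :* u)) refl (½ ^ p) (𝟙 o') (U x y ^ p))
        go true true false _ _ _ = ≤-reflexive (solve 2 (λ h u → h :* (con 1ℚ :* (con 1ℚ :* con 0ℚ)) := con 1ℚ :* (con 1ℚ :* con 0ℚ :* u)) refl (½ ^ p) (U x y ^ p))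

    μ : ℚ
    μ = ½ ^ (p ℕ.+ (2 ℕ.+ d)) * (α * β)

    0≤μ : 0ℚ ≤ μ
    0≤μ = 0≤½^ (p ℕ.+ (2 ℕ.+ d)) ⊠ (0≤∣∣ X ⊠ 0≤∣∣ Y)

    large : μ ^ m ≤ 𝔼 (λ t → Q t ^ m)
    large = cancelˡ (0<^ (me ℕ.+ me) 𝕏.0<γ) (≤-trans (*-monoˡ (0≤^ (me ℕ.+ me) 0≤γ) absorb) (≤-trans (≤-reflexive (trans (solve 3 (λ e g k → e :* (g :* k) := g :* e :* k) refl (γ ^ (me ℕ.+ me)) γ (((3 ÷ 1) * μ) ^ m)) (sym (*-^ γ ((3 ÷ 1) * μ) m))))
      (≤-trans (^-mono m (0≤γ ⊠ (lit {0ℚ} {3 ÷ 1} ⊠ 0≤μ)) (≤-trans mass average)) (≤-trans (𝔼.E-pow (me ℕ.+ me) (λ t → 0≤𝟙 (D t)) 0≤Q) (*-monoˡ (0≤^ (me ℕ.+ me) 0≤γ) (𝔼.E-mono λ t → 𝟙*≤ (D t) (0≤^ m (0≤Q t))))))))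
      where
      0≤γ = 0≤∣∣ D
      mass : γ * ((3 ÷ 1) * μ) ≤ ½ ^ p * ((3 ÷ 4) * a)
      mass = ≤-trans (≤-reflexive (trans (cong (λ z → γ * ((3 ÷ 1) * (z * (α * β)))) (trans (^-+ ½ p (2 ℕ.+ d)) (cong (½ ^ p *_) (^-+ ½ 2 d)))) (solve 5 (λ γ h t a b → γ :* (con (3 ÷ 1) :* (h :* (con ½ :* (con ½ :* con 1ℚ) :* t) :* (a :* b))) := h :* (con (3 ÷ 4) :* (t :* (a :* b :* γ)))) refl γ (½ ^ p) (½ ^ d) α β)))
        (*-monoˡ (0≤½^ p) (*-monoˡ (lit {0ℚ} {3 ÷ 4}) (≤-trans (*-monoˡ (0≤½^ d) da) (≤-reflexive (trans (sym (*-assoc _ _ a)) (trans (*≡ʳ (trans (*-comm _ _) (2^½ d))) (*-identityˡ a)))))))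
      absorb : μ ^ m ≤ γ * ((3 ÷ 1) * μ) ^ m
      absorb = ≤-trans (≤-trans (≤-reflexive (sym (*-identityˡ _))) (*-monoʳ (0≤^ m 0≤μ) (≤-trans (≤-reflexive (sym (trans (*-comm _ _) (2^½ m)))) (*-mono (0≤½^ m) (≤-trans (½^-mono L≤m) Lγ) (0≤^ m (lit {0ℚ} {2ℚ})) (^-mono m (lit {0ℚ} {2ℚ}) (lit {2ℚ} {3 ÷ 1}))))))
        (≤-reflexive (trans (*-assoc γ _ _) (cong (γ *_) (sym (*-^ (3 ÷ 1) μ m)))))

    trip : Trip Q (ℍ.Q p) (𝔾.Q p)
    trip = Trip-cong (λ t → sym (pow-cv p ℍ.ok 𝔾.ok (λ x z → 𝕏.c * dev h x z) (λ y z → 𝕐.c * dev g y z) r t)) (λ t → sym (ℍ.Q-cv p t)) (λ t → sym (𝔾.Q-cv p t))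
      (Trip-scale (r ^ p) (0≤^ p 0≤r) (Trip-tup p λ v → Trip-cv _ _))

    contradiction : ⊥
    contradiction = cases (ℚP.≤-total (ℍ.T₁ ^ m) (𝔼 (λ t → ℍ.Q p t ^ m)))
      where
      0≤g : 0ℚ ≤ 𝔼 (λ t → 𝔾.Q p t ^ m)
      0≤g = 𝔼.E-0≤ λ t → 0≤^ m (𝔼.E-0≤ λ x → (0≤𝟙 (𝔾.ok x) ⊠ 0≤𝟙 (𝔾.ok (x ⊕ t))) ⊠ 0≤^even (𝔾.G x (x ⊕ t)) pe)
      prod : ℍ.T₁ ^ m * 𝔾.T₁ ^ m ≡ μ ^ m * μ ^ m
      prod = trans (sym (*-^ ℍ.T₁ 𝔾.T₁ m)) (trans (cong (_^ m) (solve 3 (λ h a b → h :* (a :* a) :* (h :* (b :* b)) := h :* (a :* b) :* (h :* (a :* b))) refl (½ ^ (p ℕ.+ (2 ℕ.+ d))) α β)) (*-^ μ μ m))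
      cases : (ℍ.T₁ ^ m ≤ 𝔼 (λ t → ℍ.Q p t ^ m)) ⊎ (𝔼 (λ t → ℍ.Q p t ^ m) ≤ ℍ.T₁ ^ m) → ⊥
      cases (inj₁ le) = ℍ.absurd le
      cases (inj₂ le) = 𝔾.absurd (cancelˡ (0<^ m ℍ.0<T₁) (≤-trans (≤-reflexive prod) (≤-trans (*-mono (0≤^ m 0≤μ) large (0≤^ m 0≤μ) large) (≤-trans (Trip-mean (Trip-^ m trip)) (*-monoʳ 0≤g le)))))

-- Density increments

weight : ∀ {n} → (F n → F n → Bool) → Fn n → ℚ → F n → F n → ℚ
weight A D t x y = 𝟙 (D (x ⊕ y)) * 𝟙 (A x y) - t * 𝟙 (D (x ⊕ y))

Main : ℚ → ℚ → ℕ → Set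
Main t ε n₀ = ∀ {n} → n₀ ℕ.≤ n → (A : F n → F n → Bool) → CornerFree A → ∀ X Y D → form (weight A D t) X Y ≤ ε

weight-form : ∀ {n} (A : F n → F n → Bool) X Y D t → form (weight A D t) X Y ≡ mean (part A X Y D) - t * tri X Y D
weight-form A X Y D t = trans (form-lin X Y _ (λ x y → 𝟙 (D (x ⊕ y))) t) (cong (λ z → z - t * tri X Y D) (𝔼.E-cong λ x → 𝔼.E-cong λ y → pt (A x y) (X x) (Y y) (D (x ⊕ y))))
  where
  pt : ∀ a b c d → 𝟙 b * 𝟙 c * (𝟙 d * 𝟙 a) ≡ 𝟙 (a ∧ (b ∧ (c ∧ d)))
  pt false b c d = trans (*≡ˡ (*-zeroʳ _)) (*-zeroʳ _)
  pt true b c d = trans (solve 3 (λ b c d → b :* c :* (d :* con 1ℚ) := b :* (c :* d)) refl (𝟙 b) (𝟙 c) (𝟙 d)) (sym (trans (𝟙-∧ b _) (cong (𝟙 b *_) (𝟙-∧ c d))))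

transposed : ∀ {n} {A : Set} → (F n → F n → A) → F n → F n → A
transposed A x y = A y x

CornerFree-transposed : ∀ {n} {A : F n → F n → Bool} → CornerFree A → CornerFree (transposed A)
CornerFree-transposed cf x y d ne (p , q , r) = cf y x d ne (p , r , q)

CornerFree-res : ∀ {r m n} {A : F n → F n → Bool} → CornerFree A → (φ : Flag r m n) → ∀ a b → CornerFree (res A φ a b)
CornerFree-res {A = A} cf φ a b x y d ne (p , q , r) = cf (e φ a x) (e φ b y) (e φ 𝟘 d) (λ z → ne (e-𝟘 φ d z))
  (p , subst (λ z → A z (e φ b y) ≡ true) (step a x) q , subst (λ z → A (e φ a x) z ≡ true) (step b y) r)
  where
  step : ∀ a x → e φ a (x ⊕ d) ≡ e φ a x ⊕ e φ 𝟘 d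
  step a x = sym (trans (e-⊕ φ a 𝟘 x d) (cong (λ z → e φ z (x ⊕ d)) (⊕-𝟘 a)))

den-e : ∀ {k r m n} (φ : Flag r m n) (H : Fn k) Z (f : F k → F n → Bool) → den H Z f ≡ 𝔼 (λ v → den H (Z ∘e (φ , v)) (λ y w → f y (e φ v w)))
den-e φ H Z f = trans (𝔼.E-cong λ y → trans (cong (𝟙 (H y) *_) (𝔼-e φ _)) (sym (𝔼.E-* _ _))) (𝔼-swap _)

∣∣-e : ∀ {r m n} (φ : Flag r m n) (Z : Fn n) → 𝔼 (λ v → ∣ Z ∘e (φ , v) ∣) ≡ ∣ Z ∣
∣∣-e φ Z = sym (𝔼-e φ _)

tri-den : ∀ {n} (H Z Q : Fn n) → tri H Z Q ≡ den H Z (λ y w → Q (y ⊕ w))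
tri-den H Z Q = form-x _ H Z

sums : ∀ {ρ m n} h u (κ : ℚ) R r (Y : Fn n) (φ : Flag ρ m n) v → 0ℚ ≤ κ → ρ ℕ.≤ R → R ℕ.+ RUL h u ℕ.≤ r → Spread r κ Y →
  ∀ H Z → den H Z (λ y z → Y (e φ v y ⊕ z)) ≤ (1ℚ + ½ ^ u) * ((1ℚ + κ) * ∣ Y ∣) * (∣ H ∣ * ∣ Z ∣) + ½ ^ h
sums h u κ R r Y φ v 0≤κ ρ≤ le sp H Z = ≤-trans (≤-reflexive (trans (den-e φ H Z (λ y z → Y (e φ v y ⊕ z))) (𝔼.E-cong λ v' → trans (𝔼.E-cong λ y → cong (𝟙 (H y) *_) (𝔼.E-cong λ w → cong (λ z → 𝟙 (Z (e φ v' w)) * 𝟙 (Y z)) (e-⊕ φ v v' y w))) (sym (tri-den H (Z ∘e (φ , v')) (Y ∘e (φ , v ⊕ v')))))))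
  (≤-trans (𝔼.E-mono λ v' → sum-bound h u (Y ∘e (φ , v ⊕ v')) b 0≤b (bd (v ⊕ v')) H (Z ∘e (φ , v'))) (≤-reflexive (trans (𝔼.E-+ _ _) (cong₂ _+_ (trans (𝔼.E-* _ _) (cong ((1ℚ + ½ ^ u) * b *_) (trans (𝔼.E-* _ _) (cong (∣ H ∣ *_) (∣∣-e φ Z))))) (𝔼.E-const _)))))
  where
  b = (1ℚ + κ) * ∣ Y ∣
  0≤b : 0ℚ ≤ b
  0≤b = (0≤1 ⊞ 0≤κ) ⊠ 0≤∣∣ Y
  bd : ∀ c → Bounded (RUL h u) b (Y ∘e (φ , c))
  bd c ψ d le' = ≤-trans (≤-reflexive (∣∣-cong λ y → cong Y (sym (e-++ φ ψ c d y)))) (sp (φ ++F ψ) (c ++ d) (ℕP.≤-trans (ℕP.+-mono-≤ ρ≤ le') le))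

rectangles : ∀ {t ε n₀} → 0ℚ ≤ t → Main t ε n₀ → ∀ {ρ m n} (A : F n → F n → Bool) → CornerFree A → ∀ X Y D (φ : Flag ρ m n) u → n₀ ℕ.≤ m →
  ∀ H Z → den H Z (λ y z → hₓ (part A X Y D) (e φ u y) z) ≤ t * den H Z (λ y z → Y (e φ u y ⊕ z)) + ε
rectangles {t} {ε} 0≤t M {m = m} A cf X Y D φ u le H Z = ≤-trans (≤-reflexive (den-e φ H Z (λ y z → hₓ (part A X Y D) (e φ u y) z))) (≤-trans (𝔼.E-mono each) (≤-reflexive (trans (𝔼.E-+ _ _) (cong₂ _+_ (trans (𝔼.E-* t _) (cong (t *_) (sym (den-e φ H Z (λ y z → Y (e φ u y ⊕ z)))))) (𝔼.E-const ε)))))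
  where
  each : ∀ v → den H (Z ∘e (φ , v)) (λ y w → hₓ (part A X Y D) (e φ u y) (e φ v w)) ≤ t * den H (Z ∘e (φ , v)) (λ y w → Y (e φ u y ⊕ e φ v w)) + ε
  each v = ≤-trans (≤-reflexive left) (≤-trans (≤by (dif (≤-trans (≤-reflexive (sym (weight-form A' X' Y' D' t))) (M le A' (CornerFree-res cf φ u (u ⊕ v)) X' Y' D'))) (solve 3 (λ m s ε → ε :- (m :- s) := s :+ ε :- m) refl (mean (part A' X' Y' D')) (t * tri X' Y' D') ε))
      (+-mono (*-monoˡ 0≤t right) ≤-refl))
    where
    A' : F m → F m → Bool
    A' = res A φ u (u ⊕ v)
    X' Y' D' : Fn m
    X' y = H y ∧ X (e φ u y)
    Y' y = Y (e φ (u ⊕ v) y)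
    D' w = Z (e φ v w) ∧ D (e φ v w)
    bool : ∀ h z a x y d → 𝟙 h * (𝟙 z * 𝟙 (a ∧ (x ∧ (y ∧ d)))) ≡ 𝟙 (a ∧ ((h ∧ x) ∧ (y ∧ (z ∧ d))))
    bool h z false x y d = trans (*≡ˡ (*-zeroʳ _)) (*-zeroʳ _)
    bool false z true x y d = *-zeroˡ _
    bool true z true false y d = trans (*-identityˡ _) (*-zeroʳ _)
    bool true z true true false d = trans (*-identityˡ _) (*-zeroʳ _)
    bool true z true true true d = trans (*-identityˡ _) (sym (𝟙-∧ z d))
    left : den H (Z ∘e (φ , v)) (λ y w → hₓ (part A X Y D) (e φ u y) (e φ v w)) ≡ mean (part A' X' Y' D')
    left = 𝔼.E-cong λ y → trans (sym (𝔼.E-* _ _)) (trans (𝔼.E-cong λ w → trans (bool (H y) (Z (e φ v w)) (A (e φ u y) (e φ u y ⊕ e φ v w)) (X (e φ u y)) (Y (e φ u y ⊕ e φ v w)) (D (e φ u y ⊕ (e φ u y ⊕ e φ v w))))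
        (cong 𝟙 (cong₂ (λ s d → A (e φ u y) s ∧ ((H y ∧ X (e φ u y)) ∧ (Y s ∧ d))) (e-⊕ φ u v y w) (trans (cong (λ z → Z (e φ v w) ∧ D z) (⊕-cancel (e φ u y) (e φ v w))) (cong D' (sym (⊕-cancel y w)))))))
      (𝔼-shiftˡ y (λ y' → 𝟙 (part A' X' Y' D' y y'))))
    right : tri X' Y' D' ≤ den H (Z ∘e (φ , v)) (λ y w → Y (e φ u y ⊕ e φ v w))
    right = 𝔼.E-mono λ y → ≤-trans (≤-reflexive (sym (𝔼-shiftˡ y _))) (≤-trans (𝔼.E-mono λ w → pt y w) (≤-reflexive (𝔼.E-* _ _)))
      where
      drop : ∀ h x y z d → 𝟙 (h ∧ x) * 𝟙 y * 𝟙 (z ∧ d) ≤ 𝟙 h * (𝟙 z * 𝟙 y)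
      drop h x y z d = ≤-trans (*-mono (0≤𝟙 (h ∧ x) ⊠ 0≤𝟙 y) (*-monoʳ (0≤𝟙 y) (∧≤ h x)) (0≤𝟙 (z ∧ d)) (∧≤ z d)) (≤-reflexive (solve 3 (λ h y z → h :* y :* z := h :* (z :* y)) refl (𝟙 h) (𝟙 y) (𝟙 z)))
        where
        ∧≤ : ∀ a b → 𝟙 (a ∧ b) ≤ 𝟙 a
        ∧≤ false b = ≤-refl
        ∧≤ true b = 𝟙≤1 b
      pt : ∀ y w → 𝟙 (X' y) * 𝟙 (Y' (y ⊕ w)) * 𝟙 (D' (y ⊕ (y ⊕ w))) ≤ 𝟙 (H y) * (𝟙 (Z (e φ v w)) * 𝟙 (Y (e φ u y ⊕ e φ v w)))
      pt y w = subst₂ (λ s z → 𝟙 (X' y) * 𝟙 (Y s) * 𝟙 (D' z) ≤ 𝟙 (H y) * (𝟙 (Z (e φ v w)) * 𝟙 (Y (e φ u y ⊕ e φ v w)))) (e-⊕ φ u v y w) (sym (⊕-cancel y w))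
        (drop (H y) (X (e φ u y)) (Y (e φ u y ⊕ e φ v w)) (Z (e φ v w)) (D (e φ v w)))

part-transposed : ∀ {n} (A : F n → F n → Bool) X Y D x y → part (transposed A) Y X D y x ≡ part A X Y D x y
part-transposed A X Y D x y = trans (cong (λ z → A x y ∧ (Y y ∧ (X x ∧ D z))) (⊕-comm y x)) (bool (A x y) (X x) (Y y) (D (x ⊕ y)))
  where
  bool : ∀ a x y d → a ∧ (y ∧ (x ∧ d)) ≡ a ∧ (x ∧ (y ∧ d))
  bool false x y d = refl
  bool true false false d = refl
  bool true false true d = refl
  bool true true false d = refl
  bool true true true d = refl

module Config (L d₀ : ℕ) (P : Par L (suc d₀)) (u : ℕ) (13≤u : 13 ℕ.≤ u) (t ε₃ ε' : ℚ) (n₀ : ℕ) (Lε : ½ ^ L ≤ ε₃) (lo : ½ ^ d₀ ≤ t) (t≤1 : t ≤ 1ℚ)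
  (ε'≤ : ε' ≤ ½ * (ε₃ * ½ ^ Par.K P)) (M : Main ((1ℚ + ½ ^ 12) * t) ε' n₀) where
  open Par P

  h H r : ℕ
  h = hG ℕ.+ (L ℕ.+ K ℕ.+ 2)
  H = suc H₁ ℕ.+ (L ℕ.+ u)
  r = R₄ ℕ.+ RUL h u ℕ.+ RTS H L u

  κ η t' : ℚ
  κ = ½ ^ (5 ℕ.+ u)
  η = ½ ^ u
  t' = (1ℚ + ½ ^ 12) * t

  ν = 1 ÷ 8192

  η≤ : η ≤ ν
  η≤ = ≤-trans (½^-mono 13≤u) (≤-reflexive (solve 0 (con ½ :* (con ½ :* (con ½ :* (con ½ :* (con ½ :* (con ½ :* (con ½ :* (con ½ :* (con ½ :* (con ½ :* (con ½ :* (con ½ :* (con ½ :* con 1ℚ)))))))))))) := con (1 ÷ 8192)) refl))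
  κ≤η : κ ≤ η
  κ≤η = ½^-mono (ℕP.m≤n+m u 5)

  0≤t : 0ℚ ≤ t
  0≤t = ≤-trans (0≤½^ d₀) lo
  0≤t' : 0ℚ ≤ t'
  0≤t' = (0≤1 ⊞ 0≤½^ 12) ⊠ 0≤t
  t'≤2 : t' ≤ 2ℚ
  t'≤2 = ≤-trans (*-mono (0≤1 ⊞ 0≤½^ 12) (+-mono (≤-refl {1ℚ}) (½^≤1 12)) 0≤t t≤1) (≤-reflexive (solve 0 ((con 1ℚ :+ con 1ℚ) :* con 1ℚ := con 2ℚ) refl))

  gap : (1ℚ + ½ ^ 12) * ((1ℚ + η) * (1ℚ + κ)) ≤ (513 ÷ 512) * ((1ℚ - η) * (1ℚ - η))
  gap = ≤-trans (*-monoˡ (0≤1 ⊞ 0≤½^ 12) (*-mono (0≤1 ⊞ 0≤½^ u) (+-mono (≤-refl {1ℚ}) η≤) (0≤1 ⊞ 0≤½^ (5 ℕ.+ u)) (+-mono (≤-refl {1ℚ}) (≤-trans κ≤η η≤))))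
    (≤-trans const (*-monoˡ (lit {0ℚ} {513 ÷ 512}) (*-mono 0≤1-ν 1-ν≤ 0≤1-ν 1-ν≤)))
    where
    0≤1-ν : 0ℚ ≤ 1ℚ - ν
    0≤1-ν = dif (lit {ν} {1ℚ})
    1-ν≤ : 1ℚ - ν ≤ 1ℚ - η
    1-ν≤ = +-mono (≤-refl {1ℚ}) (neg-anti η≤)
    cst : ℚ
    cst = (513 ÷ 512) ℚ.* ((1ℚ ℚ.- ν) ℚ.* (1ℚ ℚ.- ν)) ℚ.- (4097 ÷ 4096) ℚ.* ((1ℚ ℚ.+ ν) ℚ.* (1ℚ ℚ.+ ν))
    const : (1ℚ + ½ ^ 12) * ((1ℚ + ν) * (1ℚ + ν)) ≤ (513 ÷ 512) * ((1ℚ - ν) * (1ℚ - ν))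
    const = ≤by (lit {0ℚ} {cst}) (solve 0 (con cst := con (513 ÷ 512) :* ((con 1ℚ :- con ν) :* (con 1ℚ :- con ν)) :- (con 1ℚ :+ con ½ :* (con ½ :* (con ½ :* (con ½ :* (con ½ :* (con ½ :* (con ½ :* (con ½ :* (con ½ :* (con ½ :* (con ½ :* (con ½ :* con 1ℚ)))))))))))) :* ((con 1ℚ :+ con ν) :* (con 1ℚ :+ con ν))) refl)

  config : ∀ {n} → R₄ ℕ.+ n₀ ℕ.≤ n → 2 ℕ.+ (L ℕ.+ L) ℕ.≤ n → (A : F n → F n → Bool) → CornerFree A → ∀ X Y D → Spread r κ X → Spread r κ Y → form (weight A D t) X Y ≤ ε₃
  config {n} n≥ n≥' A cf X Y D sX sY = ≤-stable λ nope → contra (≤-trans (<⇒≤ (ℚP.≰⇒> nope)) (≤-reflexive (weight-form A X Y D t)))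
    where
    B = part A X Y D
    a α β γ σ : ℚ
    a = mean B
    α = ∣ X ∣
    β = ∣ Y ∣
    γ = ∣ D ∣
    σ = tri X Y D
    0≤σ : 0ℚ ≤ σ
    0≤σ = 𝔼.E-0≤ λ x → 𝔼.E-0≤ λ y → (0≤𝟙 (X x) ⊠ 0≤𝟙 (Y y)) ⊠ 0≤𝟙 (D (x ⊕ y))
    contra : ε₃ ≤ a - t * σ → ⊥
    contra big = Corner.Contradiction.contradiction A cf X Y D L (suc d₀) P Lα Lβ Lγ La da Rₓ Rᵧ (sums4 X sX) (sums4 Y sY) (doubled X sX) (doubled Y sY) (square X Lα sX) (square Y Lβ sY) n≥'
      where
      a≥ : ε₃ + t * σ ≤ a
      a≥ = ≤by (dif big) (solve 3 (λ a s l → a :- s :- l := a :- (l :+ s)) refl a (t * σ) ε₃)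
      ε≤a : ε₃ ≤ a
      ε≤a = ≤-trans (≤by (0≤t ⊠ 0≤σ) (solve 2 (λ l s → s := l :+ s :- l) refl ε₃ (t * σ))) a≥
      La : ½ ^ L ≤ a
      La = ≤-trans Lε ε≤a
      tσ≤ : t * σ ≤ a
      tσ≤ = ≤-trans (≤by (≤-trans (0≤½^ L) Lε) (solve 2 (λ l s → l := l :+ s :- s) refl ε₃ (t * σ))) a≥
      Lα : ½ ^ L ≤ α
      Lα = ≤-trans La (𝔼.E-mono λ x → 𝔼.E-≤ λ y → proj₁ (part-≤ A X Y D x y))
      Lβ : ½ ^ L ≤ β
      Lβ = ≤-trans La (≤-trans (≤-reflexive (𝔼-swap _)) (𝔼.E-mono λ y → 𝔼.E-≤ λ x → proj₁ (part-≤' A X Y D x y)))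
      Lγ : ½ ^ L ≤ γ
      Lγ = ≤-trans La (𝔼.E-≤ λ x → ≤-trans (≤-reflexive (sym (𝔼-shiftˡ x _))) (𝔼.E-mono λ z → ≤-trans (proj₂ (part-≤ A X Y D x (x ⊕ z))) (≤-trans (*-monoˡ (0≤𝟙 (D (x ⊕ (x ⊕ z)))) (𝟙≤1 (Y (x ⊕ z)))) (≤-reflexive (trans (*-identityʳ _) (cong (λ w → 𝟙 (D w)) (⊕-cancel x z)))))))
      spread-mono : ∀ {R} X → R ℕ.≤ r → Spread r κ X → Spread R κ X
      spread-mono X le s φ c le' = s φ c (ℕP.≤-trans le' le)
      ts≤ : RTS H L u ℕ.≤ r
      ts≤ = ℕP.m≤n+m (RTS H L u) (R₄ ℕ.+ RUL h u)
      ul≤ : R₄ ℕ.+ RUL h u ℕ.≤ r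
      ul≤ = ℕP.m≤m+n _ _
      σ≥ : (1ℚ - η) * (1ℚ - η) * (α * β * γ) ≤ σ
      σ≥ = ≤-trans (≤by (((dif (≤-trans η≤ (lit {ν} {1ℚ}))) ⊠ (0≤∣∣ X ⊠ 0≤∣∣ Y)) ⊠ dif small) (solve 5 (λ n a b g h → (con 1ℚ :- n) :* (a :* b) :* (n :* g :- h) := (con 1ℚ :- n) :* (a :* b) :* (g :- h) :- (con 1ℚ :- n) :* (con 1ℚ :- n) :* (a :* b :* g)) refl η α β γ (½ ^ H)))
          (proj₂ (tri-spread X Y D H L u Lα Lβ (spread-mono X ts≤ sX) (spread-mono Y ts≤ sY)))
        where
        small : ½ ^ H ≤ η * γ
        small = ≤-trans (½^-mono (ℕP.≤-trans (ℕP.m≤n+m (L ℕ.+ u) (suc H₁)) ℕP.≤-refl)) (≤-trans (≤-reflexive (trans (^-+ ½ L u) (*-comm _ _))) (*-monoˡ (0≤½^ u) Lγ))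
      0≤αβγ : 0ℚ ≤ α * β * γ
      0≤αβγ = (0≤∣∣ X ⊠ 0≤∣∣ Y) ⊠ 0≤∣∣ D
      da : α * β * γ ≤ 2ℚ ^ suc d₀ * a
      da = ≤-trans (≤-trans (≤-trans (≤-reflexive (trans (sym (*-identityˡ _)) (*≡ʳ (sym (2^½ (suc d₀)))))) (≤-reflexive (solve 3 (λ p h x → p :* (con ½ :* h) :* x := p :* (h :* (con ½ :* x))) refl (2ℚ ^ suc d₀) (½ ^ d₀) (α * β * γ))))
          (*-monoˡ (0≤^ (suc d₀) (lit {0ℚ} {2ℚ})) (*-mono (0≤½^ d₀) lo (0≤½ ⊠ 0≤αβγ) (≤-trans (*-monoʳ 0≤αβγ half) σ≥)))) (*-monoˡ (0≤^ (suc d₀) (lit {0ℚ} {2ℚ})) tσ≤)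
        where
        3/4≤ : 3 ÷ 4 ≤ 1ℚ - η
        3/4≤ = ≤-trans (≤-reflexive (solve 0 (con (3 ÷ 4) := con 1ℚ :- con (1 ÷ 4)) refl)) (+-mono (≤-refl {1ℚ}) (neg-anti (≤-trans η≤ (lit {ν} {1 ÷ 4}))))
        half : ½ ≤ (1ℚ - η) * (1ℚ - η)
        half = ≤-trans (≤by (lit {0ℚ} {1 ÷ 16}) (solve 0 (con (1 ÷ 16) := con (3 ÷ 4) :* con (3 ÷ 4) :- con ½) refl)) (*-mono (lit {0ℚ} {3 ÷ 4}) 3/4≤ (lit {0ℚ} {3 ÷ 4}) 3/4≤)
      sums' : ∀ X → Spread r κ X → ∀ {ρ m} (φ : Flag ρ m n) v → ρ ℕ.≤ R₄ → ∀ H Z → den H Z (λ y z → X (e φ v y ⊕ z)) ≤ (1ℚ + η) * ((1ℚ + κ) * ∣ X ∣) * (∣ H ∣ * ∣ Z ∣) + ½ ^ h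
      sums' X sX φ v le = sums h u κ R₄ r X φ v (0≤½^ (5 ℕ.+ u)) le ul≤ sX
      sums4 : ∀ X → Spread r κ X → Corner.Sums A cf X Y D L (suc d₀) P X
      sums4 X sX φ v le H Z = ≤-trans (sums' X sX φ v le H Z) (+-mono (*-monoʳ (0≤∣∣ H ⊠ 0≤∣∣ Z) (≤-trans (*-mono (0≤1 ⊞ 0≤½^ u) (+-mono (≤-refl {1ℚ}) (½^≤1 u)) ((0≤1 ⊞ 0≤½^ (5 ℕ.+ u)) ⊠ 0≤∣∣ X) (*-monoʳ (0≤∣∣ X) (+-mono (≤-refl {1ℚ}) (½^≤1 (5 ℕ.+ u)))))
         (≤-reflexive (solve 1 (λ x → (con 1ℚ :+ con 1ℚ) :* ((con 1ℚ :+ con 1ℚ) :* x) := con (4 ÷ 1) :* x) refl ∣ X ∣)))) (½^-mono (ℕP.m≤m+n hG _)))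
      doubled : ∀ X → Spread r κ X → Corner.Doubled A cf X Y D L (suc d₀) P X
      doubled X sX φ v le = ≤-trans (sX φ v (ℕP.≤-trans le (ℕP.≤-trans (ℕP.m≤m+n R₄ _) ul≤))) (*-monoʳ (0≤∣∣ X) (≤-trans (+-mono (≤-refl {1ℚ}) (½^≤1 (5 ℕ.+ u))) (≤-reflexive (solve 0 (con 1ℚ :+ con 1ℚ := con 2ℚ) refl))))
      square : ∀ X → ½ ^ L ≤ ∣ X ∣ → Spread r κ X → Corner.Square A cf X Y D L (suc d₀) P X
      square X LX sX = ≤-trans (𝔼.E-mono λ t → pt t) (≤-trans ts (½^-mono (ℕP.m≤m+n (suc H₁) (L ℕ.+ u))))
        where
        open TS X X H L u LX LX (spread-mono X ts≤ sX) (spread-mono X ts≤ sX) using (Bad; ts; upper)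
        0<x : 0ℚ < ∣ X ∣
        0<x = <-≤ (0<½^ L) LX
        pt : ∀ t → 𝟙 ((2ℚ * (∣ X ∣ * ∣ X ∣)) ≤ᵇ (X ∘∘ X) t) ≤ 𝟙 (Bad t)
        pt t = 𝔹-elim (λ b → 𝟙 ((2ℚ * (∣ X ∣ * ∣ X ∣)) ≤ᵇ (X ∘∘ X) t) ≤ 𝟙 b) (Bad t) (λ _ → 𝟙≤1 ((2ℚ * (∣ X ∣ * ∣ X ∣)) ≤ᵇ (X ∘∘ X) t))
          (λ ok → ≤ᵇ-elim (λ b → 𝟙 b ≤ 0ℚ) (2ℚ * (∣ X ∣ * ∣ X ∣)) ((X ∘∘ X) t) (λ le → ⊥-elim (<⇒≱ (0<* 0<x 0<x) (≤by (dif (≤-trans le (upper t ok)) ⊞ ((dif (≤-trans η≤ (lit {ν} {½})) ⊠ (0≤∣∣ X ⊠ 0≤∣∣ X)) ⊞ (dif (≤-trans le (upper t ok)) ⊞ (dif (≤-trans η≤ (lit {ν} {½})) ⊠ (0≤∣∣ X ⊠ 0≤∣∣ X)))))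
              (solve 2 (λ n x → (con 1ℚ :+ n) :* x :- con 2ℚ :* x :+ ((con ½ :- n) :* x :+ ((con 1ℚ :+ n) :* x :- con 2ℚ :* x :+ (con ½ :- n) :* x)) := con 0ℚ :- x) refl η (∣ X ∣ * ∣ X ∣))))) (λ _ → ≤-refl))
      increments : ∀ A → CornerFree A → ∀ X Y → Spread r κ Y → t * ((1ℚ - η) * (1ℚ - η) * (∣ X ∣ * ∣ Y ∣ * γ)) ≤ a →
        ∀ {ρ m} (φ : Flag ρ m n) v → ρ ℕ.≤ R₄ → ∀ H Z → (∣ X ∣ * γ) * den H Z (λ y z → hₓ (part A X Y D) (e φ v y) z) ≤ a * ((513 ÷ 512) * (∣ H ∣ * ∣ Z ∣) + (∣ X ∣ * γ) * ½ ^ K)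
      increments A cf X Y sY ta {ρ} {m} φ v le H Z = ≤-trans (*-monoˡ 0≤xγ (≤-trans (rectangles 0≤t' M A cf X Y D φ v m≥ H Z) (+-mono (*-monoˡ 0≤t' (sums' Y sY φ v le H Z)) ε'≤)))
          (≤by (((0≤t ⊠ (0≤∣∣ Y ⊠ (0≤xγ ⊠ 0≤hz))) ⊠ dif gap) ⊞ ((lit {0ℚ} {513 ÷ 512} ⊠ 0≤hz) ⊠ dif ta) ⊞ (0≤xγ ⊠ dif small))
            (solve 12 (λ z η κ t x y g hz w a k l → (t :* (y :* ((x :* g) :* hz))) :* (con (513 ÷ 512) :* ((con 1ℚ :- η) :* (con 1ℚ :- η)) :- (con 1ℚ :+ z) :* ((con 1ℚ :+ η) :* (con 1ℚ :+ κ)))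
                 :+ con (513 ÷ 512) :* hz :* (a :- t :* ((con 1ℚ :- η) :* (con 1ℚ :- η) :* (x :* y :* g))) :+ (x :* g) :* (a :* k :- ((con 1ℚ :+ z) :* t :* w :+ con ½ :* (l :* k)))
               := a :* (con (513 ÷ 512) :* hz :+ (x :* g) :* k) :- (x :* g) :* ((con 1ℚ :+ z) :* t :* ((con 1ℚ :+ η) :* ((con 1ℚ :+ κ) :* y) :* hz :+ w) :+ con ½ :* (l :* k))) refl (½ ^ 12) η κ t (∣ X ∣) (∣ Y ∣) γ (∣ H ∣ * ∣ Z ∣) (½ ^ h) a (½ ^ K) ε₃))
        where
        0≤xγ : 0ℚ ≤ ∣ X ∣ * γ
        0≤xγ = 0≤∣∣ X ⊠ 0≤∣∣ D
        0≤hz : 0ℚ ≤ ∣ H ∣ * ∣ Z ∣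
        0≤hz = 0≤∣∣ H ⊠ 0≤∣∣ Z
        m≥ : n₀ ℕ.≤ m
        m≥ = ℕP.+-cancelˡ-≤ ρ n₀ m (ℕP.≤-trans (ℕP.+-monoˡ-≤ n₀ le) (ℕP.≤-trans n≥ (ℕP.≤-reflexive (sym (flag-dim φ)))))
        small : t' * ½ ^ h + ½ * (ε₃ * ½ ^ K) ≤ a * ½ ^ K
        small = ≤-trans (+-mono (*-mono 0≤t' t'≤2 (0≤½^ h) (½^-mono (ℕP.m≤n+m (L ℕ.+ K ℕ.+ 2) hG))) ≤-refl)
          (≤-trans (≤-reflexive (cong (λ z → 2ℚ * z + ½ * (ε₃ * ½ ^ K)) (trans (^-+ ½ (L ℕ.+ K) 2) (cong (_* ½ ^ 2) (^-+ ½ L K))))) (≤by (dif (*-monoʳ (0≤½^ K) ε≤a) ⊞ (0≤½ ⊠ dif (*-monoʳ (0≤½^ K) Lε)))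
            (solve 3 (λ a e x → a :- e :+ con ½ :* (e :- x) := a :- (con 2ℚ :* (x :* (con ½ :* (con ½ :* con 1ℚ))) :+ con ½ :* e)) refl (a * ½ ^ K) (ε₃ * ½ ^ K) (½ ^ L * ½ ^ K))))
      tσ' : t * ((1ℚ - η) * (1ℚ - η) * (α * β * γ)) ≤ a
      tσ' = ≤-trans (*-monoˡ 0≤t σ≥) tσ≤
      Rₓ : Corner.Rectangles A cf X Y D L (suc d₀) P (Corner.h A cf X Y D L (suc d₀) P) α
      Rₓ = increments A cf X Y sY tσ'
      Rᵧ : Corner.Rectangles A cf X Y D L (suc d₀) P (Corner.g A cf X Y D L (suc d₀) P) β
      Rᵧ φ v le H Z = ≤-trans (≤-reflexive (cong (β * γ *_) (𝔼.E-cong λ y → cong (𝟙 (H y) *_) (𝔼.E-cong λ z → cong (λ b → 𝟙 (Z z) * 𝟙 b) (sym (part-transposed A X Y D _ _))))))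
        (increments (transposed A) (CornerFree-transposed cf) Y X sX (subst (λ z → t * ((1ℚ - η) * (1ℚ - η) * (z * γ)) ≤ a) (*-comm α β) tσ') φ v le H Z)

Main-trivial : ∀ {t ε n₀} → 1ℚ ≤ t → 0ℚ ≤ ε → Main t ε n₀
Main-trivial {t} 1≤t 0≤ε _ A cf X Y D = ≤-trans (𝔼.E-≤ λ x → 𝔼.E-≤ λ y → ≤-trans (*-monoˡ (0≤𝟙 (X x) ⊠ 0≤𝟙 (Y y)) (pt (D (x ⊕ y)) (A x y))) (≤-reflexive (*-zeroʳ _))) 0≤ε
  where
  pt : ∀ d a → 𝟙 d * 𝟙 a - t * 𝟙 d ≤ 0ℚ
  pt d a = ≤by (0≤𝟙 d ⊠ (dif 1≤t ⊞ dif (𝟙≤1 a))) (solve 3 (λ d a t → d :* (t :- con 1ℚ :+ (con 1ℚ :- a)) := con 0ℚ :- (d :* a :- t :* d)) refl (𝟙 d) (𝟙 a) t)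

RSP-mono : ∀ r k {I J} → I ℕ.≤ J → RSP r k I ℕ.≤ RSP r k J
RSP-mono r k {I} {J} le = subst₂ ℕ._≤_ (sym (RSP-def r k I)) (sym (RSP-def r k J)) (ℕP.*-mono-≤ le (ℕP.+-mono-≤ (ℕP.*-mono-≤ (ℕ.s≤s (ℕP.*-mono-≤ (ℕP.*-monoˡ-≤ J.N (ℕP.*-monoʳ-≤ 32 (ℕP.*-mono-≤ T≤ T≤))) T≤)) (ℕP.+-monoˡ-≤ r R≤)) R≤))
  where
  module I = SPparams r k I
  module J = SPparams r k J
  T≤ : I.T ℕ.≤ J.T
  T≤ = ℕP.+-monoʳ-≤ 8 (ℕP.+-mono-≤ le le)
  R≤ : I.R₂ ℕ.≤ J.R₂
  R≤ = ℕP.*-monoˡ-≤ r (ℕ.s≤s (ℕP.*-monoʳ-≤ J.N T≤))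

module Iterate (L d₀ : ℕ) (P : Par L (suc d₀)) (u : ℕ) (13≤u : 13 ℕ.≤ u) (w J I⁺ : ℕ)
  (I≡ : I⁺ ≡ d₀ ℕ.+ J ℕ.* (4 ℕ.+ (w ℕ.+ w) ℕ.+ suc (Par.K P))) (L≡ : L ≡ I⁺ ℕ.+ (4 ℕ.+ (w ℕ.+ w))) (hw : 8 ℕ.+ (I⁺ ℕ.+ I⁺) ℕ.≤ 2 ℕ.^ w)
  (grown : 1ℚ ≤ (1ℚ + ½ ^ 12) ^ J * ½ ^ d₀) where
  open Par P using (K; hG; H₁; R₄)

  Δ h H r S₀ : ℕ
  Δ = 4 ℕ.+ (w ℕ.+ w) ℕ.+ suc K
  h = hG ℕ.+ (L ℕ.+ K ℕ.+ 2)
  H = suc H₁ ℕ.+ (L ℕ.+ u)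
  r = R₄ ℕ.+ RUL h u ℕ.+ RTS H L u
  S₀ = RSP r (5 ℕ.+ u) I⁺ ℕ.+ (R₄ ℕ.+ (2 ℕ.+ (L ℕ.+ L)))

  step : ∀ {t n₀} I → I ℕ.≤ I⁺ → ½ ^ d₀ ≤ t → t ≤ 1ℚ → Main ((1ℚ + ½ ^ 12) * t) (½ ^ (Δ ℕ.+ I)) n₀ → Main t (½ ^ I) (S₀ ℕ.+ n₀)
  step {t} {n₀} I I≤ lo t≤1 M {n} n≥ A cf X Y D = SP.sp r (5 ℕ.+ u) I (ℕ.s≤s ℕ.z≤n) ε₃ (0≤½^ E₃) small W W≤1 sm X Y
    where
    E₃ : ℕ
    E₃ = I ℕ.+ (4 ℕ.+ (w ℕ.+ w))
    ε₃ : ℚ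
    ε₃ = ½ ^ E₃
    ε'≤ : ½ ^ (Δ ℕ.+ I) ≤ ½ * (ε₃ * ½ ^ K)
    ε'≤ = ≤-reflexive (trans (cong (½ ^_) (ℕS.solve 3 (λ I w K → w ℕS.:+ (ℕS.con 1 ℕS.:+ K) ℕS.:+ I ℕS.:= ℕS.con 1 ℕS.:+ (I ℕS.:+ w ℕS.:+ K)) refl I (4 ℕ.+ (w ℕ.+ w)) K)) (cong (½ *_) (^-+ ½ E₃ K)))
    Lε : ½ ^ L ≤ ε₃
    Lε = ½^-mono (subst (E₃ ℕ.≤_) (sym L≡) (ℕP.+-monoˡ-≤ _ I≤))
    T : ℕ
    T = 8 ℕ.+ (I ℕ.+ I)
    ιT≤ : ι T ≤ 2ℚ ^ w
    ιT≤ = ≤-trans (ι-mono (ℕP.≤-trans (ℕP.+-monoʳ-≤ 8 (ℕP.+-mono-≤ I≤ I≤)) hw)) (≤-reflexive (trans (ι-^ 2 w) (cong (_^ w) (solve 0 (con 1ℚ :+ (con 1ℚ :+ con 0ℚ) := con 2ℚ) refl))))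
    small : (16 ÷ 1) * (ι T * ι T) * ε₃ ≤ ½ ^ I
    small = ≤-trans (*-monoʳ (0≤½^ E₃) (*-monoˡ (lit {0ℚ} {16 ÷ 1}) (*-mono (0≤ι T) ιT≤ (0≤ι T) ιT≤)))
      (≤-reflexive (trans (cong (λ z → (16 ÷ 1) * (2ℚ ^ w * 2ℚ ^ w) * z) (trans (^-+ ½ I _) (cong (½ ^ I *_) (trans (^-+ ½ 4 (w ℕ.+ w)) (cong (½ ^ 4 *_) (^-+ ½ w w))))))
        (trans (solve 3 (λ p h i → con (16 ÷ 1) :* (p :* p) :* (i :* ((con ½ :* (con ½ :* (con ½ :* (con ½ :* con 1ℚ)))) :* (h :* h))) := i :* ((p :* h) :* (p :* h))) refl (2ℚ ^ w) (½ ^ w) (½ ^ I))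
          (trans (cong (λ z → ½ ^ I * (z * z)) (2^½ w)) (trans (cong (½ ^ I *_) (*-identityˡ 1ℚ)) (*-identityʳ _))))))
    0≤t : 0ℚ ≤ t
    0≤t = ≤-trans (0≤½^ d₀) lo
    W : F n → F n → ℚ
    W = weight A D t
    W≤1 : ∀ x y → W x y ≤ 1ℚ
    W≤1 x y = ≤-trans (≤by (0≤t ⊠ 0≤𝟙 (D (x ⊕ y))) (solve 2 (λ a b → b := a :- (a :- b)) refl _ (t * 𝟙 (D (x ⊕ y))))) (≤-trans (𝟙*≤ (D (x ⊕ y)) (0≤𝟙 (A x y))) (𝟙≤1 (A x y)))
    sm : Small r (½ ^ (5 ℕ.+ u)) (δSP I) (RSP r (5 ℕ.+ u) I) ε₃ W
    sm {ρ} {m} φ a b X' Y' le sX sY _ _ = ≤-trans (≤-reflexive (form-cong X' Y' λ x y → cong (λ z → 𝟙 (D z) * 𝟙 (A (e φ a x) (e φ b y)) - t * 𝟙 (D z)) (e-⊕ φ a b x y)))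
        (Config.config L d₀ P u 13≤u t ε₃ (½ ^ (Δ ℕ.+ I)) n₀ Lε lo t≤1 ε'≤ M (ℕP.≤-trans (ℕP.+-monoˡ-≤ n₀ (ℕP.m≤m+n R₄ (2 ℕ.+ (L ℕ.+ L)))) m≥) (ℕP.≤-trans (ℕP.≤-trans (ℕP.m≤n+m (2 ℕ.+ (L ℕ.+ L)) R₄) (ℕP.m≤m+n _ n₀)) m≥)
          (res A φ a b) (CornerFree-res cf φ a b) X' Y' (D ∘e (φ , a ⊕ b)) sX sY)
      where
      m≥ : R₄ ℕ.+ (2 ℕ.+ (L ℕ.+ L)) ℕ.+ n₀ ℕ.≤ m
      m≥ = ℕP.+-cancelˡ-≤ ρ _ m (ℕP.≤-trans (ℕP.+-monoˡ-≤ _ (ℕP.≤-trans le (RSP-mono r (5 ℕ.+ u) I≤)))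
        (ℕP.≤-trans (ℕP.≤-reflexive (sym (ℕP.+-assoc (RSP r (5 ℕ.+ u) I⁺) (R₄ ℕ.+ (2 ℕ.+ (L ℕ.+ L))) n₀))) (ℕP.≤-trans n≥ (ℕP.≤-reflexive (sym (flag-dim φ))))))

  target : ℕ → ℚ
  target i = (1ℚ + ½ ^ 12) ^ i * ½ ^ d₀

  iterate : ∀ j i → i ℕ.+ j ≡ J → Main (target i) (½ ^ (i ℕ.* Δ ℕ.+ d₀)) (j ℕ.* S₀)
  iterate zero i eq = Main-trivial (subst (λ i → 1ℚ ≤ target i) (trans (sym eq) (ℕP.+-identityʳ i)) grown) (0≤½^ (i ℕ.* Δ ℕ.+ d₀))
  iterate (suc j) i eq = cases (ℚP.≤-total 1ℚ (target i))
    where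
    next : Main ((1ℚ + ½ ^ 12) * target i) (½ ^ (Δ ℕ.+ (i ℕ.* Δ ℕ.+ d₀))) (j ℕ.* S₀)
    next = subst₂ (λ a b → Main a (½ ^ b) (j ℕ.* S₀)) (*-assoc _ _ _) (ℕP.+-assoc Δ (i ℕ.* Δ) d₀) (iterate j (suc i) (trans (sym (ℕP.+-suc i j)) eq))
    I≤ : i ℕ.* Δ ℕ.+ d₀ ℕ.≤ I⁺
    I≤ = subst (i ℕ.* Δ ℕ.+ d₀ ℕ.≤_) (trans (ℕP.+-comm (J ℕ.* Δ) d₀) (sym I≡)) (ℕP.+-monoˡ-≤ d₀ (ℕP.*-monoˡ-≤ Δ (subst (i ℕ.≤_) eq (ℕP.m≤m+n i (suc j)))))
    cases : (1ℚ ≤ target i) ⊎ (target i ≤ 1ℚ) → Main (target i) (½ ^ (i ℕ.* Δ ℕ.+ d₀)) (suc j ℕ.* S₀)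
    cases (inj₁ le) = Main-trivial le (0≤½^ (i ℕ.* Δ ℕ.+ d₀))
    cases (inj₂ le) = step (i ℕ.* Δ ℕ.+ d₀) I≤ (≤-trans (≤-reflexive (sym (*-identityˡ _))) (*-monoʳ (0≤½^ d₀) (1≤^ i (≤by (0≤½^ 12) (solve 1 (λ h → h := con 1ℚ :+ h :- con 1ℚ) refl (½ ^ 12)))))) le next

  main : Main (½ ^ d₀) (½ ^ d₀) (J ℕ.* S₀)
  main = subst (λ t → Main t (½ ^ d₀) (J ℕ.* S₀)) (*-identityˡ _) (iterate J 0 refl)

-- Choice of parameters

record Poly (f : ℕ → ℕ) : Set where
  constructor poly
  field
    deg C : ℕ
    bd : ∀ d → f d ℕ.≤ C ℕ.* suc d ℕ.^ deg
open Poly using (bd)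

pow-mono : ∀ d {j k} → j ℕ.≤ k → suc d ℕ.^ j ℕ.≤ suc d ℕ.^ k
pow-mono d le = ℕP.^-monoʳ-≤ (suc d) le

raise : ∀ {f} (P : Poly f) k → Poly.deg P ℕ.≤ k → ∀ d → f d ℕ.≤ Poly.C P ℕ.* suc d ℕ.^ k
raise P k le d = ℕP.≤-trans (bd P d) (ℕP.*-monoʳ-≤ (Poly.C P) (pow-mono d le))

infixl 6 _⊹_
infixl 7 _⊛_

_⊹_ : ∀ {f g} → Poly f → Poly g → Poly (λ d → f d ℕ.+ g d)
P ⊹ Q = poly k (Poly.C P ℕ.+ Poly.C Q) λ d →
    ℕP.≤-trans (ℕP.+-mono-≤ (raise P k (ℕP.m≤m⊔n _ _) d) (raise Q k (ℕP.m≤n⊔m _ _) d)) (ℕP.≤-reflexive (sym (ℕP.*-distribʳ-+ (suc d ℕ.^ k) (Poly.C P) (Poly.C Q))))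
  where
  k = Poly.deg P ℕ.⊔ Poly.deg Q

_⊛_ : ∀ {f g} → Poly f → Poly g → Poly (λ d → f d ℕ.* g d)
P ⊛ Q = poly (Poly.deg P ℕ.+ Poly.deg Q) (Poly.C P ℕ.* Poly.C Q) λ d →
    ℕP.≤-trans (ℕP.*-mono-≤ (bd P d) (bd Q d)) (ℕP.≤-reflexive (trans (ℕS.solve 4 (λ a b c d → (a ℕS.:* b) ℕS.:* (c ℕS.:* d) ℕS.:= (a ℕS.:* c) ℕS.:* (b ℕS.:* d)) refl (Poly.C P) (suc d ℕ.^ Poly.deg P) (Poly.C Q) (suc d ℕ.^ Poly.deg Q))
      (cong (Poly.C P ℕ.* Poly.C Q ℕ.*_) (sym (ℕP.^-distribˡ-+-* (suc d) (Poly.deg P) (Poly.deg Q))))))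

κP : ∀ c → Poly (λ _ → c)
κP c = poly 0 c λ d → ℕP.≤-reflexive (sym (ℕP.*-identityʳ c))

idP : Poly suc
idP = poly 1 1 λ d → ℕP.≤-reflexive (sym (trans (ℕP.*-identityˡ _) (ℕP.*-identityʳ _)))

congP : ∀ {f g} → (∀ d → f d ≡ g d) → Poly f → Poly g
congP h P = poly (Poly.deg P) (Poly.C P) λ d → subst (ℕ._≤ _) (h d) (bd P d)

sucP : ∀ {f} → Poly f → Poly (λ d → suc (f d))
sucP P = κP 1 ⊹ P

RAP-poly : ∀ {h} s → Poly h → Poly (λ d → RAP (h d) s)
RAP-poly {h} s P = congP (λ d → sym (RAP-def (h d) s)) (sucP (H ⊹ H))
  where
  i : Poly (λ d → APparams.i (h d) s)
  i = sucP (κP s ⊹ P)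
  q : Poly (λ d → APparams.q (h d) s)
  q = i ⊛ κP (2 ℕ.^ (3 ℕ.+ s))
  l : Poly (λ d → APparams.l (h d) s)
  l = κP 64 ⊛ (q ⊛ q)
  j : Poly (λ d → APparams.j (h d) s)
  j = i ⊹ (κP s ⊹ P ⊹ κP 2)
  H : Poly (λ d → APparams.H (h d) s)
  H = κP 2 ⊹ j ⊛ (l ⊛ P)

RBKM-poly : ∀ {H L} s → Poly H → Poly L → Poly (λ d → RBKM (H d) (L d) s)
RBKM-poly {H} {L} s P Q = congP (λ d → sym (RBKM-def (H d) (L d) s)) (RAP-poly (suc s) (sucP (P ⊹ l ⊛ Q)))
  where
  l : Poly (λ d → BKMparams.l (H d) (L d) s)
  l = κP (2 ℕ.^ s) ⊛ (P ⊹ κP s ⊹ κP 2)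

RTS-poly : ∀ {H L} u → Poly H → Poly L → Poly (λ d → RTS (H d) (L d) u)
RTS-poly {H} {L} u P Q = congP (λ d → sym (RTS-def (H d) (L d) u)) (RBKM-poly (5 ℕ.+ u) (P ⊹ κP 4 ⊹ sucP (e' ⊹ e') ⊛ (κP u ⊹ (Q ⊹ Q))) Q)
  where
  e' : Poly (λ d → TSparams.e' (H d) (L d) u)
  e' = P ⊹ κP 2

RSP-poly : ∀ {r I} k → Poly r → Poly I → Poly (λ d → RSP (r d) k (I d))
RSP-poly {r} {I} k P Q = congP (λ d → sym (RSP-def (r d) k (I d))) (Q ⊛ (R₁ ⊹ R₂))
  where
  T : Poly (λ d → SPparams.T (r d) k (I d))
  T = κP 8 ⊹ (Q ⊹ Q)
  N : Poly (λ d → SPparams.N (r d) k (I d))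
  N = κP (2 ℕ.^ k)
  R₂ : Poly (λ d → SPparams.R₂ (r d) k (I d))
  R₂ = sucP (N ⊛ T) ⊛ P
  N₁ : Poly (λ d → SPparams.N₁ (r d) k (I d))
  N₁ = κP 32 ⊛ (T ⊛ T) ⊛ N
  R₁ : Poly (λ d → SPparams.R₁ (r d) k (I d))
  R₁ = sucP (N₁ ⊛ T) ⊛ (R₂ ⊹ P)

RUL-poly : ∀ {h} u → Poly h → Poly (λ d → RUL (h d) u)
RUL-poly {h} u P = congP (λ d → sym (RUL-def (h d) u)) (RSP-poly (5 ℕ.+ u) (RTS-poly u (P ⊹ (κP 4 ⊹ (T ⊹ T))) (sucP T)) P)
  where
  T : Poly (λ d → 8 ℕ.+ (h d ℕ.+ h d))
  T = κP 8 ⊹ (P ⊹ P)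

opaque
  c₇ c₈ c₁₂ u₁₃ : ℕ
  c₇ = 2 ℕ.^ 7
  c₈ = 2 ℕ.^ 8
  c₁₂ = 2 ℕ.^ 12
  u₁₃ = 13

  2≤c₇ : 2ℚ ≤ (1ℚ + ½ ^ 7) ^ c₇
  2≤c₇ = two≤ (2 ℕ.^ 7) (½^2^ 7)

  2≤c₈ : 2ℚ ≤ (1ℚ + ½ ^ 8) ^ c₈
  2≤c₈ = two≤ (2 ℕ.^ 8) (½^2^ 8)

  2≤c₁₂ : 2ℚ ≤ (1ℚ + ½ ^ 12) ^ c₁₂
  2≤c₁₂ = two≤ (2 ℕ.^ 12) (½^2^ 12)

  13≤u₁₃ : 13 ℕ.≤ u₁₃
  13≤u₁₃ = ℕP.≤-refl

module Choice (L d : ℕ) where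
  pe p q' l₀ : ℕ
  pe = d ℕ.+ 2
  p = pe ℕ.+ pe
  q' = c₇ ℕ.* (9 ℕ.+ (p ℕ.+ p) ℕ.+ d)
  l₀ = c₈ ℕ.* (4 ℕ.+ d)

  2^≤ : ∀ {x} c → 2ℚ ≤ x ^ c → ∀ k → 2ℚ ^ k ≤ x ^ (c ℕ.* k)
  2^≤ {x} c h k = ≤-trans (^-mono k (lit {0ℚ} {2ℚ}) h) (≤-reflexive (sym (^-* x c k)))

  ratio : ∀ k (x y z : ℚ) → 0ℚ ≤ x → 0ℚ ≤ z → x * z ≤ y → x ^ k * z ^ k ≤ y ^ k
  ratio k x y z hx hz h = ≤-trans (≤-reflexive (sym (*-^ x z k))) (^-mono k (hx ⊠ hz) h)

  c7 : ℚ
  c7 = 1ℚ + ½ ^ 7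

  c7≡ : c7 ≡ 129 ÷ 128
  c7≡ = solve 0 (con 1ℚ :+ con ½ :* (con ½ :* (con ½ :* (con ½ :* (con ½ :* (con ½ :* (con ½ :* con 1ℚ)))))) := con (129 ÷ 128)) refl

  1≤c7 : 1ℚ ≤ c7
  1≤c7 = subst (1ℚ ≤_) (sym c7≡) (lit {1ℚ} {129 ÷ 128})
  0≤c7 : 0ℚ ≤ c7
  0≤c7 = ≤-trans 0≤1 1≤c7

  big : ∀ k → k ℕ.≤ 9 ℕ.+ (p ℕ.+ p) ℕ.+ d → 2ℚ ^ k ≤ c7 ^ q'
  big k le = ≤-trans (2^≤ c₇ 2≤c₇ k) (^-monoʳ 1≤c7 (ℕP.*-monoʳ-≤ c₇ le))

  qg : (256 ÷ 1) * (65 ÷ 64) ^ (suc p ℕ.+ q') ≤ (33 ÷ 32) ^ (suc p ℕ.+ q')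
  qg = ≤-trans (*-monoʳ (0≤^ (suc p ℕ.+ q') (lit {0ℚ} {65 ÷ 64})) 256≤) (≤-trans (≤-reflexive (*-comm _ _)) (ratio (suc p ℕ.+ q') (65 ÷ 64) (33 ÷ 32) c7 (lit {0ℚ} {65 ÷ 64}) 0≤c7
      (subst (λ z → (65 ÷ 64) * z ≤ 33 ÷ 32) (sym c7≡) (≤by (lit {0ℚ} {(33 ÷ 32) ℚ.- (65 ÷ 64) ℚ.* (129 ÷ 128)}) (solve 0 (con ((33 ÷ 32) ℚ.- (65 ÷ 64) ℚ.* (129 ÷ 128)) := con (33 ÷ 32) :- con (65 ÷ 64) :* con (129 ÷ 128)) refl)))))
    where
    256≤ : 256 ÷ 1 ≤ c7 ^ (suc p ℕ.+ q')
    256≤ = ≤-trans (≤-reflexive (solve 0 (con (256 ÷ 1) := con 2ℚ :* (con 2ℚ :* (con 2ℚ :* (con 2ℚ :* (con 2ℚ :* (con 2ℚ :* (con 2ℚ :* (con 2ℚ :* con 1ℚ)))))))) refl)) (≤-trans (big 8 (ℕP.≤-trans (ℕP.n≤1+n 8) (ℕP.≤-trans (ℕP.m≤m+n 9 (p ℕ.+ p)) (ℕP.m≤m+n _ d)))) (^-monoʳ 1≤c7 (ℕP.m≤n+m q' (suc p))))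

  gain : 2ℚ ^ (4 ℕ.+ d) ≤ ϖ ^ suc l₀
  gain = ≤-trans (2^≤ {ϖ} c₈ (subst (λ z → 2ℚ ≤ z ^ c₈) (sym ϖ≡) 2≤c₈) (4 ℕ.+ d)) (^-monoʳ 1≤ϖ (ℕP.n≤1+n l₀))

  n1 : (16 ÷ 1) * (1 ÷ 8) ^ p ≤ ½ ^ (p ℕ.+ (2 ℕ.+ d))
  n1 = ≤-trans (≤-reflexive (cong ((16 ÷ 1) *_) (trans (cong (_^ p) (solve 0 (con (1 ÷ 8) := con ½ :* (con ½ :* con ½)) refl)) (trans (*-^ ½ (½ * ½) p) (trans (cong (½ ^ p *_) (*-^ ½ ½ p)) (trans (cong (½ ^ p *_) (½^-+ p p)) (½^-+ p (p ℕ.+ p))))))))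
    (≤-trans (*-monoˡ (lit {0ℚ} {16 ÷ 1}) (½^-mono le)) (≤-reflexive (solve 1 (λ h → con (16 ÷ 1) :* (con ½ :* (con ½ :* (con ½ :* (con ½ :* h)))) := h) refl (½ ^ (p ℕ.+ (2 ℕ.+ d))))))
    where
    le : 4 ℕ.+ (p ℕ.+ (2 ℕ.+ d)) ℕ.≤ p ℕ.+ (p ℕ.+ p)
    le = ℕP.≤-trans (ℕP.≤-trans (ℕP.m≤m+n _ (3 ℕ.* d ℕ.+ 2)) (ℕP.≤-reflexive (ℕS.solve 2 (λ p d → ℕS.con 4 ℕS.:+ (p ℕS.:+ (ℕS.con 2 ℕS.:+ d)) ℕS.:+ (ℕS.con 3 ℕS.:* d ℕS.:+ ℕS.con 2) ℕS.:= p ℕS.:+ (((d ℕS.:+ ℕS.con 2) ℕS.:+ (d ℕS.:+ ℕS.con 2)) ℕS.:+ ((d ℕS.:+ ℕS.con 2) ℕS.:+ (d ℕS.:+ ℕS.con 2)))) refl p d))) ℕP.≤-refl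

  n2 : (64 ÷ 1) * ((16 ÷ 17) ^ q' * (33 ÷ 32) ^ (suc p ℕ.+ q')) ≤ ½ ^ (p ℕ.+ (2 ℕ.+ d))
  n2 = cancelˡ (0<^ q' (<-≤ (lit< {0ℚ} {1ℚ}) 1≤c7)) (≤-trans (≤-reflexive rearr) (≤-trans (*-mono (lit {0ℚ} {64 ÷ 1} ⊠ 0≤^ (suc p) (lit {0ℚ} {33 ÷ 32})) (*-monoˡ (lit {0ℚ} {64 ÷ 1}) (^-mono (suc p) (lit {0ℚ} {33 ÷ 32}) (lit {33 ÷ 32} {2ℚ}))) (0≤^ q' ((0≤c7 ⊠ lit {0ℚ} {16 ÷ 17}) ⊠ lit {0ℚ} {33 ÷ 32})) (^-≤1 q' ((0≤c7 ⊠ lit {0ℚ} {16 ÷ 17}) ⊠ lit {0ℚ} {33 ÷ 32}) c≤1))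
      (≤-trans (≤-reflexive (trans (*-identityʳ _) (trans (sym (*-identityʳ _)) (trans (cong ((64 ÷ 1) * 2ℚ ^ suc p *_) (sym (2^½ (p ℕ.+ (2 ℕ.+ d))))) (trans (solve 3 (λ a b h → con (64 ÷ 1) :* (con 2ℚ :* a) :* (b :* h) := con 2ℚ :* (con 2ℚ :* (con 2ℚ :* (con 2ℚ :* (con 2ℚ :* (con 2ℚ :* (con 2ℚ :* (a :* b))))))) :* h) refl (2ℚ ^ p) (2ℚ ^ (p ℕ.+ (2 ℕ.+ d))) (½ ^ (p ℕ.+ (2 ℕ.+ d)))) (cong (λ z → 2ℚ * (2ℚ * (2ℚ * (2ℚ * (2ℚ * (2ℚ * (2ℚ * z)))))) * ½ ^ (p ℕ.+ (2 ℕ.+ d))) (sym (^-+ 2ℚ p (p ℕ.+ (2 ℕ.+ d)))))))))) (*-monoʳ (0≤½^ (p ℕ.+ (2 ℕ.+ d))) (big (7 ℕ.+ (p ℕ.+ (p ℕ.+ (2 ℕ.+ d)))) (ℕP.≤-reflexive (ℕS.solve 2 (λ p d → ℕS.con 7 ℕS.:+ (p ℕS.:+ (p ℕS.:+ (ℕS.con 2 ℕS.:+ d))) ℕS.:= ℕS.con 9 ℕS.:+ (p ℕS.:+ p) ℕS.:+ d) refl p d)))))))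
    where
    rearr : c7 ^ q' * ((64 ÷ 1) * ((16 ÷ 17) ^ q' * (33 ÷ 32) ^ (suc p ℕ.+ q'))) ≡ (64 ÷ 1) * (33 ÷ 32) ^ suc p * (c7 * (16 ÷ 17) * (33 ÷ 32)) ^ q'
    rearr = trans (cong (λ z → c7 ^ q' * ((64 ÷ 1) * ((16 ÷ 17) ^ q' * z))) (^-+ (33 ÷ 32) (suc p) q')) (trans (solve 4 (λ c a b e → c :* (con (64 ÷ 1) :* (a :* (b :* e))) := con (64 ÷ 1) :* b :* (c :* a :* e)) refl (c7 ^ q') ((16 ÷ 17) ^ q') ((33 ÷ 32) ^ suc p) ((33 ÷ 32) ^ q'))
      (cong ((64 ÷ 1) * (33 ÷ 32) ^ suc p *_) (sym (trans (*-^ (c7 * (16 ÷ 17)) (33 ÷ 32) q') (*≡ʳ (*-^ c7 (16 ÷ 17) q'))))))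
    c≤1 : c7 * (16 ÷ 17) * (33 ÷ 32) ≤ 1ℚ
    c≤1 = subst (λ z → z * (16 ÷ 17) * (33 ÷ 32) ≤ 1ℚ) (sym c7≡) (≤by (lit {0ℚ} {1ℚ ℚ.- (129 ÷ 128) ℚ.* (16 ÷ 17) ℚ.* (33 ÷ 32)}) (solve 0 (con (1ℚ ℚ.- (129 ÷ 128) ℚ.* (16 ÷ 17) ℚ.* (33 ÷ 32)) := con 1ℚ :- con (129 ÷ 128) :* con (16 ÷ 17) :* con (33 ÷ 32)) refl))

  params : Par L d
  params = record { pe = pe ; me = L ; q' = q' ; l₀ = l₀ ; qg = qg ; gain = gain ; n1 = n1 ; n2 = n2 ; L≤m = ℕP.≤-trans (ℕP.m≤m+n L L) (ℕP.n≤1+n _) }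

n<2^n : ∀ n → suc n ℕ.≤ 2 ℕ.^ n
n<2^n zero = ℕP.≤-refl
n<2^n (suc n) = ℕP.≤-trans (ℕP.+-mono-≤ (ℕP.≤-trans (ℕ.s≤s ℕ.z≤n) (n<2^n n)) (n<2^n n)) (ℕP.≤-reflexive (cong (2 ℕ.^ n ℕ.+_) (sym (ℕP.+-identityʳ _))))

rearrange : ∀ D J W K → 8 ℕ.+ ((D ℕ.+ J ℕ.* (4 ℕ.+ (W ℕ.+ W) ℕ.+ suc K)) ℕ.+ (D ℕ.+ J ℕ.* (4 ℕ.+ (W ℕ.+ W) ℕ.+ suc K))) ≡
  (8 ℕ.+ (D ℕ.+ J ℕ.* (5 ℕ.+ K)) ℕ.* 2) ℕ.+ J ℕ.* 4 ℕ.* W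
rearrange = ℕS.solve 4 (λ D J W K → ℕS.con 8 ℕS.:+ ((D ℕS.:+ J ℕS.:* (ℕS.con 4 ℕS.:+ (W ℕS.:+ W) ℕS.:+ (ℕS.con 1 ℕS.:+ K))) ℕS.:+ (D ℕS.:+ J ℕS.:* (ℕS.con 4 ℕS.:+ (W ℕS.:+ W) ℕS.:+ (ℕS.con 1 ℕS.:+ K))))
  ℕS.:= (ℕS.con 8 ℕS.:+ (D ℕS.:+ J ℕS.:* (ℕS.con 5 ℕS.:+ K)) ℕS.:* ℕS.con 2) ℕS.:+ J ℕS.:* ℕS.con 4 ℕS.:* W) refl

log-bound : ∀ a b D {G Y} → G ℕ.≤ a ℕ.* D ℕ.^ 3 → Y ℕ.≤ b ℕ.* D ℕ.^ 3 →
  let s = 3 ℕ.+ (a ℕ.+ b ℕ.+ D ℕ.* 3) in G ℕ.+ Y ℕ.* (s ℕ.+ s) ℕ.≤ 2 ℕ.^ (s ℕ.+ s)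
log-bound a b D {G} {Y} G≤ Y≤ = begin
    G ℕ.+ Y ℕ.* w ≤⟨ ℕP.+-mono-≤ G≤ (ℕP.*-monoˡ-≤ w Y≤) ⟩
    a ℕ.* D³ ℕ.+ b ℕ.* D³ ℕ.* w ≤⟨ ℕP.m≤m+n _ (a ℕ.* D³ ℕ.* w ℕ.+ b ℕ.* D³) ⟩
    a ℕ.* D³ ℕ.+ b ℕ.* D³ ℕ.* w ℕ.+ (a ℕ.* D³ ℕ.* w ℕ.+ b ℕ.* D³) ≡⟨ ℕS.solve 4 (λ a b D W → a ℕS.:* D ℕS.:+ b ℕS.:* D ℕS.:* W ℕS.:+ (a ℕS.:* D ℕS.:* W ℕS.:+ b ℕS.:* D) ℕS.:= (a ℕS.:+ b) ℕS.:* D ℕS.:* (ℕS.con 1 ℕS.:+ W)) refl a b D³ w ⟩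
    (a ℕ.+ b) ℕ.* D³ ℕ.* suc w ≤⟨ ℕP.*-mono-≤ (ℕP.*-mono-≤ (ℕP.≤-trans (ℕP.n≤1+n _) (n<2^n (a ℕ.+ b))) D³≤) (twice (a ℕ.+ b ℕ.+ D ℕ.* 3)) ⟩
    2 ℕ.^ (a ℕ.+ b) ℕ.* 2 ℕ.^ (D ℕ.* 3) ℕ.* 2 ℕ.^ s ≡⟨ cong (ℕ._* 2 ℕ.^ s) (sym (ℕP.^-distribˡ-+-* 2 (a ℕ.+ b) (D ℕ.* 3))) ⟩
    2 ℕ.^ (a ℕ.+ b ℕ.+ D ℕ.* 3) ℕ.* 2 ℕ.^ s ≤⟨ ℕP.*-monoˡ-≤ (2 ℕ.^ s) (ℕP.^-monoʳ-≤ 2 (ℕP.m≤n+m (a ℕ.+ b ℕ.+ D ℕ.* 3) 3)) ⟩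
    2 ℕ.^ s ℕ.* 2 ℕ.^ s ≡⟨ sym (ℕP.^-distribˡ-+-* 2 s s) ⟩
    2 ℕ.^ w ∎
  where
  open ℕP.≤-Reasoning
  s w D³ : ℕ
  s = 3 ℕ.+ (a ℕ.+ b ℕ.+ D ℕ.* 3)
  w = s ℕ.+ s
  D³ = D ℕ.^ 3
  D³≤ : D³ ℕ.≤ 2 ℕ.^ (D ℕ.* 3)
  D³≤ = ℕP.≤-trans (ℕP.^-monoˡ-≤ 3 (ℕP.≤-trans (ℕP.n≤1+n _) (n<2^n D))) (ℕP.≤-reflexive (ℕP.^-*-assoc 2 D 3))
  twice : ∀ r → suc ((3 ℕ.+ r) ℕ.+ (3 ℕ.+ r)) ℕ.≤ 2 ℕ.^ (3 ℕ.+ r)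
  twice r = ℕP.≤-trans (ℕP.≤-trans (ℕP.m≤m+n _ (1 ℕ.+ 6 ℕ.* r)) (ℕP.≤-reflexive (ℕS.solve 1 (λ r → ℕS.con 1 ℕS.:+ ((ℕS.con 3 ℕS.:+ r) ℕS.:+ (ℕS.con 3 ℕS.:+ r)) ℕS.:+ (ℕS.con 1 ℕS.:+ ℕS.con 6 ℕS.:* r) ℕS.:= ℕS.con 8 ℕS.:* (ℕS.con 1 ℕS.:+ r)) refl r)))
    (ℕP.≤-trans (ℕP.*-monoʳ-≤ 8 (n<2^n r)) (ℕP.≤-reflexive (sym (ℕP.^-distribˡ-+-* 2 3 r))))

-- All parameters as functions of d, for a density threshold ½^(d+1).
module Schedule where
  private
    module Ch d = Choice 0 (suc (suc d))

  d₂P : Poly (λ d → suc (suc d))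
  d₂P = sucP idP

  pP : Poly (λ d → Ch.p d)
  pP = (d₂P ⊹ κP 2) ⊹ (d₂P ⊹ κP 2)

  q'P : Poly (λ d → Ch.q' d)
  q'P = κP c₇ ⊛ (κP 9 ⊹ (pP ⊹ pP) ⊹ d₂P)

  l₀P : Poly (λ d → Ch.l₀ d)
  l₀P = κP c₈ ⊛ (κP 4 ⊹ d₂P)

  q : ℕ → ℕ
  q d = suc (Ch.p d) ℕ.+ Ch.q' d

  qP : Poly q
  qP = sucP pP ⊹ q'P

  k₂ K J : ℕ → ℕ
  k₂ d = 6 ℕ.+ (6 ℕ.+ (suc (suc d) ℕ.+ suc (suc d))) ℕ.* q d
  K d = (2 ℕ.+ k₂ d) ℕ.+ (10 ℕ.+ suc (Ch.l₀ d) ℕ.* (4 ℕ.+ suc (suc d)))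
  J d = c₁₂ ℕ.* suc d

  k₂P : Poly k₂
  k₂P = κP 6 ⊹ (κP 6 ⊹ (d₂P ⊹ d₂P)) ⊛ qP

  KP : Poly K
  KP = (κP 2 ⊹ k₂P) ⊹ (κP 10 ⊹ sucP l₀P ⊛ (κP 4 ⊹ d₂P))

  JP : Poly J
  JP = κP c₁₂ ⊛ idP

  GP : Poly (λ d → 8 ℕ.+ (suc d ℕ.+ J d ℕ.* (5 ℕ.+ K d)) ℕ.* 2)
  GP = κP 8 ⊹ (idP ⊹ JP ⊛ (κP 5 ⊹ KP)) ⊛ κP 2

  YP : Poly (λ d → J d ℕ.* 4)
  YP = JP ⊛ κP 4

  c₄ : ℕ
  c₄ = Poly.C GP ℕ.+ Poly.C YP

  s w I⁺ L : ℕ → ℕ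
  s d = 3 ℕ.+ (c₄ ℕ.+ suc d ℕ.* 3)
  w d = s d ℕ.+ s d
  I⁺ d = suc d ℕ.+ J d ℕ.* (4 ℕ.+ (w d ℕ.+ w d) ℕ.+ suc (K d))
  L d = I⁺ d ℕ.+ (4 ℕ.+ (w d ℕ.+ w d))

  wP : Poly w
  wP = sP ⊹ sP
    where
    sP : Poly s
    sP = κP 3 ⊹ (κP c₄ ⊹ idP ⊛ κP 3)

  I⁺P : Poly I⁺
  I⁺P = idP ⊹ JP ⊛ (κP 4 ⊹ (wP ⊹ wP) ⊹ sucP KP)

  LP : Poly L
  LP = I⁺P ⊹ (κP 4 ⊹ (wP ⊹ wP))

  hw : ∀ d → 8 ℕ.+ (I⁺ d ℕ.+ I⁺ d) ℕ.≤ 2 ℕ.^ w d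
  hw d = ℕP.≤-trans (ℕP.≤-reflexive (rearrange (suc d) (J d) (w d) (K d))) (log-bound (Poly.C GP) (Poly.C YP) (suc d)
    (raise GP 3 (toWitness {a? = Poly.deg GP ℕP.≤? 3} _) d) (raise YP 3 (toWitness {a? = Poly.deg YP ℕP.≤? 3} _) d))

  par : ∀ d → Par (L d) (suc (suc d))
  par d = Choice.params (L d) (suc (suc d))

  grown : ∀ d → 1ℚ ≤ (1ℚ + ½ ^ 12) ^ J d * ½ ^ suc d
  grown d = ≤-trans (≤-reflexive (sym (2^½ (suc d)))) (*-monoʳ (0≤½^ (suc d)) (Choice.2^≤ 0 0 c₁₂ 2≤c₁₂ (suc d)))

  module It d = Iterate (L d) (suc d) (par d) u₁₃ 13≤u₁₃ (w d) (J d) (I⁺ d) refl refl (hw d) (grown d)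

  hxP : Poly (λ d → Par.hx (par d))
  hxP = κP 6 ⊹ (LP ⊹ LP) ⊛ qP ⊹ (LP ⊹ LP)

  hGP : Poly (λ d → Par.hG (par d))
  hGP = sucP l₀P ⊛ (LP ⊹ (LP ⊹ (κP 2 ⊹ k₂P))) ⊹ (k₂P ⊹ (κP 4 ⊛ LP ⊹ κP 4)) ⊹ (hxP ⊹ κP 3 ⊛ LP)

  H₁P : Poly (λ d → Par.H₁ (par d))
  H₁P = κP 2 ⊹ (pP ⊹ (κP 2 ⊹ d₂P) ⊹ (LP ⊹ LP) ⊹ (κP 5 ⊹ (LP ⊹ LP) ⊛ qP)) ⊛ sucP (LP ⊹ LP)

  h₄P : Poly (λ d → Par.h₄ (par d))
  h₄P = (LP ⊹ LP) ⊛ qP ⊹ (sucP H₁P ⊹ (κP 1 ⊹ (LP ⊹ LP)))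

  R₄P : Poly (λ d → Par.R₄ (par d))
  R₄P = sucP (κP 1 ⊛ sucP H₁P) ⊛ RUL-poly 0 h₄P

  rP : Poly (λ d → It.r d)
  rP = R₄P ⊹ RUL-poly u₁₃ (hGP ⊹ (LP ⊹ KP ⊹ κP 2)) ⊹ RTS-poly u₁₃ (sucP H₁P ⊹ (LP ⊹ κP u₁₃)) LP

  S₀P : Poly (λ d → It.S₀ d)
  S₀P = RSP-poly (5 ℕ.+ u₁₃) rP I⁺P ⊹ (R₄P ⊹ (κP 2 ⊹ (LP ⊹ LP)))

  total : Poly (λ d → J d ℕ.* It.S₀ d)
  total = JP ⊛ S₀P

  total-bound : ∀ d → J d ℕ.* It.S₀ d ℕ.≤ Poly.C total ℕ.* suc d ℕ.^ 178
  total-bound = raise total 178 (toWitness {a? = Poly.deg total ℕP.≤? 178} _)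

  opaque
    quasipolynomial : Σ ℕ λ C → ∀ d {n} → C ℕ.* suc d ℕ.^ 178 ℕ.≤ n → (A : F n → F n → Bool) → CornerFree A → mean A ≤ ½ ^ d
    quasipolynomial = Poly.C total , λ d {n} le A cf → bound d (It.main d (ℕP.≤-trans (total-bound d) le) A cf (λ _ → true) (λ _ → true) (λ _ → true)) A refl
      where
      bound : ∀ d {n} {B : F n → F n → Bool} → form (weight B (λ _ → true) (½ ^ suc d)) (λ _ → true) (λ _ → true) ≤ ½ ^ suc d → ∀ A → A ≡ B → mean A ≤ ½ ^ d
      bound d {n} {B} h A refl = ≤by (dif (≤-trans (≤-reflexive (sym (weight-form B (λ _ → true) (λ _ → true) (λ _ → true) (½ ^ suc d)))) h))
        (trans (cong₂ (λ a σ → ½ ^ suc d - (a - ½ ^ suc d * σ)) meanB tri1) (solve 2 (λ h a → con ½ :* h :- (a :- con ½ :* h :* con 1ℚ) := h :- a) refl (½ ^ d) (mean B)))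
        where
        meanB : mean (part B (λ _ → true) (λ _ → true) (λ _ → true)) ≡ mean B
        meanB = 𝔼.E-cong λ x → 𝔼.E-cong λ y → cong 𝟙 (𝔹P.∧-identityʳ (B x y))
        tri1 : tri {n} (λ _ → true) (λ _ → true) (λ _ → true) ≡ 1ℚ
        tri1 = trans (𝔼.E-cong λ x → trans (𝔼.E-const _) (solve 0 (con 1ℚ :* con 1ℚ :* con 1ℚ := con 1ℚ) refl)) (𝔼.E-const 1ℚ)

open import Data.List as List using (List; []; _∷_)

-- Counting points

sumL : ∀ {A : Set} → List A → (A → ℚ) → ℚ
sumL [] f = 0ℚ
sumL (x ∷ xs) f = f x + sumL xs f

sumL-++ : ∀ {A : Set} (xs ys : List A) f → sumL (xs List.++ ys) f ≡ sumL xs f + sumL ys f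
sumL-++ [] ys f = sym (+-identityˡ _)
sumL-++ (x ∷ xs) ys f = trans (cong (f x +_) (sumL-++ xs ys f)) (sym (+-assoc _ _ _))

sumL-map : ∀ {A B : Set} (g : A → B) xs f → sumL (List.map g xs) f ≡ sumL xs (λ x → f (g x))
sumL-map g [] f = refl
sumL-map g (x ∷ xs) f = cong (f (g x) +_) (sumL-map g xs f)

sumL-concatMap : ∀ {A B : Set} (g : A → List B) xs f → sumL (List.concatMap g xs) f ≡ sumL xs (λ x → sumL (g x) f)
sumL-concatMap g [] f = refl
sumL-concatMap g (x ∷ xs) f = trans (sumL-++ (g x) _ f) (cong (sumL (g x) f +_) (sumL-concatMap g xs f))

sumL-cong : ∀ {A : Set} (xs : List A) {f g : A → ℚ} → (∀ x → f x ≡ g x) → sumL xs f ≡ sumL xs g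
sumL-cong [] h = refl
sumL-cong (x ∷ xs) h = cong₂ _+_ (h x) (sumL-cong xs h)

length-filter : ∀ {A : Set} (f : A → Bool) xs → ι (List.length (List.filter (λ x → f x 𝔹P.≟ true) xs)) ≡ sumL xs (λ x → 𝟙 (f x))
length-filter f [] = refl
length-filter f (x ∷ xs) with f x
... | true = cong (1ℚ +_) (length-filter f xs)
... | false = trans (length-filter f xs) (sym (+-identityˡ _))

sum-allVecs : ∀ n (f : F n → ℚ) → sumL (allVecs n) f ≡ 2ℚ ^ n * 𝔼 f
sum-allVecs zero f = trans (+-identityʳ _) (sym (trans (*-identityˡ _) (𝔼-[] f)))
sum-allVecs (suc n) f = trans (sumL-++ (List.map (false ∷_) (allVecs n)) _ f) (trans (cong₂ _+_ (trans (sumL-map _ (allVecs n) f) (sum-allVecs n _)) (trans (sumL-map _ (allVecs n) f) (sum-allVecs n _)))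
  (trans (solve 3 (λ p a b → p :* a :+ p :* b := con 2ℚ :* p :* (con ½ :* (a :+ b))) refl (2ℚ ^ n) (𝔼 (λ x → f (false ∷ x))) (𝔼 (λ x → f (true ∷ x)))) (cong (2ℚ * 2ℚ ^ n *_) (sym (𝔼-∷ f)))))

card-mean : ∀ {n} (A : SubsetPairs n) → ι (card A) ≡ 2ℚ ^ n * (2ℚ ^ n * mean A)
card-mean {n} A = trans (length-filter (λ p → A (proj₁ p) (proj₂ p)) (List.concatMap (λ x → List.map (λ y → x , y) (allVecs n)) (allVecs n)))
  (trans (sumL-concatMap (λ x → List.map (λ y → x , y) (allVecs n)) (allVecs n) (λ p → 𝟙 (A (proj₁ p) (proj₂ p))))
  (trans (sumL-cong (allVecs n) (λ x → trans (sumL-map (λ y → x , y) (allVecs n) (λ p → 𝟙 (A (proj₁ p) (proj₂ p)))) (sum-allVecs n (λ y → 𝟙 (A x y)))))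
  (trans (sum-allVecs n _) (cong (2ℚ ^ n *_) (𝔼.E-* (2ℚ ^ n) _)))))

ι-reflect : ∀ {m n} → ι m ≤ ι n → m ℕ.≤ n
ι-reflect {m} {n} h with m ℕP.≤? n
... | yes p = p
... | no ¬p = ⊥-elim (<⇒≱ (subst₂ _<_ (trans (+-comm 0ℚ (ι n)) (+-identityʳ _)) refl (+-mono-<-≤ {0ℚ} {1ℚ} lit< (≤-refl {ι n}))) (≤-trans (ι-mono (ℕP.≰⇒> ¬p)) h))

ι-2^ : ∀ n → ι (2 ℕ.^ n) ≡ 2ℚ ^ n
ι-2^ n = trans (ι-^ 2 n) (cong (_^ n) (solve 0 (con 1ℚ :+ (con 1ℚ :+ con 0ℚ) := con 2ℚ) refl))

4^≡ : ∀ n → 4 ℕ.^ n ≡ 2 ℕ.^ n ℕ.* 2 ℕ.^ n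
4^≡ n = trans (ℕP.^-*-assoc 2 2 n) (trans (cong (λ z → 2 ℕ.^ (n ℕ.+ z)) (ℕP.+-identityʳ n)) (ℕP.^-distribˡ-+-* 2 n n))

card-bound : ∀ {n} (A : SubsetPairs n) d → mean A ≤ ½ ^ d → 2 ℕ.^ d ℕ.* card A ℕ.≤ 4 ℕ.^ n
card-bound {n} A d h = ι-reflect (≤-trans (≤-reflexive (trans (ι-* (2 ℕ.^ d) (card A)) (cong₂ _*_ (ι-2^ d) (card-mean A)))) (≤-trans (*-monoˡ (0≤^ d lit) (*-monoˡ (0≤^ n lit) (*-monoˡ (0≤^ n lit) h)))
  (≤-reflexive (trans (solve 3 (λ a p h → a :* (p :* (p :* h)) := p :* p :* (a :* h)) refl (2ℚ ^ d) (2ℚ ^ n) (½ ^ d)) (trans (cong (2ℚ ^ n * 2ℚ ^ n *_) (2^½ d)) (trans (*-identityʳ _)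
    (sym (trans (cong ι (4^≡ n)) (trans (ι-* (2 ℕ.^ n) (2 ℕ.^ n)) (cong₂ _*_ (ι-2^ n) (ι-2^ n)))))))))))

-- Any three points of {x, x + d} × {y, y + d} form a corner.
mean≤½ : ∀ {n} → 1 ℕ.≤ n → (A : F n → F n → Bool) → CornerFree A → mean A ≤ ½ ^ 1
mean≤½ {suc n} _ A cf = ≤-trans (≤by (lit {0ℚ} {1 ÷ 4} ⊠ dif four) (solve 1 (λ m → con (1 ÷ 4) :* (con 2ℚ :- (m :+ m :+ (m :+ m))) := con ½ :- m) refl (mean A))) (≤-reflexive (sym (*-identityʳ ½)))
  where
  d : F (suc n)
  d = true ∷ 𝟘
  d≢ : d ≢ 𝟘
  d≢ ()
  pt : ∀ x y → 𝟙 (A x y) + 𝟙 (A (x ⊕ d) y) + (𝟙 (A x (y ⊕ d)) + 𝟙 (A (x ⊕ d) (y ⊕ d))) ≤ 2ℚ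
  pt x y = go _ _ _ _ refl refl refl refl
    where
    back : ∀ {b} z → A z y ≡ b → A z ((y ⊕ d) ⊕ d) ≡ b
    back z h = trans (cong (A z) (⊕-cancelʳ y d)) h
    back' : ∀ {b} z → A x z ≡ b → A ((x ⊕ d) ⊕ d) z ≡ b
    back' z h = trans (cong (λ u → A u z) (⊕-cancelʳ x d)) h
    small : ∀ a b c e → a ℚ.+ b ℚ.+ (c ℚ.+ e) ≤ 2ℚ → a + b + (c + e) ≤ 2ℚ
    small a b c e h = ≤-trans (≤-reflexive (sym (trans (con-+ (a ℚ.+ b) (c ℚ.+ e)) (cong₂ _+_ (con-+ a b) (con-+ c e))))) h
    go : ∀ a b c e → A x y ≡ a → A (x ⊕ d) y ≡ b → A x (y ⊕ d) ≡ c → A (x ⊕ d) (y ⊕ d) ≡ e → 𝟙 a + 𝟙 b + (𝟙 c + 𝟙 e) ≤ 2ℚ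
    go true true true e h1 h2 h3 h4 = ⊥-elim (cf x y d d≢ (h1 , h2 , h3))
    go true true false true h1 h2 h3 h4 = ⊥-elim (cf (x ⊕ d) y d d≢ (h2 , back' y h1 , h4))
    go true false true true h1 h2 h3 h4 = ⊥-elim (cf x (y ⊕ d) d d≢ (h3 , h4 , back x h1))
    go false true true true h1 h2 h3 h4 = ⊥-elim (cf (x ⊕ d) (y ⊕ d) d d≢ (h4 , back' (y ⊕ d) h3 , back (x ⊕ d) h2))
    go true true false false _ _ _ _ = small 1ℚ 1ℚ 0ℚ 0ℚ lit
    go true false true false _ _ _ _ = small 1ℚ 0ℚ 1ℚ 0ℚ lit
    go true false false e _ _ _ _ = ≤-trans (+-mono (≤-refl {1ℚ + 0ℚ}) (+-mono (≤-refl {0ℚ}) (𝟙≤1 e))) (small 1ℚ 0ℚ 0ℚ 1ℚ lit)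
    go false true true false _ _ _ _ = small 0ℚ 1ℚ 1ℚ 0ℚ lit
    go false true false e _ _ _ _ = ≤-trans (+-mono (≤-refl {0ℚ + 1ℚ}) (+-mono (≤-refl {0ℚ}) (𝟙≤1 e))) (small 0ℚ 1ℚ 0ℚ 1ℚ lit)
    go false false c e _ _ _ _ = ≤-trans (+-mono (≤-refl {0ℚ + 0ℚ}) (+-mono (𝟙≤1 c) (𝟙≤1 e))) (small 0ℚ 0ℚ 1ℚ 1ℚ lit)
  four : mean A + mean A + (mean A + mean A) ≤ 2ℚ
  four = ≤-trans (≤-reflexive (sym (trans (𝔼.E-cong λ x → trans (𝔼.E-+ _ _) (cong₂ _+_ (𝔼.E-+ _ _) (𝔼.E-+ _ _))) (trans (𝔼.E-+ _ _) (cong₂ _+_ (trans (𝔼.E-+ _ _) (cong (mean A +_) (𝔼-shift d (λ x → 𝔼 (λ y → 𝟙 (A x y))))))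
      (trans (𝔼.E-+ _ _) (cong₂ _+_ (𝔼.E-cong λ x → 𝔼-shift d (λ y → 𝟙 (A x y))) (trans (𝔼-shift d (λ x → 𝔼 (λ y → 𝟙 (A x (y ⊕ d))))) (𝔼.E-cong λ x → 𝔼-shift d (λ y → 𝟙 (A x y)))))))))))
    (𝔼.E-≤ λ x → 𝔼.E-≤ (pt x))

^-*-distrib : ∀ k x y → (x ℕ.* y) ℕ.^ k ≡ x ℕ.^ k ℕ.* y ℕ.^ k
^-*-distrib zero x y = refl
^-*-distrib (suc k) x y = trans (cong (x ℕ.* y ℕ.*_) (^-*-distrib k x y)) (ℕS.solve 4 (λ x y u v → (x ℕS.:* y) ℕS.:* (u ℕS.:* v) ℕS.:= (x ℕS.:* u) ℕS.:* (y ℕS.:* v)) refl x y (x ℕ.^ k) (y ℕ.^ k))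

raised : ∀ {n k} a b d → a ℕ.≤ d ℕ.* b → 2 ℕ.^ d ℕ.* k ℕ.≤ 4 ℕ.^ n → 2 ℕ.^ a ℕ.* k ℕ.^ b ℕ.≤ 4 ℕ.^ (n ℕ.* b)
raised {n} {k} a b d le h = ℕP.≤-trans (ℕP.*-monoˡ-≤ (k ℕ.^ b) (ℕP.^-monoʳ-≤ 2 le)) (ℕP.≤-trans (ℕP.≤-reflexive (trans (cong (ℕ._* k ℕ.^ b) (sym (ℕP.^-*-assoc 2 d b))) (sym (^-*-distrib b (2 ℕ.^ d) k))))
  (ℕP.≤-trans (ℕP.^-monoˡ-≤ b h) (ℕP.≤-reflexive (ℕP.^-*-assoc 4 n b))))

descale : ∀ k C d a b {n} → suc d ℕ.* suc b ℕ.≤ 3 ℕ.* a → ((3 ℕ.* suc C) ℕ.* a) ℕ.^ suc k ℕ.≤ n ℕ.* suc b ℕ.^ suc k → C ℕ.* suc d ℕ.^ suc k ℕ.≤ n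
descale k C d a b {n} h hyp = ℕP.*-cancelʳ-≤ _ n (suc b ℕ.^ suc k) {{ℕP.m^n≢0 (suc b) (suc k)}} (begin
  C ℕ.* suc d ℕ.^ suc k ℕ.* suc b ℕ.^ suc k ≡⟨ trans (ℕP.*-assoc C _ _) (cong (C ℕ.*_) (sym (^-*-distrib (suc k) (suc d) (suc b)))) ⟩
  C ℕ.* (suc d ℕ.* suc b) ℕ.^ suc k ≤⟨ ℕP.*-mono-≤ C≤ (ℕP.^-monoˡ-≤ (suc k) h) ⟩
  suc C ℕ.^ suc k ℕ.* (3 ℕ.* a) ℕ.^ suc k ≡⟨ sym (^-*-distrib (suc k) (suc C) (3 ℕ.* a)) ⟩
  (suc C ℕ.* (3 ℕ.* a)) ℕ.^ suc k ≡⟨ cong (ℕ._^ suc k) (ℕS.solve 2 (λ c a → c ℕS.:* (ℕS.con 3 ℕS.:* a) ℕS.:= (ℕS.con 3 ℕS.:* c) ℕS.:* a) refl (suc C) a) ⟩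
  ((3 ℕ.* suc C) ℕ.* a) ℕ.^ suc k ≤⟨ hyp ⟩
  n ℕ.* suc b ℕ.^ suc k ∎)
  where
  open ℕP.≤-Reasoning
  C≤ : C ℕ.≤ suc C ℕ.^ suc k
  C≤ = ℕP.≤-trans (ℕP.n≤1+n C) (ℕP.m≤m*n (suc C) (suc C ℕ.^ k) {{ℕP.m^n≢0 (suc C) k}})

no-zero : ∀ k C a n → ((3 ℕ.* suc C) ℕ.* suc a) ℕ.^ k ℕ.≤ n ℕ.* 0 → ⊥
no-zero k C a n h = ℕP.<⇒≱ {0} (ℕP.m^n>0 ((3 ℕ.* suc C) ℕ.* suc a) k) (ℕP.≤-trans h (ℕP.≤-reflexive (ℕP.*-zeroʳ n)))

-- For a ≤ b the trivial bound by half suffices; otherwise d = ⌊a / b⌋ + 1 satisfies a ≤ d b and (d + 1) b ≤ 3 a.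
bounded : ∀ {m k} → m ≡ suc k → ∀ C → (∀ d {n} → C ℕ.* suc d ℕ.^ m ℕ.≤ n → (A : F n → F n → Bool) → CornerFree A → mean A ≤ ½ ^ d) →
  ∀ {n} → 1 ℕ.≤ n → (A : SubsetPairs n) → CornerFree A → ∀ a b → ((3 ℕ.* suc C) ℕ.* a) ℕ.^ m ℕ.≤ n ℕ.* b ℕ.^ m → 2 ℕ.^ a ℕ.* card A ℕ.^ b ℕ.≤ 4 ℕ.^ (n ℕ.* b)
bounded {k = k} refl C quasi {n} 1≤n A cf zero zero h = ℕP.≤-reflexive (cong (4 ℕ.^_) (sym (ℕP.*-zeroʳ n)))
bounded {k = k} refl C quasi {n} 1≤n A cf (suc a) zero h = ⊥-elim (no-zero (suc k) C a n h)
bounded {k = k} refl C quasi {n} 1≤n A cf a (suc b) h with a ℕP.≤? suc b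
... | yes a≤b = raised {n} {card A} a (suc b) 1 (ℕP.≤-trans a≤b (ℕP.≤-reflexive (sym (ℕP.*-identityˡ (suc b))))) (card-bound A 1 (mean≤½ 1≤n A cf))
... | no a≰b = raised {n} {card A} a (suc b) (suc (a / suc b)) a≤ (card-bound A (suc (a / suc b)) (quasi (suc (a / suc b)) (descale k C (suc (a / suc b)) a b 3a h) A cf))
  where
  a≤ : a ℕ.≤ suc (a / suc b) ℕ.* suc b
  a≤ = ℕP.≤-trans (ℕP.≤-reflexive (m≡m%n+[m/n]*n a (suc b))) (ℕP.+-monoˡ-≤ (a / suc b ℕ.* suc b) (ℕP.<⇒≤ (m%n<n a (suc b))))
  3a : suc (suc (a / suc b)) ℕ.* suc b ℕ.≤ 3 ℕ.* a
  3a = ℕP.≤-trans (ℕP.+-mono-≤ (ℕP.<⇒≤ (ℕP.≰⇒> a≰b)) (ℕP.+-mono-≤ (ℕP.<⇒≤ (ℕP.≰⇒> a≰b)) (m/n*n≤m a (suc b)))) (ℕP.≤-reflexive (ℕS.solve 1 (λ a → a ℕS.:+ (a ℕS.:+ a) ℕS.:= ℕS.con 3 ℕS.:* a) refl a))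

theorem1p3 : Σ ℕ (λ q → 1 ℕ.≤ q × ((n : ℕ) → 1 ℕ.≤ n → (A : SubsetPairs n) → CornerFree A → BoundedBy q n (card A)))
theorem1p3 = 3 ℕ.* suc (proj₁ Schedule.quasipolynomial) , ℕ.s≤s ℕ.z≤n , λ n 1≤n A cf → bounded {178} refl (proj₁ Schedule.quasipolynomial) (proj₂ Schedule.quasipolynomial) 1≤n A cf
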